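{- Let $\ell$ be an odd prime, and define \[ \gamma := \begin{cases} 5 & \text{if } \ell \equiv 3 \pmod 8,\\ 6 & \text{if } \ell \equiv 5,7 \pmod 8,\\ 7 & \text{if } \ell \equiv 1 \pmod 8.\end{cases} \] Then for every integer $n \geq 0$, \[ \overline{p}(\ell^{2}n) + \left(\frac{ -n}{\ell}\right)\ell^{ -2}\,\overline{p}(n) + \ell^{ -3}\,\overline{p}(n/\ell^{2}) \equiv (1+\ell)\,\overline{p}(n) \pmod{16}, \] \[ \ell^{2}n\,\overline{p}(\ell^{2}n) + \left(\frac{ -n}{\ell}\right) n\,\overline{p}(n) + \ell^{ -1} n\,\overline{p}(n/\ell^{2}) \equiv (1+\ell)\, n\,\overline{p}(n) \pmod{2^{\gamma}}. \]
   Context: An overpartition of $n$ is a partition of $n$ in which the first occurrence of each distinct part may be overlined or not; $\overline{p}(n)$ is the number of overpartitions of $n$, with $\overline{p}(0)=1$, so that $\sum_{n\ge0}\overline{p}(n)q^n=\prod_{n\ge1}\frac{1+q^n}{1-q^n}$. By convention $\overline{p}(x)=0$ if $x$ is not a nonnegative integer. Negative powers of $\ell$ denote inverses of $\ell$ modulo the respective modulus ($16$ or $2^\gamma$). $\left(\frac{\cdot}{\ell}\right)$ is the Legendre symbol (equal to $0$ when $\ell \mid n$). -}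

module Defs where

open import Data.Nat as ℕ using (ℕ; zero; suc; NonZero)
open import Data.Nat.DivMod using (_/_; _%_)
open import Data.Nat.Divisibility using (_∣?_)
open import Data.Integer as ℤ using (ℤ; +_; -_; _-_)
open import Data.Integer.DivMod using (_%ℕ_)
open import Data.Integer.Divisibility using (_∣_)
open import Data.List using (List; []; _∷_; _++_; concatMap; length; upTo; map)
open import Data.Bool.ListAction using (any)
open import Data.Bool using (Bool; true; false; if_then_else_)
open import Data.Product using (_×_; _,_)
open import Relation.Nullary.Decidable using (does)

-- An overpartition is represented by a list of blocks (k , m , b):
-- the distinct part k occurs with multiplicity m ≥ 1, and b says whether
-- its first occurrence is overlined. Blocks appear with strictly
-- decreasing parts.
Overpartition : Set
Overpartition = List (ℕ × ℕ × Bool)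

overpartitionsUpTo : ℕ → ℕ → List Overpartition
overpartitionsUpTo zero zero = [] ∷ []
overpartitionsUpTo zero (suc n) = []
overpartitionsUpTo (suc k) n =
  overpartitionsUpTo k n ++
  concatMap (λ i → let m = suc i in
     if does (m ℕ.* suc k ℕ.≤? n)
       then concatMap (λ b → map (λ rest → (suc k , m , b) ∷ rest)
                                 (overpartitionsUpTo k (n ℕ.∸ m ℕ.* suc k)))
                      (false ∷ true ∷ [])
       else [])
    (upTo n)

pbar : ℕ → ℕ
pbar n = length (overpartitionsUpTo n n)

-- p̄(n / d), with the convention p̄(x) = 0 if x is not a nonnegative integer.
-- (Only used with d = ℓ² ≠ 0; the d = 0 case is an irrelevant default.)
pbarDiv : ℕ → ℕ → ℕ
pbarDiv n zero = 0
pbarDiv n (suc d) = if does (suc d ∣? n) then pbar (n / suc d) else 0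

infix 4 _≡_[mod_]
_≡_[mod_] : ℤ → ℤ → ℕ → Set
a ≡ b [mod m ] = (+ m) ∣ (a - b)

-- Legendre symbol (a / p) for an odd prime p: 0 if p ∣ a, 1 if a is a
-- nonzero quadratic residue mod p, and -1 otherwise.
-- (Only used with p an odd prime; p = 0 is an irrelevant default.)
legendre : ℤ → ℕ → ℤ
legendre a zero = + 0
legendre a (suc q) with a %ℕ suc q
... | zero = + 0
... | suc r =
  if any (λ x → does ((x ℕ.* x) % suc q ℕ.≟ suc r)) (upTo (suc q))
    then + 1 else - (+ 1)

gamma : ℕ → ℕ
gamma ℓ with ℓ % 8
... | 3 = 5
... | 5 = 6
... | 7 = 6
... | _ = 7

{-# OPTIONS --safe #-}

-- Since Σ p̄(n) qⁿ is the inverse of φ(-q) and φ = 1 + 2 S with S = Σ_{x ≥ 1} q^{x²}, the series P = 1/φ, whose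
-- coefficients are (-1)ⁿ p̄(n), is a polynomial in S modulo every power of 2. Modulo 16 it is -φ³ + 4 S + 2, and
-- modulo 64 and 128 the derivative q dP/dq is -q d(φ³)/dq plus terms supported on squares and on twice squares
-- plus, for 128, theta series of x² + y² + 2z² and x² + 2y² + 2z² whose coefficients are values of r₃. So both
-- congruences follow from the Hecke relation r₃(ℓ² n) + (-n/ℓ) r₃(n) + ℓ r₃(n/ℓ²) = (1 + ℓ) r₃(n).
-- That relation is obtained by counting pairs (neighbour, vector) for the ℓ + 1 lattices ℓ-neighbouring ℤ³: they are
-- indexed by the isotropic lines modulo ℓ, and Lagrange's descent on quaternions shows that each is isometric to ℤ³.
-- The values of (-1/ℓ) and (2/ℓ) that are needed are themselves read off the Hecke relation at n = 1 and n = 2.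

module Submission where

open import Defs
open import Algebra.Bundles using (CommutativeRing)
import Algebra.Solver.Ring as RingSolver
open import Algebra.Solver.Ring.AlmostCommutativeRing using (fromCommutativeRing; _-Raw-AlmostCommutative⟶_)
open import Data.Bool using (Bool; true; false; if_then_else_; T)
open import Data.Bool.ListAction using (any)
open import Data.Empty using (⊥; ⊥-elim)
open import Data.Fin as Fin using (Fin; zero; suc; toℕ; fromℕ<)
import Data.Fin.Properties as Finₚ
open import Data.Integer as ℤ using (ℤ; +_; -[1+_]; -_; _+_; _*_; _-_; _^_; 0ℤ; 1ℤ) renaming (∣_∣ to abs)
import Data.Integer.Properties as ℤₚ
open import Data.Integer.DivMod using (_/ℕ_; _%ℕ_; a≡a%ℕn+[a/ℕn]*n; n%ℕd<d)
open import Data.Integer.Divisibility.Signed as ℤ∣ using (_∣_; divides; _∣?_)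
  renaming (∣-refl to ∣-rfl; ∣-trans to ∣-trs; ∣m∣n⇒∣m+n to ∣-+; ∣m⇒∣-m to ∣-neg; ∣n⇒∣m*n to ∣-*ˡ; ∣m⇒∣m*n to ∣-*ʳ; *-monoʳ-∣ to ∣-mono)
import Data.Integer.Solver
open import Data.Integer.Tactic.RingSolver using (solve-∀)
open import Data.List using (List; []; _∷_; _++_; concatMap; length; upTo; applyUpTo; map; cartesianProduct)
import Data.List.Properties as Listₚ
open import Data.List.Membership.Propositional using (lose; find)
open import Data.List.Membership.Propositional.Properties using (∈-upTo⁺)
open import Data.List.Relation.Unary.Any.Properties using (any⁺; any⁻)
open import Data.Maybe using (Maybe; just; nothing)
open import Data.Nat as ℕ using (ℕ; zero; suc; s≤s; z≤n)
import Data.Nat.Properties as ℕₚ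
open import Data.Nat.Coprimality using (prime⇒coprime; coprime-Bézout)
import Data.Nat.Divisibility as ℕ∣
open import Data.Nat.DivMod as ℕ/ using (_%_; _/_)
open import Data.Nat.GCD using (module Bézout)
open import Data.Nat.Induction using (<-wellFounded)
open import Data.Nat.Primality using (Prime; euclidsLemma; prime[2]; prime⇒irreducible; prime⇒nonTrivial; prime⇒nonZero)
open import Data.Nat.Tactic.RingSolver using () renaming (solve-∀ to solveℕ)
open import Data.Product using (_×_; _,_; proj₁; proj₂; ∃-syntax)
open import Data.Sum using (_⊎_; inj₁; inj₂; [_,_]′; reduce)
open import Data.Unit using (tt)
open import Function using (_∘_; id)
open import Induction.WellFounded using (Acc; acc)
open import Relation.Binary using (IsEquivalence; Setoid)
open import Relation.Binary.Definitions using (tri<; tri≈; tri>)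
open import Relation.Binary.PropositionalEquality
open import Relation.Nullary using (Dec; yes; no; ¬_; does)
open import Relation.Nullary.Decidable using (dec-true; dec-false; map′; _×-dec_)
open import Algebra.Properties.AbelianGroup ℤₚ.+-0-abelianGroup using () renaming (∙-cancelˡ to +-cancelˡ; ∙-cancelʳ to +-cancelʳ)

-- The factor `n` raises the modulus because q d/dq moves `1/φ` from weight -1/2 to weight 3/2, the
-- weight of `φ³`, whose relation has the eigenvalue 1 + ℓ, and because it gains a factor 2 on every
-- even power of `S`. The terms that remain do not satisfy that relation. They are pushed onto
-- exponents that are squares or related to squares by a factor 2: there, if ℓ² does not divide n,
-- the symbol (-n/ℓ) is one of the two constants (-1/ℓ) and (-2/ℓ), and the defect becomes a
-- polynomial in ℓ. The exponent γ records how far this polynomial vanishes in each class of ℓ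
-- modulo 8. Only the class 1 reaches 128: there (-1/ℓ) = (-2/ℓ) = 1, and the ternary form whose
-- coefficients are r₃ at a doubled argument sees the same symbol as r₃ itself. Infinite products
-- never occur. Gauss's identity is proved for partial products and read off below the truncation
-- order. Lattices stay inside ℤ³ as well: a neighbour is replaced by its multiple by ℓ, at the
-- price of divisibility conditions modulo ℓ².

module ℤSolver = Data.Integer.Solver.+-*-Solver

-- Formal power series over ℤ as a commutative ring.

module PowerSeries where

  Series : Set
  Series = ℕ → ℤ

  infix 4 _≋_
  record _≋_ (f g : Series) : Set where
    constructor pointwise
    field coeff : ∀ n → f n ≡ g n
  open _≋_ public

  tail : Series → Series
  tail f n = f (suc n)

  infixl 6 _⊕_
  infixl 7 _⊛_
  infix 8 ⊖_

  -- Opaque, so that unification can read off the arguments of a sum.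
  opaque
    _⊕_ : Series → Series → Series
    (f ⊕ g) n = f n + g n

    ⊖_ : Series → Series
    (⊖ f) n = - f n

    ⊕-coeff : ∀ f g n → (f ⊕ g) n ≡ f n + g n
    ⊕-coeff f g n = refl

    ⊖-coeff : ∀ f n → (⊖ f) n ≡ - f n
    ⊖-coeff f n = refl

  κ : ℤ → Series
  κ c zero    = c
  κ c (suc n) = 0ℤ

  -- The Cauchy product, peeled as (a + q f) g = a g + q (f g), so that the ring laws follow by
  -- recursion on the exponent.
  _⊛_ : Series → Series → Series
  (f ⊛ g) zero    = f 0 * g 0
  (f ⊛ g) (suc n) = f 0 * g (suc n) + (tail f ⊛ g) n

  -- A coefficient of a product sees no coefficient of larger exponent. This locality replaces
  -- limits: infinite products are compared through truncations.
  ⊛-cong-upTo : ∀ n {f f′ g g′ : Series} → (∀ i → i ℕ.≤ n → f i ≡ f′ i) →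
                (∀ i → i ℕ.≤ n → g i ≡ g′ i) → (f ⊛ g) n ≡ (f′ ⊛ g′) n
  ⊛-cong-upTo zero p q = cong₂ _*_ (p 0 ℕ.z≤n) (q 0 ℕ.z≤n)
  ⊛-cong-upTo (suc n) p q =
    cong₂ _+_ (cong₂ _*_ (p 0 ℕ.z≤n) (q (suc n) ℕₚ.≤-refl))
              (⊛-cong-upTo n (λ i i≤n → p (suc i) (ℕ.s≤s i≤n)) (λ i i≤n → q i (ℕₚ.m≤n⇒m≤1+n i≤n)))

  ⊛-cong : ∀ {f f′ g g′} → f ≋ f′ → g ≋ g′ → f ⊛ g ≋ f′ ⊛ g′
  ⊛-cong p q = pointwise λ n → ⊛-cong-upTo n (λ i _ → coeff p i) (λ i _ → coeff q i)

  ⊛-sucʳ : ∀ f g n → (f ⊛ g) (suc n) ≡ f (suc n) * g 0 + (f ⊛ tail g) n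
  ⊛-sucʳ f g zero = ℤₚ.+-comm (f 0 * g 1) (f 1 * g 0)
  ⊛-sucʳ f g (suc n) rewrite ⊛-sucʳ (tail f) g n =
    (λ (a b c : ℤ) → swap a b c) (f 0 * g (suc (suc n))) (f (suc (suc n)) * g 0) ((tail f ⊛ tail g) n)
    where
    swap : ∀ a b c → a + (b + c) ≡ b + (a + c)
    swap = solve-∀

  ⊛-comm-coeff : ∀ f g n → (f ⊛ g) n ≡ (g ⊛ f) n
  ⊛-comm-coeff f g zero = ℤₚ.*-comm (f 0) (g 0)
  ⊛-comm-coeff f g (suc n) = begin
    f 0 * g (suc n) + (tail f ⊛ g) n  ≡⟨ cong₂ _+_ (ℤₚ.*-comm (f 0) (g (suc n))) (⊛-comm-coeff (tail f) g n) ⟩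
    g (suc n) * f 0 + (g ⊛ tail f) n  ≡⟨ ⊛-sucʳ g f n ⟨
    (g ⊛ f) (suc n)                   ∎
    where open ≡-Reasoning

  opaque
    unfolding _⊕_

    ⊛-distribʳ-coeff : ∀ h f g n → ((f ⊕ g) ⊛ h) n ≡ (f ⊛ h) n + (g ⊛ h) n
    ⊛-distribʳ-coeff h f g zero = ℤₚ.*-distribʳ-+ (h 0) (f 0) (g 0)
    ⊛-distribʳ-coeff h f g (suc n) rewrite ⊛-distribʳ-coeff h (tail f) (tail g) n = lemma (f 0) (g 0) (h (suc n)) _ _
      where
      lemma : ∀ a b c x y → (a + b) * c + (x + y) ≡ a * c + x + (b * c + y)
      lemma = solve-∀

  ⊛-scaleˡ : ∀ c f g n → ((λ i → c * f i) ⊛ g) n ≡ c * (f ⊛ g) n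
  ⊛-scaleˡ c f g zero = ℤₚ.*-assoc c (f 0) (g 0)
  ⊛-scaleˡ c f g (suc n) rewrite ⊛-scaleˡ c (tail f) g n = lemma c (f 0) (g (suc n)) _
    where
    lemma : ∀ c a b x → c * a * b + c * x ≡ c * (a * b + x)
    lemma = solve-∀

  opaque
    unfolding _⊕_

    ⊛-assoc-coeff : ∀ f g h n → ((f ⊛ g) ⊛ h) n ≡ (f ⊛ (g ⊛ h)) n
    ⊛-assoc-coeff f g h zero = ℤₚ.*-assoc (f 0) (g 0) (h 0)
    ⊛-assoc-coeff f g h (suc n) = begin
      f 0 * g 0 * h (suc n) + (tail (f ⊛ g) ⊛ h) n
        ≡⟨ cong (λ x → f 0 * g 0 * h (suc n) + x) (⊛-distribʳ-coeff h (λ i → f 0 * tail g i) (tail f ⊛ g) n) ⟩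
      f 0 * g 0 * h (suc n) + (((λ i → f 0 * tail g i) ⊛ h) n + ((tail f ⊛ g) ⊛ h) n)
        ≡⟨ cong₂ (λ x y → f 0 * g 0 * h (suc n) + (x + y)) (⊛-scaleˡ (f 0) (tail g) h n) (⊛-assoc-coeff (tail f) g h n) ⟩
      f 0 * g 0 * h (suc n) + (f 0 * (tail g ⊛ h) n + (tail f ⊛ (g ⊛ h)) n)
        ≡⟨ lemma (f 0) (g 0) (h (suc n)) _ _ ⟩
      f 0 * (g 0 * h (suc n) + (tail g ⊛ h) n) + (tail f ⊛ (g ⊛ h)) n ∎
      where
      open ≡-Reasoning
      lemma : ∀ a b c x y → a * b * c + (a * x + y) ≡ a * (b * c + x) + y
      lemma = solve-∀

  zero-⊛ : ∀ g n → ((λ _ → 0ℤ) ⊛ g) n ≡ 0ℤ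
  zero-⊛ g zero = refl
  zero-⊛ g (suc n) rewrite zero-⊛ g n = refl

  κ-⊛ : ∀ c g n → (κ c ⊛ g) n ≡ c * g n
  κ-⊛ c g zero = refl
  κ-⊛ c g (suc n) rewrite zero-⊛ g n = ℤₚ.+-identityʳ _

  ≋-isEquivalence : IsEquivalence _≋_
  ≋-isEquivalence = record
    { refl  = pointwise λ n → refl
    ; sym   = λ p → pointwise λ n → sym (coeff p n)
    ; trans = λ p q → pointwise λ n → trans (coeff p n) (coeff q n)
    }

  κ-0 : ∀ n → κ 0ℤ n ≡ 0ℤ
  κ-0 zero = refl
  κ-0 (suc n) = refl

  opaque
    unfolding _⊕_

    ⊕-cong : ∀ {f f′ g g′} → f ≋ f′ → g ≋ g′ → f ⊕ g ≋ f′ ⊕ g′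
    ⊕-cong p q = pointwise λ n → cong₂ _+_ (coeff p n) (coeff q n)

    ⊖-cong : ∀ {f f′} → f ≋ f′ → ⊖ f ≋ ⊖ f′
    ⊖-cong p = pointwise λ n → cong -_ (coeff p n)

    ⊕-assoc : ∀ f g h → (f ⊕ g) ⊕ h ≋ f ⊕ (g ⊕ h)
    ⊕-assoc f g h = pointwise λ n → ℤₚ.+-assoc (f n) (g n) (h n)

    ⊕-comm : ∀ f g → f ⊕ g ≋ g ⊕ f
    ⊕-comm f g = pointwise λ n → ℤₚ.+-comm (f n) (g n)

    ⊕-identityˡ : ∀ f → κ 0ℤ ⊕ f ≋ f
    ⊕-identityˡ f = pointwise λ n → trans (cong (λ x → x + f n) (κ-0 n)) (ℤₚ.+-identityˡ (f n))

    ⊖-inverseˡ : ∀ f → ⊖ f ⊕ f ≋ κ 0ℤ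
    ⊖-inverseˡ f = pointwise λ n → trans (ℤₚ.+-inverseˡ (f n)) (sym (κ-0 n))

    ⊛-distribʳ : ∀ h f g → (f ⊕ g) ⊛ h ≋ f ⊛ h ⊕ g ⊛ h
    ⊛-distribʳ h f g = pointwise (⊛-distribʳ-coeff h f g)

    κ-+ : ∀ x y → κ (x + y) ≋ κ x ⊕ κ y
    κ-+ x y = pointwise λ { zero → refl ; (suc n) → refl }

    κ-neg : ∀ x → κ (- x) ≋ ⊖ κ x
    κ-neg x = pointwise λ { zero → refl ; (suc n) → refl }

  ⊛-comm : ∀ f g → f ⊛ g ≋ g ⊛ f
  ⊛-comm f g = pointwise (⊛-comm-coeff f g)

  ⊛-identityˡ : ∀ f → κ 1ℤ ⊛ f ≋ f
  ⊛-identityˡ f = pointwise λ n → trans (κ-⊛ 1ℤ f n) (ℤₚ.*-identityˡ (f n))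

  module ≋ = IsEquivalence ≋-isEquivalence

  seriesRing : CommutativeRing _ _
  seriesRing = record
    { Carrier = Series ; _≈_ = _≋_ ; _+_ = _⊕_ ; _*_ = _⊛_ ; -_ = ⊖_ ; 0# = κ 0ℤ ; 1# = κ 1ℤ
    ; isCommutativeRing = record
      { isRing = record
        { +-isAbelianGroup = record
          { isGroup = record
            { isMonoid = record
              { isSemigroup = record
                { isMagma = record { isEquivalence = ≋-isEquivalence ; ∙-cong = ⊕-cong }
                ; assoc = ⊕-assoc }
              ; identity = ⊕-identityˡ , λ f → ≋.trans (⊕-comm f (κ 0ℤ)) (⊕-identityˡ f) }
            ; inverse = ⊖-inverseˡ , λ f → ≋.trans (⊕-comm f (⊖ f)) (⊖-inverseˡ f)
            ; ⁻¹-cong = ⊖-cong }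
          ; comm = ⊕-comm }
        ; *-cong = ⊛-cong
        ; *-assoc = λ f g h → pointwise (⊛-assoc-coeff f g h)
        ; *-identity = ⊛-identityˡ , λ f → ≋.trans (⊛-comm f (κ 1ℤ)) (⊛-identityˡ f)
        ; distrib = (λ f g h → ≋.trans (⊛-comm f (g ⊕ h)) (≋.trans (⊛-distribʳ f g h) (⊕-cong (⊛-comm g f) (⊛-comm h f))))
                  , ⊛-distribʳ }
      ; *-comm = ⊛-comm } }

  seriesSetoid : Setoid _ _
  seriesSetoid = CommutativeRing.setoid seriesRing

  private
    κ-morphism : ℤ.+-*-rawRing -Raw-AlmostCommutative⟶ fromCommutativeRing seriesRing
    κ-morphism = record
      { ⟦_⟧ = κ
      ; +-homo = κ-+
      ; *-homo = λ x y → pointwise λ { zero → refl ; (suc n) → sym (trans (κ-⊛ x (κ y) (suc n)) (ℤₚ.*-zeroʳ x)) }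
      ; -‿homo = κ-neg
      ; 0-homo = ≋.refl
      ; 1-homo = ≋.refl
      }

    κ-≟ : ∀ x y → Maybe (κ x ≋ κ y)
    κ-≟ x y with x ℤ.≟ y
    ... | yes refl = just (pointwise λ n → refl)
    ... | no _     = nothing

  module SeriesSolver = RingSolver ℤ.+-*-rawRing (fromCommutativeRing seriesRing) κ-morphism κ-≟

  opaque
    unfolding _⊕_

    -- Proof by linear combination: `c` times the known equation is added to the goal, after which
    -- both sides agree as polynomials and the ring solver applies. The choice of `c` is the whole
    -- content of a use.
    comb : ∀ {L R u v} c → u ≋ v → L ⊕ c ⊛ v ≋ R ⊕ c ⊛ u → L ≋ R
    comb {L} {R} {u} {v} c h p = pointwise λ n →
      +-cancelʳ ((c ⊛ v) n) (L n) (R n)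
        (trans (coeff p n) (cong (λ x → R n + x) (coeff (⊛-cong (≋.refl {c}) h) n)))

  X : ℕ → Series
  X zero    n       = κ 1ℤ n
  X (suc k) zero    = 0ℤ
  X (suc k) (suc n) = X k n

  X-self : ∀ k → X k k ≡ 1ℤ
  X-self zero    = refl
  X-self (suc k) = X-self k

  X-≢ : ∀ k n → k ≢ n → X k n ≡ 0ℤ
  X-≢ zero zero k≢n = ⊥-elim (k≢n refl)
  X-≢ zero (suc n) k≢n = refl
  X-≢ (suc k) zero k≢n = refl
  X-≢ (suc k) (suc n) k≢n = X-≢ k n (λ { refl → k≢n refl })

  X-⊛-≥ : ∀ k f n → (X k ⊛ f) (k ℕ.+ n) ≡ f n
  X-⊛-≥ zero f n = trans (κ-⊛ 1ℤ f n) (ℤₚ.*-identityˡ (f n))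
  X-⊛-≥ (suc k) f n = trans (ℤₚ.+-identityˡ _) (X-⊛-≥ k f n)

  X-⊛-< : ∀ k f {n} → n ℕ.< k → (X k ⊛ f) n ≡ 0ℤ
  X-⊛-< (suc k) f {zero} n<k = refl
  X-⊛-< (suc k) f {suc n} (ℕ.s≤s n<k) = trans (ℤₚ.+-identityˡ _) (X-⊛-< k f n<k)

  X-+ : ∀ m n → X (m ℕ.+ n) ≋ X m ⊛ X n
  X-+ zero n = pointwise λ i → sym (trans (κ-⊛ 1ℤ (X n) i) (ℤₚ.*-identityˡ _))
  X-+ (suc m) n = pointwise λ { zero → refl ; (suc i) → sym (trans (ℤₚ.+-identityˡ _) (sym (coeff (X-+ m n) i))) }

  -- Turns a recursion of step `k` between coefficients into a functional equation.
  shifted : ∀ {f g} k h → (∀ n → n ℕ.< k → f n ≡ g n) → (∀ n → f (k ℕ.+ n) ≡ g (k ℕ.+ n) + h n) →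
            f ≋ g ⊕ X k ⊛ h
  shifted {f} {g} k h below above = pointwise λ n → trans (go n) (sym (⊕-coeff g (X k ⊛ h) n))
    where
    go : ∀ n → f n ≡ g n + (X k ⊛ h) n
    go n with n ℕ.<? k
    ... | yes n<k = trans (below n n<k) (sym (trans (cong (λ x → g n + x) (X-⊛-< k h n<k)) (ℤₚ.+-identityʳ _)))
    ... | no n≮k  = subst (λ m → f m ≡ g m + (X k ⊛ h) m) (ℕₚ.m+[n∸m]≡n (ℕₚ.≮⇒≥ n≮k))
                      (trans (above _) (cong (λ x → g (k ℕ.+ (n ℕ.∸ k)) + x) (sym (X-⊛-≥ k h _))))

  sumS : ℕ → (ℕ → Series) → Series
  sumS zero    t = κ 0ℤ
  sumS (suc n) t = sumS n t ⊕ t n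

  sgn : ℕ → ℤ
  sgn zero    = 1ℤ
  sgn (suc n) = - sgn n

  -- The substitution of -q for q, a ring homomorphism by `twist-⊛-coeff`.
  twist : Series → Series
  twist f n = sgn n * f n

  twist-⊛-coeff : ∀ f g n → sgn n * (f ⊛ g) n ≡ (twist f ⊛ twist g) n
  twist-⊛-coeff f g zero = lemma (f 0) (g 0)
    where
    lemma : ∀ a b → 1ℤ * (a * b) ≡ (1ℤ * a) * (1ℤ * b)
    lemma = solve-∀
  twist-⊛-coeff f g (suc n) = begin
    - sgn n * (f 0 * g (suc n) + (tail f ⊛ g) n)
      ≡⟨ lemma (sgn n) (f 0) (g (suc n)) _ ⟩
    (1ℤ * f 0) * (- sgn n * g (suc n)) + - 1ℤ * (sgn n * (tail f ⊛ g) n)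
      ≡⟨ cong (λ x → (1ℤ * f 0) * (- sgn n * g (suc n)) + - 1ℤ * x) (twist-⊛-coeff (tail f) g n) ⟩
    (1ℤ * f 0) * (- sgn n * g (suc n)) + - 1ℤ * (twist (tail f) ⊛ twist g) n
      ≡⟨ cong (λ x → (1ℤ * f 0) * (- sgn n * g (suc n)) + x) (sym (⊛-scaleˡ (- 1ℤ) (twist (tail f)) (twist g) n)) ⟩
    (1ℤ * f 0) * (- sgn n * g (suc n)) + ((λ i → - 1ℤ * twist (tail f) i) ⊛ twist g) n
      ≡⟨ cong (λ x → (1ℤ * f 0) * (- sgn n * g (suc n)) + x)
           (⊛-cong-upTo n (λ i _ → lemma₂ (sgn i) (f (suc i))) (λ i _ → refl)) ⟩
    (1ℤ * f 0) * (- sgn n * g (suc n)) + (tail (twist f) ⊛ twist g) n ∎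
    where
    open ≡-Reasoning
    lemma : ∀ s a b x → - s * (a * b + x) ≡ (1ℤ * a) * (- s * b) + - 1ℤ * (s * x)
    lemma = solve-∀
    lemma₂ : ∀ s x → - 1ℤ * (s * x) ≡ - s * x
    lemma₂ = solve-∀

-- The generating function of overpartitions.

module Overpartitions where

  open PowerSeries
  open SeriesSolver using (solve; _:=_; _:+_; _:*_; :-_; con)

  ∑ : ℕ → (ℕ → ℕ) → ℕ
  ∑ zero    t = 0
  ∑ (suc n) t = t 0 ℕ.+ ∑ n (t ∘ suc)

  ∑-cong : ∀ n {t u} → (∀ i → t i ≡ u i) → ∑ n t ≡ ∑ n u
  ∑-cong zero p = refl
  ∑-cong (suc n) p = cong₂ ℕ._+_ (p 0) (∑-cong n (p ∘ suc))

  ∑-zero : ∀ n {t} → (∀ i → t i ≡ 0) → ∑ n t ≡ 0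
  ∑-zero zero p = refl
  ∑-zero (suc n) p rewrite p 0 = ∑-zero n (p ∘ suc)

  ∑-extend : ∀ m n {t} → (∀ i → t (n ℕ.+ i) ≡ 0) → ∑ (n ℕ.+ m) t ≡ ∑ n t
  ∑-extend m zero p = ∑-zero m p
  ∑-extend m (suc n) {t} p = cong (t 0 ℕ.+_) (∑-extend m n p)

  length-concatMap : ∀ {A : Set} (f : ℕ → List A) g n →
                     length (concatMap f (applyUpTo g n)) ≡ ∑ n (λ i → length (f (g i)))
  length-concatMap f g zero = refl
  length-concatMap f g (suc n) =
    trans (Listₚ.length-++ (f (g 0))) (cong (length (f (g 0)) ℕ.+_) (length-concatMap f (g ∘ suc) n))

  count≤ : ℕ → ℕ → ℕ
  count≤ k n = length (overpartitionsUpTo k n)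

  -- Contribution of the overpartitions in which the part `suc k` occurs exactly `suc i` times; the
  -- 2 is the choice of an overline.
  withPart : ℕ → ℕ → ℕ → ℕ
  withPart k n i = if does (suc i ℕ.* suc k ℕ.≤? n) then 2 ℕ.* count≤ k (n ℕ.∸ suc i ℕ.* suc k) else 0

  count≤-suc : ∀ k n → count≤ (suc k) n ≡ count≤ k n ℕ.+ ∑ n (withPart k n)
  count≤-suc k n = trans (Listₚ.length-++ (overpartitionsUpTo k n))
    (cong (count≤ k n ℕ.+_) (trans (length-concatMap _ id n) (∑-cong n block)))
    where
    block : ∀ i → length (if does (suc i ℕ.* suc k ℕ.≤? n)
         then concatMap (λ b → map (λ rest → (suc k , suc i , b) ∷ rest)
                                   (overpartitionsUpTo k (n ℕ.∸ suc i ℕ.* suc k)))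
                        (false ∷ true ∷ [])
         else []) ≡ withPart k n i
    block i with does (suc i ℕ.* suc k ℕ.≤? n)
    ... | false = refl
    ... | true = begin
      length (map c₀ ps ++ map c₁ ps ++ [])          ≡⟨ Listₚ.length-++ (map c₀ ps) ⟩
      length (map c₀ ps) ℕ.+ length (map c₁ ps ++ [])
        ≡⟨ cong₂ ℕ._+_ (Listₚ.length-map c₀ ps) (Listₚ.length-++ (map c₁ ps)) ⟩
      length ps ℕ.+ (length (map c₁ ps) ℕ.+ 0)       ≡⟨ cong (λ x → length ps ℕ.+ (x ℕ.+ 0)) (Listₚ.length-map c₁ ps) ⟩
      2 ℕ.* length ps                                ∎
      where
      open ≡-Reasoning
      ps = overpartitionsUpTo k (n ℕ.∸ suc i ℕ.* suc k)
      c₀ = λ (rest : Overpartition) → (suc k , suc i , false) ∷ rest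
      c₁ = λ (rest : Overpartition) → (suc k , suc i , true) ∷ rest

  if-yes : ∀ {A P : Set} (d : Dec P) {x y : A} → P → (if does d then x else y) ≡ x
  if-yes d p rewrite dec-true d p = refl

  if-no : ∀ {A P : Set} (d : Dec P) {x y : A} → ¬ P → (if does d then x else y) ≡ y
  if-no d ¬p rewrite dec-false d ¬p = refl

  withPart-> : ∀ k n i → n ℕ.< suc i ℕ.* suc k → withPart k n i ≡ 0
  withPart-> k n i lt = if-no (suc i ℕ.* suc k ℕ.≤? n) (ℕₚ.<⇒≱ lt)

  count≤-< : ∀ k n → n ℕ.< suc k → count≤ (suc k) n ≡ count≤ k n
  count≤-< k n n<K = trans (count≤-suc k n) (trans (cong (count≤ k n ℕ.+_)
    (∑-zero n λ i → withPart-> k n i (ℕₚ.≤-trans n<K (ℕₚ.m≤m+n (suc k) (i ℕ.* suc k))))) (ℕₚ.+-identityʳ _))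

  withPart-shift-0 : ∀ k n → withPart k (suc k ℕ.+ n) 0 ≡ 2 ℕ.* count≤ k n
  withPart-shift-0 k n =
    trans (if-yes (1 ℕ.* suc k ℕ.≤? suc k ℕ.+ n) (ℕₚ.≤-trans (ℕₚ.≤-reflexive (ℕₚ.*-identityˡ (suc k))) (ℕₚ.m≤m+n (suc k) n)))
          (cong (λ m → 2 ℕ.* count≤ k m) (trans (cong (suc k ℕ.+ n ℕ.∸_) (ℕₚ.*-identityˡ (suc k))) (ℕₚ.m+n∸m≡n (suc k) n)))

  withPart-shift-suc : ∀ k n i → withPart k (suc k ℕ.+ n) (suc i) ≡ withPart k n i
  withPart-shift-suc k n i with suc i ℕ.* suc k ℕ.≤? n
  ... | yes le = trans (if-yes (suc (suc i) ℕ.* suc k ℕ.≤? suc k ℕ.+ n) (ℕₚ.+-monoʳ-≤ (suc k) le))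
                  (trans (cong (λ m → 2 ℕ.* count≤ k m) (ℕₚ.[m+n]∸[m+o]≡n∸o k n (suc i ℕ.* suc k)))
                         (sym (if-yes (suc i ℕ.* suc k ℕ.≤? n) le)))
  ... | no ¬le = trans (if-no (suc (suc i) ℕ.* suc k ℕ.≤? suc k ℕ.+ n) (λ p → ¬le (ℕₚ.+-cancelˡ-≤ (suc k) _ _ p)))
                       (sym (if-no (suc i ℕ.* suc k ℕ.≤? n) ¬le))

  -- Remove one copy of the part `suc k`. Multiplicity one leaves twice `count≤ k n`, higher
  -- multiplicities leave the same sum with index lowered by one; one of the two copies completes
  -- that sum to `count≤ (suc k) n`.
  count≤-shift : ∀ k n → count≤ (suc k) (suc k ℕ.+ n) ≡ count≤ k (suc k ℕ.+ n) ℕ.+ (count≤ k n ℕ.+ count≤ (suc k) n)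
  count≤-shift k n = begin
    count≤ (suc k) (suc k ℕ.+ n)
      ≡⟨ count≤-suc k (suc k ℕ.+ n) ⟩
    count≤ k (suc k ℕ.+ n) ℕ.+ (withPart k (suc k ℕ.+ n) 0 ℕ.+ ∑ (k ℕ.+ n) (λ i → withPart k (suc k ℕ.+ n) (suc i)))
      ≡⟨ cong₂ (λ x y → count≤ k (suc k ℕ.+ n) ℕ.+ (x ℕ.+ y)) (withPart-shift-0 k n)
           (trans (∑-cong (k ℕ.+ n) (withPart-shift-suc k n))
             (trans (cong (λ m → ∑ m (withPart k n)) (ℕₚ.+-comm k n)) (∑-extend k n λ i → withPart-> k n (n ℕ.+ i) (large i)))) ⟩
    count≤ k (suc k ℕ.+ n) ℕ.+ (2 ℕ.* count≤ k n ℕ.+ ∑ n (withPart k n))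
      ≡⟨ cong (count≤ k (suc k ℕ.+ n) ℕ.+_) (assoc (count≤ k n) _) ⟩
    count≤ k (suc k ℕ.+ n) ℕ.+ (count≤ k n ℕ.+ (count≤ k n ℕ.+ ∑ n (withPart k n)))
      ≡⟨ cong (λ x → count≤ k (suc k ℕ.+ n) ℕ.+ (count≤ k n ℕ.+ x)) (count≤-suc k n) ⟨
    count≤ k (suc k ℕ.+ n) ℕ.+ (count≤ k n ℕ.+ count≤ (suc k) n) ∎
    where
    open ≡-Reasoning
    assoc : ∀ a b → 2 ℕ.* a ℕ.+ b ≡ a ℕ.+ (a ℕ.+ b)
    assoc = solveℕ
    large : ∀ i → n ℕ.< suc (n ℕ.+ i) ℕ.* suc k
    large i = ℕₚ.≤-trans (s≤s (ℕₚ.m≤m+n n i)) (ℕₚ.m≤m*n (suc (n ℕ.+ i)) (suc k))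

  𝒬 : ℕ → Series
  𝒬 k n = + count≤ k n

  -- This is (1 - x) 𝒬 (k+1) = (1 + x) 𝒬 k with x = q^(k+1), written without subtraction.
  𝒬-suc : ∀ k → 𝒬 (suc k) ≋ 𝒬 k ⊕ X (suc k) ⊛ (𝒬 k ⊕ 𝒬 (suc k))
  𝒬-suc k = shifted {𝒬 (suc k)} {𝒬 k} (suc k) (𝒬 k ⊕ 𝒬 (suc k)) (λ n n<K → cong +_ (count≤-< k n n<K))
      (λ n → trans (cong +_ (count≤-shift k n)) (cong (λ x → 𝒬 k (suc k ℕ.+ n) + x) (sym (⊕-coeff (𝒬 k) (𝒬 (suc k)) n))))

  𝒬-zero : 𝒬 0 ≋ κ 1ℤ
  𝒬-zero = pointwise λ { zero → refl ; (suc n) → refl }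

  -- The geometric series 1/(1 - q^(k+1)).
  geo : ℕ → Series
  geo k n = if does (suc k ℕ∣.∣? n) then 1ℤ else 0ℤ

  geo-unfold : ∀ k → geo k ≋ κ 1ℤ ⊕ X (suc k) ⊛ geo k
  geo-unfold k = shifted {geo k} {κ 1ℤ} (suc k) (geo k) below above
    where
    below : ∀ n → n ℕ.< suc k → geo k n ≡ κ 1ℤ n
    below zero _ = if-yes (suc k ℕ∣.∣? 0) {1ℤ} {0ℤ} (suc k ℕ∣.∣0)
    below (suc n) n<K = if-no (suc k ℕ∣.∣? suc n) (λ d → ℕₚ.<⇒≱ n<K (ℕ∣.∣⇒≤ d))
    above : ∀ n → geo k (suc k ℕ.+ n) ≡ 0ℤ + geo k n
    above n = trans (go (suc k ℕ∣.∣? n)) (sym (ℤₚ.+-identityˡ _))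
      where
      go : Dec (suc k ℕ∣.∣ n) → geo k (suc k ℕ.+ n) ≡ geo k n
      go (yes d) = trans (if-yes (suc k ℕ∣.∣? suc k ℕ.+ n) (ℕ∣.∣m∣n⇒∣m+n ℕ∣.∣-refl d)) (sym (if-yes (suc k ℕ∣.∣? n) d))
      go (no ¬d) = trans (if-no (suc k ℕ∣.∣? suc k ℕ.+ n) (λ d → ¬d (ℕ∣.∣m+n∣m⇒∣n d ℕ∣.∣-refl))) (sym (if-no (suc k ℕ∣.∣? n) ¬d))

  -- g k = 1/(q;q)_k
  g : ℕ → Series
  g zero    = κ 1ℤ
  g (suc k) = g k ⊛ geo k

  g-suc : ∀ k → g (suc k) ≋ g k ⊕ X (suc k) ⊛ g (suc k)
  g-suc k = comb (g k) (geo-unfold k)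
    (solve 3 (λ u x h → u :* h :+ u :* (con 1ℤ :+ x :* h) := u :+ x :* (u :* h) :+ u :* h) ≋.refl (g k) (X (suc k)) (geo k))

  g-pred : ∀ k → g k ≋ (κ 1ℤ ⊕ ⊖ X (suc k)) ⊛ g (suc k)
  g-pred k = comb (κ 1ℤ) (≋.sym (g-suc k))
    (solve 3 (λ u v x → u :+ con 1ℤ :* v := (con 1ℤ :+ :- x) :* v :+ con 1ℤ :* (u :+ x :* v)) ≋.refl (g k) (g (suc k)) (X (suc k)))

  -- The product (q²;q²)_k.
  D : ℕ → Series
  D zero    = κ 1ℤ
  D (suc k) = D k ⊛ (κ 1ℤ ⊕ ⊖ X (suc k ℕ.+ suc k))

  X-double : ∀ k → κ 1ℤ ⊕ ⊖ X (k ℕ.+ k) ≋ κ 1ℤ ⊕ ⊖ (X k ⊛ X k)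
  X-double k = ⊕-cong ≋.refl (⊖-cong (X-+ k k))

  -- The fraction (-q;q)_k / (q;q)_k, extended by (q;q)_k so that (1 + x)(1 - x) = 1 - x² collects
  -- the numerator into `D`.
  𝒬-product : ∀ k → 𝒬 k ≋ g k ⊛ g k ⊛ D k
  𝒬-product zero = ≋.trans 𝒬-zero (solve 0 (con 1ℤ := con 1ℤ :* con 1ℤ :* con 1ℤ) ≋.refl)
  𝒬-product (suc k) = begin
    𝒬 (suc k)
      ≈⟨ comb h (𝒬-suc k) (comb (⊖ 𝒬 (suc k)) (geo-unfold k)
         (solve 4 (λ a b x h → a :+ h :* (b :+ x :* (b :+ a)) :+ :- a :* (con 1ℤ :+ x :* h)
            := b :* (con 1ℤ :+ x) :* h :+ h :* a :+ :- a :* h) ≋.refl (𝒬 (suc k)) (𝒬 k) x h)) ⟩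
    𝒬 k ⊛ (κ 1ℤ ⊕ x) ⊛ h
      ≈⟨ ⊛-cong (⊛-cong (𝒬-product k) ≋.refl) ≋.refl ⟩
    g k ⊛ g k ⊛ D k ⊛ (κ 1ℤ ⊕ x) ⊛ h
      ≈⟨ comb (⊖ (g k ⊛ g k ⊛ D k ⊛ (κ 1ℤ ⊕ x) ⊛ h)) (geo-unfold k)
         (solve 4 (λ u d x h → u :* u :* d :* (con 1ℤ :+ x) :* h :+ (:- (u :* u :* d :* (con 1ℤ :+ x) :* h)) :* (con 1ℤ :+ x :* h)
            := u :* h :* (u :* h) :* (d :* (con 1ℤ :+ :- (x :* x))) :+ (:- (u :* u :* d :* (con 1ℤ :+ x) :* h)) :* h) ≋.refl (g k)
                (D k) x h) ⟩
    g k ⊛ h ⊛ (g k ⊛ h) ⊛ (D k ⊛ (κ 1ℤ ⊕ ⊖ (x ⊛ x)))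
      ≈⟨ ⊛-cong ≋.refl (⊛-cong ≋.refl (X-double (suc k))) ⟨
    g (suc k) ⊛ g (suc k) ⊛ D (suc k) ∎
    where
    open import Relation.Binary.Reasoning.Setoid seriesSetoid
    x = X (suc k)
    h = geo k

  -- A finite form of Gauss's identity for φ(-q).

  signedTerm : ℕ → ℕ → Series
  signedTerm k j = κ (sgn (suc j)) ⊛ X (suc j ℕ.* suc j) ⊛ g (k ℕ.∸ suc j) ⊛ g (k ℕ.+ suc j)

  -- (1 - q^{2K}) times the partial sums for K minus those for K - 1 telescopes.
  telescope : ∀ j a → let k = j ℕ.+ a; K = suc k in
    (κ 1ℤ ⊕ ⊖ X (K ℕ.+ K)) ⊛ sumS j (signedTerm K) ≋
    sumS j (signedTerm k) ⊕ ⊖ (X K ⊛ g k ⊛ g K) ⊕ κ (sgn j) ⊛ X (j ℕ.* j ℕ.+ j ℕ.+ K) ⊛ g a ⊛ g (K ℕ.+ j)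
  telescope zero a rewrite ℕₚ.+-identityʳ a =
    solve 4 (λ x y u v → (con 1ℤ :+ :- y) :* con 0ℤ := con 0ℤ :+ :- (x :* u :* v) :+ con 1ℤ :* x :* u :* v)
       ≋.refl (X (suc a)) (X (suc a ℕ.+ suc a)) (g a) (g (suc a))
  telescope (suc j) a = begin
    (κ 1ℤ ⊕ ⊖ X (K ℕ.+ K)) ⊛ (sumS j (signedTerm K) ⊕ signedTerm K j)
      ≈⟨ solve 3 (λ y s t → (con 1ℤ :+ :- y) :* (s :+ t) := (con 1ℤ :+ :- y) :* s :+ (con 1ℤ :+ :- y) :* t) ≋.refl (X (K ℕ.+ K))
          (sumS j (signedTerm K)) (signedTerm K j) ⟩
    (κ 1ℤ ⊕ ⊖ X (K ℕ.+ K)) ⊛ sumS j (signedTerm K) ⊕ (κ 1ℤ ⊕ ⊖ X (K ℕ.+ K)) ⊛ signedTerm K j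
      ≈⟨ ⊕-cong ih (⊛-cong (⊕-cong ≋.refl (⊖-cong XKK)) term) ⟩
    sumS j (signedTerm k) ⊕ ⊖ (X K ⊛ g k ⊛ g K) ⊕ κ (sgn j) ⊛ (M ⊛ A) ⊛ G ⊛ ((κ 1ℤ ⊕ ⊖ B) ⊛ H)
        ⊕ (κ 1ℤ ⊕ ⊖ (A ⊛ B)) ⊛ (κ (sgn (suc j)) ⊛ M ⊛ G ⊛ H)
      ≈⟨ ⊕-cong ≋.refl (⊛-cong ≋.refl (⊛-cong (⊛-cong (⊛-cong (κ-neg (sgn j)) ≋.refl) ≋.refl) ≋.refl)) ⟩
    sumS j (signedTerm k) ⊕ ⊖ (X K ⊛ g k ⊛ g K) ⊕ κ (sgn j) ⊛ (M ⊛ A) ⊛ G ⊛ ((κ 1ℤ ⊕ ⊖ B) ⊛ H)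
        ⊕ (κ 1ℤ ⊕ ⊖ (A ⊛ B)) ⊛ (⊖ κ (sgn j) ⊛ M ⊛ G ⊛ H)
      -- The old boundary term and the new summand become a summand of level `k` and the next
      -- boundary term: up to the common factor, A(1 - B) - (1 - AB) = -(1 - A)(1 - B) - B(1 - A).
      ≈⟨ solve 8 (λ s t c m a b g h →
           s :+ :- t :+ c :* (m :* a) :* g :* ((con 1ℤ :+ :- b) :* h) :+ (con 1ℤ :+ :- (a :* b)) :* (:- c :* m :* g :* h)
           := s :+ (:- c :* m :* ((con 1ℤ :+ :- a) :* g) :* ((con 1ℤ :+ :- b) :* h)) :+ :- t :+ :- c :* (m :* b) :*
               ((con 1ℤ :+ :- a) :* g) :* h)
           ≋.refl (sumS j (signedTerm k)) (X K ⊛ g k ⊛ g K) (κ (sgn j)) M A B G H ⟩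
    sumS j (signedTerm k) ⊕ (⊖ κ (sgn j) ⊛ M ⊛ ((κ 1ℤ ⊕ ⊖ A) ⊛ G) ⊛ ((κ 1ℤ ⊕ ⊖ B) ⊛ H)) ⊕ ⊖ (X K ⊛ g k ⊛ g K)
       ⊕ ⊖ κ (sgn j) ⊛ (M ⊛ B) ⊛ ((κ 1ℤ ⊕ ⊖ A) ⊛ G) ⊛ H
      ≈⟨ ⊕-cong (⊕-cong (⊕-cong ≋.refl (⊛-cong (⊛-cong (⊛-cong (κ-neg (sgn j)) ≋.refl) (g-pred a)) gB)) ≋.refl)
                (⊛-cong (⊛-cong (⊛-cong (κ-neg (sgn j)) MB) (g-pred a)) ≋.refl) ⟨
    sumS j (signedTerm k) ⊕ (κ (sgn (suc j)) ⊛ M ⊛ g a ⊛ g (K ℕ.+ j)) ⊕ ⊖ (X K ⊛ g k ⊛ g K)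
       ⊕ κ (sgn (suc j)) ⊛ X (suc j ℕ.* suc j ℕ.+ suc j ℕ.+ K) ⊛ g a ⊛ H
      ≈⟨ ⊕-cong (⊕-cong (⊕-cong ≋.refl term′) ≋.refl) ≋.refl ⟨
    sumS j (signedTerm k) ⊕ signedTerm k j ⊕ ⊖ (X K ⊛ g k ⊛ g K)
       ⊕ κ (sgn (suc j)) ⊛ X (suc j ℕ.* suc j ℕ.+ suc j ℕ.+ K) ⊛ g a ⊛ H ∎
    where
    open import Relation.Binary.Reasoning.Setoid seriesSetoid
    k = suc j ℕ.+ a
    K = suc k
    A = X (suc a)
    B = X (suc (K ℕ.+ j))
    M = X (suc j ℕ.* suc j)
    G = g (suc a)
    H = g (K ℕ.+ suc j)
    Kj : K ℕ.+ suc j ≡ suc (K ℕ.+ j)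
    Kj = ℕₚ.+-suc K j
    k-a : j ℕ.+ suc a ≡ k
    k-a = ℕₚ.+-suc j a
    e₁ : ∀ j a → suc (suc j ℕ.+ a) ℕ.+ suc (suc j ℕ.+ a) ≡ suc a ℕ.+ suc (suc (suc j ℕ.+ a) ℕ.+ j)
    e₁ = solveℕ
    e₂ : ∀ j a → j ℕ.* j ℕ.+ j ℕ.+ suc (suc j ℕ.+ a) ≡ suc j ℕ.* suc j ℕ.+ suc a
    e₂ = solveℕ
    e₃ : ∀ j a → suc j ℕ.* suc j ℕ.+ suc j ℕ.+ suc (suc j ℕ.+ a) ≡ suc j ℕ.* suc j ℕ.+ suc (suc (suc j ℕ.+ a) ℕ.+ j)
    e₃ = solveℕ
    XKK : X (K ℕ.+ K) ≋ A ⊛ B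
    XKK = ≋.trans (≋.reflexive (cong X (e₁ j a))) (X-+ (suc a) (suc (K ℕ.+ j)))
    MA : X (j ℕ.* j ℕ.+ j ℕ.+ K) ≋ M ⊛ A
    MA = ≋.trans (≋.reflexive (cong X (e₂ j a))) (X-+ (suc j ℕ.* suc j) (suc a))
    MB : X (suc j ℕ.* suc j ℕ.+ suc j ℕ.+ K) ≋ M ⊛ B
    MB = ≋.trans (≋.reflexive (cong X (e₃ j a))) (X-+ (suc j ℕ.* suc j) (suc (K ℕ.+ j)))
    gB : g (K ℕ.+ j) ≋ (κ 1ℤ ⊕ ⊖ B) ⊛ H
    gB = ≋.trans (g-pred (K ℕ.+ j)) (⊛-cong ≋.refl (≋.reflexive (cong g (sym Kj))))
    ih : (κ 1ℤ ⊕ ⊖ X (K ℕ.+ K)) ⊛ sumS j (signedTerm K) ≋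
         sumS j (signedTerm k) ⊕ ⊖ (X K ⊛ g k ⊛ g K) ⊕ κ (sgn j) ⊛ (M ⊛ A) ⊛ G ⊛ ((κ 1ℤ ⊕ ⊖ B) ⊛ H)
    ih = ≋.trans (subst (λ k → (κ 1ℤ ⊕ ⊖ X (suc k ℕ.+ suc k)) ⊛ sumS j (signedTerm (suc k)) ≋
            sumS j (signedTerm k) ⊕ ⊖ (X (suc k) ⊛ g k ⊛ g (suc k)) ⊕ κ (sgn j) ⊛ X (j ℕ.* j ℕ.+ j ℕ.+ suc k) ⊛ G ⊛ g (suc k ℕ.+ j))
            k-a (telescope j (suc a)))
            (⊕-cong ≋.refl (⊛-cong (⊛-cong (⊛-cong ≋.refl MA) ≋.refl) gB))
    diff : K ℕ.∸ suc j ≡ suc a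
    diff = trans (cong (ℕ._∸ j) (sym k-a)) (ℕₚ.m+n∸m≡n j (suc a))
    diff′ : k ℕ.∸ suc j ≡ a
    diff′ = ℕₚ.m+n∸m≡n j a
    term : signedTerm K j ≋ κ (sgn (suc j)) ⊛ M ⊛ G ⊛ H
    term = ⊛-cong (⊛-cong ≋.refl (≋.reflexive (cong g diff))) ≋.refl
    term′ : signedTerm k j ≋ κ (sgn (suc j)) ⊛ M ⊛ g a ⊛ g (K ℕ.+ j)
    term′ = ⊛-cong (⊛-cong ≋.refl (≋.reflexive (cong g diff′))) (≋.reflexive (cong g (ℕₚ.+-suc k j)))

  -- The sum over |j| ≤ k of (-1)^j q^(j²) / ((q;q)_(k-j) (q;q)_(k+j)), with j and -j folded into
  -- the factor 2.
  F : ℕ → Series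
  F k = g k ⊛ g k ⊕ κ (+ 2) ⊛ sumS k (signedTerm k)

  -- The boundary term of `telescope` at j = k is cancelled by the last summand of level `suc k`.
  -- The other boundary term completes the square: (1 - x²)u² - 2x(1 - x)u² = ((1 - x)u)² with u =
  -- `g (suc k)`.
  F-suc : ∀ k → (κ 1ℤ ⊕ ⊖ X (suc k ℕ.+ suc k)) ⊛ F (suc k) ≋ F k
  F-suc k = begin
    (κ 1ℤ ⊕ ⊖ Y) ⊛ F K
      ≈⟨ solve 4 (λ y u s t → (con 1ℤ :+ :- y) :* (u :* u :+ con (+ 2) :* (s :+ t)) :=
            (con 1ℤ :+ :- y) :* (u :* u) :+ con (+ 2) :* ((con 1ℤ :+ :- y) :* s) :+ con (+ 2) :* ((con 1ℤ :+ :- y) :* t))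
            ≋.refl Y (g K) (sumS k (signedTerm K)) (signedTerm K k) ⟩
    (κ 1ℤ ⊕ ⊖ Y) ⊛ (g K ⊛ g K) ⊕ κ (+ 2) ⊛ ((κ 1ℤ ⊕ ⊖ Y) ⊛ sumS k (signedTerm K)) ⊕ κ (+ 2) ⊛ ((κ 1ℤ ⊕ ⊖ Y) ⊛ signedTerm K k)
      ≈⟨ ⊕-cong (⊕-cong (⊛-cong (X-double K) ≋.refl) (⊛-cong ≋.refl tele)) (⊛-cong ≋.refl (⊛-cong ≋.refl last)) ⟩
    (κ 1ℤ ⊕ ⊖ (X K ⊛ X K)) ⊛ (g K ⊛ g K)
      ⊕ κ (+ 2) ⊛ (sumS k (signedTerm k) ⊕ ⊖ (X K ⊛ ((κ 1ℤ ⊕ ⊖ X K) ⊛ g K) ⊛ g K) ⊕ κ (sgn k) ⊛ M ⊛ κ 1ℤ ⊛ ((κ 1ℤ ⊕ ⊖ Y) ⊛ g (K ℕ.+ K)))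
      ⊕ κ (+ 2) ⊛ ((κ 1ℤ ⊕ ⊖ Y) ⊛ (⊖ κ (sgn k) ⊛ M ⊛ κ 1ℤ ⊛ g (K ℕ.+ K)))
      ≈⟨ solve 7 (λ x y u s c m h →
           (con 1ℤ :+ :- (x :* x)) :* (u :* u)
           :+ con (+ 2) :* (s :+ :- (x :* ((con 1ℤ :+ :- x) :* u) :* u) :+ c :* m :* con 1ℤ :* ((con 1ℤ :+ :- y) :* h))
           :+ con (+ 2) :* ((con 1ℤ :+ :- y) :* (:- c :* m :* con 1ℤ :* h))
           := (con 1ℤ :+ :- x) :* u :* ((con 1ℤ :+ :- x) :* u) :+ con (+ 2) :* s)
           ≋.refl (X K) Y (g K) (sumS k (signedTerm k)) (κ (sgn k)) M (g (K ℕ.+ K)) ⟩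
    (κ 1ℤ ⊕ ⊖ X K) ⊛ g K ⊛ ((κ 1ℤ ⊕ ⊖ X K) ⊛ g K) ⊕ κ (+ 2) ⊛ sumS k (signedTerm k)
      ≈⟨ ⊕-cong (⊛-cong (g-pred k) (g-pred k)) ≋.refl ⟨
    F k ∎
    where
    open import Relation.Binary.Reasoning.Setoid seriesSetoid
    K = suc k
    Y = X (K ℕ.+ K)
    M = X (K ℕ.* K)
    Kk : suc (K ℕ.+ k) ≡ K ℕ.+ K
    Kk = sym (ℕₚ.+-suc K k)
    gY : g (K ℕ.+ k) ≋ (κ 1ℤ ⊕ ⊖ Y) ⊛ g (K ℕ.+ K)
    gY = subst (λ m → g (K ℕ.+ k) ≋ (κ 1ℤ ⊕ ⊖ X m) ⊛ g m) Kk (g-pred (K ℕ.+ k))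
    e : ∀ k → k ℕ.* k ℕ.+ k ℕ.+ suc k ≡ suc k ℕ.* suc k
    e = solveℕ
    tele : (κ 1ℤ ⊕ ⊖ Y) ⊛ sumS k (signedTerm K) ≋
      sumS k (signedTerm k) ⊕ ⊖ (X K ⊛ ((κ 1ℤ ⊕ ⊖ X K) ⊛ g K) ⊛ g K) ⊕ κ (sgn k) ⊛ M ⊛ κ 1ℤ ⊛ ((κ 1ℤ ⊕ ⊖ Y) ⊛ g (K ℕ.+ K))
    tele = ≋.trans (subst (λ k′ → (κ 1ℤ ⊕ ⊖ X (suc k′ ℕ.+ suc k′)) ⊛ sumS k (signedTerm (suc k′)) ≋
            sumS k (signedTerm k′) ⊕ ⊖ (X (suc k′) ⊛ g k′ ⊛ g (suc k′)) ⊕ κ (sgn k) ⊛ X (k ℕ.* k ℕ.+ k ℕ.+ suc k′) ⊛ g 0 ⊛ g (suc k′ ℕ.+ k))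
            (ℕₚ.+-identityʳ k) (telescope k 0))
       (⊕-cong (⊕-cong ≋.refl (⊖-cong (⊛-cong (⊛-cong ≋.refl (g-pred k)) ≋.refl)))
               (⊛-cong (⊛-cong (⊛-cong ≋.refl (≋.reflexive (cong X (e k)))) ≋.refl) gY))
    last : signedTerm K k ≋ ⊖ κ (sgn k) ⊛ M ⊛ κ 1ℤ ⊛ g (K ℕ.+ K)
    last = ⊛-cong (⊛-cong (⊛-cong (κ-neg (sgn k)) ≋.refl) (≋.reflexive (cong g (ℕₚ.n∸n≡0 k)))) ≋.refl

  -- So `F k` is 1/(q²;q²)_k. For growing `k` its left side tends to φ(-q)/(q;q)², which makes φ(-q)
  -- the inverse of the overpartition series.
  F⊛D : ∀ k → F k ⊛ D k ≋ κ 1ℤ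
  F⊛D zero = solve 0 ((con 1ℤ :* con 1ℤ :+ con (+ 2) :* con 0ℤ) :* con 1ℤ := con 1ℤ) ≋.refl
  F⊛D (suc k) = ≋.trans (solve 3 (λ f d e → f :* (d :* e) := (e :* f) :* d) ≋.refl (F (suc k)) (D k) _)
    (≋.trans (⊛-cong (F-suc k) ≋.refl) (F⊛D k))

  sumZ : ℕ → (ℕ → ℤ) → ℤ
  sumZ zero    t = 0ℤ
  sumZ (suc n) t = sumZ n t + t n

  sumZ-cong : ∀ n {t u} → (∀ i → i ℕ.< n → t i ≡ u i) → sumZ n t ≡ sumZ n u
  sumZ-cong zero p = refl
  sumZ-cong (suc n) p = cong₂ _+_ (sumZ-cong n (λ i i<n → p i (ℕₚ.m<n⇒m<1+n i<n))) (p n ℕₚ.≤-refl)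

  sumZ-scale : ∀ c n t → sumZ n (λ i → c * t i) ≡ c * sumZ n t
  sumZ-scale c zero t = sym (ℤₚ.*-zeroʳ c)
  sumZ-scale c (suc n) t rewrite sumZ-scale c n t = sym (ℤₚ.*-distribˡ-+ c (sumZ n t) (t n))

  sumZ-extend : ∀ n d {t} → (∀ i → n ℕ.≤ i → t i ≡ 0ℤ) → sumZ (n ℕ.+ d) t ≡ sumZ n t
  sumZ-extend n zero p = cong (λ m → sumZ m _) (ℕₚ.+-identityʳ n)
  sumZ-extend n (suc d) p rewrite ℕₚ.+-suc n d | p (n ℕ.+ d) (ℕₚ.m≤m+n n d) =
    trans (ℤₚ.+-identityʳ _) (sumZ-extend n d p)

  sumS-coeff : ∀ n t i → sumS n t i ≡ sumZ n (λ j → t j i)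
  sumS-coeff zero t i = κ-0 i
  sumS-coeff (suc n) t i = trans (⊕-coeff (sumS n t) (t n) i) (cong (λ x → x + t n i) (sumS-coeff n t i))

  sumS-⊛ : ∀ n t h → sumS n t ⊛ h ≋ sumS n (λ j → t j ⊛ h)
  sumS-⊛ zero t h = solve 1 (λ h → con 0ℤ :* h := con 0ℤ) ≋.refl h
  sumS-⊛ (suc n) t h = ≋.trans (⊛-distribʳ h (sumS n t) (t n)) (⊕-cong (sumS-⊛ n t h) ≋.refl)

  g-stable : ∀ a d i → i ℕ.≤ a → g (a ℕ.+ d) i ≡ g a i
  g-stable a zero i i≤a = cong (λ m → g m i) (ℕₚ.+-identityʳ a)
  g-stable a (suc d) i i≤a rewrite ℕₚ.+-suc a d = begin
    g (suc (a ℕ.+ d)) i                                        ≡⟨ coeff (g-suc (a ℕ.+ d)) i ⟩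
    (g (a ℕ.+ d) ⊕ X (suc (a ℕ.+ d)) ⊛ g (suc (a ℕ.+ d))) i    ≡⟨ ⊕-coeff (g (a ℕ.+ d)) _ i ⟩
    g (a ℕ.+ d) i + (X (suc (a ℕ.+ d)) ⊛ g (suc (a ℕ.+ d))) i
      ≡⟨ cong₂ _+_ (g-stable a d i i≤a) (X-⊛-< (suc (a ℕ.+ d)) _ (s≤s (ℕₚ.≤-trans i≤a (ℕₚ.m≤m+n a d)))) ⟩
    g a i + 0ℤ                                                 ≡⟨ ℤₚ.+-identityʳ _ ⟩
    g a i                                                      ∎
    where open ≡-Reasoning

  count≤-stable : ∀ n d → count≤ (n ℕ.+ d) n ≡ pbar n
  count≤-stable n zero = cong (λ m → count≤ m n) (ℕₚ.+-identityʳ n)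
  count≤-stable n (suc d) rewrite ℕₚ.+-suc n d =
    trans (count≤-< (n ℕ.+ d) n (s≤s (ℕₚ.m≤m+n n d))) (count≤-stable n d)

  signedSquare : ℕ → Series
  signedSquare j = κ (sgn (suc j)) ⊛ X (suc j ℕ.* suc j)

  θ≤ : ℕ → Series
  θ≤ k = κ 1ℤ ⊕ κ (+ 2) ⊛ sumS k signedSquare

  signedTerm-truncated : ∀ k j n → j ℕ.< k → n ℕ.≤ k → signedTerm k j n ≡ (signedSquare j ⊛ (g k ⊛ g k)) n
  signedTerm-truncated k j n j<k n≤k = begin
    (κ c ⊛ X m ⊛ g a ⊛ g b) n
      ≡⟨ coeff (solve 4 (λ c x u v → c :* x :* u :* v := c :* (x :* (u :* v))) ≋.refl (κ c) (X m) (g a) (g b)) n ⟩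
    (κ c ⊛ (X m ⊛ (g a ⊛ g b))) n  ≡⟨ κ-⊛ c _ n ⟩
    c * (X m ⊛ (g a ⊛ g b)) n      ≡⟨ cong (c *_) agree ⟩
    c * (X m ⊛ (g k ⊛ g k)) n      ≡⟨ κ-⊛ c _ n ⟨
    (κ c ⊛ (X m ⊛ (g k ⊛ g k))) n
      ≡⟨ coeff (solve 3 (λ c x u → c :* (x :* (u :* u)) := c :* x :* (u :* u)) ≋.refl (κ c) (X m) (g k)) n ⟩
    (κ c ⊛ X m ⊛ (g k ⊛ g k)) n ∎
    where
    open ≡-Reasoning
    c = sgn (suc j)
    m = suc j ℕ.* suc j
    a = k ℕ.∸ suc j
    b = k ℕ.+ suc j
    k-split : a ℕ.+ suc j ≡ k
    k-split = ℕₚ.m∸n+n≡m j<k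
    agree : (X m ⊛ (g a ⊛ g b)) n ≡ (X m ⊛ (g k ⊛ g k)) n
    agree with n ℕ.<? m
    ... | yes n<m = trans (X-⊛-< m _ n<m) (sym (X-⊛-< m _ n<m))
    ... | no n≮m  = subst (λ n → (X m ⊛ (g a ⊛ g b)) n ≡ (X m ⊛ (g k ⊛ g k)) n) m+i≡n
        (trans (X-⊛-≥ m _ i) (trans (⊛-cong-upTo i
           (λ l l≤i → sym (trans (cong (λ k → g k l) (sym k-split)) (g-stable a (suc j) l (ℕₚ.≤-trans l≤i i≤a))))
           (λ l l≤i → g-stable k (suc j) l (ℕₚ.≤-trans l≤i (ℕₚ.≤-trans i≤a (ℕₚ.m∸n≤m k (suc j))))))
         (sym (X-⊛-≥ m _ i))))
      where
      i = n ℕ.∸ m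
      m+i≡n : m ℕ.+ i ≡ n
      m+i≡n = ℕₚ.m+[n∸m]≡n (ℕₚ.≮⇒≥ n≮m)
      -- The exponent (j+1)² is at least j + 1, so it pays for the index lost in passing from `k` to
      -- `k ∸ suc j`, and the truncation order `k` survives.
      i≤a : i ℕ.≤ a
      i≤a = ℕₚ.∸-mono n≤k (ℕₚ.m≤m*n (suc j) (suc j))

  F-truncated : ∀ k n → n ℕ.≤ k → F k n ≡ (θ≤ k ⊛ (g k ⊛ g k)) n
  F-truncated k n n≤k = begin
    F k n
      ≡⟨ ⊕-coeff (g k ⊛ g k) _ n ⟩
    (g k ⊛ g k) n + (κ (+ 2) ⊛ sumS k (signedTerm k)) n
      ≡⟨ cong (λ x → (g k ⊛ g k) n + x) (trans (κ-⊛ (+ 2) _ n) (cong (+ 2 *_) (sumS-coeff k (signedTerm k) n))) ⟩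
    (g k ⊛ g k) n + + 2 * sumZ k (λ j → signedTerm k j n)
      ≡⟨ cong (λ x → (g k ⊛ g k) n + + 2 * x) (sumZ-cong k (λ j j<k → signedTerm-truncated k j n j<k n≤k)) ⟩
    (g k ⊛ g k) n + + 2 * sumZ k (λ j → (signedSquare j ⊛ (g k ⊛ g k)) n)
      ≡⟨ cong (λ x → (g k ⊛ g k) n + x) (sym (trans (κ-⊛ (+ 2) _ n) (cong (+ 2 *_) (sumS-coeff k (λ j → signedSquare j ⊛ (g k ⊛ g k)) n))))
          ⟩
    (g k ⊛ g k) n + (κ (+ 2) ⊛ sumS k (λ j → signedSquare j ⊛ (g k ⊛ g k))) n
      ≡⟨ ⊕-coeff (g k ⊛ g k) _ n ⟨
    (g k ⊛ g k ⊕ κ (+ 2) ⊛ sumS k (λ j → signedSquare j ⊛ (g k ⊛ g k))) n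
      ≡⟨ coeff (⊕-cong ≋.refl (⊛-cong ≋.refl (sumS-⊛ k signedSquare (g k ⊛ g k)))) n ⟨
    (g k ⊛ g k ⊕ κ (+ 2) ⊛ (sumS k signedSquare ⊛ (g k ⊛ g k))) n
      ≡⟨ coeff (solve 2 (λ u s → u :+ con (+ 2) :* (s :* u) := (con 1ℤ :+ con (+ 2) :* s) :* u) ≋.refl (g k ⊛ g k) (sumS k signedSquare)) n
          ⟩
    (θ≤ k ⊛ (g k ⊛ g k)) n ∎
    where open ≡-Reasoning

  gauss-truncated : ∀ k n → n ℕ.≤ k → (θ≤ k ⊛ 𝒬 k) n ≡ κ 1ℤ n
  gauss-truncated k n n≤k = begin
    (θ≤ k ⊛ 𝒬 k) n                  ≡⟨ coeff (⊛-cong ≋.refl (𝒬-product k)) n ⟩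
    (θ≤ k ⊛ (g k ⊛ g k ⊛ D k)) n
      ≡⟨ coeff (solve 3 (λ t u d → t :* (u :* d) := t :* u :* d) ≋.refl (θ≤ k) (g k ⊛ g k) (D k)) n ⟩
    (θ≤ k ⊛ (g k ⊛ g k) ⊛ D k) n
      ≡⟨ ⊛-cong-upTo n (λ i i≤n → sym (F-truncated k i (ℕₚ.≤-trans i≤n n≤k))) (λ i _ → refl) ⟩
    (F k ⊛ D k) n                    ≡⟨ coeff (F⊛D k) n ⟩
    κ 1ℤ n                           ∎
    where open ≡-Reasoning

  -- S = Σ_{x ≥ 1} q^{x²} and φ = Σ_{x ∈ ℤ} q^{x²}.
  S φ : Series
  S n = sumZ n (λ j → X (suc j ℕ.* suc j) n)
  φ = κ 1ℤ ⊕ κ (+ 2) ⊛ S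

  S-upTo : ∀ n d → sumZ (n ℕ.+ d) (λ j → X (suc j ℕ.* suc j) n) ≡ S n
  S-upTo n d = sumZ-extend n d λ i n≤i →
    X-≢ (suc i ℕ.* suc i) n (ℕₚ.>⇒≢ (ℕₚ.≤-trans (s≤s n≤i) (ℕₚ.m≤m*n (suc i) (suc i))))

  sgn-+ : ∀ m n → sgn (m ℕ.+ n) ≡ sgn m * sgn n
  sgn-+ zero n = sym (ℤₚ.*-identityˡ _)
  sgn-+ (suc m) n rewrite sgn-+ m n = ℤₚ.neg-distribˡ-* (sgn m) (sgn n)

  sgn² : ∀ m → sgn m * sgn m ≡ 1ℤ
  sgn² zero = refl
  sgn² (suc m) = trans (lemma (sgn m)) (sgn² m)
    where
    lemma : ∀ x → - x * - x ≡ x * x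
    lemma = solve-∀

  sgn-double : ∀ m → sgn (m ℕ.+ m) ≡ 1ℤ
  sgn-double m = trans (sgn-+ m m) (sgn² m)

  -- Identifies the sign (-1)^j of a theta term with the sign (-1)^n of its exponent n = j², so that
  -- the signed theta series is a twist of `φ`.
  sgn-square : ∀ m → sgn (m ℕ.* m) ≡ sgn m
  sgn-square zero = refl
  sgn-square (suc m) = cong -_ (begin
    sgn (m ℕ.+ m ℕ.* suc m)              ≡⟨ cong sgn (e m) ⟩
    sgn ((m ℕ.+ m) ℕ.+ m ℕ.* m)          ≡⟨ sgn-+ (m ℕ.+ m) (m ℕ.* m) ⟩
    sgn (m ℕ.+ m) * sgn (m ℕ.* m)        ≡⟨ cong₂ _*_ (sgn-double m) (sgn-square m) ⟩
    1ℤ * sgn m                           ≡⟨ ℤₚ.*-identityˡ _ ⟩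
    sgn m                                ∎)
    where
    open ≡-Reasoning
    e : ∀ m → m ℕ.+ m ℕ.* suc m ≡ (m ℕ.+ m) ℕ.+ m ℕ.* m
    e = solveℕ

  κ-suc-coeff : ∀ c n → sgn n * κ c n ≡ κ c n
  κ-suc-coeff c zero = ℤₚ.*-identityˡ c
  κ-suc-coeff c (suc n) = ℤₚ.*-zeroʳ (sgn (suc n))

  θ≤-coeff : ∀ k n → n ℕ.≤ k → θ≤ k n ≡ twist φ n
  θ≤-coeff k n n≤k = begin
    θ≤ k n ≡⟨ ⊕-coeff (κ 1ℤ) _ n ⟩
    κ 1ℤ n + (κ (+ 2) ⊛ sumS k signedSquare) n
      ≡⟨ cong (λ x → κ 1ℤ n + x) (trans (κ-⊛ (+ 2) _ n) (cong (+ 2 *_) (sumS-coeff k signedSquare n))) ⟩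
    κ 1ℤ n + + 2 * sumZ k (λ j → signedSquare j n)
      ≡⟨ cong (λ x → κ 1ℤ n + + 2 * x) (trans (sumZ-cong k (λ j _ → twisted j)) (sumZ-scale (sgn n) k _)) ⟩
    κ 1ℤ n + + 2 * (sgn n * sumZ k (λ j → X (suc j ℕ.* suc j) n))
      ≡⟨ cong (λ x → κ 1ℤ n + + 2 * (sgn n * x)) (trans (cong (λ m → sumZ m (λ j → X (suc j ℕ.* suc j) n)) (sym (ℕₚ.m+[n∸m]≡n n≤k)))
          (S-upTo n (k ℕ.∸ n))) ⟩
    κ 1ℤ n + + 2 * (sgn n * S n)
      ≡⟨ cong (λ x → x + + 2 * (sgn n * S n)) (sym (κ-suc-coeff 1ℤ n)) ⟩
    sgn n * κ 1ℤ n + + 2 * (sgn n * S n)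
      ≡⟨ lemma (sgn n) (κ 1ℤ n) (S n) ⟩
    sgn n * (κ 1ℤ n + + 2 * S n)
      ≡⟨ cong (sgn n *_) (trans (cong (λ x → κ 1ℤ n + x) (sym (κ-⊛ (+ 2) S n))) (sym (⊕-coeff (κ 1ℤ) (κ (+ 2) ⊛ S) n))) ⟩
    twist φ n ∎
    where
    open ≡-Reasoning
    lemma : ∀ s a b → s * a + + 2 * (s * b) ≡ s * (a + + 2 * b)
    lemma = solve-∀
    twisted : ∀ j → signedSquare j n ≡ sgn n * X (suc j ℕ.* suc j) n
    twisted j = trans (κ-⊛ (sgn (suc j)) (X (suc j ℕ.* suc j)) n) (go (suc j ℕ.* suc j ℕ.≟ n))
      where
      go : Dec (suc j ℕ.* suc j ≡ n) → sgn (suc j) * X (suc j ℕ.* suc j) n ≡ sgn n * X (suc j ℕ.* suc j) n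
      go (yes refl) = cong (_* X (suc j ℕ.* suc j) (suc j ℕ.* suc j)) (sym (sgn-square (suc j)))
      go (no ≢n) rewrite X-≢ (suc j ℕ.* suc j) n ≢n = trans (ℤₚ.*-zeroʳ (sgn (suc j))) (sym (ℤₚ.*-zeroʳ (sgn n)))

  P : Series
  P = twist (λ n → + pbar n)

  φ⊛P : φ ⊛ P ≋ κ 1ℤ
  φ⊛P = pointwise λ n → begin
    (φ ⊛ P) n
      -- `twist` is an involution: writing `φ` as a double twist lets one twist be pulled out of the
      -- product, where the untwisted identity applies.
      ≡⟨ ⊛-cong-upTo n (λ i _ → sym (trans (sym (ℤₚ.*-assoc (sgn i) (sgn i) (φ i))) (trans (cong (_* φ i) (sgn² i)) (ℤₚ.*-identityˡ _))))
          (λ i _ → refl) ⟩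
    (twist (twist φ) ⊛ P) n
      ≡⟨ twist-⊛-coeff (twist φ) (λ n → + pbar n) n ⟨
    sgn n * (twist φ ⊛ (λ n → + pbar n)) n
      ≡⟨ cong (sgn n *_) (⊛-cong-upTo n (λ i i≤n → sym (θ≤-coeff n i i≤n)) (λ i i≤n → cong +_ (sym (stable n i i≤n)))) ⟩
    sgn n * (θ≤ n ⊛ 𝒬 n) n  ≡⟨ cong (sgn n *_) (gauss-truncated n n ℕₚ.≤-refl) ⟩
    sgn n * κ 1ℤ n          ≡⟨ κ-suc-coeff 1ℤ n ⟩
    κ 1ℤ n                  ∎
    where
    open ≡-Reasoning
    stable : ∀ k n → n ℕ.≤ k → count≤ k n ≡ pbar n
    stable k n n≤k = trans (cong (λ k → count≤ k n) (sym (ℕₚ.m+[n∸m]≡n n≤k))) (count≤-stable n (k ℕ.∸ n))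

-- Integral quaternions and Lagrange's descent.

module Quaternions where

  abs-square : ∀ x → + ((abs x) ℕ.* (abs x)) ≡ x * x
  abs-square x = trans (cong +_ (sym (ℤₚ.abs-* x x))) (ℤₚ.0≤i⇒+∣i∣≡i (sq≥0 x))
    where
    sq≥0 : ∀ x → 0ℤ ℤ.≤ x * x
    sq≥0 (+ zero) = ℤ.+≤+ z≤n
    sq≥0 (+ suc n) = ℤ.+≤+ z≤n
    sq≥0 -[1+ n ] = ℤ.+≤+ z≤n

  ℤ³ : Set
  ℤ³ = ℤ × ℤ × ℤ

  infix 9 _!_
  _!_ : ℤ³ → Fin 3 → ℤ
  (x , y , z) ! zero          = x
  (x , y , z) ! suc zero      = y
  (x , y , z) ! suc (suc zero) = z

  opaque
    dot : ℤ³ → ℤ³ → ℤ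
    dot (x , y , z) (x′ , y′ , z′) = x * x′ + y * y′ + z * z′

    dot-≡ : ∀ x y z x′ y′ z′ → dot (x , y , z) (x′ , y′ , z′) ≡ x * x′ + y * y′ + z * z′
    dot-≡ x y z x′ y′ z′ = refl

  ∣-lin₂ : ∀ {d x y} a b → d ∣ x → d ∣ y → d ∣ a * x + b * y
  ∣-lin₂ a b p q = ∣-+ (∣-*ˡ a p) (∣-*ˡ b q)

  ∣-lin₃ : ∀ {d x y z} a b c → d ∣ x → d ∣ y → d ∣ z → d ∣ a * x + b * y + c * z
  ∣-lin₃ a b c p q r = ∣-+ (∣-lin₂ a b p q) (∣-*ˡ c r)

  ∣-lin₄ : ∀ {d x y z w} a b c e → d ∣ x → d ∣ y → d ∣ z → d ∣ w → d ∣ a * x + b * y + c * z + e * w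
  ∣-lin₄ a b c e p q r s = ∣-+ (∣-lin₃ a b c p q r) (∣-*ˡ e s)

  ∣-≡ : ∀ {d x y} → d ∣ x → x ≡ y → d ∣ y
  ∣-≡ p refl = p

  -- The rows are ℓ times an orthonormal basis of a unimodular lattice, the ℓ-neighbour of ℤ³ attached to e.
  record Rotation (ℓ : ℕ) (e : ℤ³) : Set where
    field
      row      : Fin 3 → ℤ³
      norm     : ∀ k → dot (row k) (row k) ≡ + ℓ * + ℓ
      orth     : ∀ j k → j ≢ k → dot (row j) (row k) ≡ 0ℤ
      complete : ∀ w j → dot w (row zero) * row zero ! j + dot w (row (suc zero)) * row (suc zero) ! j
                   + dot w (row (suc (suc zero))) * row (suc (suc zero)) ! j ≡ + ℓ * + ℓ * w ! j
      perp     : ∀ k → + ℓ ∣ dot (row k) e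
      pivot    : ∃[ k ] ∃[ j ] ¬ (+ ℓ ∣ row k ! j)

  record Quaternion : Set where
    constructor quat
    field a b c d : ℤ

  N : Quaternion → ℤ
  N (quat a b c d) = a * a + b * b + c * c + d * d

  -- The components of e α vanish modulo L.
  record Annihilates (L : ℤ) (e : ℤ³) (α : Quaternion) : Set where
    constructor annihilates
    open Quaternion α
    field
      re : L ∣ e ! zero * b + e ! suc zero * c + e ! suc (suc zero) * d
      im₁ : L ∣ e ! zero * a + e ! suc zero * d - e ! suc (suc zero) * c
      im₂ : L ∣ e ! suc zero * a - e ! zero * d + e ! suc (suc zero) * b
      im₃ : L ∣ e ! suc (suc zero) * a + e ! zero * c - e ! suc zero * b

  -- Rounding x / k to the nearest integer q.
  record Nearest (k : ℕ) (x : ℤ) : Set where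
    field
      q     : ℤ
      r     : ℕ
      r<2k  : r ℕ.< k ℕ.+ k
      split : + 2 * x + + k ≡ + r + q * (+ k + + k)

  opaque
    nearest : ∀ k x → 0 ℕ.< k → Nearest k x
    nearest k@(suc _) x _ = record
      { q     = (+ 2 * x + + k) /ℕ (k ℕ.+ k)
      ; r     = (+ 2 * x + + k) %ℕ (k ℕ.+ k)
      ; r<2k  = n%ℕd<d (+ 2 * x + + k) (k ℕ.+ k)
      ; split = a≡a%ℕn+[a/ℕn]*n (+ 2 * x + + k) (k ℕ.+ k)
      }

  module _ {ℓ : ℕ} (ℓ-prime : Prime ℓ) where

    private
      L : ℤ
      L = + ℓ

    prime-∣-* : ∀ x y → L ∣ x * y → L ∣ x ⊎ L ∣ y
    prime-∣-* x y p with euclidsLemma (abs x) (abs y) ℓ-prime (subst (ℓ ℕ∣.∣_) (ℤₚ.abs-* x y) (ℤ∣.∣⇒∣ᵤ p))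
    ... | inj₁ q = inj₁ (ℤ∣.∣ᵤ⇒∣ q)
    ... | inj₂ q = inj₂ (ℤ∣.∣ᵤ⇒∣ q)

    prime-∣-cancel : ∀ x y → ¬ (L ∣ x) → L ∣ x * y → L ∣ y
    prime-∣-cancel x y ¬p q with prime-∣-* x y q
    ... | inj₁ p = ⊥-elim (¬p p)
    ... | inj₂ p = p

    no-divisor : ∀ k → 1 ℕ.< k → k ℕ.< ℓ → ¬ (k ℕ∣.∣ ℓ)
    no-divisor k 1<k k<ℓ k∣ℓ with prime⇒irreducible ℓ-prime k∣ℓ
    ... | inj₁ refl = ℕₚ.<-irrefl refl 1<k
    ... | inj₂ refl = ℕₚ.<-irrefl refl k<ℓ

    -- Lagrange's descent. With q the quaternion nearest to α / k, the quaternion (α times the conjugate of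
    -- α - k q) / k equals L minus α times the conjugate of q, whose norm is L k′ with k′ < k.
    descent-step : ∀ e k → 1 ℕ.< k → k ℕ.< ℓ → ∀ α → N α ≡ + k * L → Annihilates L e α →
                   ∃[ k′ ] 1 ℕ.≤ k′ × k′ ℕ.< k × ∃[ α′ ] N α′ ≡ + k′ * L × Annihilates L e α′
    descent-step e@(e₁ , e₂ , e₃) k 1<k k<ℓ α@(quat a b c d) Nα ann@(annihilates re im₁ im₂ im₃) = go k′ refl
      where
      K = + k
      m = k ℕ.+ k
      k>0 : 0 ℕ.< k
      k>0 = ℕₚ.<-trans (s≤s z≤n) 1<k
      quo : ℤ → ℤ
      quo x = Nearest.q (nearest k x k>0)
      remℕ : ℤ → ℕ
      remℕ x = Nearest.r (nearest k x k>0)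
      rem : ℤ → ℤ
      rem x = + remℕ x
      split : ∀ x → + 2 * x + K ≡ rem x + quo x * (K + K)
      split x = Nearest.split (nearest k x k>0)
      qa = quo a
      qb = quo b
      qc = quo c
      qd = quo d
      -- This is N(α - k q)/k, because N α = k L.
      k′ = L - + 2 * (a * qa + b * qb + c * qc + d * qd) + K * (qa * qa + qb * qb + qc * qc + qd * qd)
      α′ = quat (L - (a * qa + b * qb + c * qc + d * qd)) (a * qb - b * qa + c * qd - d * qc)
                (a * qc - b * qd - c * qa + d * qb) (a * qd + b * qc - c * qb - d * qa)
      Nα′ : N α′ ≡ k′ * L
      Nα′ = trans (identity a b c d qa qb qc qd L) (trans (cong (λ n → L * L - + 2 * L * s + n * t) Nα) (collect L s K t))
        where
        s = a * qa + b * qb + c * qc + d * qd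
        t = qa * qa + qb * qb + qc * qc + qd * qd
        identity : ∀ a b c d x y z w L →
                (L - (a * x + b * y + c * z + d * w)) * (L - (a * x + b * y + c * z + d * w))
                + (a * y - b * x + c * w - d * z) * (a * y - b * x + c * w - d * z)
                + (a * z - b * w - c * x + d * y) * (a * z - b * w - c * x + d * y)
                + (a * w + b * z - c * y - d * x) * (a * w + b * z - c * y - d * x)
                ≡ L * L - + 2 * L * (a * x + b * y + c * z + d * w) + (a * a + b * b + c * c + d * d) * (x * x + y * y + z * z + w * w)
        identity = solve-∀
        collect : ∀ L s K t → L * L - + 2 * L * s + K * L * t ≡ (L - + 2 * s + K * t) * L
        collect = solve-∀
      -- e α′ = L e - (e α) q̄, and both terms vanish modulo L.
      ann′ : Annihilates L e α′
      ann′ = annihilates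
        (∣-≡ (∣-lin₄ qa qb qc qd re′ im₁ im₂ im₃) (i₀ a b c d qa qb qc qd e₁ e₂ e₃ L))
        (∣-≡ (∣-+ (∣-lin₄ qb (- qa) qd (- qc) re′ im₁ im₂ im₃) (∣-*ˡ e₁ ∣-rfl)) (i₁ a b c d qa qb qc qd e₁ e₂ e₃ L))
        (∣-≡ (∣-+ (∣-lin₄ qc (- qd) (- qa) qb re′ im₁ im₂ im₃) (∣-*ˡ e₂ ∣-rfl)) (i₂ a b c d qa qb qc qd e₁ e₂ e₃ L))
        (∣-≡ (∣-+ (∣-lin₄ qd qc (- qb) (- qa) re′ im₁ im₂ im₃) (∣-*ˡ e₃ ∣-rfl)) (i₃ a b c d qa qb qc qd e₁ e₂ e₃ L))
        where
        re′ = ∣-neg re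
        i₀ : ∀ a b c d x y z w e₁ e₂ e₃ L →
             x * - (e₁ * b + e₂ * c + e₃ * d) + y * (e₁ * a + e₂ * d - e₃ * c) + z * (e₂ * a - e₁ * d + e₃ * b) + w *
                 (e₃ * a + e₁ * c - e₂ * b)
             ≡ e₁ * (a * y - b * x + c * w - d * z) + e₂ * (a * z - b * w - c * x + d * y) + e₃ * (a * w + b * z - c * y - d * x)
        i₀ = solve-∀
        i₁ : ∀ a b c d x y z w e₁ e₂ e₃ L →
             y * - (e₁ * b + e₂ * c + e₃ * d) + - x * (e₁ * a + e₂ * d - e₃ * c) + w * (e₂ * a - e₁ * d + e₃ * b) + - z *
                 (e₃ * a + e₁ * c - e₂ * b) + e₁ * L
             ≡ e₁ * (L - (a * x + b * y + c * z + d * w)) + e₂ * (a * w + b * z - c * y - d * x) - e₃ * (a * z - b * w - c * x + d * y)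
        i₁ = solve-∀
        i₂ : ∀ a b c d x y z w e₁ e₂ e₃ L →
             z * - (e₁ * b + e₂ * c + e₃ * d) + - w * (e₁ * a + e₂ * d - e₃ * c) + - x * (e₂ * a - e₁ * d + e₃ * b) + y *
                 (e₃ * a + e₁ * c - e₂ * b) + e₂ * L
             ≡ e₂ * (L - (a * x + b * y + c * z + d * w)) - e₁ * (a * w + b * z - c * y - d * x) + e₃ * (a * y - b * x + c * w - d * z)
        i₂ = solve-∀
        i₃ : ∀ a b c d x y z w e₁ e₂ e₃ L →
             w * - (e₁ * b + e₂ * c + e₃ * d) + z * (e₁ * a + e₂ * d - e₃ * c) + - y * (e₂ * a - e₁ * d + e₃ * b) + - x *
                 (e₃ * a + e₁ * c - e₂ * b) + e₃ * L
             ≡ e₃ * (L - (a * x + b * y + c * z + d * w)) + e₁ * (a * z - b * w - c * x + d * y) - e₂ * (a * y - b * x + c * w - d * z)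
        i₃ = solve-∀
      -- For each component `rem x - K` is 2(x - k q). Its square and `slack x` add up to k², so the
      -- component is off by at most k/2, and by exactly k/2 when the slack is 0.
      square-excess : ℤ → ℕ
      square-excess x = (abs (rem x - K)) ℕ.* (abs (rem x - K))
      slack : ℤ → ℕ
      slack x = remℕ x ℕ.* (m ℕ.∸ remℕ x)
      rem<m : ∀ x → remℕ x ℕ.< m
      rem<m x = Nearest.r<2k (nearest k x k>0)
      excess-slack : ∀ x → + square-excess x + + slack x ≡ K * K
      excess-slack x = trans (cong₂ _+_ (abs-square (rem x - K))
          (trans (ℤₚ.pos-* (remℕ x) (m ℕ.∸ remℕ x)) (cong (rem x *_)
              (sym (trans (ℤₚ.m-n≡m⊖n m (remℕ x)) (ℤₚ.⊖-≥ {m} {remℕ x} (ℕₚ.<⇒≤ (rem<m x))))))))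
        (identity (rem x) K)
        where
        identity : ∀ r k → (r - k) * (r - k) + r * (k + k - r) ≡ k * k
        identity = solve-∀
      rem-K : ∀ x → rem x - K ≡ + 2 * x - + 2 * K * quo x
      rem-K x = trans (l₁ (rem x) K (quo x)) (trans (cong (λ y → y - K - quo x * (K + K)) (sym (split x))) (l₂ x K (quo x)))
        where
        l₁ : ∀ r k q → r - k ≡ (r + q * (k + k)) - k - q * (k + k)
        l₁ = solve-∀
        l₂ : ∀ x k q → (+ 2 * x + k) - k - q * (k + k) ≡ + 2 * x - + 2 * k * q
        l₂ = solve-∀
      total-excess : + (square-excess a ℕ.+ square-excess b ℕ.+ square-excess c ℕ.+ square-excess d) ≡ + 4 * K * k′
      total-excess = trans (cong₂ _+_ (cong₂ _+_ (cong₂ _+_ (sq a) (sq b)) (sq c)) (sq d))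
          (trans (identity a b c d qa qb qc qd K) (trans (cong (λ n → + 4 * n - + 8 * K * s + + 4 * K * K * t) Nα) (collect K L s t)))
        where
        s = a * qa + b * qb + c * qc + d * qd
        t = qa * qa + qb * qb + qc * qc + qd * qd
        sq : ∀ x → + square-excess x ≡ (+ 2 * x - + 2 * K * quo x) * (+ 2 * x - + 2 * K * quo x)
        sq x = trans (abs-square (rem x - K)) (cong₂ _*_ (rem-K x) (rem-K x))
        identity : ∀ a b c d x y z w K → (+ 2 * a - + 2 * K * x) * (+ 2 * a - + 2 * K * x) + (+ 2 * b - + 2 * K * y) *
            (+ 2 * b - + 2 * K * y)
           + (+ 2 * c - + 2 * K * z) * (+ 2 * c - + 2 * K * z) + (+ 2 * d - + 2 * K * w) * (+ 2 * d - + 2 * K * w)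
           ≡ + 4 * (a * a + b * b + c * c + d * d) - + 8 * K * (a * x + b * y + c * z + d * w) + + 4 * K * K *
               (x * x + y * y + z * z + w * w)
        identity = solve-∀
        collect : ∀ K L s t → + 4 * (K * L) - + 8 * K * s + + 4 * K * K * t ≡ + 4 * K * (L - + 2 * s + K * t)
        collect = solve-∀
      total-slack : + 4 * K * k′ + + (slack a ℕ.+ slack b ℕ.+ slack c ℕ.+ slack d) ≡ + 4 * K * K
      total-slack = trans (cong (_+ + (slack a ℕ.+ slack b ℕ.+ slack c ℕ.+ slack d)) (sym total-excess))
        (trans (shuffle (+ square-excess a) (+ square-excess b) (+ square-excess c) (+ square-excess d) (+ slack a) (+ slack b) (+ slack c)
            (+ slack d))
          (trans (cong₂ _+_ (cong₂ _+_ (cong₂ _+_ (excess-slack a) (excess-slack b)) (excess-slack c)) (excess-slack d)) (four K)))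
        where
        shuffle : ∀ a b c d x y z w → a + b + c + d + (x + y + z + w) ≡ (a + x) + (b + y) + (c + z) + (d + w)
        shuffle = solve-∀
        four : ∀ K → K * K + K * K + K * K + K * K ≡ + 4 * K * K
        four = solve-∀
      -- Both degenerate cases of the rounding end with k dividing ℓ, impossible for 1 < k < ℓ.
      absurd : ∀ t → + 4 * K * L ≡ + 4 * K * (t * K) → ⊥
      absurd t eq = no-divisor k 1<k k<ℓ (ℤ∣.∣⇒∣ᵤ (divides t
          (ℤₚ.*-cancelˡ-≡ (+ 4 * K) L (t * K) {{ℤₚ.i*j≢0 (+ 4) K {{_}} {{ℕ.>-nonZero k>0}}}} eq)))
      4Nα : + 4 * K * L ≡ (+ 2 * a) * (+ 2 * a) + (+ 2 * b) * (+ 2 * b) + (+ 2 * c) * (+ 2 * c) + (+ 2 * d) * (+ 2 * d)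
      4Nα = trans (ℤₚ.*-assoc (+ 4) K L) (trans (cong (+ 4 *_) (sym Nα)) (identity a b c d))
        where
        identity : ∀ a b c d → + 4 * (a * a + b * b + c * c + d * d)
            ≡ (+ 2 * a) * (+ 2 * a) + (+ 2 * b) * (+ 2 * b) + (+ 2 * c) * (+ 2 * c) + (+ 2 * d) * (+ 2 * d)
        identity = solve-∀
      double-by : ∀ x r → rem x ≡ r → + 2 * x ≡ r - K + + 2 * K * quo x
      double-by x r refl = trans (l x K (quo x)) (cong (λ y → y + + 2 * K * quo x) (sym (rem-K x)))
        where
        l : ∀ x K q → + 2 * x ≡ + 2 * x - + 2 * K * q + + 2 * K * q
        l = solve-∀
      substituted : ∀ r → (∀ x → x ≡ a ⊎ x ≡ b ⊎ x ≡ c ⊎ x ≡ d → rem x ≡ r) → + 4 * K * L ≡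
        (r - K + + 2 * K * qa) * (r - K + + 2 * K * qa) + (r - K + + 2 * K * qb) * (r - K + + 2 * K * qb)
        + (r - K + + 2 * K * qc) * (r - K + + 2 * K * qc) + (r - K + + 2 * K * qd) * (r - K + + 2 * K * qd)
      substituted r p = trans 4Nα (cong₂ _+_ (cong₂ _+_ (cong₂ _+_ (sq (p a (inj₁ refl))) (sq (p b (inj₂ (inj₁ refl)))))
        (sq (p c (inj₂ (inj₂ (inj₁ refl)))))) (sq (p d (inj₂ (inj₂ (inj₂ refl))))))
        where
        sq : ∀ {x} → rem x ≡ r → (+ 2 * x) * (+ 2 * x) ≡ (r - K + + 2 * K * quo x) * (r - K + + 2 * K * quo x)
        sq {x} e = cong₂ _*_ (double-by x r e) (double-by x r e)
      summands-zero : ∀ (f : ℤ → ℕ) → f a ℕ.+ f b ℕ.+ f c ℕ.+ f d ≡ 0 → ∀ x → x ≡ a ⊎ x ≡ b ⊎ x ≡ c ⊎ x ≡ d → f x ≡ 0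
      summands-zero f e x (inj₁ refl) = ℕₚ.m+n≡0⇒m≡0 (f a) (ℕₚ.m+n≡0⇒m≡0 (f a ℕ.+ f b) (ℕₚ.m+n≡0⇒m≡0 (f a ℕ.+ f b ℕ.+ f c) e))
      summands-zero f e x (inj₂ (inj₁ refl)) = ℕₚ.m+n≡0⇒n≡0 (f a) (ℕₚ.m+n≡0⇒m≡0 (f a ℕ.+ f b) (ℕₚ.m+n≡0⇒m≡0 (f a ℕ.+ f b ℕ.+ f c) e))
      summands-zero f e x (inj₂ (inj₂ (inj₁ refl))) = ℕₚ.m+n≡0⇒n≡0 (f a ℕ.+ f b) (ℕₚ.m+n≡0⇒m≡0 (f a ℕ.+ f b ℕ.+ f c) e)
      summands-zero f e x (inj₂ (inj₂ (inj₂ refl))) = ℕₚ.m+n≡0⇒n≡0 (f a ℕ.+ f b ℕ.+ f c) e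
      excess-zero : ∀ x → square-excess x ≡ 0 → rem x ≡ K
      excess-zero x e = ℤₚ.i-j≡0⇒i≡j (rem x) K (ℤₚ.∣i∣≡0⇒i≡0 (square-zero e))
        where
        square-zero : ∀ {n} → n ℕ.* n ≡ 0 → n ≡ 0
        square-zero {zero} _ = refl
      slack-zero : ∀ x → slack x ≡ 0 → rem x ≡ 0ℤ
      slack-zero x e with ℕₚ.m*n≡0⇒m≡0∨n≡0 _ e
      ... | inj₁ r≡0 = cong +_ r≡0
      ... | inj₂ m∸r≡0 = ⊥-elim (ℕₚ.<⇒≱ (rem<m x) (ℕₚ.m∸n≡0⇒m≤n m∸r≡0))
      -- Here α = k q, so k² divides N α = k L.
      all-zero : k′ ≡ 0ℤ → ⊥
      all-zero e = absurd (qa * qa + qb * qb + qc * qc + qd * qd) (trans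
        (substituted K λ x x∈ → excess-zero x (summands-zero square-excess
            (ℤₚ.+-injective (trans total-excess (trans (cong (+ 4 * K *_) e) (ℤₚ.*-zeroʳ (+ 4 * K))))) x x∈))
        (identity K qa qb qc qd))
        where
        identity : ∀ K x y z w → (K - K + + 2 * K * x) * (K - K + + 2 * K * x) + (K - K + + 2 * K * y) * (K - K + + 2 * K * y)
          + (K - K + + 2 * K * z) * (K - K + + 2 * K * z) + (K - K + + 2 * K * w) * (K - K + + 2 * K * w)
          ≡ + 4 * K * ((x * x + y * y + z * z + w * w) * K)
        identity = solve-∀
      -- Every component is an odd multiple of k/2. Four odd squares add up to a multiple of 4, so
      -- again k² divides k L.
      all-half : slack a ℕ.+ slack b ℕ.+ slack c ℕ.+ slack d ≡ 0 → ⊥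
      all-half e = absurd (qa * qa - qa + (qb * qb - qb) + (qc * qc - qc) + (qd * qd - qd) + 1ℤ) (trans
        (substituted 0ℤ λ x x∈ → slack-zero x (summands-zero slack e x x∈))
        (identity K qa qb qc qd))
        where
        identity : ∀ K x y z w → (0ℤ - K + + 2 * K * x) * (0ℤ - K + + 2 * K * x) + (0ℤ - K + + 2 * K * y) * (0ℤ - K + + 2 * K * y)
          + (0ℤ - K + + 2 * K * z) * (0ℤ - K + + 2 * K * z) + (0ℤ - K + + 2 * K * w) * (0ℤ - K + + 2 * K * w)
          ≡ + 4 * K * ((x * x - x + (y * y - y) + (z * z - z) + (w * w - w) + 1ℤ) * K)
        identity = solve-∀
      cast : ∀ j → + 4 * K * + j ≡ + (4 ℕ.* k ℕ.* j)
      cast j = trans (cong (_* + j) (sym (ℤₚ.pos-* 4 k))) (sym (ℤₚ.pos-* (4 ℕ.* k) j))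
      go : ∀ k″ → k′ ≡ k″ → ∃[ k′ ] 1 ℕ.≤ k′ × k′ ℕ.< k × ∃[ α′ ] N α′ ≡ + k′ * L × Annihilates L e α′
      go (+ zero) eq = ⊥-elim (all-zero eq)
      go -[1+ n ] eq = ⊥-elim (nonzero (ℕₚ.m+n≡0⇒n≡0 E (ℤₚ.+-injective sum-zero)))
        where
        E = square-excess a ℕ.+ square-excess b ℕ.+ square-excess c ℕ.+ square-excess d
        nonzero : 4 ℕ.* k ℕ.* suc n ≢ 0
        nonzero e with ℕₚ.m*n≡0⇒m≡0∨n≡0 (4 ℕ.* k) e
        ... | inj₁ 4k≡0 = ℕₚ.<-irrefl (sym ([ (λ ()) , (λ p → p) ]′ (ℕₚ.m*n≡0⇒m≡0∨n≡0 4 4k≡0))) k>0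
        ... | inj₂ ()
        sum-zero : + (E ℕ.+ 4 ℕ.* k ℕ.* suc n) ≡ 0ℤ
        sum-zero = trans (cong₂ _+_ (trans total-excess (cong (+ 4 * K *_) eq)) (sym (cast (suc n))))
          (trans (sym (ℤₚ.*-distribˡ-+ (+ 4 * K) -[1+ n ] (+ suc n)))
              (trans (cong (+ 4 * K *_) (ℤₚ.+-inverseʳ -[1+ n ])) (ℤₚ.*-zeroʳ (+ 4 * K))))
      go (+ suc n) eq with suc n ℕ.<? k
      ... | yes n<k = suc n , s≤s z≤n , n<k , α′ , trans Nα′ (cong (_* L) eq) , ann′
      -- By `total-slack`, 4 k k′ plus the slack is 4 k², so k ≤ k′ forces the slack to be 0.
      ... | no n≮k = ⊥-elim (all-half (ℕₚ.n≤0⇒n≡0 (ℕₚ.+-cancelˡ-≤ (4 ℕ.* k ℕ.* k) _ _ (begin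
              4 ℕ.* k ℕ.* k ℕ.+ z          ≤⟨ ℕₚ.+-monoˡ-≤ z (ℕₚ.*-monoʳ-≤ (4 ℕ.* k) (ℕₚ.≮⇒≥ n≮k)) ⟩
              4 ℕ.* k ℕ.* suc n ℕ.+ z      ≡⟨ ℤₚ.+-injective slack-ℕ ⟩
              4 ℕ.* k ℕ.* k                ≡⟨ ℕₚ.+-identityʳ _ ⟨
              4 ℕ.* k ℕ.* k ℕ.+ 0          ∎))))
        where
        open ℕₚ.≤-Reasoning
        z = slack a ℕ.+ slack b ℕ.+ slack c ℕ.+ slack d
        slack-ℕ : + (4 ℕ.* k ℕ.* suc n ℕ.+ z) ≡ + (4 ℕ.* k ℕ.* k)
        slack-ℕ = trans (cong (λ x → x + + z) (sym (cast (suc n))))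
            (trans (cong (λ x → + 4 * K * x + + z) (sym eq)) (trans total-slack (cast k)))

    -- Lowers the multiplier to 1 while e α stays 0 modulo L: this invariant ties the final
    -- quaternion of norm ℓ to the given isotropic vector and not just to ℓ.
    descent : ∀ e k → Acc ℕ._<_ k → 1 ℕ.≤ k → k ℕ.< ℓ → ∀ α → N α ≡ + k * L → Annihilates L e α →
              ∃[ α′ ] N α′ ≡ L × Annihilates L e α′
    descent e k (acc rec) 1≤k k<ℓ α Nα ann with ℕₚ.m≤n⇒m<n∨m≡n 1≤k
    ... | inj₂ refl = α , trans Nα (ℤₚ.*-identityˡ L) , ann
    ... | inj₁ 1<k with descent-step e k 1<k k<ℓ α Nα ann
    ...   | k′ , 1≤k′ , k′<k , α′ , Nα′ , ann′ = descent e k′ (rec k′<k) 1≤k′ (ℕₚ.<-trans k′<k k<ℓ) α′ Nα′ ann′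

-- Integral rotations attached to isotropic vectors modulo ℓ.

module Rotations where

  open Quaternions

  module _ {ℓ : ℕ} (ℓ-prime : Prime ℓ) (ℓ≢2 : ℓ ≢ 2) where

    private
      L : ℤ
      L = + ℓ

    1<ℓ : 1 ℕ.< ℓ
    1<ℓ = ℕ.nonTrivial⇒n>1 ℓ {{prime⇒nonTrivial ℓ-prime}}

    2<ℓ : 2 ℕ.< ℓ
    2<ℓ = ℕₚ.≤∧≢⇒< 1<ℓ (λ e → ℓ≢2 (sym e))

    ∤-small : ∀ n → 0 ℕ.< n → n ℕ.< ℓ → ¬ (L ∣ + n)
    ∤-small (suc n) _ n<ℓ p = ℕₚ.<⇒≱ n<ℓ (ℕ∣.∣⇒≤ (ℤ∣.∣⇒∣ᵤ p))

    ∤2 : ¬ (L ∣ + 2)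
    ∤2 = ∤-small 2 (s≤s z≤n) 2<ℓ

    2-cancel : ∀ {x} → L ∣ + 2 * x → L ∣ x
    2-cancel = prime-∣-cancel ℓ-prime (+ 2) _ ∤2

    prime-∣-square : ∀ x → L ∣ x * x → L ∣ x
    prime-∣-square x p = reduce (prime-∣-* ℓ-prime x x p)

    -- Otherwise ℓ² would divide the norm ℓ.
    divides-quaternion : ∀ α → N α ≡ L → let open Quaternion α in ¬ (L ∣ a × L ∣ b × L ∣ c × L ∣ d)
    divides-quaternion (quat _ _ _ _) Nα (divides x refl , divides y refl , divides z refl , divides w refl) =
      ℕₚ.<⇒≱ 1<ℓ
          (ℕₚ.≤-reflexive
          (ℕ∣.∣1⇒≡1 (ℤ∣.∣⇒∣ᵤ (divides t (ℤₚ.*-cancelˡ-≡ L 1ℤ (t * L) {{prime⇒nonZero ℓ-prime}}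
          (trans (ℤₚ.*-identityʳ L) (trans (sym Nα) (identity x y z w L))))))))
      where
      t = x * x + y * y + z * z + w * w
      identity : ∀ x y z w L → x * L * (x * L) + y * L * (y * L) + z * L * (z * L) + w * L * (w * L)
          ≡ L * ((x * x + y * y + z * z + w * w) * L)
      identity = solve-∀

    -- The rows are α i ᾱ, α j ᾱ and α k ᾱ.
    rotation : ∀ e α → N α ≡ L → Annihilates L e α → Rotation ℓ e
    rotation e@(e₁ , e₂ , e₃) α@(quat a b c d) Nα (annihilates re im₁ im₂ im₃) = record
      { row = row ; norm = norm ; orth = orth ; complete = complete ; perp = perp ; pivot = pivot }
      where
      row : Fin 3 → ℤ³
      row zero = a * a + b * b - c * c - d * d , + 2 * (b * c + a * d) , + 2 * (b * d - a * c)
      row (suc zero) = + 2 * (b * c - a * d) , a * a - b * b + c * c - d * d , + 2 * (c * d + a * b)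
      row (suc (suc zero)) = + 2 * (b * d + a * c) , + 2 * (c * d - a * b) , a * a - b * b - c * c + d * d
      dot-row : ∀ k v₁ v₂ v₃ → dot (row k) (v₁ , v₂ , v₃) ≡ row k ! zero * v₁ + row k ! suc zero * v₂ + row k ! suc (suc zero) * v₃
      dot-row zero v₁ v₂ v₃ = dot-≡ _ _ _ v₁ v₂ v₃
      dot-row (suc zero) v₁ v₂ v₃ = dot-≡ _ _ _ v₁ v₂ v₃
      dot-row (suc (suc zero)) v₁ v₂ v₃ = dot-≡ _ _ _ v₁ v₂ v₃
      N² : N α * N α ≡ L * L
      N² = cong₂ _*_ Nα Nα
      norm : ∀ k → dot (row k) (row k) ≡ L * L
      norm zero = trans (dot-row zero _ _ _) (trans (identity a b c d) N²)
        where
        identity : ∀ a b c d → (a * a + b * b - c * c - d * d) * (a * a + b * b - c * c - d * d) + + 2 * (b * c + a * d) *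
            (+ 2 * (b * c + a * d)) + + 2 * (b * d - a * c) * (+ 2 * (b * d - a * c))
                   ≡ (a * a + b * b + c * c + d * d) * (a * a + b * b + c * c + d * d)
        identity = solve-∀
      norm (suc zero) = trans (dot-row (suc zero) _ _ _) (trans (identity a b c d) N²)
        where
        identity : ∀ a b c d → + 2 * (b * c - a * d) * (+ 2 * (b * c - a * d)) + (a * a - b * b + c * c - d * d) *
            (a * a - b * b + c * c - d * d) + + 2 * (c * d + a * b) * (+ 2 * (c * d + a * b))
                   ≡ (a * a + b * b + c * c + d * d) * (a * a + b * b + c * c + d * d)
        identity = solve-∀
      norm (suc (suc zero)) = trans (dot-row (suc (suc zero)) _ _ _) (trans (identity a b c d) N²)
        where
        identity : ∀ a b c d → + 2 * (b * d + a * c) * (+ 2 * (b * d + a * c)) + + 2 * (c * d - a * b) * (+ 2 * (c * d - a * b)) +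
            (a * a - b * b - c * c + d * d) * (a * a - b * b - c * c + d * d)
                   ≡ (a * a + b * b + c * c + d * d) * (a * a + b * b + c * c + d * d)
        identity = solve-∀
      dot-comm : ∀ u v → dot u v ≡ dot v u
      dot-comm (x , y , z) (x′ , y′ , z′) = trans (dot-≡ x y z x′ y′ z′)
          (trans (cong₂ _+_ (cong₂ _+_ (ℤₚ.*-comm x x′) (ℤₚ.*-comm y y′)) (ℤₚ.*-comm z z′)) (sym (dot-≡ x′ y′ z′ x y z)))
      orth₀₁ : dot (row zero) (row (suc zero)) ≡ 0ℤ
      orth₀₁ = trans (dot-row zero _ _ _) (identity a b c d)
        where
        identity : ∀ a b c d → (a * a + b * b - c * c - d * d) * (+ 2 * (b * c - a * d)) + + 2 * (b * c + a * d) *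
            (a * a - b * b + c * c - d * d) + + 2 * (b * d - a * c) * (+ 2 * (c * d + a * b)) ≡ 0ℤ
        identity = solve-∀
      orth₀₂ : dot (row zero) (row (suc (suc zero))) ≡ 0ℤ
      orth₀₂ = trans (dot-row zero _ _ _) (identity a b c d)
        where
        identity : ∀ a b c d → (a * a + b * b - c * c - d * d) * (+ 2 * (b * d + a * c)) + + 2 * (b * c + a * d) *
            (+ 2 * (c * d - a * b)) + + 2 * (b * d - a * c) * (a * a - b * b - c * c + d * d) ≡ 0ℤ
        identity = solve-∀
      orth₁₂ : dot (row (suc zero)) (row (suc (suc zero))) ≡ 0ℤ
      orth₁₂ = trans (dot-row (suc zero) _ _ _) (identity a b c d)
        where
        identity : ∀ a b c d → + 2 * (b * c - a * d) * (+ 2 * (b * d + a * c)) + (a * a - b * b + c * c - d * d) *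
            (+ 2 * (c * d - a * b)) + + 2 * (c * d + a * b) * (a * a - b * b - c * c + d * d) ≡ 0ℤ
        identity = solve-∀
      orth : ∀ j k → j ≢ k → dot (row j) (row k) ≡ 0ℤ
      orth zero zero p = ⊥-elim (p refl)
      orth zero (suc zero) _ = orth₀₁
      orth zero (suc (suc zero)) _ = orth₀₂
      orth (suc zero) zero _ = trans (dot-comm (row (suc zero)) (row zero)) orth₀₁
      orth (suc zero) (suc zero) p = ⊥-elim (p refl)
      orth (suc zero) (suc (suc zero)) _ = orth₁₂
      orth (suc (suc zero)) zero _ = trans (dot-comm (row (suc (suc zero))) (row zero)) orth₀₂
      orth (suc (suc zero)) (suc zero) _ = trans (dot-comm (row (suc (suc zero))) (row (suc zero))) orth₁₂
      orth (suc (suc zero)) (suc (suc zero)) p = ⊥-elim (p refl)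
      -- Orthogonality of the columns, again a polynomial identity in α. It is what later makes the
      -- image of ℤ³ exhaust the lattice.
      complete : ∀ w j → dot w (row zero) * row zero ! j + dot w (row (suc zero)) * row (suc zero) ! j
                   + dot w (row (suc (suc zero))) * row (suc (suc zero)) ! j ≡ L * L * w ! j
      complete (x , y , z) zero = trans (cong₂ _+_ (cong₂ _+_ (cong (_* _) (dot-≡ x y z _ _ _)) (cong (_* _) (dot-≡ x y z _ _ _)))
          (cong (_* _) (dot-≡ x y z _ _ _)))
        (trans (identity a b c d x y z) (cong (_* x) N²))
        where
        identity : ∀ a b c d x y z →
          (x * (a * a + b * b - c * c - d * d) + y * (+ 2 * (b * c + a * d)) + z * (+ 2 * (b * d - a * c))) *
              (a * a + b * b - c * c - d * d)
          + (x * (+ 2 * (b * c - a * d)) + y * (a * a - b * b + c * c - d * d) + z * (+ 2 * (c * d + a * b))) * (+ 2 * (b * c - a * d))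
          + (x * (+ 2 * (b * d + a * c)) + y * (+ 2 * (c * d - a * b)) + z * (a * a - b * b - c * c + d * d)) * (+ 2 * (b * d + a * c))
          ≡ (a * a + b * b + c * c + d * d) * (a * a + b * b + c * c + d * d) * x
        identity = solve-∀
      complete (x , y , z) (suc zero) = trans (cong₂ _+_ (cong₂ _+_ (cong (_* _) (dot-≡ x y z _ _ _)) (cong (_* _) (dot-≡ x y z _ _ _)))
          (cong (_* _) (dot-≡ x y z _ _ _)))
        (trans (identity a b c d x y z) (cong (_* y) N²))
        where
        identity : ∀ a b c d x y z →
          (x * (a * a + b * b - c * c - d * d) + y * (+ 2 * (b * c + a * d)) + z * (+ 2 * (b * d - a * c))) * (+ 2 * (b * c + a * d))
          + (x * (+ 2 * (b * c - a * d)) + y * (a * a - b * b + c * c - d * d) + z * (+ 2 * (c * d + a * b))) *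
              (a * a - b * b + c * c - d * d)
          + (x * (+ 2 * (b * d + a * c)) + y * (+ 2 * (c * d - a * b)) + z * (a * a - b * b - c * c + d * d)) * (+ 2 * (c * d - a * b))
          ≡ (a * a + b * b + c * c + d * d) * (a * a + b * b + c * c + d * d) * y
        identity = solve-∀
      complete (x , y , z) (suc (suc zero)) = trans (cong₂ _+_
          (cong₂ _+_ (cong (_* _) (dot-≡ x y z _ _ _)) (cong (_* _) (dot-≡ x y z _ _ _))) (cong (_* _) (dot-≡ x y z _ _ _)))
        (trans (identity a b c d x y z) (cong (_* z) N²))
        where
        identity : ∀ a b c d x y z →
          (x * (a * a + b * b - c * c - d * d) + y * (+ 2 * (b * c + a * d)) + z * (+ 2 * (b * d - a * c))) * (+ 2 * (b * d - a * c))
          + (x * (+ 2 * (b * c - a * d)) + y * (a * a - b * b + c * c - d * d) + z * (+ 2 * (c * d + a * b))) * (+ 2 * (c * d + a * b))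
          + (x * (+ 2 * (b * d + a * c)) + y * (+ 2 * (c * d - a * b)) + z * (a * a - b * b - c * c + d * d)) *
              (a * a - b * b - c * c + d * d)
          ≡ (a * a + b * b + c * c + d * d) * (a * a + b * b + c * c + d * d) * z
        identity = solve-∀
      -- `g₀` to `g₃` are the components of e α. The dot product of e with α i ᾱ is minus the real
      -- part of (e α)(i ᾱ), hence a combination of them whose coefficients are, up to sign, those
      -- of i ᾱ; likewise for j and k.
      g₀ : L ∣ - (e₁ * b + e₂ * c + e₃ * d)
      g₀ = ∣-neg re
      g₁ : L ∣ e₁ * a + e₂ * d - e₃ * c
      g₁ = im₁
      g₂ : L ∣ e₂ * a - e₁ * d + e₃ * b
      g₂ = im₂
      g₃ : L ∣ e₃ * a + e₁ * c - e₂ * b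
      g₃ = im₃
      perp : ∀ k → L ∣ dot (row k) e
      perp zero = subst (L ∣_) (trans identified (sym (dot-row zero e₁ e₂ e₃))) combination
        where
        identity : ∀ a b c d e₁ e₂ e₃ → - b * - (e₁ * b + e₂ * c + e₃ * d) + a * (e₁ * a + e₂ * d - e₃ * c) + d *
            (e₂ * a - e₁ * d + e₃ * b) + - c * (e₃ * a + e₁ * c - e₂ * b)
          ≡ (a * a + b * b - c * c - d * d) * e₁ + + 2 * (b * c + a * d) * e₂ + + 2 * (b * d - a * c) * e₃
        identity = solve-∀
        combination : L ∣ - b * - (e₁ * b + e₂ * c + e₃ * d) + a * (e₁ * a + e₂ * d - e₃ * c) + d * (e₂ * a - e₁ * d + e₃ * b) + - c *
            (e₃ * a + e₁ * c - e₂ * b)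
        combination = ∣-lin₄ (- b) a d (- c) g₀ g₁ g₂ g₃
        identified : - b * - (e₁ * b + e₂ * c + e₃ * d) + a * (e₁ * a + e₂ * d - e₃ * c) + d * (e₂ * a - e₁ * d + e₃ * b) + - c *
            (e₃ * a + e₁ * c - e₂ * b)
          ≡ (a * a + b * b - c * c - d * d) * e₁ + + 2 * (b * c + a * d) * e₂ + + 2 * (b * d - a * c) * e₃
        identified = identity a b c d e₁ e₂ e₃
      perp (suc zero) = subst (L ∣_) (trans identified (sym (dot-row (suc zero) e₁ e₂ e₃))) combination
        where
        identity : ∀ a b c d e₁ e₂ e₃ → - c * - (e₁ * b + e₂ * c + e₃ * d) + - d * (e₁ * a + e₂ * d - e₃ * c) + a *
            (e₂ * a - e₁ * d + e₃ * b) + b * (e₃ * a + e₁ * c - e₂ * b)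
          ≡ + 2 * (b * c - a * d) * e₁ + (a * a - b * b + c * c - d * d) * e₂ + + 2 * (c * d + a * b) * e₃
        identity = solve-∀
        combination : L ∣ - c * - (e₁ * b + e₂ * c + e₃ * d) + - d * (e₁ * a + e₂ * d - e₃ * c) + a * (e₂ * a - e₁ * d + e₃ * b) + b *
            (e₃ * a + e₁ * c - e₂ * b)
        combination = ∣-lin₄ (- c) (- d) a b g₀ g₁ g₂ g₃
        identified : - c * - (e₁ * b + e₂ * c + e₃ * d) + - d * (e₁ * a + e₂ * d - e₃ * c) + a * (e₂ * a - e₁ * d + e₃ * b) + b *
            (e₃ * a + e₁ * c - e₂ * b)
          ≡ + 2 * (b * c - a * d) * e₁ + (a * a - b * b + c * c - d * d) * e₂ + + 2 * (c * d + a * b) * e₃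
        identified = identity a b c d e₁ e₂ e₃
      perp (suc (suc zero)) = subst (L ∣_) (trans identified (sym (dot-row (suc (suc zero)) e₁ e₂ e₃))) combination
        where
        identity : ∀ a b c d e₁ e₂ e₃ → - d * - (e₁ * b + e₂ * c + e₃ * d) + c * (e₁ * a + e₂ * d - e₃ * c) + - b *
            (e₂ * a - e₁ * d + e₃ * b) + a * (e₃ * a + e₁ * c - e₂ * b)
          ≡ + 2 * (b * d + a * c) * e₁ + + 2 * (c * d - a * b) * e₂ + (a * a - b * b - c * c + d * d) * e₃
        identity = solve-∀
        combination : L ∣ - d * - (e₁ * b + e₂ * c + e₃ * d) + c * (e₁ * a + e₂ * d - e₃ * c) + - b * (e₂ * a - e₁ * d + e₃ * b) + a *
            (e₃ * a + e₁ * c - e₂ * b)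
        combination = ∣-lin₄ (- d) c (- b) a g₀ g₁ g₂ g₃
        identified : - d * - (e₁ * b + e₂ * c + e₃ * d) + c * (e₁ * a + e₂ * d - e₃ * c) + - b * (e₂ * a - e₁ * d + e₃ * b) + a *
            (e₃ * a + e₁ * c - e₂ * b)
          ≡ + 2 * (b * d + a * c) * e₁ + + 2 * (c * d - a * b) * e₂ + (a * a - b * b - c * c + d * d) * e₃
        identified = identity a b c d e₁ e₂ e₃
      pivot : ∃[ k ] ∃[ j ] ¬ (L ∣ row k ! j)
      pivot = choose (L ∣? _) (L ∣? _) (L ∣? _)
        where
        choose : Dec (L ∣ row zero ! zero) → Dec (L ∣ row (suc zero) ! suc zero) → Dec (L ∣ row (suc (suc zero)) ! suc (suc zero)) →
            ∃[ k ] ∃[ j ] ¬ (L ∣ row k ! j)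
        choose (no ¬p) _ _ = zero , zero , ¬p
        choose (yes _) (no ¬p) _ = suc zero , suc zero , ¬p
        choose (yes _) (yes _) (no ¬p) = suc (suc zero) , suc (suc zero) , ¬p
        -- The three diagonal entries and N α span 4a², 4b², 4c² and 4d², so ℓ would divide every
        -- component of α.
        choose (yes p) (yes q) (yes r) = ⊥-elim (divides-quaternion α Nα
          ( square (a-part a b c d) (∣-lin₄ 1ℤ 1ℤ 1ℤ 1ℤ n p q r)
          , square (b-part a b c d) (∣-lin₄ 1ℤ 1ℤ (- 1ℤ) (- 1ℤ) n p q r)
          , square (c-part a b c d) (∣-lin₄ 1ℤ (- 1ℤ) 1ℤ (- 1ℤ) n p q r)
          , square (d-part a b c d) (∣-lin₄ 1ℤ (- 1ℤ) (- 1ℤ) 1ℤ n p q r)))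
          where
          n : L ∣ N α
          n = subst (L ∣_) (sym Nα) ∣-rfl
          square : ∀ {x y} → y ≡ + 2 * (+ 2 * (x * x)) → L ∣ y → L ∣ x
          square {x} refl p = prime-∣-square x (2-cancel (2-cancel p))
          a-part : ∀ a b c d → 1ℤ * (a * a + b * b + c * c + d * d) + 1ℤ * (a * a + b * b - c * c - d * d) + 1ℤ *
              (a * a - b * b + c * c - d * d) + 1ℤ * (a * a - b * b - c * c + d * d) ≡ + 2 * (+ 2 * (a * a))
          a-part = solve-∀
          b-part : ∀ a b c d → 1ℤ * (a * a + b * b + c * c + d * d) + 1ℤ * (a * a + b * b - c * c - d * d) + - 1ℤ *
              (a * a - b * b + c * c - d * d) + - 1ℤ * (a * a - b * b - c * c + d * d) ≡ + 2 * (+ 2 * (b * b))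
          b-part = solve-∀
          c-part : ∀ a b c d → 1ℤ * (a * a + b * b + c * c + d * d) + - 1ℤ * (a * a + b * b - c * c - d * d) + 1ℤ *
              (a * a - b * b + c * c - d * d) + - 1ℤ * (a * a - b * b - c * c + d * d) ≡ + 2 * (+ 2 * (c * c))
          c-part = solve-∀
          d-part : ∀ a b c d → 1ℤ * (a * a + b * b + c * c + d * d) + - 1ℤ * (a * a + b * b - c * c - d * d) + - 1ℤ *
              (a * a - b * b + c * c - d * d) + 1ℤ * (a * a - b * b - c * c + d * d) ≡ + 2 * (+ 2 * (d * d))
          d-part = solve-∀

    -- A representative of absolute value at most ℓ/2. Three such squares add up to at most 3ℓ²/4,
    -- which starts the descent with a multiplier below ℓ.
    centred : ∀ x → ∃[ y ] ∃[ q ] y ≡ x + L * q × 4 ℕ.* (abs y ℕ.* abs y) ℕ.≤ ℓ ℕ.* ℓ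
    centred x with 2 ℕ.* r ℕ.≤? ℓ
      where
      instance _ = prime⇒nonZero ℓ-prime
      r = x %ℕ ℓ
    ... | yes small = + r , - q , sym (trans (cong (λ y → y + L * - q) division) (identity (+ r) q L)) , bound r small
      where
      instance _ = prime⇒nonZero ℓ-prime
      r = x %ℕ ℓ
      q = x /ℕ ℓ
      division = a≡a%ℕn+[a/ℕn]*n x ℓ
      identity : ∀ r q L → r + q * L + L * - q ≡ r
      identity = solve-∀
      bound : ∀ n → 2 ℕ.* n ℕ.≤ ℓ → 4 ℕ.* (n ℕ.* n) ℕ.≤ ℓ ℕ.* ℓ
      bound n p = ℕₚ.≤-trans (ℕₚ.≤-reflexive (ids n)) (ℕₚ.*-mono-≤ p p)
        where
        ids : ∀ n → 4 ℕ.* (n ℕ.* n) ≡ 2 ℕ.* n ℕ.* (2 ℕ.* n)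
        ids = solveℕ
    ... | no ¬small = + r - L , - q - 1ℤ , sym (trans (cong (λ y → y + L * (- q - 1ℤ)) division) (identity (+ r) q L)) ,
        subst (λ n → 4 ℕ.* (n ℕ.* n) ℕ.≤ ℓ ℕ.* ℓ) (sym abs-y) (bound (ℓ ℕ.∸ r) close)
      where
      instance _ = prime⇒nonZero ℓ-prime
      r = x %ℕ ℓ
      q = x /ℕ ℓ
      division = a≡a%ℕn+[a/ℕn]*n x ℓ
      identity : ∀ r q L → r + q * L + L * (- q - 1ℤ) ≡ r - L
      identity = solve-∀
      abs-y : abs (+ r - L) ≡ ℓ ℕ.∸ r
      abs-y = trans (cong abs (ℤₚ.m-n≡m⊖n r ℓ)) (ℤₚ.∣⊖∣-≤ (ℕₚ.<⇒≤ (n%ℕd<d x ℓ)))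
      close : 2 ℕ.* (ℓ ℕ.∸ r) ℕ.≤ ℓ
      close = ℕₚ.≤-trans (ℕₚ.≤-reflexive (ℕₚ.*-distribˡ-∸ 2 ℓ r)) (ℕₚ.≤-trans (ℕₚ.∸-monoʳ-≤ (2 ℕ.* ℓ) (ℕₚ.≰⇒≥ ¬small))
        (ℕₚ.≤-reflexive (trans (cong (ℕ._∸ ℓ) (cong (ℓ ℕ.+_) (ℕₚ.+-identityʳ ℓ))) (ℕₚ.m+n∸m≡n ℓ ℓ))))
      bound : ∀ n → 2 ℕ.* n ℕ.≤ ℓ → 4 ℕ.* (n ℕ.* n) ℕ.≤ ℓ ℕ.* ℓ
      bound n p = ℕₚ.≤-trans (ℕₚ.≤-reflexive (ids n)) (ℕₚ.*-mono-≤ p p)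
        where
        ids : ∀ n → 4 ℕ.* (n ℕ.* n) ≡ 2 ℕ.* n ℕ.* (2 ℕ.* n)
        ids = solveℕ

    -- The descent starts from the pure quaternion α with centred components congruent to e. Then e
    -- α ≡ e² = -(e · e) ≡ 0, and N α is a multiple k ℓ with 0 < k < ℓ.
    rotation-exists : ∀ e → L ∣ dot e e → (∃[ j ] ¬ (L ∣ e ! j)) → Rotation ℓ e
    rotation-exists e@(e₁ , e₂ , e₃) e·e (j , e≢0) with centred e₁ | centred e₂ | centred e₃
    ... | x , p , refl , bx | y , q , refl , by | z , r , refl , bz = go (ℤ∣.∣⇒∣ᵤ L∣n)
      where
      n = abs x ℕ.* abs x ℕ.+ abs y ℕ.* abs y ℕ.+ abs z ℕ.* abs z
      α = quat 0ℤ x y z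
      e·e′ : L ∣ e₁ * e₁ + e₂ * e₂ + e₃ * e₃
      e·e′ = subst (L ∣_) (dot-≡ e₁ e₂ e₃ e₁ e₂ e₃) e·e
      n≡N : + n ≡ N α
      n≡N = trans (cong₂ _+_ (cong₂ _+_ (abs-square x) (abs-square y)) (abs-square z)) (identity x y z)
        where
        identity : ∀ x y z → x * x + y * y + z * z ≡ 0ℤ * 0ℤ + x * x + y * y + z * z
        identity = solve-∀
      L∣n : L ∣ + n
      L∣n = ∣-≡ (∣-+ e·e′ (∣-*ʳ _ ∣-rfl)) (trans (identity e₁ e₂ e₃ p q r L) (sym n≡N))
        where
        identity : ∀ e₁ e₂ e₃ p q r L → e₁ * e₁ + e₂ * e₂ + e₃ * e₃ + L * (+ 2 * (e₁ * p + e₂ * q + e₃ * r) + L * (p * p + q * q + r * r))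
          ≡ 0ℤ * 0ℤ + (e₁ + L * p) * (e₁ + L * p) + (e₂ + L * q) * (e₂ + L * q) + (e₃ + L * r) * (e₃ + L * r)
        identity = solve-∀
      L∣L* : ∀ x → L ∣ L * x
      L∣L* x = ∣-*ʳ x ∣-rfl
      ann : Annihilates L e α
      ann = annihilates
        (∣-≡ (∣-+ e·e′ (L∣L* (e₁ * p + e₂ * q + e₃ * r))) (i₀ e₁ e₂ e₃ p q r L))
        (∣-≡ (L∣L* (e₂ * r - e₃ * q)) (i₁ e₁ e₂ e₃ q r L))
        (∣-≡ (L∣L* (e₃ * p - e₁ * r)) (i₂ e₁ e₂ e₃ p r L))
        (∣-≡ (L∣L* (e₁ * q - e₂ * p)) (i₁ e₃ e₁ e₂ p q L))
        where
        i₀ : ∀ e₁ e₂ e₃ p q r L → e₁ * e₁ + e₂ * e₂ + e₃ * e₃ + L * (e₁ * p + e₂ * q + e₃ * r)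
            ≡ e₁ * (e₁ + L * p) + e₂ * (e₂ + L * q) + e₃ * (e₃ + L * r)
        i₀ = solve-∀
        i₁ : ∀ e₁ e₂ e₃ q r L → L * (e₂ * r - e₃ * q) ≡ e₁ * 0ℤ + e₂ * (e₃ + L * r) - e₃ * (e₂ + L * q)
        i₁ = solve-∀
        i₂ : ∀ e₁ e₂ e₃ p r L → L * (e₃ * p - e₁ * r) ≡ e₂ * 0ℤ - e₁ * (e₃ + L * r) + e₃ * (e₁ + L * p)
        i₂ = solve-∀
      zero-component : ∀ x p → abs (x + L * p) ℕ.* abs (x + L * p) ≡ 0 → L ∣ x
      zero-component x p e = ∣-≡ (L∣L* (- p)) (trans (sym (ℤₚ.+-identityˡ _))
          (trans (cong (_+ L * - p) (sym (ℤₚ.∣i∣≡0⇒i≡0 {x + L * p} (square-zero e)))) (identity x L p)))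
        where
        square-zero : ∀ {n} → n ℕ.* n ≡ 0 → n ≡ 0
        square-zero {zero} _ = refl
        identity : ∀ x L p → x + L * p + L * - p ≡ x
        identity = solve-∀
      n≢0 : n ≢ 0
      n≢0 n≡0 = e≢0 (component j)
        where
        xy≡0 = ℕₚ.m+n≡0⇒m≡0 (abs x ℕ.* abs x ℕ.+ abs y ℕ.* abs y) n≡0
        component : ∀ j → L ∣ e ! j
        component zero = zero-component e₁ p (ℕₚ.m+n≡0⇒m≡0 (abs x ℕ.* abs x) xy≡0)
        component (suc zero) = zero-component e₂ q (ℕₚ.m+n≡0⇒n≡0 (abs x ℕ.* abs x) xy≡0)
        component (suc (suc zero)) = zero-component e₃ r (ℕₚ.m+n≡0⇒n≡0 (abs x ℕ.* abs x ℕ.+ abs y ℕ.* abs y) n≡0)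
      go : ℓ ℕ∣.∣ n → Rotation ℓ e
      go (ℕ∣.divides k n≡kℓ) = rotation e (proj₁ descended) (proj₁ (proj₂ descended)) (proj₂ (proj₂ descended))
        where
        k≥1 : 1 ℕ.≤ k
        k≥1 = ℕₚ.n≢0⇒n>0 λ { refl → n≢0 n≡kℓ }
        4n≤3ℓ² : 4 ℕ.* n ℕ.≤ 3 ℕ.* (ℓ ℕ.* ℓ)
        4n≤3ℓ² = begin
          4 ℕ.* n ≡⟨ identity (abs x ℕ.* abs x) (abs y ℕ.* abs y) (abs z ℕ.* abs z) ⟩
          4 ℕ.* (abs x ℕ.* abs x) ℕ.+ 4 ℕ.* (abs y ℕ.* abs y) ℕ.+ 4 ℕ.* (abs z ℕ.* abs z) ≤⟨ ℕₚ.+-mono-≤ (ℕₚ.+-mono-≤ bx by) bz ⟩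
          ℓ ℕ.* ℓ ℕ.+ ℓ ℕ.* ℓ ℕ.+ ℓ ℕ.* ℓ ≡⟨ three (ℓ ℕ.* ℓ) ⟩
          3 ℕ.* (ℓ ℕ.* ℓ) ∎
          where
          open ℕₚ.≤-Reasoning
          identity : ∀ a b c → 4 ℕ.* (a ℕ.+ b ℕ.+ c) ≡ 4 ℕ.* a ℕ.+ 4 ℕ.* b ℕ.+ 4 ℕ.* c
          identity = solveℕ
          three : ∀ a → a ℕ.+ a ℕ.+ a ≡ 3 ℕ.* a
          three = solveℕ
        k<ℓ : k ℕ.< ℓ
        k<ℓ = ℕₚ.≰⇒> λ ℓ≤k → ℕₚ.<⇒≱ (ℕₚ.*-monoˡ-< (ℓ ℕ.* ℓ) {{ℕₚ.m*n≢0 ℓ ℓ {{prime⇒nonZero ℓ-prime}} {{prime⇒nonZero ℓ-prime}}}} {3} {4}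
            ℕₚ.≤-refl)
          (ℕₚ.≤-trans (ℕₚ.*-monoʳ-≤ 4 (ℕₚ.*-monoˡ-≤ ℓ ℓ≤k)) (ℕₚ.≤-trans (ℕₚ.≤-reflexive (cong (4 ℕ.*_) (sym n≡kℓ))) 4n≤3ℓ²))
        descended : ∃[ α′ ] N α′ ≡ L × Annihilates L e α′
        descended = descent ℓ-prime e k (<-wellFounded k) k≥1 k<ℓ α (trans (sym n≡N) (trans (cong +_ n≡kℓ) (ℤₚ.pos-* k ℓ))) ann

-- Counting by sums of indicator values.

module Counting where

  ⟦_⟧ : ∀ {P : Set} → Dec P → ℤ
  ⟦ d ⟧ = if does d then 1ℤ else 0ℤ

  ⟦⟧-yes : ∀ {P : Set} (d : Dec P) → P → ⟦ d ⟧ ≡ 1ℤ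
  ⟦⟧-yes d p rewrite dec-true d p = refl

  ⟦⟧-no : ∀ {P : Set} (d : Dec P) → ¬ P → ⟦ d ⟧ ≡ 0ℤ
  ⟦⟧-no d ¬p rewrite dec-false d ¬p = refl

  ⟦⟧-⇔ : ∀ {P Q : Set} (d : Dec P) (e : Dec Q) → (P → Q) → (Q → P) → ⟦ d ⟧ ≡ ⟦ e ⟧
  ⟦⟧-⇔ (yes p) e f g = sym (⟦⟧-yes e (f p))
  ⟦⟧-⇔ (no ¬p) e f g = sym (⟦⟧-no e (¬p ∘ g))

  ⟦⟧-× : ∀ {P Q : Set} (d : Dec P) (e : Dec Q) → ⟦ d ×-dec e ⟧ ≡ ⟦ d ⟧ * ⟦ e ⟧
  ⟦⟧-× (yes _) (yes _) = refl
  ⟦⟧-× (yes _) (no _)  = refl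
  ⟦⟧-× (no _)  e       = sym (ℤₚ.*-zeroˡ ⟦ e ⟧)

  ⟦⟧-cong : ∀ {P : Set} (d : Dec P) {x y : ℤ} → (P → x ≡ y) → ⟦ d ⟧ * x ≡ ⟦ d ⟧ * y
  ⟦⟧-cong (yes p) f = cong (1ℤ *_) (f p)
  ⟦⟧-cong (no _) {x} {y} f = trans (ℤₚ.*-zeroˡ x) (sym (ℤₚ.*-zeroˡ y))

  sumL : ∀ {A : Set} → List A → (A → ℤ) → ℤ
  sumL []       f = 0ℤ
  sumL (x ∷ xs) f = f x + sumL xs f

  module _ {A : Set} where

    sumL-cong : ∀ (xs : List A) {f g} → (∀ x → f x ≡ g x) → sumL xs f ≡ sumL xs g
    sumL-cong []       p = refl
    sumL-cong (x ∷ xs) p = cong₂ _+_ (p x) (sumL-cong xs p)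

    sumL-0 : ∀ (xs : List A) → sumL xs (λ _ → 0ℤ) ≡ 0ℤ
    sumL-0 []       = refl
    sumL-0 (x ∷ xs) = trans (ℤₚ.+-identityˡ _) (sumL-0 xs)

    sumL-+ : ∀ (xs : List A) f g → sumL xs (λ x → f x + g x) ≡ sumL xs f + sumL xs g
    sumL-+ []       f g = refl
    sumL-+ (x ∷ xs) f g rewrite sumL-+ xs f g = lemma (f x) (g x) (sumL xs f) (sumL xs g)
      where
      lemma : ∀ a b c d → a + b + (c + d) ≡ a + c + (b + d)
      lemma = solve-∀

    sumL-* : ∀ (xs : List A) c f → sumL xs (λ x → c * f x) ≡ c * sumL xs f
    sumL-* []       c f = sym (ℤₚ.*-zeroʳ c)
    sumL-* (x ∷ xs) c f rewrite sumL-* xs c f = sym (ℤₚ.*-distribˡ-+ c (f x) (sumL xs f))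

    sumL-++ : ∀ (xs ys : List A) f → sumL (xs ++ ys) f ≡ sumL xs f + sumL ys f
    sumL-++ []       ys f = sym (ℤₚ.+-identityˡ _)
    sumL-++ (x ∷ xs) ys f rewrite sumL-++ xs ys f = sym (ℤₚ.+-assoc (f x) (sumL xs f) (sumL ys f))

  sumL-map : ∀ {A B : Set} (h : A → B) xs f → sumL (map h xs) f ≡ sumL xs (f ∘ h)
  sumL-map h []       f = refl
  sumL-map h (x ∷ xs) f = cong (λ s → f (h x) + s) (sumL-map h xs f)

  sumL-swap : ∀ {A B : Set} (xs : List A) (ys : List B) (f : A → B → ℤ) →
              sumL xs (λ x → sumL ys (λ y → f x y)) ≡ sumL ys (λ y → sumL xs (λ x → f x y))
  sumL-swap []       ys f = sym (sumL-0 ys)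
  sumL-swap (x ∷ xs) ys f rewrite sumL-swap xs ys f = sym (sumL-+ ys (f x) (λ y → sumL xs (λ x → f x y)))

  sumL-× : ∀ {A B : Set} (xs : List A) (ys : List B) f →
           sumL (cartesianProduct xs ys) f ≡ sumL xs (λ x → sumL ys (λ y → f (x , y)))
  sumL-× []       ys f = refl
  sumL-× (x ∷ xs) ys f = trans (sumL-++ (map (x ,_) ys) (cartesianProduct xs ys) f)
                               (cong₂ _+_ (sumL-map (x ,_) ys f) (sumL-× xs ys f))

  record Enumeration (A : Set) : Set where
    field
      list : List A
      _≟_  : (x y : A) → Dec (x ≡ y)

    -- Exactly one occurrence is demanded, and only of chosen elements: a finite box in an infinite
    -- type need only list the solutions that are counted.
    Listed : A → Set
    Listed a = sumL list (λ x → ⟦ x ≟ a ⟧) ≡ 1ℤ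

  open Enumeration public using (list; Listed)

  count : ∀ {A : Set} (E : Enumeration A) {P : A → Set} → (∀ x → Dec (P x)) → ℤ
  count E P? = sumL (list E) (λ x → ⟦ P? x ⟧)

  module _ {A B : Set} (E : Enumeration A) (F : Enumeration B) where
    private
      module E = Enumeration E
      module F = Enumeration F

    -- Each x with P is weighted by the sum over y of [y = f x], which is 1; after exchanging the
    -- sums each y with Q collects the single term of its preimage. The inverse `g` receives the
    -- proof of Q because in the uses it divides by something that only this proof shows to be a
    -- divisor.
    count-bij : ∀ {P : A → Set} {Q : B → Set} (P? : ∀ x → Dec (P x)) (Q? : ∀ y → Dec (Q y))
      (f : A → B) (g : ∀ y → Q y → A) → (∀ x → P x → Q (f x)) → (∀ y q → P (g y q)) →
      (∀ x → P x → ∀ q → g (f x) q ≡ x) → (∀ y q → f (g y q) ≡ y) →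
      (∀ x → P x → E.Listed x) → (∀ y → Q y → F.Listed y) →
      count E P? ≡ count F Q?
    count-bij P? Q? f g P⇒Q Q⇒P gf fg P-listed Q-listed = begin
      sumL E.list (λ x → ⟦ P? x ⟧)
        ≡⟨ sumL-cong E.list (λ x → sym (trans (⟦⟧-cong (P? x) (λ p → Q-listed (f x) (P⇒Q x p))) (ℤₚ.*-identityʳ _))) ⟩
      sumL E.list (λ x → ⟦ P? x ⟧ * sumL F.list (λ y → ⟦ y F.≟ f x ⟧))
        ≡⟨ sumL-cong E.list (λ x → sym (sumL-* F.list ⟦ P? x ⟧ (λ y → ⟦ y F.≟ f x ⟧))) ⟩
      sumL E.list (λ x → sumL F.list (λ y → ⟦ P? x ⟧ * ⟦ y F.≟ f x ⟧))
        ≡⟨ sumL-swap E.list F.list (λ x y → ⟦ P? x ⟧ * ⟦ y F.≟ f x ⟧) ⟩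
      sumL F.list (λ y → sumL E.list (λ x → ⟦ P? x ⟧ * ⟦ y F.≟ f x ⟧))
        ≡⟨ sumL-cong F.list inner ⟩
      sumL F.list (λ y → ⟦ Q? y ⟧) ∎
      where
      open ≡-Reasoning
      inner : ∀ y → sumL E.list (λ x → ⟦ P? x ⟧ * ⟦ y F.≟ f x ⟧) ≡ ⟦ Q? y ⟧
      inner y with Q? y
      ... | yes q = trans (sumL-cong E.list λ x → trans (sym (⟦⟧-× (P? x) (y F.≟ f x)))
              (⟦⟧-⇔ (P? x ×-dec (y F.≟ f x)) (x E.≟ g y q) (λ { (p , refl) → sym (gf x p q) }) (λ { refl → Q⇒P y q , sym (fg y q) })))
            (P-listed (g y q) (Q⇒P y q))
      ... | no ¬q = trans (sumL-cong E.list λ x → trans (sym (⟦⟧-× (P? x) (y F.≟ f x)))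
              (⟦⟧-no (P? x ×-dec (y F.≟ f x)) (λ { (p , refl) → ¬q (P⇒Q x p) }))) (sumL-0 E.list)

  below : ℕ → Enumeration ℕ
  below n = record { list = upTo n ; _≟_ = ℕ._≟_ }

  sumL-applyUpTo-≢ : ∀ n (f : ℕ → ℕ) a → (∀ i → f i ≢ a) → sumL (applyUpTo f n) (λ x → ⟦ x ℕ.≟ a ⟧) ≡ 0ℤ
  sumL-applyUpTo-≢ zero f a p = refl
  sumL-applyUpTo-≢ (suc n) f a p = cong₂ _+_ (⟦⟧-no (f 0 ℕ.≟ a) (p 0)) (sumL-applyUpTo-≢ n (f ∘ suc) a (p ∘ suc))

  below-listed : ∀ n i → i ℕ.< n → Listed (below n) i
  below-listed n i i<n = go n id i (λ p → p) i<n
    where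
    go : ∀ n (f : ℕ → ℕ) i → (∀ {i j} → f i ≡ f j → i ≡ j) → i ℕ.< n → sumL (applyUpTo f n) (λ x → ⟦ x ℕ.≟ f i ⟧) ≡ 1ℤ
    go (suc n) f zero inj _ = cong₂ _+_ (⟦⟧-yes (f 0 ℕ.≟ f 0) refl) (sumL-applyUpTo-≢ n (f ∘ suc) (f 0) (λ i e → ℕₚ.1+n≢0 (inj e)))
    go (suc n) f (suc i) inj (s≤s i<n) = cong₂ _+_ (⟦⟧-no (f 0 ℕ.≟ f (suc i)) (λ e → ℕₚ.0≢1+n (inj e)))
      (go n (f ∘ suc) i (λ e → ℕₚ.suc-injective (inj e)) i<n)

  interval : ℕ → Enumeration ℤ
  interval n = record { list = map +_ (upTo (suc n)) ++ map -[1+_] (upTo n) ; _≟_ = ℤ._≟_ }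

  interval-listed : ∀ n x → abs x ℕ.≤ n → Listed (interval n) x
  interval-listed n x bound = trans (sumL-++ (map +_ (upTo (suc n))) (map -[1+_] (upTo n)) isX)
     (trans (cong₂ _+_ (sumL-map +_ (upTo (suc n)) isX) (sumL-map -[1+_] (upTo n) isX)) (go x bound))
    where
    isX : ℤ → ℤ
    isX y = ⟦ y ℤ.≟ x ⟧
    go : ∀ x → abs x ℕ.≤ n → sumL (upTo (suc n)) (λ i → ⟦ + i ℤ.≟ x ⟧) + sumL (upTo n) (λ i → ⟦ -[1+ i ] ℤ.≟ x ⟧) ≡ 1ℤ
    go (+ m) le = cong₂ _+_
      (trans (sumL-cong (upTo (suc n)) (λ i → ⟦⟧-⇔ (+ i ℤ.≟ + m) (i ℕ.≟ m) ℤₚ.+-injective (cong (+_)))) (below-listed (suc n) m (s≤s le)))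
      (trans (sumL-cong (upTo n) (λ i → ⟦⟧-no (-[1+ i ] ℤ.≟ + m) (λ ()))) (sumL-0 (upTo n)))
    go -[1+ m ] le = cong₂ _+_
      (trans (sumL-cong (upTo (suc n)) (λ i → ⟦⟧-no (+ i ℤ.≟ -[1+ m ]) (λ ()))) (sumL-0 (upTo (suc n))))
      (trans (sumL-cong (upTo n) (λ i → ⟦⟧-⇔ (-[1+ i ] ℤ.≟ -[1+ m ]) (i ℕ.≟ m) ℤₚ.-[1+-injective (cong (-[1+_])))) (below-listed n m le))

  infixr 2 _⊗_
  _⊗_ : ∀ {A B : Set} → Enumeration A → Enumeration B → Enumeration (A × B)
  _⊗_ {A} {B} E F = record { list = cartesianProduct (list E) (list F) ; _≟_ = eq }
    where
    eq : (u v : A × B) → Dec (u ≡ v)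
    eq (x , y) (x′ , y′) = map′ (λ { (refl , refl) → refl }) (λ { refl → refl , refl })
        (Enumeration._≟_ E x x′ ×-dec Enumeration._≟_ F y y′)

  ⊗-listed : ∀ {A B : Set} (E : Enumeration A) (F : Enumeration B) {a b} → Listed E a → Listed F b → Listed (E ⊗ F) (a , b)
  ⊗-listed E F {a} {b} p q = begin
    sumL (cartesianProduct (list E) (list F)) _
      ≡⟨ sumL-× (list E) (list F) (λ u → ⟦ Enumeration._≟_ (E ⊗ F) u (a , b) ⟧) ⟩
    sumL (list E) (λ x → sumL (list F) (λ y → ⟦ Enumeration._≟_ (E ⊗ F) (x , y) (a , b) ⟧))
      ≡⟨ sumL-cong (list E) (λ x → trans (sumL-cong (list F) (λ y → ⟦⟧-× (Enumeration._≟_ E x a) (Enumeration._≟_ F y b)))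
           (trans (sumL-* (list F) ⟦ Enumeration._≟_ E x a ⟧ (λ y → ⟦ Enumeration._≟_ F y b ⟧))
               (trans (cong (⟦ Enumeration._≟_ E x a ⟧ *_) q) (ℤₚ.*-identityʳ _)))) ⟩
    sumL (list E) (λ x → ⟦ Enumeration._≟_ E x a ⟧)
      ≡⟨ p ⟩
    1ℤ ∎
    where open ≡-Reasoning

-- Membership in a neighbour lattice as orthogonality modulo ℓ.

module Neighbours where

  open Quaternions
  open Rotations
  open ℤSolver using (solve; _:=_; _:+_; _:*_; _:-_; :-_; con)

  dot-comm : ∀ u v → dot u v ≡ dot v u
  dot-comm (x , y , z) (x′ , y′ , z′) = trans (dot-≡ x y z x′ y′ z′)
    (trans (solve 6 (λ x y z x′ y′ z′ → x :* x′ :+ y :* y′ :+ z :* z′ := x′ :* x :+ y′ :* y :+ z′ :* z) refl x y z x′ y′ z′)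
           (sym (dot-≡ x′ y′ z′ x y z)))

  infixr 7 _·_
  _·_ : ℤ → ℤ³ → ℤ³
  c · (x , y , z) = c * x , c * y , c * z

  dot-· : ∀ c u v → dot (c · u) v ≡ c * dot u v
  dot-· c (x , y , z) (x′ , y′ , z′) = trans (dot-≡ (c * x) (c * y) (c * z) x′ y′ z′)
    (trans (solve 7 (λ c x y z x′ y′ z′ → c :* x :* x′ :+ c :* y :* y′ :+ c :* z :* z′ :=
        c :* (x :* x′ :+ y :* y′ :+ z :* z′)) refl c x y z x′ y′ z′)
           (cong (c *_) (sym (dot-≡ x y z x′ y′ z′))))

  V-≡ : ∀ {u v : ℤ³} → (∀ j → u ! j ≡ v ! j) → u ≡ v
  V-≡ p = cong₂ _,_ (p zero) (cong₂ _,_ (p (suc zero)) (p (suc (suc zero))))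

  ·-! : ∀ c u j → (c · u) ! j ≡ c * u ! j
  ·-! c u zero = refl
  ·-! c u (suc zero) = refl
  ·-! c u (suc (suc zero)) = refl

  module _ {ℓ : ℕ} (ℓ-prime : Prime ℓ) where

    private
      L : ℤ
      L = + ℓ
      instance
        ℓ-nonZero : ℕ.NonZero ℓ
        ℓ-nonZero = prime⇒nonZero ℓ-prime

    L∣L² : L ∣ L * L
    L∣L² = divides L refl

    L*-cancel : ∀ {x y} → L * x ∣ L * y → x ∣ y
    L*-cancel = ℤ∣.*-cancelˡ-∣ L

    -- Euclid's lemma twice: first for `y`, then for the quotient of `y` by ℓ.
    square-cancel : ∀ ρ {y} → ¬ (L ∣ ρ) → L * L ∣ ρ * y → L * L ∣ y
    square-cancel ρ L∤ρ p with prime-∣-cancel ℓ-prime ρ _ L∤ρ (∣-trs L∣L² p)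
    ... | divides z refl = subst (L * L ∣_) (ℤₚ.*-comm L z)
            (∣-mono L (prime-∣-cancel ℓ-prime ρ z L∤ρ (L*-cancel (subst (L * L ∣_) (swap ρ z L) p))))
      where
      swap : ∀ ρ z L → ρ * (z * L) ≡ L * (ρ * z)
      swap = solve 3 (λ ρ z L → ρ :* (z :* L) := L :* (ρ :* z)) refl

    -- Proportionality modulo ℓ expressed by the 2 × 2 minors, so that no factor has to be named or
    -- inverted.
    Parallel : ℤ³ → ℤ³ → Set
    Parallel a b = ∀ i j → L ∣ a ! i * b ! j - a ! j * b ! i

    -- Two isotropic orthogonal vectors of a nondegenerate ternary space are parallel:
    -- (a₁b₂ - a₂b₁)² = (a₁² + a₂²)(b₁² + b₂²) - (a₁b₁ + a₂b₂)² ≡ a₃²b₃² - a₃²b₃².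
    parallel : ∀ a b → L ∣ dot a a → L ∣ dot b b → L ∣ dot a b → Parallel a b
    parallel a@(a₁ , a₂ , a₃) b@(b₁ , b₂ , b₃) a·a b·b a·b = go
      where
      identity : ∀ a₁ a₂ a₃ b₁ b₂ b₃ → (b₁ * b₁ + b₂ * b₂) * (a₁ * a₁ + a₂ * a₂ + a₃ * a₃) + - (a₃ * a₃) * (b₁ * b₁ + b₂ * b₂ + b₃ * b₃)
        + (a₃ * b₃ - a₁ * b₁ - a₂ * b₂) * (a₁ * b₁ + a₂ * b₂ + a₃ * b₃) ≡ (a₁ * b₂ - a₂ * b₁) * (a₁ * b₂ - a₂ * b₁)
      identity = solve 6 (λ a₁ a₂ a₃ b₁ b₂ b₃ → (b₁ :* b₁ :+ b₂ :* b₂) :* (a₁ :* a₁ :+ a₂ :* a₂ :+ a₃ :* a₃) :+ :- (a₃ :* a₃) :*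
          (b₁ :* b₁ :+ b₂ :* b₂ :+ b₃ :* b₃)
        :+ (a₃ :* b₃ :- a₁ :* b₁ :- a₂ :* b₂) :* (a₁ :* b₁ :+ a₂ :* b₂ :+ a₃ :* b₃) :=
            (a₁ :* b₂ :- a₂ :* b₁) :* (a₁ :* b₂ :- a₂ :* b₁)) refl
      minor : ∀ a₁ a₂ a₃ b₁ b₂ b₃ → L ∣ a₁ * a₁ + a₂ * a₂ + a₃ * a₃ → L ∣ b₁ * b₁ + b₂ * b₂ + b₃ * b₃ → L ∣ a₁ * b₁ + a₂ * b₂ + a₃ * b₃ →
              L ∣ a₁ * b₂ - a₂ * b₁
      minor a₁ a₂ a₃ b₁ b₂ b₃ p q r = reduce (prime-∣-* ℓ-prime (a₁ * b₂ - a₂ * b₁) (a₁ * b₂ - a₂ * b₁)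
        (subst (L ∣_) (identity a₁ a₂ a₃ b₁ b₂ b₃) (∣-lin₃ (b₁ * b₁ + b₂ * b₂) (- (a₃ * a₃)) (a₃ * b₃ - a₁ * b₁ - a₂ * b₂) p q r)))
      rotate : ∀ x y z → x + y + z ≡ y + z + x
      rotate = solve 3 (λ x y z → x :+ y :+ z := y :+ z :+ x) refl
      A = subst (L ∣_) (dot-≡ a₁ a₂ a₃ a₁ a₂ a₃) a·a
      B = subst (L ∣_) (dot-≡ b₁ b₂ b₃ b₁ b₂ b₃) b·b
      C = subst (L ∣_) (dot-≡ a₁ a₂ a₃ b₁ b₂ b₃) a·b
      m₀₁ : L ∣ a₁ * b₂ - a₂ * b₁
      m₀₁ = minor a₁ a₂ a₃ b₁ b₂ b₃ A B C
      m₁₂ : L ∣ a₂ * b₃ - a₃ * b₂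
      m₁₂ = minor a₂ a₃ a₁ b₂ b₃ b₁ (subst (L ∣_) (rotate (a₁ * a₁) (a₂ * a₂) (a₃ * a₃)) A)
          (subst (L ∣_) (rotate (b₁ * b₁) (b₂ * b₂) (b₃ * b₃)) B) (subst (L ∣_) (rotate (a₁ * b₁) (a₂ * b₂) (a₃ * b₃)) C)
      m₂₀ : L ∣ a₃ * b₁ - a₁ * b₃
      m₂₀ = minor a₃ a₁ a₂ b₃ b₁ b₂ (subst (L ∣_) (sym (rotate (a₃ * a₃) (a₁ * a₁) (a₂ * a₂))) A)
          (subst (L ∣_) (sym (rotate (b₃ * b₃) (b₁ * b₁) (b₂ * b₂))) B) (subst (L ∣_) (sym (rotate (a₃ * b₃) (a₁ * b₁) (a₂ * b₂))) C)
      flip : ∀ x y → L ∣ x - y → L ∣ y - x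
      flip x y d = subst (L ∣_) (solve 2 (λ x y → :- (x :- y) := y :- x) refl x y) (∣-neg d)
      diagonal : ∀ x → L ∣ x - x
      diagonal x = subst (L ∣_) (sym (ℤₚ.+-inverseʳ x)) (divides 0ℤ refl)
      go : Parallel a b
      go zero zero = diagonal (a₁ * b₁)
      go zero (suc zero) = m₀₁
      go zero (suc (suc zero)) = flip (a₃ * b₁) (a₁ * b₃) m₂₀
      go (suc zero) zero = flip (a₁ * b₂) (a₂ * b₁) m₀₁
      go (suc zero) (suc zero) = diagonal (a₂ * b₂)
      go (suc zero) (suc (suc zero)) = m₁₂
      go (suc (suc zero)) zero = m₂₀
      go (suc (suc zero)) (suc zero) = flip (a₂ * b₃) (a₃ * b₂) m₁₂
      go (suc (suc zero)) (suc (suc zero)) = diagonal (a₃ * b₃)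

    -- Up to minors, b_j (x · a) is a_j (x · b), and b_j is a unit modulo ℓ.
    transfer : ∀ a b x j → Parallel a b → ¬ (L ∣ b ! j) → L ∣ dot x b → L ∣ dot x a
    transfer a@(a₁ , a₂ , a₃) b@(b₁ , b₂ , b₃) x@(x₁ , x₂ , x₃) j par L∤bⱼ x·b = prime-∣-cancel ℓ-prime (b ! j) (dot x a) L∤bⱼ
      (subst (L ∣_) (trans (identity a₁ a₂ a₃ b₁ b₂ b₃ x₁ x₂ x₃ (a ! j) (b ! j)) (cong (b ! j *_) (sym (dot-≡ x₁ x₂ x₃ a₁ a₂ a₃))))
          combination)
      where
      identity : ∀ a₁ a₂ a₃ b₁ b₂ b₃ x₁ x₂ x₃ aⱼ bⱼ → x₁ * (a₁ * bⱼ - aⱼ * b₁) + x₂ * (a₂ * bⱼ - aⱼ * b₂) + x₃ * (a₃ * bⱼ - aⱼ * b₃) + aⱼ *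
          (x₁ * b₁ + x₂ * b₂ + x₃ * b₃)
        ≡ bⱼ * (x₁ * a₁ + x₂ * a₂ + x₃ * a₃)
      identity = solve 11 (λ a₁ a₂ a₃ b₁ b₂ b₃ x₁ x₂ x₃ aⱼ bⱼ →
          x₁ :* (a₁ :* bⱼ :- aⱼ :* b₁) :+ x₂ :* (a₂ :* bⱼ :- aⱼ :* b₂) :+ x₃ :* (a₃ :* bⱼ :- aⱼ :* b₃) :+ aⱼ :*
          (x₁ :* b₁ :+ x₂ :* b₂ :+ x₃ :* b₃)
        := bⱼ :* (x₁ :* a₁ :+ x₂ :* a₂ :+ x₃ :* a₃)) refl
      combination : L ∣ x₁ * (a₁ * b ! j - a ! j * b₁) + x₂ * (a₂ * b ! j - a ! j * b₂) + x₃ * (a₃ * b ! j - a ! j * b₃) + a ! j *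
          (x₁ * b₁ + x₂ * b₂ + x₃ * b₃)
      combination = ∣-lin₄ x₁ x₂ x₃ (a ! j) (par zero j) (par (suc zero) j) (par (suc (suc zero)) j)
          (subst (L ∣_) (dot-≡ x₁ x₂ x₃ b₁ b₂ b₃) x·b)

    module Neighbour (ℓ≢2 : ℓ ≢ 2) {e : ℤ³} (e·e : L ∣ dot e e) (jₑ : Fin 3) (eⱼ : ¬ (L ∣ e ! jₑ)) (R : Rotation ℓ e) where
      open Rotation R

      k₀ j₀ : Fin 3
      k₀ = proj₁ pivot
      j₀ = proj₁ (proj₂ pivot)

      r : ℤ³
      r = row k₀

      ρ : ℤ
      ρ = r ! j₀

      L∤ρ : ¬ (L ∣ ρ)
      L∤ρ = proj₂ (proj₂ pivot)

      row·row : ∀ m k → L * L ∣ dot (row m) (row k)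
      row·row m k with m Fin.≟ k
      ... | yes refl = subst (L * L ∣_) (sym (norm m)) ∣-rfl
      ... | no m≢k   = subst (L * L ∣_) (sym (orth m k m≢k)) (divides 0ℤ refl)

      row·row-L : ∀ m k → L ∣ dot (row m) (row k)
      row·row-L m k = ∣-trs L∣L² (row·row m k)

      -- The rows have norm ℓ² and are orthogonal to e modulo ℓ, so modulo ℓ the matrix has rank
      -- one: all its rows are multiples of e.
      row∥e : ∀ m → Parallel (row m) e
      row∥e m = parallel (row m) e (row·row-L m m) e·e (perp m)

      e∥r : Parallel e r
      e∥r = parallel e r e·e (row·row-L k₀ k₀) (subst (L ∣_) (dot-comm r e) (perp k₀))

      row∥r : ∀ m → Parallel (row m) r
      row∥r m = parallel (row m) r (row·row-L m m) (row·row-L k₀ k₀) (row·row-L m k₀)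

      -- w lies in ℓ times the neighbour lattice.
      InNeighbour : ℤ³ → Set
      InNeighbour w = ∀ k → L * L ∣ dot w (row k)

      inNeighbour⇒perp : ∀ w → InNeighbour w → L ∣ dot w e
      inNeighbour⇒perp w p = transfer e r w j₀ e∥r L∤ρ (∣-trs L∣L² (p k₀))

      -- For the vector `L · u` one factor ℓ cancels in the condition modulo ℓ², so membership tests
      -- the orthogonality of `u` itself to e.
      multiple-inNeighbour⇒perp : ∀ u → InNeighbour (L · u) → L ∣ dot u e
      multiple-inNeighbour⇒perp u p = transfer e r u j₀ e∥r L∤ρ (L*-cancel (subst (L * L ∣_) (dot-· L u r) (p k₀)))

      perp⇒multiple-inNeighbour : ∀ u → L ∣ dot u e → InNeighbour (L · u)
      perp⇒multiple-inNeighbour u p k = subst (L * L ∣_) (sym (dot-· L u (row k))) (∣-mono L (transfer (row k) e u jₑ (row∥e k) eⱼ p))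

      -- Modulo ℓ such a `w` is proportional to the row `r`, so ρ w = c r + ℓ q. Comparing norms
      -- modulo ℓ² gives that ℓ divides 2c (q · r), and c is a unit as `w` is not a multiple of ℓ.
      -- Hence q is orthogonal to `r`, then to every row, and ρ w · row is divisible by ℓ².
      perp⇒inNeighbour : ∀ w → ¬ (∀ j → L ∣ w ! j) → L * L ∣ dot w w → L ∣ dot w e → InNeighbour w
      perp⇒inNeighbour w@(w₁ , w₂ , w₃) prim w·w w·e k = square-cancel ρ L∤ρ (subst (L * L ∣_) (sym (expand (row k)))
          (∣-+ (∣-*ˡ c (row·row k₀ k)) (∣-mono L (transfer (row k) r q j₀ (row∥r k) L∤ρ q·r))))
        where
        c = w ! j₀
        w∥r : Parallel w r
        w∥r = parallel w r (∣-trs L∣L² w·w) (row·row-L k₀ k₀) (transfer r e w jₑ (row∥e k₀) eⱼ w·e)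
        q : ℤ³
        q = _∣_.quotient (w∥r zero j₀) , _∣_.quotient (w∥r (suc zero) j₀) , _∣_.quotient (w∥r (suc (suc zero)) j₀)
        component : ∀ i → ρ * w ! i ≡ c * r ! i + L * q ! i
        component i = trans (solve 4 (λ ρ w c r → ρ :* w := c :* r :+ (w :* ρ :- c :* r)) refl ρ (w ! i) c (r ! i))
          (cong (λ x → c * r ! i + x) (trans (_∣_.equality (w∥r i j₀)) (trans (cong (_* L) (quotient i)) (ℤₚ.*-comm (q ! i) L))))
          where
          quotient : ∀ i → _∣_.quotient (w∥r i j₀) ≡ q ! i
          quotient zero = refl
          quotient (suc zero) = refl
          quotient (suc (suc zero)) = refl
        expand : ∀ v → ρ * dot w v ≡ c * dot r v + L * dot q v
        expand v@(v₁ , v₂ , v₃) = begin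
          ρ * dot w v
            ≡⟨ cong (ρ *_) (dot-≡ w₁ w₂ w₃ v₁ v₂ v₃) ⟩
          ρ * (w₁ * v₁ + w₂ * v₂ + w₃ * v₃)
            ≡⟨ solve 7 (λ ρ a b c x y z → ρ :* (a :* x :+ b :* y :+ c :* z) :=
                ρ :* a :* x :+ ρ :* b :* y :+ ρ :* c :* z) refl ρ w₁ w₂ w₃ v₁ v₂ v₃ ⟩
          ρ * w₁ * v₁ + ρ * w₂ * v₂ + ρ * w₃ * v₃
            ≡⟨ cong₂ _+_ (cong₂ _+_ (cong (_* v₁) (component zero)) (cong (_* v₂) (component (suc zero))))
                (cong (_* v₃) (component (suc (suc zero)))) ⟩
          (c * r ! zero + L * q ! zero) * v₁ + (c * r ! suc zero + L * q ! suc zero) * v₂ +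
              (c * r ! suc (suc zero) + L * q ! suc (suc zero)) * v₃
            ≡⟨ solve 11 (λ c L r₁ r₂ r₃ q₁ q₂ q₃ v₁ v₂ v₃ → (c :* r₁ :+ L :* q₁) :* v₁ :+ (c :* r₂ :+ L :* q₂) :* v₂ :+
                (c :* r₃ :+ L :* q₃) :* v₃
                  := c :* (r₁ :* v₁ :+ r₂ :* v₂ :+ r₃ :* v₃) :+ L :* (q₁ :* v₁ :+ q₂ :* v₂ :+ q₃ :* v₃)) refl
                  c L (r ! zero) (r ! suc zero) (r ! suc (suc zero)) (q ! zero) (q ! suc zero) (q ! suc (suc zero)) v₁ v₂ v₃ ⟩
          c * (r ! zero * v₁ + r ! suc zero * v₂ + r ! suc (suc zero) * v₃) + L *
              (q ! zero * v₁ + q ! suc zero * v₂ + q ! suc (suc zero) * v₃)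
            ≡⟨ cong₂ (λ x y → c * x + L * y) (sym (dot-≡ (r ! zero) (r ! suc zero) (r ! suc (suc zero)) v₁ v₂ v₃))
                (sym (dot-≡ (q ! zero) (q ! suc zero) (q ! suc (suc zero)) v₁ v₂ v₃)) ⟩
          c * dot r v + L * dot q v ∎
          where open ≡-Reasoning
        L∤c : ¬ (L ∣ c)
        L∤c L∣c = prim λ i → prime-∣-cancel ℓ-prime ρ (w ! i) L∤ρ (subst (L ∣_) (sym (component i))
          (∣-+ (∣-*ʳ (r ! i) L∣c) (∣-*ʳ (q ! i) ∣-rfl)))
        norm-w : ρ * (ρ * dot w w) ≡ c * (c * dot r r) + (L * (+ 2 * (c * dot q r)) + L * L * dot q q)
        norm-w = begin
          ρ * (ρ * dot w w)
            ≡⟨ cong (ρ *_) (trans (expand w) (cong₂ (λ x y → c * x + L * y) (dot-comm r w) (dot-comm q w))) ⟩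
          ρ * (c * dot w r + L * dot w q)
            ≡⟨ solve 5 (λ ρ c L x y → ρ :* (c :* x :+ L :* y) := c :* (ρ :* x) :+ L :* (ρ :* y)) refl ρ c L (dot w r) (dot w q) ⟩
          c * (ρ * dot w r) + L * (ρ * dot w q)
            ≡⟨ cong₂ (λ x y → c * x + L * y) (expand r) (trans (expand q) (cong (λ x → c * x + L * dot q q) (dot-comm r q))) ⟩
          c * (c * dot r r + L * dot q r) + L * (c * dot q r + L * dot q q)
            ≡⟨ solve 5 (λ c L x y z → c :* (c :* x :+ L :* y) :+ L :* (c :* y :+ L :* z) :=
                c :* (c :* x) :+ (L :* (con (+ 2) :* (c :* y)) :+ L :* L :* z)) refl c L (dot r r) (dot q r) (dot q q) ⟩
          c * (c * dot r r) + (L * (+ 2 * (c * dot q r)) + L * L * dot q q) ∎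
          where open ≡-Reasoning
        q·r : L ∣ dot q r
        q·r = prime-∣-cancel ℓ-prime c (dot q r) L∤c (2-cancel ℓ-prime ℓ≢2 (L*-cancel
          (ℤ∣.∣m+n∣n⇒∣m {m = L * (+ 2 * (c * dot q r))} {L * L * dot q q}
            (ℤ∣.∣m+n∣m⇒∣n {m = c * (c * dot r r)} {L * (+ 2 * (c * dot q r)) + L * L * dot q q}
              (subst (L * L ∣_) norm-w (∣-*ˡ ρ (∣-*ˡ ρ w·w)))
              (∣-*ˡ c (∣-*ˡ c (row·row k₀ k₀))))
            (∣-*ʳ (dot q q) ∣-rfl))))

-- Quadratic residues and zeros of binary quadratic forms.

module QuadraticResidues where

  open Quaternions
  open Rotations
  open Neighbours
  open Counting
  open ℤSolver using (solve; _:=_; _:+_; _:*_; _:-_; :-_; con)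

  sumL-cong-below : ∀ n {f g : ℕ → ℤ} → (∀ i → i ℕ.< n → f i ≡ g i) → sumL (upTo n) f ≡ sumL (upTo n) g
  sumL-cong-below n = go n id
    where
    go : ∀ n (h : ℕ → ℕ) {f g : ℕ → ℤ} → (∀ i → i ℕ.< n → f (h i) ≡ g (h i)) → sumL (applyUpTo h n) f ≡ sumL (applyUpTo h n) g
    go zero h p = refl
    go (suc n) h p = cong₂ _+_ (p 0 (s≤s z≤n)) (go n (h ∘ suc) (λ i i<n → p (suc i) (s≤s i<n)))

  -- The symbol as a function of the residue alone, so that a residue known only through an equation
  -- can be substituted.
  legendreResidue : ℕ → ℕ → ℤ
  legendreResidue zero    _       = + 0
  legendreResidue (suc q) zero    = + 0
  legendreResidue (suc q) (suc r) = if any (λ x → does ((x ℕ.* x) % suc q ℕ.≟ suc r)) (upTo (suc q)) then + 1 else - (+ 1)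

  legendre-residue : ∀ a ℓ .{{_ : ℕ.NonZero ℓ}} → legendre a ℓ ≡ legendreResidue ℓ (a %ℕ ℓ)
  legendre-residue a (suc q) with a %ℕ suc q
  ... | zero  = refl
  ... | suc r = refl

  module Residues {ℓ : ℕ} (ℓ-prime : Prime ℓ) (ℓ≢2 : ℓ ≢ 2) where

    private
      L : ℤ
      L = + ℓ
      instance
        ℓ-nonZero : ℕ.NonZero ℓ
        ℓ-nonZero = prime⇒nonZero ℓ-prime

    ℓ>0 : 0 ℕ.< ℓ
    ℓ>0 = ℕₚ.<-trans (s≤s z≤n) (1<ℓ ℓ-prime ℓ≢2)

    residue-unique : ∀ {a b} → a ℕ.< ℓ → b ℕ.< ℓ → L ∣ + a - + b → a ≡ b
    residue-unique {a} {b} a<ℓ b<ℓ p with ℕₚ.<-cmp a b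
    ... | tri≈ _ a≡b _ = a≡b
    ... | tri< a<b _ _ = ⊥-elim (∤-small ℓ-prime ℓ≢2 (b ℕ.∸ a) (ℕₚ.m<n⇒0<n∸m a<b) (ℕₚ.≤-<-trans (ℕₚ.m∸n≤m b a) b<ℓ)
        (subst (L ∣_) (trans (solve 2 (λ a b → :- (a :- b) := b :- a) refl (+ a) (+ b)) (trans (ℤₚ.m-n≡m⊖n b a) (ℤₚ.⊖-≥ (ℕₚ.<⇒≤ a<b))))
            (∣-neg p)))
    ... | tri> _ _ b<a = ⊥-elim (∤-small ℓ-prime ℓ≢2 (a ℕ.∸ b) (ℕₚ.m<n⇒0<n∸m b<a) (ℕₚ.≤-<-trans (ℕₚ.m∸n≤m a b) a<ℓ)
        (subst (L ∣_) (trans (ℤₚ.m-n≡m⊖n a b) (ℤₚ.⊖-≥ (ℕₚ.<⇒≤ b<a))) p))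

    residue : ∀ x → ∃[ r ] r ℕ.< ℓ × L ∣ x - + r
    residue x = x %ℕ ℓ , n%ℕd<d x ℓ , divides (x /ℕ ℓ)
      (trans (cong (_- + (x %ℕ ℓ)) (a≡a%ℕn+[a/ℕn]*n x ℓ)) (solve 2 (λ r q → r :+ q :- r := q) refl (+ (x %ℕ ℓ)) (x /ℕ ℓ * L)))

    ∣-sum : ∀ {x y z} → L ∣ x - y → L ∣ y - z → L ∣ x - z
    ∣-sum {x} {y} {z} p q = subst (L ∣_) (solve 3 (λ x y z → x :- y :+ (y :- z) := x :- z) refl x y z) (∣-+ p q)

    ∣-flip : ∀ {x y} → L ∣ x - y → L ∣ y - x
    ∣-flip {x} {y} p = subst (L ∣_) (solve 2 (λ x y → :- (x :- y) := y :- x) refl x y) (∣-neg p)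

    ∣-resp : ∀ {x y} → L ∣ x - y → L ∣ x → L ∣ y
    ∣-resp {x} {y} p q = subst (L ∣_) (solve 2 (λ x y → x :+ (:- (x :- y)) := y) refl x y) (∣-+ q (∣-neg p))

    inverse : ∀ c → ¬ (L ∣ c) → ∃[ d ] L ∣ c * d - 1ℤ
    inverse c L∤c with residue c
    ... | zero , _ , p = ⊥-elim (L∤c (∣-resp {0ℤ} {c} (∣-flip {c} {0ℤ} p) (divides 0ℤ refl)))
    ... | suc r , r<ℓ , p with coprime-Bézout (prime⇒coprime ℓ-prime r<ℓ)
    ...   | Bézout.+- x y eq = - + y , ∣-sum {c * - + y} {+ suc r * - + y} {1ℤ}
              (subst (L ∣_) (solve 3 (λ c r y → y :* (c :- r) := c :* y :- r :* y) refl c (+ suc r) (- + y)) (∣-*ˡ (- + y) p))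
              (divides (- + x) (trans (solve 2 (λ r y → r :* (:- y) :- con 1ℤ := :- (con 1ℤ :+ y :* r)) refl (+ suc r) (+ y))
                (trans (cong -_ (trans (cong (λ z → 1ℤ + z) (sym (ℤₚ.pos-* y (suc r)))) (trans (cong (+_) eq) (ℤₚ.pos-* x ℓ))))
                    (ℤₚ.neg-distribˡ-* (+ x) L))))
    ...   | Bézout.-+ x y eq = + y , ∣-sum {c * + y} {+ suc r * + y} {1ℤ}
              (subst (L ∣_) (solve 3 (λ c r y → y :* (c :- r) := c :* y :- r :* y) refl c (+ suc r) (+ y)) (∣-*ˡ (+ y) p))
              (divides (+ x) (trans (cong (_- 1ℤ) (trans (ℤₚ.*-comm (+ suc r) (+ y))
                  (sym (trans (cong (λ z → 1ℤ + z) (sym (ℤₚ.pos-* x ℓ))) (trans (cong (+_) eq) (ℤₚ.pos-* y (suc r)))))))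
                (solve 1 (λ z → con 1ℤ :+ z :- con 1ℤ := z) refl (+ x * L))))

    countResidues : {P : ℤ → Set} → (∀ x → Dec (P x)) → ℤ
    countResidues P? = sumL (upTo ℓ) (λ y → ⟦ P? (+ y) ⟧)

    -- Substituting y = c τ + a permutes the residues when ℓ ∤ c.
    affine : ∀ {P : ℤ → Set} (P? : ∀ x → Dec (P x)) → (∀ {x y} → L ∣ x - y → P x → P y) → ∀ c a → ¬ (L ∣ c) →
             countResidues (λ τ → P? (c * τ + a)) ≡ countResidues P?
    affine {P} P? periodic c a L∤c = trans (bounded (λ τ → P? (c * τ + a)))
        (trans (count-bij (below ℓ) (below ℓ) (λ τ → (τ ℕ.<? ℓ) ×-dec P? (c * + τ + a)) (λ y → (y ℕ.<? ℓ) ×-dec P? (+ y)) f (λ y _ → g y)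
          (λ τ (_ , p) → f<ℓ τ , periodic (f-≡ τ) p)
          (λ y (_ , p) → g<ℓ y , periodic (∣-flip {c * + g y + a} {+ y} (g-≡ y)) p)
          (λ τ (τ<ℓ , _) _ → residue-unique (g<ℓ (f τ)) τ<ℓ (prime-∣-cancel ℓ-prime c _ L∤c (gf τ)))
          (λ y (y<ℓ , _) → residue-unique (f<ℓ (g y)) y<ℓ (∣-sum {+ f (g y)} {c * + g y + a} {+ y}
              (∣-flip {c * + g y + a} {+ f (g y)} (f-≡ (g y))) (g-≡ y)))
          (λ τ (τ<ℓ , _) → below-listed ℓ τ τ<ℓ) (λ y (y<ℓ , _) → below-listed ℓ y y<ℓ))
        (sym (bounded P?)))
      where
      bounded : ∀ {Q : ℤ → Set} (Q? : ∀ x → Dec (Q x)) → countResidues Q? ≡ sumL (upTo ℓ) (λ y → ⟦ (y ℕ.<? ℓ) ×-dec Q? (+ y) ⟧)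
      bounded Q? = sumL-cong-below ℓ λ i i<ℓ → ⟦⟧-⇔ (Q? (+ i)) ((i ℕ.<? ℓ) ×-dec Q? (+ i)) (i<ℓ ,_) proj₂
      d = proj₁ (inverse c L∤c)
      cd = proj₂ (inverse c L∤c)
      f g : ℕ → ℕ
      f τ = proj₁ (residue (c * + τ + a))
      g y = proj₁ (residue (d * (+ y - a)))
      f<ℓ : ∀ τ → f τ ℕ.< ℓ
      f<ℓ τ = proj₁ (proj₂ (residue (c * + τ + a)))
      g<ℓ : ∀ y → g y ℕ.< ℓ
      g<ℓ y = proj₁ (proj₂ (residue (d * (+ y - a))))
      f-≡ : ∀ τ → L ∣ (c * + τ + a) - + f τ
      f-≡ τ = proj₂ (proj₂ (residue (c * + τ + a)))
      g-≡ : ∀ y → L ∣ (c * + g y + a) - + y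
      g-≡ y = subst (L ∣_) (solve 5 (λ c d a y g → c :* (:- (d :* (y :- a) :- g)) :+ (y :- a) :* (c :* d :- con 1ℤ) :=
          c :* g :+ a :- y) refl c d a (+ y) (+ g y))
        (∣-+ (∣-*ˡ c (∣-neg (proj₂ (proj₂ (residue (d * (+ y - a))))))) (∣-*ˡ (+ y - a) cd))
      gf : ∀ τ → L ∣ c * (+ g (f τ) - + τ)
      gf τ = subst (L ∣_) (solve 5 (λ c g a t f → (c :* g :+ a :- f) :+ (:- (c :* t :+ a :- f)) := c :* (g :- t)) refl c (+ g (f τ)) a (+ τ)
          (+ f τ))
        (∣-+ (g-≡ (f τ)) (∣-neg (f-≡ τ)))

    -- Stands in for 1 + (d/ℓ). A count can be transported along substitutions, and this is how the
    -- properties of the symbol are obtained.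
    roots : ℤ → ℤ
    roots d = countResidues (λ y → L ∣? (y * y - d))

    roots-cong : ∀ {d d′} → L ∣ d - d′ → roots d ≡ roots d′
    roots-cong {d} {d′} p = sumL-cong (upTo ℓ) λ y → ⟦⟧-⇔ (L ∣? (+ y * + y - d)) (L ∣? (+ y * + y - d′))
      (λ q → ∣-sum {+ y * + y} {d} {d′} q p) (λ q → ∣-sum {+ y * + y} {d′} {d} q (∣-flip {d} {d′} p))

    roots-zero : ∀ {d} → L ∣ d → roots d ≡ 1ℤ
    roots-zero {d} p = trans (sumL-cong-below ℓ λ y y<ℓ → ⟦⟧-⇔ (L ∣? (+ y * + y - d)) (y ℕ.≟ 0)
        (λ q → residue-unique y<ℓ ℓ>0 (subst (L ∣_) (sym (ℤₚ.+-identityʳ (+ y))) (prime-∣-square ℓ-prime ℓ≢2 (+ y)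
           (subst (L ∣_) (solve 2 (λ y d → y :- d :+ d := y) refl (+ y * + y) d) (∣-+ q p)))))
        (λ { refl → subst (L ∣_) (sym (ℤₚ.+-identityˡ (- d))) (∣-neg p) }))
      (below-listed ℓ 0 ℓ>0)

    difference-of-squares : ∀ x y → L ∣ x * x - y * y → (L ∣ x - y) ⊎ (L ∣ x + y)
    difference-of-squares x y p = prime-∣-* ℓ-prime (x - y) (x + y) (subst (L ∣_) (solve 2 (λ x y → x :* x :- y :* y := (x :- y) :* (x :+ y)) refl x y) p)

    roots-square : ∀ x → ¬ (L ∣ x) → roots (x * x) ≡ + 2
    roots-square x L∤x with residue x
    ... | zero , _ , p = ⊥-elim (L∤x (∣-resp {0ℤ} {x} (∣-flip {x} {0ℤ} p) (divides 0ℤ refl)))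
    ... | r@(suc _) , r<ℓ , p = trans (sumL-cong-below ℓ split)
          (trans (sumL-+ (upTo ℓ) (λ y → ⟦ y ℕ.≟ r ⟧) (λ y → ⟦ y ℕ.≟ r′ ⟧)) (cong₂ _+_ (below-listed ℓ r r<ℓ) (below-listed ℓ r′ r′<ℓ)))
      where
      r′ = ℓ ℕ.∸ r
      r′<ℓ : r′ ℕ.< ℓ
      r′<ℓ = ℕₚ.∸-monoʳ-< (s≤s z≤n) (ℕₚ.<⇒≤ r<ℓ)
      +r′ : + r′ ≡ L - + r
      +r′ = sym (trans (ℤₚ.m-n≡m⊖n ℓ r) (ℤₚ.⊖-≥ (ℕₚ.<⇒≤ r<ℓ)))
      r≢r′ : r ≢ r′
      r≢r′ e =
          L∤x (2-cancel ℓ-prime ℓ≢2 (subst (L ∣_) (solve 3 (λ x r L → con (+ 2) :* (x :- r) :+ (r :+ r) := con (+ 2) :* x) refl x (+ r) L)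
        (∣-+ (∣-*ˡ (+ 2) p) (subst (λ y → L ∣ + r + y) (sym (trans (cong (+_) e) +r′))
            (subst (L ∣_) (solve 2 (λ r L → L := r :+ (L :- r)) refl (+ r) L) ∣-rfl)))))
      x≡-r′ : L ∣ x + + r′
      x≡-r′ = subst (λ y → L ∣ x + y) (sym +r′) (subst (L ∣_) (solve 3 (λ x r L → x :- r :+ L := x :+ (L :- r)) refl x (+ r) L)
          (∣-+ p ∣-rfl))
      split : ∀ y → y ℕ.< ℓ → ⟦ L ∣? (+ y * + y - x * x) ⟧ ≡ ⟦ y ℕ.≟ r ⟧ + ⟦ y ℕ.≟ r′ ⟧
      split y y<ℓ = go (y ℕ.≟ r) (y ℕ.≟ r′)
        where
        go : Dec (y ≡ r) → Dec (y ≡ r′) → ⟦ L ∣? (+ y * + y - x * x) ⟧ ≡ ⟦ y ℕ.≟ r ⟧ + ⟦ y ℕ.≟ r′ ⟧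
        go (yes y≡r) (yes y≡r′) = ⊥-elim (r≢r′ (trans (sym y≡r) y≡r′))
        go (yes refl) (no y≢r′) = trans
          (⟦⟧-yes (L ∣? (+ r * + r - x * x)) (subst (L ∣_) (solve 2 (λ x r → (:- x :- r) :* (x :- r) := r :* r :- x :* x) refl x (+ r))
              (∣-*ˡ (- x - + r) p)))
          (sym (cong₂ _+_ (⟦⟧-yes (r ℕ.≟ r) refl) (⟦⟧-no (r ℕ.≟ r′) y≢r′)))
        go (no y≢r) (yes y≡r′) = trans
          (⟦⟧-yes (L ∣? (+ y * + y - x * x)) (subst (L ∣_) (solve 2 (λ x r → (r :- x) :* (x :+ r) := r :* r :- x :* x) refl x (+ y))
              (∣-*ˡ (+ y - x) (subst (λ z → L ∣ x + + z) (sym y≡r′) x≡-r′))))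
          (sym (cong₂ _+_ (⟦⟧-no (y ℕ.≟ r) y≢r) (⟦⟧-yes (y ℕ.≟ r′) y≡r′)))
        go (no y≢r) (no y≢r′) = trans
          (⟦⟧-no (L ∣? (+ y * + y - x * x)) λ q → [ (λ d → y≢r (residue-unique y<ℓ r<ℓ (∣-sum {+ y} {x} {+ r} d p)))
            , (λ d → y≢r′ (residue-unique y<ℓ r′<ℓ (subst (L ∣_) (solve 3 (λ x y r → y :+ x :+ (:- (x :+ r)) := y :- r) refl x (+ y) (+ r′))
                (∣-+ d (∣-neg x≡-r′))))) ]′
            (difference-of-squares (+ y) x q))
          (sym (cong₂ _+_ (⟦⟧-no (y ℕ.≟ r) y≢r) (⟦⟧-no (y ℕ.≟ r′) y≢r′)))

    square-residue : ∀ x → L ∣ + x * + x - + ((x ℕ.* x) % ℓ)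
    square-residue x = divides (+ ((x ℕ.* x) / ℓ)) (trans (cong (_- + ((x ℕ.* x) % ℓ))
       (trans (sym (ℤₚ.pos-* x x)) (trans (cong (+_) (ℕ/.m≡m%n+[m/n]*n (x ℕ.* x) ℓ))
           (cong (λ z → + ((x ℕ.* x) % ℓ) + z) (ℤₚ.pos-* ((x ℕ.* x) / ℓ) ℓ)))))
       (solve 2 (λ r q → r :+ q :- r := q) refl (+ ((x ℕ.* x) % ℓ)) (+ ((x ℕ.* x) / ℓ) * L)))

    roots-legendreResidue : ∀ r → r ℕ.< ℓ → roots (+ r) ≡ 1ℤ + legendreResidue ℓ r
    roots-legendreResidue zero _ = trans (roots-zero {0ℤ} (divides 0ℤ refl)) (cong (λ z → 1ℤ + z) (sym (lemma ℓ)))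
      where
      lemma : ∀ ℓ → legendreResidue ℓ 0 ≡ 0ℤ
      lemma zero = refl
      lemma (suc q) = refl
    roots-legendreResidue (suc r) r<ℓ = trans (go (any test (upTo ℓ)) refl) (cong (λ z → 1ℤ + z) (sym (lemma ℓ)))
      where
      test : ℕ → Bool
      test x = does ((x ℕ.* x) % ℓ ℕ.≟ suc r)
      lemma : ∀ ℓ .{{_ : ℕ.NonZero ℓ}} → legendreResidue ℓ (suc r)
          ≡ (if any (λ x → does ((x ℕ.* x) % ℓ ℕ.≟ suc r)) (upTo ℓ) then + 1 else - (+ 1))
      lemma (suc q) = refl
      go : ∀ b → any test (upTo ℓ) ≡ b → roots (+ suc r) ≡ 1ℤ + (if b then + 1 else - (+ 1))
      go true eq with find (any⁻ test (upTo ℓ) (subst T (sym eq) tt))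
      ... | x , _ , holds = trans (roots-cong {+ suc r} {+ x * + x} (∣-flip {+ x * + x} {+ suc r} x²≡r)) (roots-square (+ x) L∤x)
        where
        x²≡r : L ∣ + x * + x - + suc r
        x²≡r = subst (λ m → L ∣ + x * + x - + m) (ℕₚ.≡ᵇ⇒≡ ((x ℕ.* x) % ℓ) (suc r) holds) (square-residue x)
        L∤x : ¬ (L ∣ + x)
        L∤x p = ∤-small ℓ-prime ℓ≢2 (suc r) (s≤s z≤n) r<ℓ (∣-resp {+ x * + x} {+ suc r} x²≡r (∣-*ʳ (+ x) p))
      go false eq = trans (sumL-cong-below ℓ λ y y<ℓ → ⟦⟧-no (L ∣? _) λ q →
          subst T eq (any⁺ test (lose (∈-upTo⁺ y<ℓ) (ℕₚ.≡⇒≡ᵇ ((y ℕ.* y) % ℓ) (suc r)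
            (residue-unique (ℕ/.m%n<n (y ℕ.* y) ℓ) r<ℓ (∣-sum {+ ((y ℕ.* y) % ℓ)} {+ y * + y} {+ suc r}
                (∣-flip {+ y * + y} (square-residue y)) q))))))
        (sumL-0 (upTo ℓ))

    roots-legendre : ∀ d → roots d ≡ 1ℤ + legendre d ℓ
    roots-legendre d = trans (roots-cong {d} {+ (d %ℕ ℓ)} (proj₂ (proj₂ (residue d))))
      (trans (roots-legendreResidue (d %ℕ ℓ) (n%ℕd<d d ℓ)) (cong (λ z → 1ℤ + z) (sym (legendre-residue d ℓ))))

    -- The number of zeros in ℙ¹(𝔽_ℓ) of c x² - 2a xy + b y².
    zeros : ℤ → ℤ → ℤ → ℤ
    zeros c a b = ⟦ L ∣? c ⟧ + countResidues (λ τ → L ∣? (c * τ * τ - + 2 * a * τ + b))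

    -- If ℓ does not divide c, completing the square turns zeros into roots. If it does, (1 : 0) is
    -- a zero and the affine part is linear: it adds one zero when ℓ does not divide a, matching the
    -- two roots of a², and none otherwise, matching the single root of 0.
    zeros-discriminant : ∀ c a b → ¬ (L ∣ c × L ∣ a × L ∣ b) → zeros c a b ≡ roots (a * a - c * b)
    zeros-discriminant c a b nontrivial = go (L ∣? c) (L ∣? a)
      where
      quadratic : ℕ → ℤ
      quadratic τ = c * + τ * + τ - + 2 * a * + τ + b
      complete : ∀ τ → c * quadratic τ ≡ (c * + τ + - a) * (c * + τ + - a) - (a * a - c * b)
      complete τ = solve 4 (λ c a b t → c :* (c :* t :* t :- con (+ 2) :* a :* t :+ b) :=
          (c :* t :+ :- a) :* (c :* t :+ :- a) :- (a :* a :- c :* b)) refl c a b (+ τ)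
      periodic : ∀ {x y} → L ∣ x - y → L ∣ x * x - (a * a - c * b) → L ∣ y * y - (a * a - c * b)
      periodic {x} {y} p q = subst (L ∣_) (solve 3 (λ x y d → x :* x :- d :+ (:- x :- y) :* (x :- y) := y :* y :- d) refl x y
          (a * a - c * b))
        (∣-+ q (∣-*ˡ (- x - y) p))
      linearise : ∀ τ → quadratic τ + - (c * (+ τ * + τ)) ≡ - (+ 2 * a) * + τ + b
      linearise τ = solve 4 (λ c a b t → c :* t :* t :- con (+ 2) :* a :* t :+ b :+ :- (c :* (t :* t)) :=
          (:- (con (+ 2) :* a)) :* t :+ b) refl c a b (+ τ)
      restore : ∀ τ → quadratic τ ≡ - (+ 2 * a) * + τ + b + c * (+ τ * + τ)
      restore τ = solve 4 (λ c a b t → c :* t :* t :- con (+ 2) :* a :* t :+ b :=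
          (:- (con (+ 2) :* a)) :* t :+ b :+ c :* (t :* t)) refl c a b (+ τ)
      cancel : ∀ τ → quadratic τ + (- (+ τ * + τ) * c + + 2 * + τ * a) ≡ b
      cancel τ = solve 4 (λ c a b t → c :* t :* t :- con (+ 2) :* a :* t :+ b :+ ((:- (t :* t)) :* c :+ con (+ 2) :* t :* a) :=
          b) refl c a b (+ τ)
      affinePart : ℤ
      affinePart = countResidues (λ τ → L ∣? (c * τ * τ - + 2 * a * τ + b))
      go : Dec (L ∣ c) → Dec (L ∣ a) → zeros c a b ≡ roots (a * a - c * b)
      go (no L∤c) _ = trans (cong (_+ affinePart) (⟦⟧-no (L ∣? c) L∤c)) (trans (ℤₚ.+-identityˡ _) (trans (sumL-cong (upTo ℓ) λ τ →
            ⟦⟧-⇔ (L ∣? quadratic τ) (L ∣? ((c * + τ + - a) * (c * + τ + - a) - (a * a - c * b)))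
              (λ p → subst (L ∣_) (complete τ) (∣-*ˡ c p))
              (λ p → prime-∣-cancel ℓ-prime c (quadratic τ) L∤c (subst (L ∣_) (sym (complete τ)) p)))
            (affine (λ y → L ∣? (y * y - (a * a - c * b))) (λ {x} {y} → periodic {x} {y}) c (- a) L∤c)))
      go (yes L∣c) (no L∤a) = trans (cong₂ _+_ (⟦⟧-yes (L ∣? c) L∣c) (trans (sumL-cong (upTo ℓ) λ τ →
              ⟦⟧-⇔ (L ∣? quadratic τ) (L ∣? (- (+ 2 * a) * + τ + b))
                (λ p → subst (L ∣_) (linearise τ) (∣-+ p (∣-neg (∣-*ʳ (+ τ * + τ) L∣c))))
                (λ p → subst (L ∣_) (sym (restore τ)) (∣-+ p (∣-*ʳ (+ τ * + τ) L∣c))))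
              (trans (affine (λ y → L ∣? y) (λ {x} {y} → ∣-resp {x} {y}) (- (+ 2 * a)) b
                  (λ p → L∤a (2-cancel ℓ-prime ℓ≢2 (subst (L ∣_) (ℤₚ.neg-involutive (+ 2 * a)) (∣-neg p)))))
                (trans (sumL-cong-below ℓ (λ y y<ℓ → ⟦⟧-⇔ (L ∣? (+ y)) (y ℕ.≟ 0)
                    (λ p → residue-unique y<ℓ ℓ>0 (subst (L ∣_) (sym (ℤₚ.+-identityʳ (+ y))) p)) (λ { refl → divides 0ℤ refl })))
                       (below-listed ℓ 0 ℓ>0)))))
            (trans (sym (roots-square a L∤a)) (roots-cong {a * a} {a * a - c * b}
              (subst (L ∣_) (solve 3 (λ a b c → c :* b := a :* a :- (a :* a :- c :* b)) refl a b c) (∣-*ʳ b L∣c))))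
      go (yes L∣c) (yes L∣a) = trans (cong₂ _+_ (⟦⟧-yes (L ∣? c) L∣c)
          (trans (sumL-cong (upTo ℓ) (λ τ → ⟦⟧-no (L ∣? quadratic τ) (λ p → nontrivial (L∣c , L∣a ,
               subst (L ∣_) (cancel τ) (∣-+ p (∣-lin₂ (- (+ τ * + τ)) (+ 2 * + τ) L∣c L∣a)))))) (sumL-0 (upTo ℓ))))
            (sym (roots-zero {a * a - c * b} (∣-+ (∣-*ʳ a L∣a) (∣-neg (∣-*ʳ b L∣c)))))

    -- Multiplication by t is a bijection from the roots of a to those of a t².
    legendre-scale : ∀ a t → ¬ (L ∣ t) → legendre (a * (t * t)) ℓ ≡ legendre a ℓ
    legendre-scale a t L∤t = +-cancelˡ 1ℤ _ _ (trans (sym (roots-legendre (a * (t * t)))) (trans (sym scaled) (roots-legendre a)))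
      where
      periodic : ∀ {x y} → L ∣ x - y → L ∣ x * x - a * (t * t) → L ∣ y * y - a * (t * t)
      periodic {x} {y} p q = subst (L ∣_) (solve 3 (λ x y d → x :* x :- d :+ (:- x :- y) :* (x :- y) := y :* y :- d) refl x y (a * (t * t)))
        (∣-+ q (∣-*ˡ (- x - y) p))
      factor : ∀ τ → (t * + τ + 0ℤ) * (t * + τ + 0ℤ) - a * (t * t) ≡ t * (t * (+ τ * + τ - a))
      factor τ = solve 3 (λ t y a → (t :* y :+ con 0ℤ) :* (t :* y :+ con 0ℤ) :- a :* (t :* t) := t :* (t :* (y :* y :- a))) refl t (+ τ) a
      scaled : roots a ≡ roots (a * (t * t))
      scaled = trans (sumL-cong (upTo ℓ) λ τ → ⟦⟧-⇔ (L ∣? (+ τ * + τ - a)) (L ∣? ((t * + τ + 0ℤ) * (t * + τ + 0ℤ) - a * (t * t)))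
          (λ p → subst (L ∣_) (sym (factor τ)) (∣-*ˡ t (∣-*ˡ t p)))
          (λ p → prime-∣-cancel ℓ-prime t _ L∤t (prime-∣-cancel ℓ-prime t _ L∤t (subst (L ∣_) (factor τ) p))))
        (affine (λ y → L ∣? (y * y - a * (t * t))) (λ {x} {y} → periodic {x} {y}) t 0ℤ L∤t)

    legendre-cong : ∀ {a b} → L ∣ a - b → legendre a ℓ ≡ legendre b ℓ
    legendre-cong {a} {b} p = +-cancelˡ 1ℤ _ _ (trans (sym (roots-legendre a)) (trans (roots-cong {a} {b} p) (roots-legendre b)))

    legendre-zero : ∀ {a} → L ∣ a → legendre a ℓ ≡ 0ℤ
    legendre-zero {a} p = +-cancelˡ 1ℤ _ _ (trans (sym (roots-legendre a)) (roots-zero {a} p))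

-- Powers of φ as counts of representations by squares.

module ThetaSeries where

  open PowerSeries
  open Overpartitions using (φ; S; S-upTo; sumZ)
  open Quaternions using (ℤ³; dot; dot-≡; abs-square)
  open Counting

  X-⟦⟧ : ∀ k n → X k n ≡ ⟦ k ℕ.≟ n ⟧
  X-⟦⟧ k n = go (k ℕ.≟ n)
    where
    go : Dec (k ≡ n) → X k n ≡ ⟦ k ℕ.≟ n ⟧
    go (yes refl) = trans (X-self k) (sym (⟦⟧-yes (k ℕ.≟ k) refl))
    go (no k≢n)   = trans (X-≢ k n k≢n) (sym (⟦⟧-no (k ℕ.≟ n) k≢n))

  -- The generating function of a weight on a list; by `weights-⊛` products of such series become
  -- cartesian products of lists.
  weights : ∀ {A : Set} → List A → (A → ℕ) → Series
  weights xs w n = sumL xs (λ x → X (w x) n)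

  weights-∷ : ∀ {A : Set} (x : A) xs w → weights (x ∷ xs) w ≋ X (w x) ⊕ weights xs w
  weights-∷ x xs w = pointwise λ n → sym (⊕-coeff (X (w x)) (weights xs w) n)

  ⊛-distribˡ : ∀ h f g → h ⊛ (f ⊕ g) ≋ h ⊛ f ⊕ h ⊛ g
  ⊛-distribˡ h f g = ≋.trans (⊛-comm h (f ⊕ g)) (≋.trans (⊛-distribʳ h f g) (⊕-cong (⊛-comm f h) (⊛-comm g h)))

  X-⊛-weights : ∀ {A : Set} k (ys : List A) w → X k ⊛ weights ys w ≋ weights ys (λ y → k ℕ.+ w y)
  X-⊛-weights k [] w = pointwise λ n → trans (⊛-comm-coeff (X k) (λ _ → 0ℤ) n) (zero-⊛ (X k) n)
  X-⊛-weights k (y ∷ ys) w = ≋.trans (⊛-cong (≋.refl {X k}) (weights-∷ y ys w))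
    (≋.trans (⊛-distribˡ (X k) (X (w y)) (weights ys w))
      (≋.trans (⊕-cong (≋.sym (X-+ k (w y))) (X-⊛-weights k ys w)) (≋.sym (weights-∷ y ys (λ y → k ℕ.+ w y)))))

  weights-⊛ : ∀ {A B : Set} (xs : List A) (ys : List B) v w →
              weights xs v ⊛ weights ys w ≋ weights (cartesianProduct xs ys) (λ (x , y) → v x ℕ.+ w y)
  weights-⊛ [] ys v w = pointwise (zero-⊛ (weights ys w))
  weights-⊛ (x ∷ xs) ys v w = ≋.trans (⊛-cong (weights-∷ x xs v) (≋.refl {weights ys w}))
    (≋.trans (⊛-distribʳ (weights ys w) (X (v x)) (weights xs v))
      (≋.trans (⊕-cong (X-⊛-weights (v x) ys w) (weights-⊛ xs ys v w)) (pointwise λ n →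
        trans (⊕-coeff (weights ys (λ y → v x ℕ.+ w y)) (weights (cartesianProduct xs ys) (λ (x , y) → v x ℕ.+ w y)) n)
          (sym (trans (sumL-++ (map (x ,_) ys) (cartesianProduct xs ys) (λ (x , y) → X (v x ℕ.+ w y) n))
            (cong (_+ weights (cartesianProduct xs ys) (λ (x , y) → v x ℕ.+ w y) n)
                (sumL-map (x ,_) ys (λ (x , y) → X (v x ℕ.+ w y) n))))))))

  sumZ-suc : ∀ n t → sumZ (suc n) t ≡ t 0 + sumZ n (t ∘ suc)
  sumZ-suc zero t = ℤₚ.+-comm 0ℤ (t 0)
  sumZ-suc (suc n) t = trans (cong (_+ t (suc n)) (sumZ-suc n t)) (ℤₚ.+-assoc (t 0) (sumZ n (t ∘ suc)) (t (suc n)))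

  sumL-upTo : ∀ n f → sumL (upTo n) f ≡ sumZ n f
  sumL-upTo n f = go n id
    where
    go : ∀ n h → sumL (applyUpTo h n) f ≡ sumZ n (f ∘ h)
    go zero h = refl
    go (suc n) h = trans (cong (λ s → f (h 0) + s) (go n (h ∘ suc))) (sym (sumZ-suc n (f ∘ h)))

  square : ℤ → ℕ
  square x = abs x ℕ.* abs x

  φ-weights : ∀ N n → n ℕ.≤ N → weights (list (interval N)) square n ≡ φ n
  φ-weights N n n≤N = begin
    sumL (list (interval N)) t
      ≡⟨ sumL-++ (map +_ (upTo (suc N))) (map -[1+_] (upTo N)) t ⟩
    sumL (map +_ (upTo (suc N))) t + sumL (map -[1+_] (upTo N)) t
      ≡⟨ cong₂ _+_ (trans (sumL-map +_ (upTo (suc N)) t)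
          (trans (sumL-upTo (suc N) (λ i → X (i ℕ.* i) n)) (sumZ-suc N (λ i → X (i ℕ.* i) n))))
                   (trans (sumL-map -[1+_] (upTo N) t) (sumL-upTo N (λ i → X (suc i ℕ.* suc i) n))) ⟩
    X 0 n + squares + squares
      ≡⟨ cong (λ s → X 0 n + s + s) (trans (cong (λ M → sumZ M (λ i → X (suc i ℕ.* suc i) n)) (sym (ℕₚ.m+[n∸m]≡n n≤N)))
          (S-upTo n (N ℕ.∸ n))) ⟩
    X 0 n + S n + S n
      ≡⟨ collect (X 0 n) (S n) ⟩
    κ 1ℤ n + + 2 * S n
      ≡⟨ cong (λ x → κ 1ℤ n + x) (κ-⊛ (+ 2) S n) ⟨
    κ 1ℤ n + (κ (+ 2) ⊛ S) n
      ≡⟨ ⊕-coeff (κ 1ℤ) (κ (+ 2) ⊛ S) n ⟨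
    φ n ∎
    where
    open ≡-Reasoning
    t : ℤ → ℤ
    t x = X (square x) n
    squares : ℤ
    squares = sumZ N (λ i → X (suc i ℕ.* suc i) n)
    collect : ∀ a b → a + b + b ≡ a + + 2 * b
    collect = solve-∀

  plane : ℕ → Enumeration (ℤ × ℤ)
  plane N = interval N ⊗ interval N

  space : ℕ → Enumeration ℤ³
  space N = interval N ⊗ plane N

  r₂ r₃ : Series
  r₂ = φ ⊛ φ
  r₃ = φ ⊛ φ ⊛ φ

  r₂-weights : ∀ N n → n ℕ.≤ N → weights (list (plane N)) (λ (x , y) → square x ℕ.+ square y) n ≡ r₂ n
  r₂-weights N n n≤N = trans (sym (coeff (weights-⊛ (list (interval N)) (list (interval N)) square square) n))
    (⊛-cong-upTo n (λ i i≤n → φ-weights N i (ℕₚ.≤-trans i≤n n≤N)) (λ i i≤n → φ-weights N i (ℕₚ.≤-trans i≤n n≤N)))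

  r₃-weights : ∀ N n → n ℕ.≤ N → weights (list (space N)) (λ (x , y , z) → square x ℕ.+ (square y ℕ.+ square z)) n ≡ r₃ n
  r₃-weights N n n≤N = trans (sym (coeff (weights-⊛ (list (interval N)) (list (plane N)) square (λ (x , y) → square x ℕ.+ square y)) n))
    (trans (⊛-cong-upTo n (λ i i≤n → φ-weights N i (ℕₚ.≤-trans i≤n n≤N)) (λ i i≤n → r₂-weights N i (ℕₚ.≤-trans i≤n n≤N)))
           (⊛-comm-coeff φ (φ ⊛ φ) n))

  r₂-count : ∀ N n → n ℕ.≤ N → count (plane N) (λ (x , y) → x * x + y * y ℤ.≟ + n) ≡ r₂ n
  r₂-count N n n≤N = trans (sumL-cong (list (plane N)) λ (x , y) → sym (trans (X-⟦⟧ (square x ℕ.+ square y) n)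
      (⟦⟧-⇔ (square x ℕ.+ square y ℕ.≟ n) (x * x + y * y ℤ.≟ + n)
        (λ e → trans (sym (cast x y)) (cong (+_) e)) (λ e → ℤₚ.+-injective (trans (cast x y) e)))))
    (r₂-weights N n n≤N)
    where
    cast : ∀ x y → + (square x ℕ.+ square y) ≡ x * x + y * y
    cast x y = cong₂ _+_ (abs-square x) (abs-square y)

  dot-square : ∀ x y z → + (square x ℕ.+ (square y ℕ.+ square z)) ≡ dot (x , y , z) (x , y , z)
  dot-square x y z = trans (cong₂ _+_ (abs-square x) (cong₂ _+_ (abs-square y) (abs-square z)))
    (trans (sym (ℤₚ.+-assoc (x * x) (y * y) (z * z))) (sym (dot-≡ x y z x y z)))

  r₃-count : ∀ N n → n ℕ.≤ N → count (space N) (λ v → dot v v ℤ.≟ + n) ≡ r₃ n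
  r₃-count N n n≤N = trans (sumL-cong (list (space N)) λ (x , y , z) → sym (trans (X-⟦⟧ (square x ℕ.+ (square y ℕ.+ square z)) n)
      (⟦⟧-⇔ (square x ℕ.+ (square y ℕ.+ square z) ℕ.≟ n) (dot (x , y , z) (x , y , z) ℤ.≟ + n)
        (λ e → trans (sym (dot-square x y z)) (cong (+_) e)) (λ e → ℤₚ.+-injective (trans (dot-square x y z) e)))))
    (r₃-weights N n n≤N)

  abs≤square : ∀ x → abs x ℕ.≤ square x
  abs≤square x with abs x
  ... | zero  = z≤n
  ... | suc n = ℕₚ.m≤m*n (suc n) (suc n)

  plane-listed : ∀ N n {x y} → n ℕ.≤ N → x * x + y * y ≡ + n → Listed (plane N) (x , y)
  plane-listed N n {x} {y} n≤N e = ⊗-listed (interval N) (interval N) {x} {y}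
      (interval-listed N x (ℕₚ.≤-trans (abs≤square x) (ℕₚ.≤-trans (ℕₚ.m≤m+n (square x) (square y)) bound)))
      (interval-listed N y (ℕₚ.≤-trans (abs≤square y) (ℕₚ.≤-trans (ℕₚ.m≤n+m (square y) (square x)) bound)))
    where
    bound : square x ℕ.+ square y ℕ.≤ N
    bound = ℕₚ.≤-trans (ℕₚ.≤-reflexive (ℤₚ.+-injective (trans (cong₂ _+_ (abs-square x) (abs-square y)) e))) n≤N

  space-listed : ∀ N n v → n ℕ.≤ N → dot v v ≡ + n → Listed (space N) v
  space-listed N n (x , y , z) n≤N e = ⊗-listed (interval N) (plane N) {x} {y , z}
      (interval-listed N x (ℕₚ.≤-trans (abs≤square x) (ℕₚ.≤-trans (ℕₚ.m≤m+n (square x) (square y ℕ.+ square z)) bound)))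
      (⊗-listed (interval N) (interval N) {y} {z}
        (interval-listed N y (ℕₚ.≤-trans (abs≤square y) (ℕₚ.≤-trans (ℕₚ.m≤m+n (square y) (square z)) bound′)))
        (interval-listed N z (ℕₚ.≤-trans (abs≤square z) (ℕₚ.≤-trans (ℕₚ.m≤n+m (square z) (square y)) bound′))))
    where
    bound : square x ℕ.+ (square y ℕ.+ square z) ℕ.≤ N
    bound = ℕₚ.≤-trans (ℕₚ.≤-reflexive (ℤₚ.+-injective (trans (dot-square x y z) e))) n≤N
    bound′ : square y ℕ.+ square z ℕ.≤ N
    bound′ = ℕₚ.≤-trans (ℕₚ.m≤n+m (square y ℕ.+ square z) (square x)) bound

-- The isometry between ℤ³ and a neighbour.

module Isometries where

  open Quaternions
  open Rotations
  open Neighbours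
  open Counting
  open ThetaSeries
  open ℤSolver using (solve; _:=_; _:+_; _:*_; con)

  infixl 6 _⊹_
  _⊹_ : ℤ³ → ℤ³ → ℤ³
  (x , y , z) ⊹ (x′ , y′ , z′) = x + x′ , y + y′ , z + z′

  ⊹-! : ∀ u v j → (u ⊹ v) ! j ≡ u ! j + v ! j
  ⊹-! u v zero = refl
  ⊹-! u v (suc zero) = refl
  ⊹-! u v (suc (suc zero)) = refl

  dot-⊹ : ∀ u v x → dot (u ⊹ v) x ≡ dot u x + dot v x
  dot-⊹ (a , b , c) (a′ , b′ , c′) (x , y , z) = trans (dot-≡ (a + a′) (b + b′) (c + c′) x y z)
    (trans (solve 9 (λ a b c a′ b′ c′ x y z → (a :+ a′) :* x :+ (b :+ b′) :* y :+ (c :+ c′) :* z :=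
        (a :* x :+ b :* y :+ c :* z) :+ (a′ :* x :+ b′ :* y :+ c′ :* z)) refl a b c a′ b′ c′ x y z)
      (cong₂ _+_ (sym (dot-≡ a b c x y z)) (sym (dot-≡ a′ b′ c′ x y z))))

  dot-·ʳ : ∀ c u v → dot u (c · v) ≡ c * dot u v
  dot-·ʳ c u v = trans (dot-comm u (c · v)) (trans (dot-· c v u) (cong (c *_) (dot-comm v u)))

  module Isometry {ℓ : ℕ} {{_ : ℕ.NonZero ℓ}} {e : ℤ³} (R : Rotation ℓ e) where
    open Rotation R

    private
      L L² : ℤ
      L = + ℓ
      L² = L * L
      i₀ i₁ i₂ : Fin 3
      i₀ = zero
      i₁ = suc zero
      i₂ = suc (suc zero)
      instance
        L²-nonZero : ℤ.NonZero L²
        L²-nonZero = ℤₚ.i*j≢0 L L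

    -- Lands in ℓ times the neighbour lattice, which keeps all vectors integral; norms are therefore
    -- multiplied by ℓ².
    image : ℤ³ → ℤ³
    image v = v ! i₀ · row i₀ ⊹ v ! i₁ · row i₁ ⊹ v ! i₂ · row i₂

    dot-image : ∀ v x → dot (image v) x ≡ v ! i₀ * dot (row i₀) x + v ! i₁ * dot (row i₁) x + v ! i₂ * dot (row i₂) x
    dot-image v x = trans (dot-⊹ (v ! i₀ · row i₀ ⊹ v ! i₁ · row i₁) (v ! i₂ · row i₂) x)
      (cong₂ _+_ (trans (dot-⊹ (v ! i₀ · row i₀) (v ! i₁ · row i₁) x) (cong₂ _+_ (dot-· (v ! i₀) (row i₀) x) (dot-· (v ! i₁) (row i₁) x)))
                 (dot-· (v ! i₂) (row i₂) x))

    coordinate : ∀ v k → dot (image v) (row k) ≡ v ! k * L²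
    coordinate v zero = trans (dot-image v (row i₀)) (trans
        (cong₂ _+_ (cong₂ _+_ (cong (v ! i₀ *_) (norm i₀)) (cong (v ! i₁ *_) (orth i₁ i₀ λ ()))) (cong (v ! i₂ *_) (orth i₂ i₀ λ ())))
      (solve 4 (λ x y z n → x :* n :+ y :* con 0ℤ :+ z :* con 0ℤ := x :* n) refl (v ! i₀) (v ! i₁) (v ! i₂) L²))
    coordinate v (suc zero) = trans (dot-image v (row i₁))
        (trans
        (cong₂ _+_ (cong₂ _+_ (cong (v ! i₀ *_) (orth i₀ i₁ λ ())) (cong (v ! i₁ *_) (norm i₁))) (cong (v ! i₂ *_) (orth i₂ i₁ λ ())))
      (solve 4 (λ x y z n → x :* con 0ℤ :+ y :* n :+ z :* con 0ℤ := y :* n) refl (v ! i₀) (v ! i₁) (v ! i₂) L²))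
    coordinate v (suc (suc zero)) = trans (dot-image v (row i₂))
        (trans
        (cong₂ _+_ (cong₂ _+_ (cong (v ! i₀ *_) (orth i₀ i₂ λ ())) (cong (v ! i₁ *_) (orth i₁ i₂ λ ()))) (cong (v ! i₂ *_) (norm i₂)))
      (solve 4 (λ x y z n → x :* con 0ℤ :+ y :* con 0ℤ :+ z :* n := z :* n) refl (v ! i₀) (v ! i₁) (v ! i₂) L²))

    image-norm : ∀ v → dot (image v) (image v) ≡ dot v v * L²
    image-norm v = trans (dot-image v (image v)) (trans
        (cong₂ _+_ (cong₂ _+_ (cong (v ! i₀ *_) (c i₀)) (cong (v ! i₁ *_) (c i₁))) (cong (v ! i₂ *_) (c i₂)))
      (trans (solve 4 (λ x y z n → x :* (x :* n) :+ y :* (y :* n) :+ z :* (z :* n) := (x :* x :+ y :* y :+ z :* z) :* n) refl (v ! i₀)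
          (v ! i₁) (v ! i₂) L²)
        (cong (_* L²) (sym (dot-≡ (v ! i₀) (v ! i₁) (v ! i₂) (v ! i₀) (v ! i₁) (v ! i₂))))))
      where
      c : ∀ k → dot (row k) (image v) ≡ v ! k * L²
      c k = trans (dot-comm (row k) (image v)) (coordinate v k)

    Divisible : ℤ³ → Set
    Divisible w = ∀ k → L² ∣ dot w (row k)

    divisible? : ∀ w → Dec (Divisible w)
    divisible? w = Finₚ.all? (λ k → L² ∣? dot w (row k))

    preimage : ∀ w → Divisible w → ℤ³
    preimage w d = _∣_.quotient (d i₀) , _∣_.quotient (d i₁) , _∣_.quotient (d i₂)

    preimage-! : ∀ w d k → dot w (row k) ≡ preimage w d ! k * L²
    preimage-! w d zero = _∣_.equality (d i₀)
    preimage-! w d (suc zero) = _∣_.equality (d i₁)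
    preimage-! w d (suc (suc zero)) = _∣_.equality (d i₂)

    preimage-image : ∀ v d → preimage (image v) d ≡ v
    preimage-image v d = V-≡ λ k → ℤₚ.*-cancelʳ-≡ (preimage (image v) d ! k) (v ! k) L²
        (trans (sym (preimage-! (image v) d k)) (coordinate v k))

    -- Surjectivity: the coordinates `dot w (row k)` recover ℓ² w by `complete`.
    image-preimage : ∀ w d → image (preimage w d) ≡ w
    image-preimage w d = V-≡ λ j → ℤₚ.*-cancelˡ-≡ L² (image z ! j) (w ! j) (trans (expand j) (complete w j))
      where
      z = preimage w d
      expand : ∀ j → L² * image z ! j ≡ dot w (row i₀) * row i₀ ! j + dot w (row i₁) * row i₁ ! j + dot w (row i₂) * row i₂ ! j
      expand j = trans (cong (L² *_) (trans (⊹-! (z ! i₀ · row i₀ ⊹ z ! i₁ · row i₁) (z ! i₂ · row i₂) j)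
          (cong₂ _+_ (trans (⊹-! (z ! i₀ · row i₀) (z ! i₁ · row i₁) j) (cong₂ _+_ (·-! (z ! i₀) (row i₀) j) (·-! (z ! i₁) (row i₁) j)))
              (·-! (z ! i₂) (row i₂) j))))
        (trans (solve 7 (λ n x y z a b c → n :* (x :* a :+ y :* b :+ z :* c) := x :* n :* a :+ y :* n :* b :+ z :* n :* c) refl L² (z ! i₀)
            (z ! i₁) (z ! i₂) (row i₀ ! j) (row i₁ ! j) (row i₂ ! j))
          (cong₂ _+_ (cong₂ _+_ (cong (_* row i₀ ! j) (sym (preimage-! w d i₀))) (cong (_* row i₁ ! j) (sym (preimage-! w d i₁))))
              (cong (_* row i₂ ! j) (sym (preimage-! w d i₂)))))

    -- The neighbour lattice is isometric to ℤ³.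
    isometry : ∀ M N n m → + m ≡ + n * L² → n ℕ.≤ M → m ℕ.≤ N →
               count (space N) (λ w → (dot w w ℤ.≟ + m) ×-dec divisible? w) ≡ count (space M) (λ v → dot v v ℤ.≟ + n)
    isometry M N n m m≡ n≤M m≤N = sym (count-bij (space M) (space N) (λ v → dot v v ℤ.≟ + n) (λ w → (dot w w ℤ.≟ + m) ×-dec divisible? w)
      image (λ w (_ , d) → preimage w d)
      (λ v e → trans (image-norm v) (trans (cong (_* L²) e) (sym m≡)) , λ k → divides (v ! k) (coordinate v k))
      (λ w (e , d) → ℤₚ.*-cancelʳ-≡ _ (+ n) L² (trans (sym (image-norm (preimage w d)))
          (trans (cong (λ x → dot x x) (image-preimage w d)) (trans e m≡))))
      (λ v _ (_ , d) → preimage-image v d)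
      (λ w (_ , d) → image-preimage w d)
      (λ v e → space-listed M n v n≤M e)
      (λ w (e , _) → space-listed N m w m≤N e))

-- The ℓ + 1 isotropic lines modulo ℓ.

module IsotropicLines where

  open Quaternions
  open Rotations
  open Neighbours
  open Counting
  open QuadraticResidues
  open ThetaSeries
  open ℤSolver using (solve; _:=_; _:+_; _:*_; _:-_; :-_; con)

  module HeckeOperator {ℓ : ℕ} (ℓ-prime : Prime ℓ) (ℓ-odd : ℓ % 2 ≡ 1) where

    private
      L : ℤ
      L = + ℓ
      instance
        ℓ-nonZero : ℕ.NonZero ℓ
        ℓ-nonZero = prime⇒nonZero ℓ-prime

    ℓ≢2 : ℓ ≢ 2
    ℓ≢2 e = ℕₚ.0≢1+n (trans (cong (_% 2) (sym e)) ℓ-odd)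

    open Residues ℓ-prime ℓ≢2 public

    -- This is (ℓ + 1)/2, chosen so that the numbers below it have distinct squares modulo ℓ while
    -- two copies of the range exceed the number of residues by one.
    half : ℕ
    half = suc (ℓ / 2)

    half+half : half ℕ.+ half ≡ suc ℓ
    half+half = trans (e (ℓ / 2)) (cong suc (trans (cong (ℕ._+ (ℓ / 2) ℕ.* 2) (sym ℓ-odd)) (sym (ℕ/.m≡m%n+[m/n]*n ℓ 2))))
      where
      e : ∀ h → suc h ℕ.+ suc h ≡ suc (1 ℕ.+ h ℕ.* 2)
      e = solveℕ

    squares-distinct : ∀ i j → i ℕ.< j → j ℕ.< half → ¬ (L ∣ + j * + j - + i * + i)
    squares-distinct i j i<j j<h p = [ (λ d → ∤-small ℓ-prime ℓ≢2 (j ℕ.∸ i) (ℕₚ.m<n⇒0<n∸m i<j) (ℕₚ.≤-<-trans (ℕₚ.m∸n≤m j i) j<ℓ)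
          (subst (L ∣_) (trans (ℤₚ.m-n≡m⊖n j i) (ℤₚ.⊖-≥ (ℕₚ.<⇒≤ i<j))) d))
        , ∤-small ℓ-prime ℓ≢2 (j ℕ.+ i) (ℕₚ.≤-<-trans z≤n (ℕₚ.<-≤-trans i<j (ℕₚ.m≤m+n j i))) j+i<ℓ ]′ (difference-of-squares (+ j) (+ i) p)
      where
      j+i<ℓ : j ℕ.+ i ℕ.< ℓ
      j+i<ℓ = ℕₚ.≤-pred (begin-strict
        suc (j ℕ.+ i)   ≡⟨ ℕₚ.+-suc j i ⟨
        j ℕ.+ suc i     ≤⟨ ℕₚ.+-monoʳ-≤ j i<j ⟩
        j ℕ.+ j         <⟨ ℕₚ.+-mono-<-≤ j<h (ℕₚ.<⇒≤ j<h) ⟩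
        half ℕ.+ half   ≡⟨ half+half ⟩
        suc ℓ           ∎)
        where open ℕₚ.≤-Reasoning
      j<ℓ : j ℕ.< ℓ
      j<ℓ = ℕₚ.≤-<-trans (ℕₚ.m≤m+n j i) j+i<ℓ

    value : ℕ → ℤ
    value i with i ℕ.<? half
    ... | yes _ = + i * + i
    ... | no _  = - 1ℤ - + (i ℕ.∸ half) * + (i ℕ.∸ half)

    -- The half + half = ℓ + 1 residues i² and -1 - i² with i < half cannot all be distinct.
    sum-of-two-squares : ∃[ s ] ∃[ t ] L ∣ 1ℤ + (s * s + t * t)
    sum-of-two-squares with Finₚ.pigeonhole (ℕₚ.n<1+n ℓ) (λ i → fromℕ< (proj₁ (proj₂ (residue (value (toℕ i))))))
    ... | i , j , i<j , eq = conclude (toℕ i) (toℕ j) i<j (Finₚ.toℕ<n j)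
        (∣-sum {value (toℕ j)} {+ proj₁ (residue (value (toℕ j)))} {value (toℕ i)} (proj₂ (proj₂ (residue (value (toℕ j)))))
          (subst (λ r → L ∣ + r - value (toℕ i)) same (∣-flip {value (toℕ i)} (proj₂ (proj₂ (residue (value (toℕ i))))))))
      where
      same : proj₁ (residue (value (toℕ i))) ≡ proj₁ (residue (value (toℕ j)))
      same = trans (sym (Finₚ.toℕ-fromℕ< (proj₁ (proj₂ (residue (value (toℕ i)))))))
          (trans (cong toℕ eq) (Finₚ.toℕ-fromℕ< (proj₁ (proj₂ (residue (value (toℕ j)))))))
      conclude : ∀ i j → i ℕ.< j → j ℕ.< suc ℓ → L ∣ value j - value i → ∃[ s ] ∃[ t ] L ∣ 1ℤ + (s * s + t * t)
      conclude i j i<j j<1+ℓ p with i ℕ.<? half | j ℕ.<? half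
      ... | yes i<h | yes j<h = ⊥-elim (squares-distinct i j i<j j<h p)
      ... | no i≮h | yes j<h = ⊥-elim (i≮h (ℕₚ.<-trans i<j j<h))
      ... | yes _ | no _ = + i , + (j ℕ.∸ half) , subst (L ∣_) (solve 2 (λ i j → :- (:- con 1ℤ :- j :* j :- i :* i) := con 1ℤ :+ (i :* i :+ j :* j)) refl (+ i) (+ (j ℕ.∸ half))) (∣-neg p)
      ... | no i≮h | no j≮h = ⊥-elim (squares-distinct (i ℕ.∸ half) (j ℕ.∸ half) (ℕₚ.∸-monoˡ-< i<j (ℕₚ.≮⇒≥ i≮h))
            (ℕₚ.+-cancelʳ-< half (j ℕ.∸ half) half (ℕₚ.≤-trans (s≤s (ℕₚ.≤-reflexive (ℕₚ.m∸n+n≡m (ℕₚ.≮⇒≥ j≮h))))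
                (ℕₚ.≤-trans j<1+ℓ (ℕₚ.≤-reflexive (sym half+half)))))
            (subst (L ∣_) (solve 2 (λ i j → :- (:- con 1ℤ :- j :* j :- (:- con 1ℤ :- i :* i)) := j :* j :- i :* i) refl (+ (i ℕ.∸ half))
                (+ (j ℕ.∸ half))) (∣-neg p)))

    s t : ℤ
    s = proj₁ sum-of-two-squares
    t = proj₁ (proj₂ sum-of-two-squares)

    1+s²+t² : L ∣ 1ℤ + (s * s + t * t)
    1+s²+t² = proj₂ (proj₂ sum-of-two-squares)

    -- The points (1 : 0) and (τ : 1) of ℙ¹(𝔽_ℓ), and the isotropic vectors parametrised by them.
    points : List (Maybe ℕ)
    points = nothing ∷ map just (upTo ℓ)

    isotropic : Maybe ℕ → ℤ³
    isotropic nothing  = 1ℤ , t , s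
    isotropic (just τ) = + τ * + τ + 1ℤ , t * (+ τ * + τ - 1ℤ) - + 2 * s * + τ , s * (+ τ * + τ - 1ℤ) + + 2 * t * + τ

    -- In the affine case the last two components are the real and imaginary parts of (t + s i)(τ +
    -- i)², so their squares add up to (s² + t²)(τ² + 1)² and the norm is (τ² + 1)²(1 + s² + t²).
    isotropic-norm : ∀ p → L ∣ dot (isotropic p) (isotropic p)
    isotropic-norm nothing = subst (L ∣_) (trans (solve 2
        (λ s t → con 1ℤ :+ (s :* s :+ t :* t) := con 1ℤ :* con 1ℤ :+ t :* t :+ s :* s) refl s t) (sym (dot-≡ 1ℤ t s 1ℤ t s))) 1+s²+t²
    isotropic-norm (just τ) = subst (L ∣_) (trans (solve 3 (λ s t x →
        (x :* x :+ con 1ℤ) :* (x :* x :+ con 1ℤ) :* (con 1ℤ :+ (s :* s :+ t :* t)) :=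
        (x :* x :+ con 1ℤ) :* (x :* x :+ con 1ℤ)
        :+ (t :* (x :* x :- con 1ℤ) :- con (+ 2) :* s :* x) :* (t :* (x :* x :- con 1ℤ) :- con (+ 2) :* s :* x)
        :+ (s :* (x :* x :- con 1ℤ) :+ con (+ 2) :* t :* x) :* (s :* (x :* x :- con 1ℤ) :+ con (+ 2) :* t :* x)) refl s t (+ τ))
        (sym (dot-≡ a b c a b c))) (∣-*ˡ (a * a) 1+s²+t²)
      where
      a = + τ * + τ + 1ℤ
      b = t * (+ τ * + τ - 1ℤ) - + 2 * s * + τ
      c = s * (+ τ * + τ - 1ℤ) + + 2 * t * + τ

    some-component : ∀ v → ¬ (∀ j → L ∣ v ! j) → ∃[ j ] ¬ (L ∣ v ! j)
    some-component v ¬all = Finₚ.¬∀⟶∃¬ 3 (λ j → L ∣ v ! j) (λ j → L ∣? (v ! j)) ¬all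

    -- In the affine case the combination of the components with coefficients 1, t, s is congruent
    -- to 2 because s² + t² ≡ -1.
    isotropic-nonzero : ∀ p → ¬ (∀ j → L ∣ isotropic p ! j)
    isotropic-nonzero nothing all = ∤-small ℓ-prime ℓ≢2 1 (s≤s z≤n) (1<ℓ ℓ-prime ℓ≢2) (all zero)
    isotropic-nonzero (just τ) all = ∤2 ℓ-prime ℓ≢2 (subst (L ∣_)
      (solve 3 (λ s t x → con 1ℤ :* (x :* x :+ con 1ℤ) :+ t :* (t :* (x :* x :- con 1ℤ) :- con (+ 2) :* s :* x) :+ s :*
          (s :* (x :* x :- con 1ℤ) :+ con (+ 2) :* t :* x)
         :+ (con 1ℤ :- x :* x) :* (con 1ℤ :+ (s :* s :+ t :* t)) := con (+ 2)) refl s t (+ τ))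
      (∣-lin₄ 1ℤ t s (1ℤ - + τ * + τ) (all zero) (all (suc zero)) (all (suc (suc zero))) 1+s²+t²))

    isotropic-pivot : ∀ p → ∃[ j ] ¬ (L ∣ isotropic p ! j)
    isotropic-pivot p = some-component (isotropic p) (isotropic-nonzero p)

    neighbour : ∀ p → Rotation ℓ (isotropic p)
    neighbour p = rotation-exists ℓ-prime ℓ≢2 (isotropic p) (isotropic-norm p) (isotropic-pivot p)

    module N (p : Maybe ℕ) = Neighbour ℓ-prime ℓ≢2 {isotropic p} (isotropic-norm p) (proj₁ (isotropic-pivot p)) (proj₂ (isotropic-pivot p)) (neighbour p)

    perpendicular : ℤ³ → ℤ
    perpendicular u = sumL points (λ p → ⟦ L ∣? dot u (isotropic p) ⟧)

    multiple? : ∀ w → Dec (∀ j → L ∣ w ! j)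
    multiple? w = Finₚ.all? (λ j → L ∣? (w ! j))

    module _ (u₁ u₂ u₃ : ℤ) where
      private
        u : ℤ³
        u = u₁ , u₂ , u₃
        a b c : ℤ
        c = u₁ + t * u₂ + s * u₃
        a = s * u₂ - t * u₃
        b = u₁ - t * u₂ - s * u₃

      -- The isotropic vectors are quadratic in the point of the projective line, so orthogonality
      -- to `u` is the vanishing of a binary quadratic form; `c`, `a`, `b` are its coefficients.
      perpendicular-zeros : perpendicular u ≡ zeros c a b
      perpendicular-zeros = cong₂ _+_
        (⟦⟧-⇔ (L ∣? dot u (1ℤ , t , s)) (L ∣? c) (subst (L ∣_) at-∞) (subst (L ∣_) (sym at-∞)))
        (trans (sumL-map just (upTo ℓ) (λ p → ⟦ L ∣? dot u (isotropic p) ⟧))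
          (sumL-cong (upTo ℓ) λ τ → ⟦⟧-⇔ (L ∣? dot u (isotropic (just τ))) (L ∣? (c * + τ * + τ - + 2 * a * + τ + b))
            (subst (L ∣_) (at-τ τ)) (subst (L ∣_) (sym (at-τ τ)))))
        where
        at-∞ : dot u (1ℤ , t , s) ≡ c
        at-∞ = trans (dot-≡ u₁ u₂ u₃ 1ℤ t s) (solve 5 (λ u₁ u₂ u₃ s t → u₁ :* con 1ℤ :+ u₂ :* t :+ u₃ :* s :=
            u₁ :+ t :* u₂ :+ s :* u₃) refl u₁ u₂ u₃ s t)
        at-τ : ∀ τ → dot u (isotropic (just τ)) ≡ c * + τ * + τ - + 2 * a * + τ + b
        at-τ τ = trans (dot-≡ u₁ u₂ u₃ (+ τ * + τ + 1ℤ) (t * (+ τ * + τ - 1ℤ) - + 2 * s * + τ) (s * (+ τ * + τ - 1ℤ) + + 2 * t * + τ))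
          (solve 6 (λ u₁ u₂ u₃ s t x → u₁ :* (x :* x :+ con 1ℤ) :+ u₂ :* (t :* (x :* x :- con 1ℤ) :- con (+ 2) :* s :* x) :+ u₃ :*
              (s :* (x :* x :- con 1ℤ) :+ con (+ 2) :* t :* x)
            := (u₁ :+ t :* u₂ :+ s :* u₃) :* x :* x :- con (+ 2) :* (s :* u₂ :- t :* u₃) :* x :+ (u₁ :- t :* u₂ :- s :* u₃)) refl u₁ u₂ u₃ s
                t (+ τ))

      -- Together with `zeros-discriminant` this gives 1 + (-u·u/ℓ) isotropic lines orthogonal to
      -- `u`: the origin of the symbol (-n/ℓ) in the Hecke relation.
      discriminant : L ∣ (a * a - c * b) - - dot u u
      discriminant = subst (L ∣_) (trans (solve 5 (λ u₁ u₂ u₃ s t → (u₂ :* u₂ :+ u₃ :* u₃) :* (con 1ℤ :+ (s :* s :+ t :* t))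
          := (s :* u₂ :- t :* u₃) :* (s :* u₂ :- t :* u₃) :- (u₁ :+ t :* u₂ :+ s :* u₃) :* (u₁ :- t :* u₂ :- s :* u₃) :-
              (:- (u₁ :* u₁ :+ u₂ :* u₂ :+ u₃ :* u₃))) refl u₁ u₂ u₃ s t)
          (cong (λ d → (a * a - c * b) - - d) (sym (dot-≡ u₁ u₂ u₃ u₁ u₂ u₃))))
        (∣-*ˡ (u₂ * u₂ + u₃ * u₃) 1+s²+t²)

      form-nonzero : ¬ (∀ j → L ∣ u ! j) → ¬ (L ∣ c × L ∣ a × L ∣ b)
      form-nonzero ¬all (L∣c , L∣a , L∣b) = ¬all λ { zero → L∣u₁ ; (suc zero) → L∣u₂ ; (suc (suc zero)) → L∣u₃ }
        where
        L∣u₁ : L ∣ u₁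
        L∣u₁ = 2-cancel ℓ-prime ℓ≢2 (subst (L ∣_) (solve 5
            (λ u₁ u₂ u₃ s t → u₁ :+ t :* u₂ :+ s :* u₃ :+ (u₁ :- t :* u₂ :- s :* u₃) := con (+ 2) :* u₁) refl u₁ u₂ u₃ s t) (∣-+ L∣c L∣b))
        L∣d : L ∣ t * u₂ + s * u₃
        L∣d = subst (L ∣_) (solve 5 (λ u₁ u₂ u₃ s t → u₁ :+ t :* u₂ :+ s :* u₃ :- u₁ := t :* u₂ :+ s :* u₃) refl u₁ u₂ u₃ s t)
            (∣-+ L∣c (∣-neg L∣u₁))
        L∣u₂ : L ∣ u₂
        L∣u₂ = subst (L ∣_) (solve 4 (λ u₂ u₃ s t → u₂ :* (con 1ℤ :+ (s :* s :+ t :* t)) :+ (:- s) :* (s :* u₂ :- t :* u₃) :+ (:- t) :*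
            (t :* u₂ :+ s :* u₃) := u₂) refl u₂ u₃ s t)
          (∣-lin₃ u₂ (- s) (- t) 1+s²+t² L∣a L∣d)
        L∣u₃ : L ∣ u₃
        L∣u₃ = subst (L ∣_) (solve 4 (λ u₂ u₃ s t → u₃ :* (con 1ℤ :+ (s :* s :+ t :* t)) :+ t :* (s :* u₂ :- t :* u₃) :+ (:- s) :*
            (t :* u₂ :+ s :* u₃) := u₃) refl u₂ u₃ s t)
          (∣-lin₃ u₃ t (- s) 1+s²+t² L∣a L∣d)

      perpendicular-components : ¬ (∀ j → L ∣ u ! j) → perpendicular u ≡ roots (- dot u u)
      perpendicular-components ¬all = trans perpendicular-zeros
          (trans (zeros-discriminant c a b (form-nonzero ¬all)) (roots-cong {a * a - c * b} { - dot u u} discriminant))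

    perpendicular-roots : ∀ u → ¬ (∀ j → L ∣ u ! j) → perpendicular u ≡ roots (- dot u u)
    perpendicular-roots (u₁ , u₂ , u₃) = perpendicular-components u₁ u₂ u₃

    sumL-1 : ∀ n → sumL (upTo n) (λ _ → 1ℤ) ≡ + n
    sumL-1 n = trans (go n id) refl
      where
      go : ∀ n (h : ℕ → ℕ) → sumL (applyUpTo h n) (λ _ → 1ℤ) ≡ + n
      go zero h = refl
      go (suc n) h = cong (λ z → 1ℤ + z) (go n (h ∘ suc))

    perpendicular-multiple : ∀ u → (∀ j → L ∣ u ! j) → perpendicular u ≡ 1ℤ + L
    perpendicular-multiple u all = trans (sumL-cong points λ p → ⟦⟧-yes (L ∣? dot u (isotropic p)) (divides-dot u (isotropic p) all))
        (cong (λ z → 1ℤ + z) (trans (sumL-map just (upTo ℓ) (λ _ → 1ℤ)) (sumL-1 ℓ)))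
      where
      divides-dot : ∀ u v → (∀ j → L ∣ u ! j) → L ∣ dot u v
      divides-dot (u₁ , u₂ , u₃) (v₁ , v₂ , v₃) all = subst (L ∣_)
        (trans (solve 6 (λ u₁ u₂ u₃ v₁ v₂ v₃ → v₁ :* u₁ :+ v₂ :* u₂ :+ v₃ :* u₃ := u₁ :* v₁ :+ u₂ :* v₂ :+ u₃ :* v₃) refl u₁ u₂ u₃ v₁ v₂ v₃)
            (sym (dot-≡ u₁ u₂ u₃ v₁ v₂ v₃)))
        (∣-lin₃ v₁ v₂ v₃ (all zero) (all (suc zero)) (all (suc (suc zero))))

-- The Hecke relation for sums of three squares.

module ThreeSquares where

  open Quaternions
  open Rotations
  open Neighbours
  open Counting
  open QuadraticResidues
  open ThetaSeries
  open Isometries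
  open IsotropicLines
  open ℤSolver using (solve; _:=_; _:+_; _:*_; _:-_; :-_; con)

  quotients : ∀ c (w : ℤ³) → (∀ j → c ∣ w ! j) → ℤ³
  quotients c w d = _∣_.quotient (d zero) , _∣_.quotient (d (suc zero)) , _∣_.quotient (d (suc (suc zero)))

  quotients-· : ∀ c w d → c · quotients c w d ≡ w
  quotients-· c w d = V-≡ λ { zero → e zero ; (suc zero) → e (suc zero) ; (suc (suc zero)) → e (suc (suc zero)) }
    where
    e : ∀ j → c * _∣_.quotient (d j) ≡ w ! j
    e j = trans (ℤₚ.*-comm c _) (sym (_∣_.equality (d j)))

  ·-cancel : ∀ c .{{_ : ℤ.NonZero c}} {u v} → c · u ≡ c · v → u ≡ v
  ·-cancel c {u} {v} e = V-≡ λ j → ℤₚ.*-cancelˡ-≡ c (u ! j) (v ! j) (trans (sym (·-! c u j)) (trans (cong (_! j) e) (·-! c v j)))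

  dot-scaled : ∀ c u → dot (c · u) (c · u) ≡ c * c * dot u u
  dot-scaled c u = trans (dot-· c u (c · u)) (trans (cong (c *_) (dot-·ʳ c u u)) (sym (ℤₚ.*-assoc c c (dot u u))))

  multiples-count : ∀ c .{{_ : ℤ.NonZero c}} M N k m → + m ≡ c * c * + k → k ℕ.≤ M → m ℕ.≤ N →
                    count (space N) (λ w → (dot w w ℤ.≟ + m) ×-dec Finₚ.all? (λ j → c ∣? (w ! j))) ≡ count (space M) (λ v → dot v v ℤ.≟ + k)
  multiples-count c M N k m m≡ k≤M m≤N = sym (count-bij (space M) (space N) (λ v → dot v v ℤ.≟ + k)
      (λ w → (dot w w ℤ.≟ + m) ×-dec Finₚ.all? (λ j → c ∣? (w ! j)))
    (λ v → c · v) (λ w (_ , d) → quotients c w d)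
    (λ v e → trans (dot-scaled c v) (trans (cong (c * c *_) e) (sym m≡)) , λ j → divides (v ! j) (trans (·-! c v j) (ℤₚ.*-comm c (v ! j))))
    (λ w (e , d) → ℤₚ.*-cancelˡ-≡ (c * c) _ (+ k) {{ℤₚ.i*j≢0 c c}}
        (trans (sym (dot-scaled c (quotients c w d))) (trans (cong (λ x → dot x x) (quotients-· c w d)) (trans e m≡))))
    (λ v _ (_ , d) → ·-cancel c (quotients-· c (c · v) d))
    (λ w (_ , d) → quotients-· c w d)
    (λ v e → space-listed M k v k≤M e)
    (λ w (e , _) → space-listed N m w m≤N e))

  module HeckeRelation {ℓ : ℕ} (ℓ-prime : Prime ℓ) (ℓ-odd : ℓ % 2 ≡ 1) where
    open HeckeOperator ℓ-prime ℓ-odd public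

    private
      L L² : ℤ
      L = + ℓ
      L² = L * L
      instance
        ℓ-nonZero : ℕ.NonZero ℓ
        ℓ-nonZero = prime⇒nonZero ℓ-prime
        L²-nonZero : ℤ.NonZero L²
        L²-nonZero = ℤₚ.i*j≢0 L L

    module _ (n : ℕ) where
      private
        m : ℕ
        m = ℓ ℕ.* ℓ ℕ.* n
        χ : ℤ
        χ = legendre (- + n) ℓ
        E : Enumeration ℤ³
        E = space m

      m≡ : + m ≡ + n * L²
      m≡ = trans (ℤₚ.pos-* (ℓ ℕ.* ℓ) n) (trans (cong (_* + n) (ℤₚ.pos-* ℓ ℓ)) (ℤₚ.*-comm L² (+ n)))

      norm? : ∀ w → Dec (dot w w ≡ + m)
      norm? w = dot w w ℤ.≟ + m

      multiple²? : ∀ w → Dec (∀ j → L² ∣ w ! j)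
      multiple²? w = Finₚ.all? (λ j → L² ∣? (w ! j))

      inNeighbour? : ∀ p w → Dec (N.InNeighbour p w)
      inNeighbour? p w = Isometry.divisible? (neighbour p) w

      weighted : ℤ³ → ℤ
      weighted w = sumL points (λ p → ⟦ inNeighbour? p w ⟧)

      -- Summing over the neighbours first: each of the ℓ + 1 lattices is isometric to ℤ³ and
      -- contributes `r₃ n`.
      neighbours-count : sumL (list E) (λ w → ⟦ norm? w ⟧ * weighted w) ≡ (1ℤ + L) * r₃ n
      neighbours-count = begin
        sumL (list E) (λ w → ⟦ norm? w ⟧ * weighted w)
          ≡⟨ sumL-cong (list E) (λ w → trans (sym (sumL-* points ⟦ norm? w ⟧ (λ p → ⟦ inNeighbour? p w ⟧)))
               (sumL-cong points (λ p → sym (⟦⟧-× (norm? w) (inNeighbour? p w))))) ⟩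
        sumL (list E) (λ w → sumL points (λ p → ⟦ norm? w ×-dec inNeighbour? p w ⟧))
          ≡⟨ sumL-swap (list E) points (λ w p → ⟦ norm? w ×-dec inNeighbour? p w ⟧) ⟩
        sumL points (λ p → count E (λ w → norm? w ×-dec inNeighbour? p w))
          ≡⟨ sumL-cong points (λ p → trans (Isometry.isometry (neighbour p) n m n m m≡ ℕₚ.≤-refl ℕₚ.≤-refl) (r₃-count n n ℕₚ.≤-refl)) ⟩
        sumL points (λ _ → r₃ n)
          ≡⟨ cong (λ z → r₃ n + z) (sumL-map just (upTo ℓ) (λ _ → r₃ n)) ⟩
        r₃ n + sumL (upTo ℓ) (λ _ → r₃ n)
          ≡⟨ cong (λ z → r₃ n + z) (trans (sumL-cong (upTo ℓ) (λ _ → sym (ℤₚ.*-identityʳ (r₃ n))))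
              (trans (sumL-* (upTo ℓ) (r₃ n) (λ _ → 1ℤ)) (cong (r₃ n *_) (sumL-1 ℓ)))) ⟩
        r₃ n + r₃ n * L
          ≡⟨ solve 2 (λ r l → r :+ r :* l := (con 1ℤ :+ l) :* r) refl (r₃ n) L ⟩
        (1ℤ + L) * r₃ n ∎
        where
        open ≡-Reasoning

      -- The number of neighbours through `w`. It is 1 if ℓ does not divide `w`, which is then
      -- itself isotropic modulo ℓ; it is 1 + χ for w = ℓ u with u not divisible by ℓ, since u has
      -- norm n; and all ℓ + 1 contain `w` if ℓ² divides it.
      weighted-value : ∀ w → dot w w ≡ + m → weighted w ≡ 1ℤ + (⟦ multiple? w ⟧ * χ + ⟦ multiple²? w ⟧ * (L - χ))
      weighted-value w w·w = go (multiple? w)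
        where
        L²∣w·w : L² ∣ dot w w
        L²∣w·w = divides (+ n) (trans w·w m≡)
        go : Dec (∀ j → L ∣ w ! j) → weighted w ≡ 1ℤ + (⟦ multiple? w ⟧ * χ + ⟦ multiple²? w ⟧ * (L - χ))
        go (no ¬all) = trans (sumL-cong points λ p → ⟦⟧-⇔ (inNeighbour? p w) (L ∣? dot w (isotropic p))
              (N.inNeighbour⇒perp p w) (N.perp⇒inNeighbour p w ¬all L²∣w·w))
            (trans (perpendicular-roots w ¬all) (trans (roots-zero { - dot w w} (∣-neg (∣-trs (L∣L² ℓ-prime) L²∣w·w)))
              (sym (trans (cong₂ (λ x y → 1ℤ + (x * χ + y * (L - χ))) (⟦⟧-no (multiple? w) ¬all)
                  (⟦⟧-no (multiple²? w) (λ d → ¬all λ j → ∣-trs (L∣L² ℓ-prime) (d j))))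
                (solve 2 (λ x l → con 1ℤ :+ (con 0ℤ :* x :+ con 0ℤ :* (l :- x)) := con 1ℤ) refl χ L)))))
        go (yes all) = trans (sumL-cong points λ p → ⟦⟧-⇔ (inNeighbour? p w) (L ∣? dot u (isotropic p))
              (λ d → N.multiple-inNeighbour⇒perp p u (subst (N.InNeighbour p) (sym Lu≡w) d))
              (λ d → subst (N.InNeighbour p) Lu≡w (N.perp⇒multiple-inNeighbour p u d)))
            (inner (multiple? u))
          where
          u = quotients L w all
          Lu≡w : L · u ≡ w
          Lu≡w = quotients-· L w all
          u·u : dot u u ≡ + n
          u·u = ℤₚ.*-cancelˡ-≡ L² (dot u u) (+ n) (trans (sym (dot-scaled L u))
              (trans (cong (λ x → dot x x) Lu≡w) (trans w·w (trans m≡ (ℤₚ.*-comm (+ n) L²)))))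
          inner : Dec (∀ j → L ∣ u ! j) → perpendicular u ≡ 1ℤ + (⟦ multiple? w ⟧ * χ + ⟦ multiple²? w ⟧ * (L - χ))
          inner (no ¬L∣u) = trans (perpendicular-roots u ¬L∣u)
              (trans (roots-legendre (- dot u u)) (trans (cong (λ d → 1ℤ + legendre (- d) ℓ) u·u)
            (sym (trans (cong₂ (λ x y → 1ℤ + (x * χ + y * (L - χ))) (⟦⟧-yes (multiple? w) all) (⟦⟧-no (multiple²? w) ¬L²∣w))
                (solve 2 (λ x l → con 1ℤ :+ (con 1ℤ :* x :+ con 0ℤ :* (l :- x)) := con 1ℤ :+ x) refl χ L)))))
            where
            ¬L²∣w : ¬ (∀ j → L² ∣ w ! j)
            ¬L²∣w d = ¬L∣u λ j → ℤ∣.*-cancelˡ-∣ L (subst (L² ∣_) (trans (cong (_! j) (sym Lu≡w)) (·-! L u j)) (d j))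
          inner (yes L∣u) = trans (perpendicular-multiple u L∣u)
            (sym (trans (cong₂ (λ x y → 1ℤ + (x * χ + y * (L - χ))) (⟦⟧-yes (multiple? w) all) (⟦⟧-yes (multiple²? w) L²∣w))
                (solve 2 (λ x l → con 1ℤ :+ (con 1ℤ :* x :+ con 1ℤ :* (l :- x)) := con 1ℤ :+ l) refl χ L)))
            where
            L²∣w : ∀ j → L² ∣ w ! j
            L²∣w j = subst (L² ∣_) (trans (sym (·-! L u j)) (cong (_! j) Lu≡w)) (∣-mono L (L∣u j))

      count² : ℤ
      count² = count E (λ w → norm? w ×-dec multiple²? w)

      hecke-sum : r₃ m + (χ * r₃ n + (L - χ) * count²) ≡ (1ℤ + L) * r₃ n
      hecke-sum = trans (sym (begin
        sumL (list E) (λ w → ⟦ norm? w ⟧ * weighted w)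
          ≡⟨ sumL-cong (list E) (λ w → trans (⟦⟧-cong (norm? w) (weighted-value w)) (distribute w)) ⟩
        sumL (list E) (λ w → ⟦ norm? w ⟧ + (χ * ⟦ norm? w ×-dec multiple? w ⟧ + (L - χ) * ⟦ norm? w ×-dec multiple²? w ⟧))
          ≡⟨ trans (sumL-+ (list E) (λ w → ⟦ norm? w ⟧) (λ w →
              χ * ⟦ norm? w ×-dec multiple? w ⟧ + (L - χ) * ⟦ norm? w ×-dec multiple²? w ⟧))
               (cong₂ _+_ (r₃-count m m ℕₚ.≤-refl) (trans (sumL-+ (list E) (λ w → χ * ⟦ norm? w ×-dec multiple? w ⟧)
                   (λ w → (L - χ) * ⟦ norm? w ×-dec multiple²? w ⟧))
                 (cong₂ _+_ (trans (sumL-* (list E) χ (λ w → ⟦ norm? w ×-dec multiple? w ⟧))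
                     (cong (χ *_) (trans (multiples-count L n m n m (trans m≡ (ℤₚ.*-comm (+ n) L²)) ℕₚ.≤-refl ℕₚ.≤-refl)
                     (r₃-count n n ℕₚ.≤-refl))))
                            (sumL-* (list E) (L - χ) (λ w → ⟦ norm? w ×-dec multiple²? w ⟧))))) ⟩
        r₃ m + (χ * r₃ n + (L - χ) * count²) ∎)) neighbours-count
        where
        open ≡-Reasoning
        distribute : ∀ w → ⟦ norm? w ⟧ * (1ℤ + (⟦ multiple? w ⟧ * χ + ⟦ multiple²? w ⟧ * (L - χ)))
                   ≡ ⟦ norm? w ⟧ + (χ * ⟦ norm? w ×-dec multiple? w ⟧ + (L - χ) * ⟦ norm? w ×-dec multiple²? w ⟧)
        distribute w = trans (solve 5 (λ a b c x l → a :* (con 1ℤ :+ (b :* x :+ c :* (l :- x))) :=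
            a :+ (x :* (a :* b) :+ (l :- x) :* (a :* c))) refl ⟦ norm? w ⟧ ⟦ multiple? w ⟧ ⟦ multiple²? w ⟧ χ L)
          (cong₂ (λ x y → ⟦ norm? w ⟧ + (χ * x + (L - χ) * y)) (sym (⟦⟧-× (norm? w) (multiple? w))) (sym (⟦⟧-× (norm? w) (multiple²? w))))

      hecke-∤ : ¬ (ℓ ℕ.* ℓ ℕ∣.∣ n) → r₃ m + χ * r₃ n ≡ (1ℤ + L) * r₃ n
      hecke-∤ ∤n = trans (solve 4 (λ a b x l → a :+ b := a :+ (b :+ (l :- x) :* con 0ℤ)) refl (r₃ m) (χ * r₃ n) χ L)
          (trans (cong (λ c → r₃ m + (χ * r₃ n + (L - χ) * c)) (sym none)) hecke-sum)
        where
        -- A vector of norm ℓ² n all of whose components are divisible by ℓ² forces ℓ² to divide n.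
        none : count² ≡ 0ℤ
        none = trans (sumL-cong (list E) λ w → ⟦⟧-no (norm? w ×-dec multiple²? w) λ (e , d) →
            ∤n (ℤ∣.∣⇒∣ᵤ (subst (_∣ + n) (sym (ℤₚ.pos-* ℓ ℓ)) (quotient w e d)))) (sumL-0 (list E))
          where
          quotient : ∀ w → dot w w ≡ + m → (∀ j → L² ∣ w ! j) → L² ∣ + n
          quotient w e d = divides (dot u u) (ℤₚ.*-cancelʳ-≡ (+ n) (dot u u * L²) L² (trans (sym m≡) (trans (sym e)
              (trans (cong (λ x → dot x x) (sym (quotients-· L² w d)))
                  (trans (dot-scaled L² u) (solve 2 (λ q x → q :* q :* x := x :* q :* q) refl L² (dot u u)))))))
            where u = quotients L² w d

    -- The symbol is 0, and the vectors of norm ℓ⁴ k divisible by ℓ² are in bijection with the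
    -- vectors of norm k.
    hecke-∣ : ∀ k → let n = ℓ ℕ.* ℓ ℕ.* k in r₃ (ℓ ℕ.* ℓ ℕ.* n) + L * r₃ k ≡ (1ℤ + L) * r₃ n
    hecke-∣ k = trans (sym (trans (cong₂ (λ x c → r₃ m + (x * r₃ n + (L - x) * c)) χ≡0 some)
          (solve 4 (λ a b l c → a :+ (con 0ℤ :* b :+ (l :- con 0ℤ) :* c) := a :+ l :* c) refl (r₃ m) (r₃ n) L (r₃ k)))) (hecke-sum n)
      where
      n = ℓ ℕ.* ℓ ℕ.* k
      m = ℓ ℕ.* ℓ ℕ.* n
      χ≡0 : legendre (- + n) ℓ ≡ 0ℤ
      χ≡0 = legendre-zero { - + n} (∣-neg (divides (L * + k) (trans (m≡ k) (solve 2 (λ l k → k :* (l :* l) := l :* k :* l) refl L (+ k)))))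
      some : count² n ≡ r₃ k
      some = trans (multiples-count L² k m k m (trans (m≡ n)
          (trans (cong (_* L²) (m≡ k)) (solve 2 (λ q k → k :* q :* q := q :* q :* k) refl L² (+ k)))) ℕₚ.≤-refl ℕₚ.≤-refl)
          (r₃-count k k ℕₚ.≤-refl)

-- Operators on series, congruences and supports modulo 4.

module SeriesOperators where

  open PowerSeries
  open Counting
  open ThetaSeries

  -- The substitution of q² for q.
  V : Series → Series
  V f zero          = f 0
  V f (suc zero)    = 0ℤ
  V f (suc (suc n)) = V (tail f) n

  V-double : ∀ f m → V f (m ℕ.+ m) ≡ f m
  V-double f zero = refl
  V-double f (suc m) rewrite ℕₚ.+-suc m m = V-double (tail f) m

  V-odd : ∀ f m → V f (suc (m ℕ.+ m)) ≡ 0ℤ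
  V-odd f zero = refl
  V-odd f (suc m) rewrite ℕₚ.+-suc m m = V-odd (tail f) m

  V-cong : ∀ {f g} → f ≋ g → V f ≋ V g
  V-cong {f} {g} p = pointwise (go (coeff p))
    where
    go : ∀ {f g} → (∀ n → f n ≡ g n) → ∀ n → V f n ≡ V g n
    go p zero = p 0
    go p (suc zero) = refl
    go p (suc (suc n)) = go (λ i → p (suc i)) n

  V-linear : ∀ a f g n → V (λ i → a * f i + g i) n ≡ a * V f n + V g n
  V-linear a f g zero = refl
  V-linear a f g (suc zero) = sym (trans (ℤₚ.+-identityʳ _) (ℤₚ.*-zeroʳ a))
  V-linear a f g (suc (suc n)) = V-linear a (tail f) (tail g) n

  V-⊕ : ∀ f g → V (f ⊕ g) ≋ V f ⊕ V g
  V-⊕ f g = pointwise λ n → trans (coeff (V-cong {f ⊕ g} {λ i → 1ℤ * f i + g i}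
      (pointwise λ i → trans (⊕-coeff f g i) (cong (_+ g i) (sym (ℤₚ.*-identityˡ (f i)))))) n)
    (trans (V-linear 1ℤ f g n) (trans (cong (_+ V g n) (ℤₚ.*-identityˡ (V f n))) (sym (⊕-coeff (V f) (V g) n))))

  V-⊛-coeff : ∀ f g n → V (f ⊛ g) n ≡ (V f ⊛ V g) n
  V-⊛-coeff f g zero = refl
  V-⊛-coeff f g (suc zero) = lemma (f 0) (g 0)
    where
    lemma : ∀ a b → 0ℤ ≡ a * 0ℤ + 0ℤ * b
    lemma = solve-∀
  V-⊛-coeff f g (suc (suc n)) = trans (V-linear (f 0) (tail g) (tail f ⊛ g) n)
    (cong (λ x → f 0 * V (tail g) n + x) (trans (V-⊛-coeff (tail f) g n) (sym (ℤₚ.+-identityˡ _))))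

  V-⊛ : ∀ f g → V (f ⊛ g) ≋ V f ⊛ V g
  V-⊛ f g = pointwise (V-⊛-coeff f g)

  V-κ : ∀ c → V (κ c) ≋ κ c
  V-κ c = pointwise λ { zero → refl ; (suc zero) → refl ; (suc (suc n)) → go n }
    where
    go : ∀ n → V (λ _ → 0ℤ) n ≡ 0ℤ
    go zero = refl
    go (suc zero) = refl
    go (suc (suc n)) = go n

  V-affine : ∀ f → V (κ 1ℤ ⊕ κ (+ 2) ⊛ f) ≋ κ 1ℤ ⊕ κ (+ 2) ⊛ V f
  V-affine f = ≋.trans (V-⊕ (κ 1ℤ) (κ (+ 2) ⊛ f)) (⊕-cong (V-κ 1ℤ) (≋.trans (V-⊛ (κ (+ 2)) f) (⊛-cong (V-κ (+ 2)) (≋.refl {V f}))))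

  -- The derivation q d/dq.
  Θ : Series → Series
  Θ f n = + n * f n

  Θ-⊛-coeff : ∀ f g n → + n * (f ⊛ g) n ≡ (Θ f ⊛ g) n + (f ⊛ Θ g) n
  Θ-⊛-coeff f g zero = lemma (f 0) (g 0)
    where
    lemma : ∀ a b → 0ℤ * (a * b) ≡ 0ℤ * a * b + a * (0ℤ * b)
    lemma = solve-∀
  Θ-⊛-coeff f g (suc n) = begin
    + suc n * (f 0 * g (suc n) + (tail f ⊛ g) n)
      ≡⟨ l₁ (+ n) (f 0) (g (suc n)) ((tail f ⊛ g) n) ⟩
    0ℤ * f 0 * g (suc n) + (tail f ⊛ g) n + + n * (tail f ⊛ g) n + f 0 * (+ suc n * g (suc n))
      ≡⟨ cong (λ x → 0ℤ * f 0 * g (suc n) + (tail f ⊛ g) n + x + f 0 * (+ suc n * g (suc n))) (Θ-⊛-coeff (tail f) g n) ⟩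
    0ℤ * f 0 * g (suc n) + (tail f ⊛ g) n + ((Θ (tail f) ⊛ g) n + (tail f ⊛ Θ g) n) + f 0 * (+ suc n * g (suc n))
      ≡⟨ l₂ (0ℤ * f 0 * g (suc n)) ((tail f ⊛ g) n) ((Θ (tail f) ⊛ g) n) ((tail f ⊛ Θ g) n) (f 0 * (+ suc n * g (suc n))) ⟩
    0ℤ * f 0 * g (suc n) + ((tail f ⊛ g) n + (Θ (tail f) ⊛ g) n) + (f 0 * (+ suc n * g (suc n)) + (tail f ⊛ Θ g) n)
      ≡⟨ cong (λ x → 0ℤ * f 0 * g (suc n) + x + (f 0 * (+ suc n * g (suc n)) + (tail f ⊛ Θ g) n))
           (trans (sym (⊛-distribʳ-coeff g (tail f) (Θ (tail f)) n))
               (⊛-cong-upTo n (λ i _ → trans (⊕-coeff (tail f) (Θ (tail f)) i) (l₃ (+ i) (f (suc i)))) (λ i _ → refl))) ⟩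
    0ℤ * f 0 * g (suc n) + (tail (Θ f) ⊛ g) n + (f 0 * (+ suc n * g (suc n)) + (tail f ⊛ Θ g) n) ∎
    where
    open ≡-Reasoning
    l₁ : ∀ n a b x → (1ℤ + n) * (a * b + x) ≡ 0ℤ * a * b + x + n * x + a * ((1ℤ + n) * b)
    l₁ = solve-∀
    l₂ : ∀ a b c d e → a + b + (c + d) + e ≡ a + (b + c) + (e + d)
    l₂ = solve-∀
    l₃ : ∀ n a → a + n * a ≡ (1ℤ + n) * a
    l₃ = solve-∀

  Θ-⊛ : ∀ f g → Θ (f ⊛ g) ≋ Θ f ⊛ g ⊕ f ⊛ Θ g
  Θ-⊛ f g = pointwise λ n → trans (Θ-⊛-coeff f g n) (sym (⊕-coeff (Θ f ⊛ g) (f ⊛ Θ g) n))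

  Θ-⊕ : ∀ f g → Θ (f ⊕ g) ≋ Θ f ⊕ Θ g
  Θ-⊕ f g = pointwise λ n → trans (cong (+ n *_) (⊕-coeff f g n)) (trans (ℤₚ.*-distribˡ-+ (+ n) (f n) (g n)) (sym (⊕-coeff (Θ f) (Θ g) n)))

  Θ-cong : ∀ {f g} → f ≋ g → Θ f ≋ Θ g
  Θ-cong p = pointwise λ n → cong (+ n *_) (coeff p n)

  Θ-κ⊛ : ∀ c f → Θ (κ c ⊛ f) ≋ κ c ⊛ Θ f
  Θ-κ⊛ c f = pointwise λ n → trans (cong (+ n *_) (κ-⊛ c f n)) (trans (lemma (+ n) c (f n)) (sym (κ-⊛ c (Θ f) n)))
    where
    lemma : ∀ n c x → n * (c * x) ≡ c * (n * x)
    lemma = solve-∀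

  -- Congruences are carried as equations with an explicit cofactor, so that they can be multiplied
  -- and combined by the ring solver; `remainder` is the way back.
  quotient : ∀ c f g → (∀ n → c ∣ f n - g n) → ∃[ h ] f ≋ g ⊕ κ c ⊛ h
  quotient c f g p = (λ n → _∣_.quotient (p n)) , pointwise λ n → trans (lemma (f n) (g n))
      (trans (cong (λ x → g n + x) (trans (_∣_.equality (p n)) (trans (ℤₚ.*-comm _ c) (sym (κ-⊛ c (λ n → _∣_.quotient (p n)) n)))))
        (sym (⊕-coeff g (κ c ⊛ (λ n → _∣_.quotient (p n))) n)))
    where
    lemma : ∀ a b → a ≡ b + (a - b)
    lemma = solve-∀

  remainder : ∀ {c f g h} → f ≋ g ⊕ κ c ⊛ h → ∀ n → c ∣ f n - g n
  remainder {c} {f} {g} {h} e n = divides (h n) (trans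
      (cong (_- g n) (trans (coeff e n) (trans (⊕-coeff g (κ c ⊛ h) n) (cong (λ x → g n + x) (κ-⊛ c h n)))))
      (lemma (g n) c (h n)))
    where
    lemma : ∀ b c h → b + c * h - b ≡ h * c
    lemma = solve-∀

  consecutive-even : ∀ x → + 2 ∣ x * x - x
  consecutive-even (+ zero) = divides 0ℤ refl
  consecutive-even (+ suc n) = subst (+ 2 ∣_) (lemma (+ n)) (∣-+ (consecutive-even (+ n)) (∣-*ʳ (+ n) (∣-rfl {+ 2})))
    where
    lemma : ∀ n → n * n - n + + 2 * n ≡ (1ℤ + n) * (1ℤ + n) - (1ℤ + n)
    lemma = solve-∀
  consecutive-even -[1+ zero ] = divides 1ℤ refl
  consecutive-even -[1+ suc n ] = subst (+ 2 ∣_) (lemma -[1+ n ]) (∣-+ (consecutive-even -[1+ n ]) (∣-*ʳ (1ℤ - -[1+ n ]) (∣-rfl {+ 2})))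
    where
    lemma : ∀ n → n * n - n + + 2 * (1ℤ - n) ≡ (- 1ℤ + n) * (- 1ℤ + n) - (- 1ℤ + n)
    lemma = solve-∀

  -- Peeling both factors at once makes the outer cross terms a double, while `V f` loses two
  -- exponents; the diagonal term at the end uses x² ≡ x modulo 2.
  frobenius-coeff : ∀ f n → + 2 ∣ (f ⊛ f) n - V f n
  frobenius-coeff f zero = consecutive-even (f 0)
  frobenius-coeff f (suc zero) = divides (f 0 * f 1) (lemma (f 0) (f 1))
    where
    lemma : ∀ a b → a * b + b * a - 0ℤ ≡ a * b * + 2
    lemma = solve-∀
  frobenius-coeff f (suc (suc n)) = subst (+ 2 ∣_) (sym (trans (cong (λ x → f 0 * f (suc (suc n)) + x - V (tail f) n) (⊛-sucʳ (tail f) f n))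
      (lemma (f 0) (f (suc (suc n))) ((tail f ⊛ tail f) n) (V (tail f) n))))
    (∣-+ (∣-*ʳ (f 0 * f (suc (suc n))) (∣-rfl {+ 2})) (frobenius-coeff (tail f) n))
    where
    lemma : ∀ a b x v → a * b + (b * a + x) - v ≡ + 2 * (a * b) + (x - v)
    lemma = solve-∀

  frobenius : ∀ f → ∃[ h ] f ⊛ f ≋ V f ⊕ κ (+ 2) ⊛ h
  frobenius f = quotient (+ 2) (f ⊛ f) (V f) (frobenius-coeff f)

  ⊛-zero : ∀ f g n → (∀ i j → i ℕ.+ j ≡ n → f i ≡ 0ℤ ⊎ g j ≡ 0ℤ) → (f ⊛ g) n ≡ 0ℤ
  ⊛-zero f g zero p = product-zero (p 0 0 refl)
    where
    product-zero : ∀ {x y} → x ≡ 0ℤ ⊎ y ≡ 0ℤ → x * y ≡ 0ℤ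
    product-zero (inj₁ refl) = refl
    product-zero {x} (inj₂ refl) = ℤₚ.*-zeroʳ x
  ⊛-zero f g (suc n) p = cong₂ _+_ (product-zero (p 0 (suc n) refl)) (⊛-zero (tail f) g n (λ i j e → p (suc i) j (cong suc e)))
    where
    product-zero : ∀ {x y} → x ≡ 0ℤ ⊎ y ≡ 0ℤ → x * y ≡ 0ℤ
    product-zero (inj₁ refl) = refl
    product-zero {x} (inj₂ refl) = ℤₚ.*-zeroʳ x

  -- Used to split the powers of `φ` into components by residue class of the exponent, so that an
  -- identity can be compared one class at a time.
  Supp : ℕ → Series → Set
  Supp k f = ∀ n → (n % 4 ≡ k) ⊎ (f n ≡ 0ℤ)

  Supp-⊛ : ∀ {k l f g} → Supp k f → Supp l g → Supp ((k ℕ.+ l) % 4) (f ⊛ g)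
  Supp-⊛ {k} {l} {f} {g} p q n with n % 4 ℕ.≟ (k ℕ.+ l) % 4
  ... | yes e = inj₁ e
  ... | no n≢ = inj₂ (⊛-zero f g n λ i j i+j≡n → vanish i j i+j≡n (p i) (q j))
    where
    vanish : ∀ i j → i ℕ.+ j ≡ n → (i % 4 ≡ k) ⊎ (f i ≡ 0ℤ) → (j % 4 ≡ l) ⊎ (g j ≡ 0ℤ) → f i ≡ 0ℤ ⊎ g j ≡ 0ℤ
    vanish i j e (inj₂ fi) _ = inj₁ fi
    vanish i j e (inj₁ _) (inj₂ gj) = inj₂ gj
    vanish i j refl (inj₁ refl) (inj₁ refl) = ⊥-elim (n≢ (ℕ/.%-distribˡ-+ i j 4))

  Supp-⊕ : ∀ {k f g} → Supp k f → Supp k g → Supp k (f ⊕ g)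
  Supp-⊕ {k} {f} {g} p q n = join (p n) (q n)
    where
    join : (n % 4 ≡ k) ⊎ (f n ≡ 0ℤ) → (n % 4 ≡ k) ⊎ (g n ≡ 0ℤ) → (n % 4 ≡ k) ⊎ ((f ⊕ g) n ≡ 0ℤ)
    join (inj₁ e) _ = inj₁ e
    join (inj₂ _) (inj₁ e) = inj₁ e
    join (inj₂ a) (inj₂ b) = inj₂ (trans (⊕-coeff f g n) (cong₂ _+_ a b))

  Supp-κ : ∀ c → Supp 0 (κ c)
  Supp-κ c zero = inj₁ refl
  Supp-κ c (suc n) = inj₂ refl

  Supp-0 : ∀ {k f} → Supp k f → ∀ n → n % 4 ≢ k → f n ≡ 0ℤ
  Supp-0 p n n≢k = [ (λ e → ⊥-elim (n≢k e)) , (λ e → e) ]′ (p n)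

-- Series supported on squares and the dissection of φ².

module Squares where

  open PowerSeries
  open Overpartitions using (φ; S; sumZ)
  open Quaternions using (prime-∣-*)
  open Counting
  open ThetaSeries
  open SeriesOperators
  open SeriesSolver using (solve; _:=_; _:+_; _:*_; _:-_; :-_; con)

  data Parity : ℕ → Set where
    even : ∀ m → Parity (m ℕ.+ m)
    odd  : ∀ m → Parity (suc (m ℕ.+ m))

  parity : ∀ n → Parity n
  parity zero = even 0
  parity (suc n) with parity n
  ... | even m = odd m
  ... | odd m  = subst Parity (cong suc (ℕₚ.+-suc m m)) (even (suc m))

  even≢odd : ∀ a b → a ℕ.+ a ≢ suc (b ℕ.+ b)
  even≢odd (suc a) (suc b) e = even≢odd a b (ℕₚ.suc-injective
      (ℕₚ.suc-injective (trans (cong suc (sym (ℕₚ.+-suc a a))) (trans e (cong (λ x → suc (suc x)) (ℕₚ.+-suc b b))))))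
  even≢odd (suc a) zero e with trans (sym (ℕₚ.+-suc a a)) (ℕₚ.suc-injective e)
  ... | ()

  double-injective : ∀ {a b} → a ℕ.+ a ≡ b ℕ.+ b → a ≡ b
  double-injective {a} {b} e = ℕₚ.*-cancelˡ-≡ a b 2 (trans (cong (a ℕ.+_) (ℕₚ.+-identityʳ a))
      (trans e (sym (cong (b ℕ.+_) (ℕₚ.+-identityʳ b)))))

  square-injective : ∀ x y → x ℕ.* x ≡ y ℕ.* y → x ≡ y
  square-injective x y e with ℕₚ.<-cmp x y
  ... | tri≈ _ x≡y _ = x≡y
  ... | tri< x<y _ _ = ⊥-elim (ℕₚ.<⇒≢ (ℕₚ.*-mono-< x<y x<y) e)
  ... | tri> _ _ y<x = ⊥-elim (ℕₚ.<⇒≢ (ℕₚ.*-mono-< y<x y<x) (sym e))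

  data SquareView (n : ℕ) : Set where
    isSquare    : ∀ x → n ≡ suc x ℕ.* suc x → S n ≡ 1ℤ → SquareView n
    notSquare : (∀ x → n ≢ suc x ℕ.* suc x) → S n ≡ 0ℤ → SquareView n

  squareView : ∀ n → SquareView n
  squareView n = conclude (go n)
    where
    t : ℕ → ℤ
    t j = X (suc j ℕ.* suc j) n
    go : ∀ k → (∃[ j ] j ℕ.< k × suc j ℕ.* suc j ≡ n × sumZ k t ≡ 1ℤ) ⊎ ((∀ j → j ℕ.< k → suc j ℕ.* suc j ≢ n) × sumZ k t ≡ 0ℤ)
    go zero = inj₂ ((λ j ()) , refl)
    go (suc k) with go k | suc k ℕ.* suc k ℕ.≟ n
    ... | inj₁ (j , j<k , e , _) | yes e′ = ⊥-elim (ℕₚ.<⇒≢ j<k (ℕₚ.suc-injective (square-injective (suc j) (suc k) (trans e (sym e′)))))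
    ... | inj₁ (j , j<k , e , s) | no ≢n = inj₁ (j , ℕₚ.m<n⇒m<1+n j<k , e , cong₂ _+_ s (X-≢ (suc k ℕ.* suc k) n ≢n))
    ... | inj₂ (none , s) | yes refl = inj₁ (k , ℕₚ.≤-refl , refl , cong₂ _+_ s (X-self (suc k ℕ.* suc k)))
    ... | inj₂ (none , s) | no ≢n = inj₂ ((λ j j<1+k → [ none j , (λ { refl → ≢n }) ]′ (ℕₚ.m<1+n⇒m<n∨m≡n j<1+k)) , cong₂ _+_ s (X-≢ (suc k ℕ.* suc k) n ≢n))
    conclude : (∃[ j ] j ℕ.< n × suc j ℕ.* suc j ≡ n × sumZ n t ≡ 1ℤ) ⊎ ((∀ j → j ℕ.< n → suc j ℕ.* suc j ≢ n) × sumZ n t ≡ 0ℤ) →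
        SquareView n
    conclude (inj₁ (j , _ , e , s)) = isSquare j (sym e) s
    conclude (inj₂ (none , s)) = notSquare (λ x e → none x (ℕₚ.≤-trans (ℕₚ.m≤m*n (suc x) (suc x)) (ℕₚ.≤-reflexive (sym e))) (sym e)) s

  S-square : ∀ x .{{_ : ℕ.NonZero x}} → S (x ℕ.* x) ≡ 1ℤ
  S-square x@(suc x-1) with squareView (x ℕ.* x)
  ... | isSquare _ _ s = s
  ... | notSquare none _ = ⊥-elim (none x-1 refl)

  S-notSquare : ∀ {n} → (∀ x → n ≢ suc x ℕ.* suc x) → S n ≡ 0ℤ
  S-notSquare {n} none with squareView n
  ... | isSquare x e _ = ⊥-elim (none x e)
  ... | notSquare _ s = s

  S-0 : S 0 ≡ 0ℤ
  S-0 = refl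

  even-square : ∀ m → (m ℕ.+ m) ℕ.* (m ℕ.+ m) ≡ (m ℕ.* m ℕ.+ m ℕ.* m) ℕ.+ (m ℕ.* m ℕ.+ m ℕ.* m)
  even-square = solveℕ

  odd-square : ∀ m → suc (m ℕ.+ m) ℕ.* suc (m ℕ.+ m) ≡ suc ((m ℕ.* m ℕ.+ m ℕ.+ (m ℕ.* m ℕ.+ m)) ℕ.+ (m ℕ.* m ℕ.+ m ℕ.+ (m ℕ.* m ℕ.+ m)))
  odd-square = solveℕ

  S-quadruple : ∀ l → S ((l ℕ.+ l) ℕ.+ (l ℕ.+ l)) ≡ S l
  S-quadruple l with squareView l
  ... | isSquare y refl s = trans (cong S (sym (even-square (suc y)))) (trans (S-square (suc y ℕ.+ suc y)) (sym s))
  ... | notSquare none s = trans (S-notSquare go) (sym s)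
    where
    root : ∀ y → y ≢ 0 → (l ℕ.+ l) ℕ.+ (l ℕ.+ l) ≡ y ℕ.* y → Parity y → ⊥
    root .0 y≢0 e (even zero) = y≢0 refl
    root .(suc m ℕ.+ suc m) _ e (even (suc m)) = none m (double-injective (double-injective (trans e (even-square (suc m)))))
    root .(suc (m ℕ.+ m)) _ e (odd m) = even≢odd (l ℕ.+ l) (m ℕ.* m ℕ.+ m ℕ.+ (m ℕ.* m ℕ.+ m)) (trans e (odd-square m))
    go : ∀ x → (l ℕ.+ l) ℕ.+ (l ℕ.+ l) ≢ suc x ℕ.* suc x
    go x e = root (suc x) (λ ()) e (parity (suc x))

  S-2mod4 : ∀ m → S (suc (m ℕ.+ m) ℕ.+ suc (m ℕ.+ m)) ≡ 0ℤ
  S-2mod4 l = S-notSquare go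
    where
    root : ∀ y → suc (l ℕ.+ l) ℕ.+ suc (l ℕ.+ l) ≡ y ℕ.* y → Parity y → ⊥
    root .(m ℕ.+ m) e (even m) = even≢odd (m ℕ.* m) l (double-injective (sym (trans e (even-square m))))
    root .(suc (m ℕ.+ m)) e (odd m) = even≢odd (suc (l ℕ.+ l)) (m ℕ.* m ℕ.+ m ℕ.+ (m ℕ.* m ℕ.+ m)) (trans e (odd-square m))
    go : ∀ x → suc (l ℕ.+ l) ℕ.+ suc (l ℕ.+ l) ≢ suc x ℕ.* suc x
    go x e = root (suc x) e (parity (suc x))

  -- S₂, S₄ and O count the squares doubled, the even squares and the odd squares.
  S₂ S₄ O φ₂ φ₄ : Series
  S₂ = V S
  S₄ = V S₂
  O  = S ⊕ ⊖ S₄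
  φ₂ = κ 1ℤ ⊕ κ (+ 2) ⊛ S₂
  φ₄ = κ 1ℤ ⊕ κ (+ 2) ⊛ S₄

  O-coeff : ∀ n → O n ≡ S n - S₄ n
  O-coeff n = trans (⊕-coeff S (⊖ S₄) n) (cong (λ x → S n + x) (⊖-coeff S₄ n))

  S-split : S ≋ S₄ ⊕ O
  S-split = solve 2 (λ s t → s := t :+ (s :+ :- t)) ≋.refl S S₄

  φ-split : φ ≋ φ₄ ⊕ κ (+ 2) ⊛ O
  φ-split = solve 2 (λ s t → con 1ℤ :+ con (+ 2) :* s := (con 1ℤ :+ con (+ 2) :* t) :+ con (+ 2) :* (s :+ :- t)) ≋.refl S S₄

  V-φ : V φ ≋ φ₂
  V-φ = V-affine S

  V-φ₂ : V φ₂ ≋ φ₄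
  V-φ₂ = V-affine S₂

  mod4-0 : ∀ l → ((l ℕ.+ l) ℕ.+ (l ℕ.+ l)) % 4 ≡ 0
  mod4-0 l = trans (cong (_% 4) (e l)) (ℕ/.m*n%n≡0 l 4)
    where
    e : ∀ l → (l ℕ.+ l) ℕ.+ (l ℕ.+ l) ≡ l ℕ.* 4
    e = solveℕ

  mod4-1 : ∀ l → suc ((l ℕ.+ l) ℕ.+ (l ℕ.+ l)) % 4 ≡ 1
  mod4-1 l = trans (cong (_% 4) (e l)) (ℕ/.[m+kn]%n≡m%n 1 l 4)
    where
    e : ∀ l → suc ((l ℕ.+ l) ℕ.+ (l ℕ.+ l)) ≡ 1 ℕ.+ l ℕ.* 4
    e = solveℕ

  S₄-odd : ∀ m → S₄ (suc (m ℕ.+ m)) ≡ 0ℤ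
  S₄-odd m = V-odd S₂ m

  S₄-2mod4 : ∀ m → S₄ (suc (m ℕ.+ m) ℕ.+ suc (m ℕ.+ m)) ≡ 0ℤ
  S₄-2mod4 m = trans (V-double S₂ (suc (m ℕ.+ m))) (V-odd S m)

  S₄-quadruple : ∀ l → S₄ ((l ℕ.+ l) ℕ.+ (l ℕ.+ l)) ≡ S l
  S₄-quadruple l = trans (V-double S₂ (l ℕ.+ l)) (V-double S l)

  Supp-S₄ : Supp 0 S₄
  Supp-S₄ n with parity n
  ... | odd m = inj₂ (S₄-odd m)
  ... | even m with parity m
  ...   | odd k = inj₂ (S₄-2mod4 k)
  ...   | even k = inj₁ (mod4-0 k)

  -- At even exponents `S` and `S₄` agree, as 4l is a square exactly when l is and 2 modulo 4 is
  -- never one; odd squares are 1 modulo 4.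
  Supp-O : Supp 1 O
  Supp-O n with parity n
  ... | even m with parity m
  ...   | odd k = inj₂ (trans (O-coeff (suc (k ℕ.+ k) ℕ.+ suc (k ℕ.+ k))) (cong₂ _-_ (S-2mod4 k) (S₄-2mod4 k)))
  ...   | even k = inj₂ (trans (O-coeff ((k ℕ.+ k) ℕ.+ (k ℕ.+ k))) (trans (cong₂ _-_ (S-quadruple k) (S₄-quadruple k)) (ℤₚ.+-inverseʳ (S k))))
  Supp-O n | odd m with squareView (suc (m ℕ.+ m))
  ... | notSquare _ s = inj₂ (trans (O-coeff (suc (m ℕ.+ m))) (cong₂ _-_ s (S₄-odd m)))
  ... | isSquare x e _ = inj₁ (go (suc x) e (parity (suc x)))
    where
    go : ∀ x → suc (m ℕ.+ m) ≡ x ℕ.* x → Parity x → suc (m ℕ.+ m) % 4 ≡ 1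
    go .(k ℕ.+ k) e (even k) = ⊥-elim (even≢odd (k ℕ.* k ℕ.+ k ℕ.* k) m (sym (trans e (even-square k))))
    go .(suc (k ℕ.+ k)) e (odd k) = trans (cong (_% 4) (trans e (odd-square k))) (mod4-1 (k ℕ.* k ℕ.+ k))

  Supp-κ⊛ : ∀ {k f} c → Supp k f → Supp k (κ c ⊛ f)
  Supp-κ⊛ {k} {f} c p n = go (p n)
    where
    go : (n % 4 ≡ k) ⊎ (f n ≡ 0ℤ) → (n % 4 ≡ k) ⊎ ((κ c ⊛ f) n ≡ 0ℤ)
    go (inj₁ e) = inj₁ e
    go (inj₂ e) = inj₂ (trans (κ-⊛ c f n) (trans (cong (c *_) e) (ℤₚ.*-zeroʳ c)))

  Supp-φ₄ : Supp 0 φ₄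
  Supp-φ₄ = Supp-⊕ {0} {κ 1ℤ} {κ (+ 2) ⊛ S₄} (Supp-κ 1ℤ) (Supp-κ⊛ {0} {S₄} (+ 2) Supp-S₄)

  Supp-V : ∀ {k f} → Supp k f → Supp ((k ℕ.+ k) % 4) (V f)
  Supp-V {k} {f} p n with parity n
  ... | odd m = inj₂ (V-odd f m)
  ... | even m = go (p m)
    where
    go : (m % 4 ≡ k) ⊎ (f m ≡ 0ℤ) → ((m ℕ.+ m) % 4 ≡ (k ℕ.+ k) % 4) ⊎ (V f (m ℕ.+ m) ≡ 0ℤ)
    go (inj₁ refl) = inj₁ (ℕ/.%-distribˡ-+ m m 4)
    go (inj₂ e) = inj₂ (trans (V-double f m) e)

  Supp-φ₄² : Supp 0 (φ₄ ⊛ φ₄)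
  Supp-φ₄² = Supp-⊛ {0} {0} {φ₄} {φ₄} Supp-φ₄ Supp-φ₄

  Supp-φ₄O : Supp 1 (φ₄ ⊛ O)
  Supp-φ₄O = Supp-⊛ {0} {1} {φ₄} {O} Supp-φ₄ Supp-O

  Supp-O² : Supp 2 (O ⊛ O)
  Supp-O² = Supp-⊛ {1} {1} {O} {O} Supp-O Supp-O

  -- The map (x, y) to (x + y, x - y) doubles the norm, and it is onto because u² + v² even makes u
  -- + v even.
  r₂-double : ∀ m → r₂ (m ℕ.+ m) ≡ r₂ m
  r₂-double m = trans (sym (r₂-count N (m ℕ.+ m) ℕₚ.≤-refl)) (trans (sym bijection) (r₂-count N m (ℕₚ.m≤m+n m m)))
    where
    N = m ℕ.+ m
    half-sum : ∀ u v → u * u + v * v ≡ + N → ∃[ h ] u + v ≡ h * + 2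
    half-sum u v e = _∣_.quotient d , _∣_.equality d
      where
      identity : ∀ u v → (u + v) * (u + v) ≡ u * u + v * v + + 2 * (u * v)
      identity = solve-∀
      double : ∀ m → m + m ≡ m * + 2
      double = solve-∀
      d : + 2 ∣ u + v
      d = reduce (prime-∣-* prime[2] (u + v) (u + v) (subst (+ 2 ∣_) (sym (identity u v))
        (∣-+ (subst (+ 2 ∣_) (sym e) (divides (+ m) (double (+ m)))) (∣-*ʳ (u * v) (∣-rfl {+ 2})))))
    g : ∀ u v → u * u + v * v ≡ + N → ℤ × ℤ
    g u v e = h , u - h
      where h = proj₁ (half-sum u v e)
    double-square : ∀ x y → (x + y) * (x + y) + (x - y) * (x - y) ≡ (x * x + y * y) * + 2
    double-square = solve-∀
    double+ : ∀ m → m + m ≡ m * + 2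
    double+ = solve-∀
    g-sum : ∀ u v e → proj₁ (g u v e) + proj₂ (g u v e) ≡ u
    g-sum u v e = lemma (proj₁ (half-sum u v e)) u
      where
      lemma : ∀ h u → h + (u - h) ≡ u
      lemma = solve-∀
    g-diff : ∀ u v e → proj₁ (g u v e) - proj₂ (g u v e) ≡ v
    g-diff u v e = trans (lemma h u) (trans (cong (_- u) (sym (proj₂ (half-sum u v e)))) (lemma′ u v))
      where
      h = proj₁ (half-sum u v e)
      lemma : ∀ h u → h - (u - h) ≡ h * + 2 - u
      lemma = solve-∀
      lemma′ : ∀ u v → u + v - u ≡ v
      lemma′ = solve-∀
    bijection : count (plane N) (λ (x , y) → x * x + y * y ℤ.≟ + m) ≡ count (plane N) (λ (x , y) → x * x + y * y ℤ.≟ + N)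
    bijection = count-bij (plane N) (plane N) (λ (x , y) → x * x + y * y ℤ.≟ + m) (λ (x , y) → x * x + y * y ℤ.≟ + N)
      (λ (x , y) → x + y , x - y) (λ (u , v) e → g u v e)
      (λ (x , y) e → trans (double-square x y) (trans (cong (_* + 2) e) (sym (double+ (+ m)))))
      (λ (u , v) e → ℤₚ.*-cancelʳ-≡ _ (+ m) (+ 2) (trans (sym (double-square (proj₁ (g u v e)) (proj₂ (g u v e))))
         (trans (cong₂ (λ a b → a * a + b * b) (g-sum u v e) (g-diff u v e)) (trans e (double+ (+ m))))))
      (λ (x , y) _ e → back x y (half-sum (x + y) (x - y) e))
      (λ (u , v) e → cong₂ _,_ (g-sum u v e) (g-diff u v e))
      (λ (x , y) e → plane-listed N m {x} {y} (ℕₚ.m≤m+n m m) e)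
      (λ (x , y) e → plane-listed N N {x} {y} ℕₚ.≤-refl e)
      where
      back : ∀ x y (h : ∃[ h ] (x + y) + (x - y) ≡ h * + 2) → (proj₁ h , (x + y) - proj₁ h) ≡ (x , y)
      back x y (h , e) = cong₂ _,_ h≡x (trans (cong (λ z → x + y - z) h≡x) (lemma′ x y))
        where
        lemma : ∀ x y → (x + y) + (x - y) ≡ x * + 2
        lemma = solve-∀
        lemma′ : ∀ x y → x + y - x ≡ y
        lemma′ = solve-∀
        h≡x : h ≡ x
        h≡x = ℤₚ.*-cancelʳ-≡ h x (+ 2) (trans (sym e) (lemma x y))

  r₂-split : r₂ ≋ φ₄ ⊛ φ₄ ⊕ κ (+ 4) ⊛ (φ₄ ⊛ O) ⊕ κ (+ 4) ⊛ (O ⊛ O)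
  r₂-split = ≋.trans (⊛-cong φ-split φ-split) (solve 2
      (λ e o → (e :+ con (+ 2) :* o) :* (e :+ con (+ 2) :* o) := e :* e :+ con (+ 4) :* (e :* o) :+ con (+ 4) :* (o :* o)) ≋.refl φ₄ O)

  sum₃ : ∀ {f g h : Series} n → (f ⊕ κ (+ 4) ⊛ g ⊕ κ (+ 4) ⊛ h) n ≡ f n + + 4 * g n + + 4 * h n
  sum₃ {f} {g} {h} n = trans (⊕-coeff (f ⊕ κ (+ 4) ⊛ g) (κ (+ 4) ⊛ h) n)
      (cong₂ _+_ (trans (⊕-coeff f (κ (+ 4) ⊛ g) n) (cong (λ x → f n + x) (κ-⊛ (+ 4) g n))) (κ-⊛ (+ 4) h n))

  sum₂ : ∀ {f h : Series} n → (f ⊕ κ (+ 4) ⊛ h) n ≡ f n + + 4 * h n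
  sum₂ {f} {h} n = trans (⊕-coeff f (κ (+ 4) ⊛ h) n) (cong (λ x → f n + x) (κ-⊛ (+ 4) h n))

  odd-mod4 : ∀ m → (suc (m ℕ.+ m) % 4 ≡ 1) ⊎ (suc (m ℕ.+ m) % 4 ≡ 3)
  odd-mod4 m with parity m
  ... | even k = inj₁ (mod4-1 k)
  ... | odd k = inj₂ (trans (cong (_% 4) (e k)) (ℕ/.[m+kn]%n≡m%n 3 k 4))
    where
    e : ∀ k → suc (suc (k ℕ.+ k) ℕ.+ suc (k ℕ.+ k)) ≡ 3 ℕ.+ k ℕ.* 4
    e = solveℕ

  odd-≢ : ∀ m k → k ≡ 0 ⊎ k ≡ 2 → suc (m ℕ.+ m) % 4 ≢ k
  odd-≢ m k k≡ e with odd-mod4 m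
  odd-≢ m .0 (inj₁ refl) e | inj₁ f with trans (sym e) f
  ... | ()
  odd-≢ m .0 (inj₁ refl) e | inj₂ f with trans (sym e) f
  ... | ()
  odd-≢ m .2 (inj₂ refl) e | inj₁ f with trans (sym e) f
  ... | ()
  odd-≢ m .2 (inj₂ refl) e | inj₂ f with trans (sym e) f
  ... | ()

  even-≢1 : ∀ m → (m ℕ.+ m) % 4 ≢ 1
  even-≢1 m e with parity m
  ... | even k with trans (sym e) (mod4-0 k)
  ...   | ()
  even-≢1 m e | odd k with trans (sym e) (trans (cong (_% 4) (f k)) (ℕ/.[m+kn]%n≡m%n 2 k 4))
    where
    f : ∀ k → suc (k ℕ.+ k) ℕ.+ suc (k ℕ.+ k) ≡ 2 ℕ.+ k ℕ.* 4
    f = solveℕ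
  ... | ()

  -- The even part of φ(q)² is φ(q²)².
  φ₂² : φ₂ ⊛ φ₂ ≋ φ₄ ⊛ φ₄ ⊕ κ (+ 4) ⊛ (O ⊛ O)
  φ₂² = ≋.trans (≋.sym (≋.trans (V-⊛ φ φ) (⊛-cong V-φ V-φ))) (pointwise λ n → trans (go n) (sym (sum₂ {φ₄ ⊛ φ₄} {O ⊛ O} n)))
    where
    go : ∀ n → V r₂ n ≡ (φ₄ ⊛ φ₄) n + + 4 * (O ⊛ O) n
    go n with parity n
    ... | odd m = trans (V-odd r₂ m) (sym (cong₂ (λ x y → x + + 4 * y)
          (Supp-0 {0} {φ₄ ⊛ φ₄} Supp-φ₄² (suc (m ℕ.+ m)) (odd-≢ m 0 (inj₁ refl)))
              (Supp-0 {2} {O ⊛ O} Supp-O² (suc (m ℕ.+ m)) (odd-≢ m 2 (inj₂ refl)))))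
    ... | even m = begin
        V r₂ (m ℕ.+ m)                              ≡⟨ V-double r₂ m ⟩
        r₂ m                                        ≡⟨ r₂-double m ⟨
        r₂ (m ℕ.+ m)                                ≡⟨ coeff r₂-split (m ℕ.+ m) ⟩
        (φ₄ ⊛ φ₄ ⊕ κ (+ 4) ⊛ (φ₄ ⊛ O) ⊕ κ (+ 4) ⊛ (O ⊛ O)) (m ℕ.+ m)
          ≡⟨ sum₃ {φ₄ ⊛ φ₄} {φ₄ ⊛ O} {O ⊛ O} (m ℕ.+ m) ⟩
        (φ₄ ⊛ φ₄) (m ℕ.+ m) + + 4 * (φ₄ ⊛ O) (m ℕ.+ m) + + 4 * (O ⊛ O) (m ℕ.+ m)
          ≡⟨ cong (λ x → (φ₄ ⊛ φ₄) (m ℕ.+ m) + + 4 * x + + 4 * (O ⊛ O) (m ℕ.+ m)) (Supp-0 {1} {φ₄ ⊛ O} Supp-φ₄O (m ℕ.+ m) (even-≢1 m)) ⟩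
        (φ₄ ⊛ φ₄) (m ℕ.+ m) + 0ℤ + + 4 * (O ⊛ O) (m ℕ.+ m)
          ≡⟨ cong (_+ + 4 * (O ⊛ O) (m ℕ.+ m)) (ℤₚ.+-identityʳ ((φ₄ ⊛ φ₄) (m ℕ.+ m))) ⟩
        (φ₄ ⊛ φ₄) (m ℕ.+ m) + + 4 * (O ⊛ O) (m ℕ.+ m) ∎
      where open ≡-Reasoning

  -- With O = q ψ(q⁸) this is the identity ψ(q)² = φ(q) ψ(q²). It compares the exponents 2 modulo 4
  -- in two expressions for φ(q²)²: `φ₂²`, and `r₂-split` with q² for q.
  O² : O ⊛ O ≋ V (φ₄ ⊛ O)
  O² = pointwise λ n → go n (n % 4 ℕ.≟ 2)
    where
    split : V (φ₄ ⊛ φ₄) ⊕ κ (+ 4) ⊛ V (φ₄ ⊛ O) ⊕ κ (+ 4) ⊛ V (O ⊛ O) ≋ φ₄ ⊛ φ₄ ⊕ κ (+ 4) ⊛ (O ⊛ O)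
    split = ≋.trans (≋.sym (≋.trans (V-⊕ (φ₄ ⊛ φ₄ ⊕ κ (+ 4) ⊛ (φ₄ ⊛ O)) (κ (+ 4) ⊛ (O ⊛ O)))
        (⊕-cong (≋.trans (V-⊕ (φ₄ ⊛ φ₄) (κ (+ 4) ⊛ (φ₄ ⊛ O))) (⊕-cong (≋.refl {V (φ₄ ⊛ φ₄)}) (scale (φ₄ ⊛ O)))) (scale (O ⊛ O)))))
      (≋.trans (V-cong (≋.sym r₂-split)) (≋.trans (V-⊛ φ φ) (≋.trans (⊛-cong V-φ V-φ) φ₂²)))
      where
      scale : ∀ f → V (κ (+ 4) ⊛ f) ≋ κ (+ 4) ⊛ V f
      scale f = ≋.trans (V-⊛ (κ (+ 4)) f) (⊛-cong (V-κ (+ 4)) (≋.refl {V f}))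
    go : ∀ n → Dec (n % 4 ≡ 2) → (O ⊛ O) n ≡ V (φ₄ ⊛ O) n
    go n (no ≢2) = trans (Supp-0 {2} {O ⊛ O} Supp-O² n ≢2) (sym (Supp-0 {2} {V (φ₄ ⊛ O)} (Supp-V {1} {φ₄ ⊛ O} Supp-φ₄O) n ≢2))
    go n (yes ≡2) = ℤₚ.*-cancelˡ-≡ (+ 4) ((O ⊛ O) n) (V (φ₄ ⊛ O) n)
        (trans (sym (trans (cong (_+ + 4 * (O ⊛ O) n) (Supp-0 {0} {φ₄ ⊛ φ₄} Supp-φ₄² n ≢0)) (ℤₚ.+-identityˡ _)))
        (trans (sym (sum₂ {φ₄ ⊛ φ₄} {O ⊛ O} n)) (trans (sym (coeff split n)) (trans (sum₃ {V (φ₄ ⊛ φ₄)} {V (φ₄ ⊛ O)} {V (O ⊛ O)} n)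
          (trans (cong₂ (λ x y → x + + 4 * V (φ₄ ⊛ O) n + + 4 * y) (Supp-0 {0} {V (φ₄ ⊛ φ₄)} (Supp-V {0} {φ₄ ⊛ φ₄} Supp-φ₄²) n ≢0)
              (Supp-0 {0} {V (O ⊛ O)} (Supp-V {2} {O ⊛ O} Supp-O²) n ≢0))
            (lemma (+ 4 * V (φ₄ ⊛ O) n)))))))
      where
      ≢0 : n % 4 ≢ 0
      ≢0 e with trans (sym e) ≡2
      ... | ()
      lemma : ∀ x → 0ℤ + x + + 4 * 0ℤ ≡ x
      lemma = solve-∀

-- Expansion of 1/φ and of its derivative in powers of S.

module Expansions where

  open PowerSeries
  open Overpartitions using (S; P; φ⊛P)
  open ThetaSeries using (r₃)
  open SeriesOperators
  open Squares
  open SeriesSolver using (solve; _:=_; _:+_; _:*_; _:-_; :-_; con)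

  -- `O₂` and `O₄` live on twice and four times the odd squares, `S₈` on eight times all positive
  -- squares.
  U O₂ O₄ S₈ : Series
  U  = Θ S
  O₂ = V O
  O₄ = V O₂
  S₈ = V S₄

  S₂-split : S₂ ≋ S₈ ⊕ O₂
  S₂-split = ≋.trans (V-cong S-split) (V-⊕ S₄ O)

  O²-factor : O ⊛ O ≋ (κ 1ℤ ⊕ κ (+ 2) ⊛ S₈) ⊛ O₂
  O²-factor = ≋.trans O² (≋.trans (V-⊛ φ₄ O) (⊛-cong (V-affine S₄) (≋.refl {O₂})))

  S₄-vanishes : ∀ n → S n ≡ 0ℤ → S₄ n ≡ 0ℤ
  S₄-vanishes n s with parity n
  ... | odd m = S₄-odd m
  ... | even m with parity m
  ...   | odd k = S₄-2mod4 k
  ...   | even k = trans (S₄-quadruple k) (trans (sym (S-quadruple k)) s)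

  private
    2≤8 : ∀ x → + 2 ∣ x → + 8 ∣ + 4 * x
    2≤8 x d = ∣-mono (+ 4) d

  odd-square-mod8 : ∀ k → + 8 ∣ + (suc (k ℕ.+ k) ℕ.* suc (k ℕ.+ k)) - 1ℤ
  odd-square-mod8 k = subst (+ 8 ∣_) (sym (trans (cong (_- 1ℤ) (ℤₚ.pos-* (suc (k ℕ.+ k)) (suc (k ℕ.+ k)))) (identity (+ k))))
      (2≤8 ((1ℤ + + k) * (1ℤ + + k) - (1ℤ + + k)) (consecutive-even (1ℤ + + k)))
    where
    identity : ∀ k → (1ℤ + (k + k)) * (1ℤ + (k + k)) - 1ℤ ≡ + 4 * ((1ℤ + k) * (1ℤ + k) - (1ℤ + k))
    identity = solve-∀

  -- An odd square is 1 modulo 8, four times an odd square is 4 modulo 8, and the square of a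
  -- multiple of 4 is 0.
  U-mod8 : ∀ n → + 8 ∣ U n - (O ⊕ κ (+ 4) ⊛ O₄) n
  U-mod8 n = subst (λ z → + 8 ∣ U n - z) (sym (sum₂ {O} {O₄} n)) (go n)
    where
    zero-case : ∀ x → x ≡ 0ℤ → + 8 ∣ x
    zero-case x refl = divides 0ℤ refl
    go : ∀ n → + 8 ∣ + n * S n - (O n + + 4 * O₄ n)
    go n with parity n
    ... | odd m = subst (+ 8 ∣_) (sym (trans (cong₂ (λ x y → + suc (m ℕ.+ m) * S (suc (m ℕ.+ m)) - (x + + 4 * y))
              (trans (O-coeff (suc (m ℕ.+ m))) (trans (cong (λ x → S (suc (m ℕ.+ m)) - x) (S₄-odd m)) (ℤₚ.+-identityʳ (S (suc (m ℕ.+ m))))))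
                  (V-odd O₂ m))
            (identity (+ suc (m ℕ.+ m)) (S (suc (m ℕ.+ m)))))) (view (squareView (suc (m ℕ.+ m))))
      where
      identity : ∀ n s → n * s - (s + + 4 * 0ℤ) ≡ (n - 1ℤ) * s
      identity = solve-∀
      root : ∀ x → suc (m ℕ.+ m) ≡ x ℕ.* x → Parity x → + 8 ∣ + suc (m ℕ.+ m) - 1ℤ
      root .(k ℕ.+ k) e (even k) = ⊥-elim (even≢odd (k ℕ.* k ℕ.+ k ℕ.* k) m (sym (trans e (even-square k))))
      root .(suc (k ℕ.+ k)) e (odd k) = subst (λ z → + 8 ∣ + z - 1ℤ) (sym e) (odd-square-mod8 k)
      view : SquareView (suc (m ℕ.+ m)) → + 8 ∣ (+ suc (m ℕ.+ m) - 1ℤ) * S (suc (m ℕ.+ m))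
      view (notSquare _ s) = zero-case _ (trans (cong ((+ suc (m ℕ.+ m) - 1ℤ) *_) s) (ℤₚ.*-zeroʳ (+ suc (m ℕ.+ m) - 1ℤ)))
      view (isSquare x e _) = ∣-*ʳ (S (suc (m ℕ.+ m))) (root (suc x) e (parity (suc x)))
    ... | even m with parity m
    ...   | odd k = zero-case _ (trans (cong₂ (λ x y → + (suc (k ℕ.+ k) ℕ.+ suc (k ℕ.+ k)) * x - y) (S-2mod4 k)
              (cong₂ (λ x y → x + + 4 * y) (trans (O-coeff (suc (k ℕ.+ k) ℕ.+ suc (k ℕ.+ k))) (cong₂ _-_ (S-2mod4 k) (S₄-2mod4 k)))
                  (trans (V-double O₂ (suc (k ℕ.+ k))) (V-odd O k))))
            (identity (+ (suc (k ℕ.+ k) ℕ.+ suc (k ℕ.+ k)))))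
      where
      identity : ∀ n → n * 0ℤ - (0ℤ - 0ℤ + + 4 * 0ℤ) ≡ 0ℤ
      identity = solve-∀
    ...   | even l = subst (+ 8 ∣_) (sym (cong₂ (λ x y → + ((l ℕ.+ l) ℕ.+ (l ℕ.+ l)) * x - y) (S-quadruple l)
              (cong₂ (λ x y → x + + 4 * y) (trans (O-coeff ((l ℕ.+ l) ℕ.+ (l ℕ.+ l)))
                  (trans (cong₂ _-_ (S-quadruple l) (S₄-quadruple l)) (ℤₚ.+-inverseʳ (S l))))
                (trans (V-double O₂ (l ℕ.+ l)) (trans (V-double O l) (O-coeff l)))))) (view (squareView l))
      where
      quad : ∀ l → l + l + (l + l) ≡ + 4 * l
      quad = solve-∀
      view : SquareView l → + 8 ∣ + ((l ℕ.+ l) ℕ.+ (l ℕ.+ l)) * S l - (0ℤ + + 4 * (S l - S₄ l))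
      view (notSquare _ s) = zero-case _ (trans (cong₂ (λ x y → + ((l ℕ.+ l) ℕ.+ (l ℕ.+ l)) * x - (0ℤ + + 4 * (x - y))) s (S₄-vanishes l s))
          (identity (+ ((l ℕ.+ l) ℕ.+ (l ℕ.+ l)))))
        where
        identity : ∀ n → n * 0ℤ - (0ℤ + + 4 * (0ℤ - 0ℤ)) ≡ 0ℤ
        identity = solve-∀
      view (isSquare x e s) = subst (+ 8 ∣_) (sym (trans (cong₂ (λ a b → a * b - (0ℤ + + 4 * (b - S₄ l))) (quad (+ l)) s)
          (identity (+ l) (S₄ l))))
          (2≤8 (+ l - 1ℤ + S₄ l) (root (suc x) e (parity (suc x))))
        where
        identity : ∀ l t → + 4 * l * 1ℤ - (0ℤ + + 4 * (1ℤ - t)) ≡ + 4 * (l - 1ℤ + t)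
        identity = solve-∀
        root : ∀ y → l ≡ y ℕ.* y → Parity y → + 2 ∣ + l - 1ℤ + S₄ l
        root .(suc (k ℕ.+ k)) e (odd k) = subst (+ 2 ∣_) (sym
            (trans (cong (λ z → + l - 1ℤ + z) (trans (cong S₄ (trans e (odd-square k))) (S₄-odd (k ℕ.* k ℕ.+ k ℕ.+ (k ℕ.* k ℕ.+ k)))))
            (ℤₚ.+-identityʳ _)))
            (∣-trs {+ 2} {+ 8} (divides (+ 4) refl) (subst (λ z → + 8 ∣ + z - 1ℤ) (sym e) (odd-square-mod8 k)))
        root .(zero ℕ.+ zero) e (even zero) = ⊥-elim (ℕₚ.1+n≢0 (trans (sym (ℕₚ.*-identityʳ 1)) (impossible e)))
          where
          impossible : l ≡ 0 → 1 ℕ.* 1 ≡ 0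
          impossible refl with trans (sym s) S-0
          ... | ()
        root .(suc k ℕ.+ suc k) e (even (suc k)) = subst (+ 2 ∣_) (sym (trans (cong (λ z → + l - 1ℤ + z)
              (trans (cong S₄ (trans e (even-square (suc k)))) (trans (S₄-quadruple (suc k ℕ.* suc k)) (S-square (suc k)))))
                  (trans (cancel (+ l)) (cong (+_) (trans e (even-square (suc k)))))))
            (divides (+ (suc k ℕ.* suc k ℕ.+ suc k ℕ.* suc k)) (twice (+ (suc k ℕ.* suc k ℕ.+ suc k ℕ.* suc k))))
          where
          cancel : ∀ l → l - 1ℤ + 1ℤ ≡ l
          cancel = solve-∀
          twice : ∀ m → m + m ≡ m * + 2
          twice = solve-∀

  -- The multiplier given to `comb` is the geometric series of 1/(1 + 2S) cut after the cubic term.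
  -- That polynomial is -φ³ + 2 + 4S + 16S², since -φ³ supplies the term -8S³.
  P-mod16 : P ≋ κ (+ 2) ⊕ κ (+ 4) ⊛ S ⊕ ⊖ r₃ ⊕ κ (+ 16) ⊛ (S ⊛ S ⊕ S ⊛ S ⊛ (S ⊛ S) ⊛ P)
  P-mod16 = comb (κ 1ℤ ⊕ κ (- + 2) ⊛ S ⊕ κ (+ 4) ⊛ (S ⊛ S) ⊕ κ (- + 8) ⊛ (S ⊛ S ⊛ S)) φ⊛P
    (solve 2 (λ p s →
       p :+ (con 1ℤ :+ con (- + 2) :* s :+ con (+ 4) :* (s :* s) :+ con (- + 8) :* (s :* s :* s)) :* con 1ℤ
       := con (+ 2) :+ con (+ 4) :* s :+ :- ((con 1ℤ :+ con (+ 2) :* s) :* (con 1ℤ :+ con (+ 2) :* s) :* (con 1ℤ :+ con (+ 2) :* s)) :+ con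
           (+ 16) :* (s :* s :+ s :* s :* (s :* s) :* p)
         :+ (con 1ℤ :+ con (- + 2) :* s :+ con (+ 4) :* (s :* s) :+ con (- + 8) :* (s :* s :* s)) :* ((con 1ℤ :+ con (+ 2) :* s) :* p))
             ≋.refl P S)

  private
    Sp2 Sp4 Sp5 Sp6 : Series
    Sp2 = S ⊛ S
    Sp4 = Sp2 ⊛ Sp2
    Sp5 = Sp4 ⊛ S
    Sp6 = Sp4 ⊛ Sp2

  -- The geometric series is cut after S⁶ because the next term carries 2⁷, the largest modulus in
  -- the theorem.
  P-expansion : P ≋ κ (+ 2) ⊕ κ (+ 4) ⊛ S ⊕ κ (+ 16) ⊛ Sp2 ⊕ κ (- 1ℤ) ⊛ r₃ ⊕ κ (+ 16) ⊛ Sp4 ⊕ κ (- + 32) ⊛ Sp5 ⊕ κ (+ 64) ⊛ Sp6 ⊕ κ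
      (+ 128) ⊛ (⊖ (Sp6 ⊛ S ⊛ P))
  P-expansion = comb (κ 1ℤ ⊕ κ (- + 2) ⊛ S ⊕ κ (+ 4) ⊛ Sp2 ⊕ κ (- + 8) ⊛ (Sp2 ⊛ S) ⊕ κ (+ 16) ⊛ Sp4 ⊕ κ (- + 32) ⊛ Sp5 ⊕ κ (+ 64) ⊛ Sp6) φ⊛P
    (solve 2 (λ p s → let s² = s :* s ; s⁴ = s² :* s² ; s⁵ = s⁴ :* s ; s⁶ = s⁴ :* s² ; f = con 1ℤ :+ con (+ 2) :* s
                          w = con 1ℤ :+ con (- + 2) :* s :+ con (+ 4) :* s² :+ con (- + 8) :* (s² :* s) :+ con (+ 16) :* s⁴ :+ con
                              (- + 32) :* s⁵ :+ con (+ 64) :* s⁶ in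
       p :+ w :* con 1ℤ
       := con (+ 2) :+ con (+ 4) :* s :+ con (+ 16) :* s² :+ con (- 1ℤ) :* (f :* f :* f) :+ con (+ 16) :* s⁴ :+ con (- + 32) :* s⁵ :+ con
           (+ 64) :* s⁶ :+ con (+ 128) :* (:- (s⁶ :* s :* p))
         :+ w :* (f :* p)) ≋.refl P S)

  ΘSp2 : Θ Sp2 ≋ κ (+ 2) ⊛ (S ⊛ U)
  ΘSp2 = ≋.trans (Θ-⊛ S S) (solve 2 (λ u s → u :* s :+ s :* u := con (+ 2) :* (s :* u)) ≋.refl U S)

  ΘSp4 : Θ Sp4 ≋ κ (+ 4) ⊛ (Sp2 ⊛ S ⊛ U)
  ΘSp4 = ≋.trans (Θ-⊛ Sp2 Sp2) (≋.trans (⊕-cong (⊛-cong ΘSp2 (≋.refl {Sp2})) (⊛-cong (≋.refl {Sp2}) ΘSp2))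
    (solve 2 (λ u s → con (+ 2) :* (s :* u) :* (s :* s) :+ (s :* s) :* (con (+ 2) :* (s :* u)) :=
        con (+ 4) :* (s :* s :* s :* u)) ≋.refl U S))

  ΘSp5 : Θ Sp5 ≋ κ (+ 5) ⊛ (Sp4 ⊛ U)
  ΘSp5 = ≋.trans (Θ-⊛ Sp4 S) (≋.trans (⊕-cong (⊛-cong ΘSp4 (≋.refl {S})) (≋.refl {Sp4 ⊛ U}))
    (solve 2 (λ u s → con (+ 4) :* (s :* s :* s :* u) :* s :+ (s :* s) :* (s :* s) :* u :=
        con (+ 5) :* ((s :* s) :* (s :* s) :* u)) ≋.refl U S))

  ΘSp6 : Θ Sp6 ≋ κ (+ 6) ⊛ (Sp4 ⊛ S ⊛ U)
  ΘSp6 = ≋.trans (Θ-⊛ Sp4 Sp2) (≋.trans (⊕-cong (⊛-cong ΘSp4 (≋.refl {Sp2})) (⊛-cong (≋.refl {Sp4}) ΘSp2))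
    (solve 2 (λ u s → con (+ 4) :* (s :* s :* s :* u) :* (s :* s) :+ (s :* s) :* (s :* s) :* (con (+ 2) :* (s :* u)) :=
        con (+ 6) :* ((s :* s) :* (s :* s) :* s :* u)) ≋.refl U S))

  -- The coefficients of Θ(S² + S⁴ - 2 S⁵).
  B : Series
  B = κ (+ 2) ⊛ (S ⊛ U) ⊕ κ (+ 4) ⊛ (Sp2 ⊛ S ⊛ U) ⊕ κ (- + 10) ⊛ (Sp4 ⊛ U)

  -- Differentiation kills the constant and multiplies even powers by 2: the term 64 S⁶ acquires 6
  -- and drops into the error modulo 128, while S², S⁴ and S⁵ are collected in 16 `B`.
  ΘP : ∃[ h ] Θ P ≋ κ (- 1ℤ) ⊛ Θ r₃ ⊕ κ (+ 4) ⊛ U ⊕ κ (+ 16) ⊛ B ⊕ κ (+ 128) ⊛ h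
  ΘP = κ (+ 3) ⊛ (Sp4 ⊛ S ⊛ U) ⊕ Θ h₀ , ≋.trans (Θ-cong P-expansion) (≋.trans linear
      (solve 5 (λ r u b t h → con 0ℤ :+ con (+ 4) :* u :+ con (+ 16) :* (con (+ 2) :* (t :* u)) :+ con (- 1ℤ) :* r :+ con (+ 16) :*
          (con (+ 4) :* (t :* t :* t :* u))
          :+ con (- + 32) :* (con (+ 5) :* (t :* t :* (t :* t) :* u)) :+ con (+ 64) :* (con (+ 6) :* (t :* t :* (t :* t) :* t :* u)) :+ con
              (+ 128) :* h
          := con (- 1ℤ) :* r :+ con (+ 4) :* u :+ con (+ 16) :*
              (con (+ 2) :* (t :* u) :+ con (+ 4) :* (t :* t :* t :* u) :+ con (- + 10) :* (t :* t :* (t :* t) :* u))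
             :+ con (+ 128) :* (con (+ 3) :* (t :* t :* (t :* t) :* t :* u) :+ h)) ≋.refl (Θ r₃) U B S (Θ h₀)))
    where
    h₀ = ⊖ (Sp6 ⊛ S ⊛ P)
    Θκ : Θ (κ (+ 2)) ≋ κ 0ℤ
    Θκ = pointwise λ { zero → refl ; (suc n) → ℤₚ.*-zeroʳ (+ suc n) }
    step : ∀ {f f′} c g {g′} → Θ f ≋ f′ → Θ g ≋ g′ → Θ (f ⊕ κ c ⊛ g) ≋ f′ ⊕ κ c ⊛ g′
    step {f} c g p q = ≋.trans (Θ-⊕ f (κ c ⊛ g)) (⊕-cong p (≋.trans (Θ-κ⊛ c g) (⊛-cong (≋.refl {κ c}) q)))
    linear : Θ (κ (+ 2) ⊕ κ (+ 4) ⊛ S ⊕ κ (+ 16) ⊛ Sp2 ⊕ κ (- 1ℤ) ⊛ r₃ ⊕ κ (+ 16) ⊛ Sp4 ⊕ κ (- + 32) ⊛ Sp5 ⊕ κ (+ 64) ⊛ Sp6 ⊕ κ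
        (+ 128) ⊛ h₀)
      ≋ κ 0ℤ ⊕ κ (+ 4) ⊛ U ⊕ κ (+ 16) ⊛ (κ (+ 2) ⊛ (S ⊛ U)) ⊕ κ (- 1ℤ) ⊛ Θ r₃ ⊕ κ (+ 16) ⊛ (κ (+ 4) ⊛ (Sp2 ⊛ S ⊛ U))
        ⊕ κ (- + 32) ⊛ (κ (+ 5) ⊛ (Sp4 ⊛ U)) ⊕ κ (+ 64) ⊛ (κ (+ 6) ⊛ (Sp4 ⊛ S ⊛ U)) ⊕ κ (+ 128) ⊛ Θ h₀
    linear = step (+ 128) h₀ (step (+ 64) Sp6 (step (- + 32) Sp5
        (step (+ 16) Sp4 (step (- 1ℤ) r₃ (step (+ 16) Sp2 (step (+ 4) S Θκ ≋.refl) ΘSp2) ≋.refl) ΘSp4) ΘSp5) ΘSp6) ≋.refl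

  private
    -- Cofactors in S² = S₂ + 2E, S₂² = S₄ + 2E₂, O₂² = O₄ + 2G and U = O + 4W.
    E E₂ G W h₈ : Series
    E  = proj₁ (frobenius S)
    E₂ = proj₁ (frobenius S₂)
    G  = proj₁ (frobenius O₂)
    h₈ = proj₁ (quotient (+ 8) U (O ⊕ κ (+ 4) ⊛ O₄) U-mod8)
    W  = O₄ ⊕ κ (+ 2) ⊛ h₈

    U-W : U ≋ O ⊕ κ (+ 4) ⊛ W
    U-W = ≋.trans (proj₂ (quotient (+ 8) U (O ⊕ κ (+ 4) ⊛ O₄) U-mod8))
      (solve 3 (λ o v h → o :+ con (+ 4) :* v :+ con (+ 8) :* h := o :+ con (+ 4) :* (v :+ con (+ 2) :* h)) ≋.refl O O₄ h₈)

    B-substituted : B ≋ κ (+ 2) ⊛ ((S₄ ⊕ O) ⊛ (O ⊕ κ (+ 4) ⊛ W)) ⊕ κ (+ 4) ⊛ ((S₂ ⊕ κ (+ 2) ⊛ E) ⊛ (S₄ ⊕ O) ⊛ (O ⊕ κ (+ 4) ⊛ W))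
                      ⊕ κ (- + 10) ⊛ ((S₂ ⊕ κ (+ 2) ⊛ E) ⊛ (S₂ ⊕ κ (+ 2) ⊛ E) ⊛ (O ⊕ κ (+ 4) ⊛ W))
    B-substituted = ⊕-cong (⊕-cong (⊛-cong ≋.refl (⊛-cong S-split U-W)) (⊛-cong ≋.refl (⊛-cong (⊛-cong (proj₂ (frobenius S)) S-split) U-W)))
      (⊛-cong ≋.refl (⊛-cong (⊛-cong (proj₂ (frobenius S)) (proj₂ (frobenius S))) U-W))

  -- Since S₂² ≡ S₄ modulo 2, the terms 2 S₄ O and -10 S₂² O cancel modulo 4; what remains is 2 O²,
  -- which `O²-factor` reduces to 2 O₂.
  B-mod4 : ∃[ h ] B ≋ κ (+ 2) ⊛ O₂ ⊕ κ (+ 4) ⊛ h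
  B-mod4 = h , (begin
      B
        ≈⟨ B-substituted ⟩
      κ (+ 2) ⊛ ((S₄ ⊕ O) ⊛ (O ⊕ κ (+ 4) ⊛ W)) ⊕ κ (+ 4) ⊛ ((S₂ ⊕ κ (+ 2) ⊛ E) ⊛ (S₄ ⊕ O) ⊛ (O ⊕ κ (+ 4) ⊛ W))
                      ⊕ κ (- + 10) ⊛ ((S₂ ⊕ κ (+ 2) ⊛ E) ⊛ (S₂ ⊕ κ (+ 2) ⊛ E) ⊛ (O ⊕ κ (+ 4) ⊛ W))
        ≈⟨ solve 5 (λ s₄ o w s₂ e → con (+ 2) :* ((s₄ :+ o) :* (o :+ con (+ 4) :* w)) :+ con (+ 4) :*
            ((s₂ :+ con (+ 2) :* e) :* (s₄ :+ o) :* (o :+ con (+ 4) :* w))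
              :+ con (- + 10) :* ((s₂ :+ con (+ 2) :* e) :* (s₂ :+ con (+ 2) :* e) :* (o :+ con (+ 4) :* w))
            := con (+ 2) :* (o :* o) :+ con (- + 10) :* (s₂ :* s₂) :* o :+ con (+ 2) :* s₄ :* o :+ con (+ 4) :*
                (con (+ 2) :* ((s₄ :+ o) :* w) :+ (s₂ :+ con (+ 2) :* e) :* (s₄ :+ o) :* (o :+ con (+ 4) :* w)
               :+ con (- + 10) :* ((s₂ :* e :+ e :* e) :* o) :+ con (- + 10) :* ((s₂ :+ con (+ 2) :* e) :* (s₂ :+ con (+ 2) :* e) :* w)))
                   ≋.refl S₄ O W S₂ E ⟩
      κ (+ 2) ⊛ (O ⊛ O) ⊕ κ (- + 10) ⊛ (S₂ ⊛ S₂) ⊛ O ⊕ κ (+ 2) ⊛ S₄ ⊛ O ⊕ κ (+ 4) ⊛ h₁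
        ≈⟨ ⊕-cong (⊕-cong (⊕-cong (⊛-cong ≋.refl O²-factor) (⊛-cong (⊛-cong ≋.refl (proj₂ (frobenius S₂))) ≋.refl)) ≋.refl) ≋.refl ⟩
      κ (+ 2) ⊛ ((κ 1ℤ ⊕ κ (+ 2) ⊛ S₈) ⊛ O₂) ⊕ κ (- + 10) ⊛ (S₄ ⊕ κ (+ 2) ⊛ E₂) ⊛ O ⊕ κ (+ 2) ⊛ S₄ ⊛ O ⊕ κ (+ 4) ⊛ h₁
        ≈⟨ solve 6 (λ s₈ o₂ s₄ e₂ o h → con (+ 2) :* ((con 1ℤ :+ con (+ 2) :* s₈) :* o₂) :+ con (- + 10) :*
            (s₄ :+ con (+ 2) :* e₂) :* o :+ con (+ 2) :* s₄ :* o :+ con (+ 4) :* h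
            := con (+ 2) :* o₂ :+ con (+ 4) :* (s₈ :* o₂ :+ con (- + 2) :* s₄ :* o :+ con (- + 5) :* e₂ :* o :+ h)) ≋.refl S₈ O₂ S₄ E₂ O h₁
                ⟩
      κ (+ 2) ⊛ O₂ ⊕ κ (+ 4) ⊛ h ∎)
    where
    open import Relation.Binary.Reasoning.Setoid seriesSetoid
    h₁ h : Series
    h₁ = κ (+ 2) ⊛ ((S₄ ⊕ O) ⊛ W) ⊕ (S₂ ⊕ κ (+ 2) ⊛ E) ⊛ (S₄ ⊕ O) ⊛ (O ⊕ κ (+ 4) ⊛ W) ⊕ κ (- + 10) ⊛ ((S₂ ⊛ E ⊕ E ⊛ E) ⊛ O)
           ⊕ κ (- + 10) ⊛ ((S₂ ⊕ κ (+ 2) ⊛ E) ⊛ (S₂ ⊕ κ (+ 2) ⊛ E) ⊛ W)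
    h = S₈ ⊛ O₂ ⊕ κ (- + 2) ⊛ S₄ ⊛ O ⊕ κ (- + 5) ⊛ E₂ ⊛ O ⊕ h₁

  -- The terms linear in O no longer cancel and are kept as one product. The terms 2 O²(1 + 2S₂)
  -- reduce to 2 O₂ + 4 O₄ by `O²-factor`, S₂ = S₈ + O₂ and O₂² ≡ O₄ modulo 2.
  B-mod8 : ∃[ h ] B ≋ κ (+ 2) ⊛ (O ⊛ (S₄ ⊕ κ (+ 2) ⊛ (S₂ ⊛ S₄) ⊕ ⊖ (S₂ ⊛ S₂))) ⊕ κ (+ 2) ⊛ O₂ ⊕ κ (+ 4) ⊛ O₄ ⊕ κ (+ 8) ⊛ h
  B-mod8 = h , (begin
      B
        ≈⟨ B-substituted ⟩
      κ (+ 2) ⊛ ((S₄ ⊕ O) ⊛ (O ⊕ κ (+ 4) ⊛ W)) ⊕ κ (+ 4) ⊛ ((S₂ ⊕ κ (+ 2) ⊛ E) ⊛ (S₄ ⊕ O) ⊛ (O ⊕ κ (+ 4) ⊛ W))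
                      ⊕ κ (- + 10) ⊛ ((S₂ ⊕ κ (+ 2) ⊛ E) ⊛ (S₂ ⊕ κ (+ 2) ⊛ E) ⊛ (O ⊕ κ (+ 4) ⊛ W))
        ≈⟨ solve 5 (λ s₄ o w s₂ e → con (+ 2) :* ((s₄ :+ o) :* (o :+ con (+ 4) :* w)) :+ con (+ 4) :*
            ((s₂ :+ con (+ 2) :* e) :* (s₄ :+ o) :* (o :+ con (+ 4) :* w))
              :+ con (- + 10) :* ((s₂ :+ con (+ 2) :* e) :* (s₂ :+ con (+ 2) :* e) :* (o :+ con (+ 4) :* w))
            := con (+ 2) :* (o :* (s₄ :+ con (+ 2) :* (s₂ :* s₄) :+ :- (s₂ :* s₂))) :+ con (+ 2) :* (o :* o) :* (con 1ℤ :+ con (+ 2) :* s₂)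
               :+ con (+ 8) :* ((s₄ :+ o) :* w :+ e :* (s₄ :+ o) :* (o :+ con (+ 4) :* w) :+ con (+ 2) :* (s₂ :* (s₄ :+ o) :* w) :+ :-
                   (s₂ :* s₂ :* o)
               :+ con (- + 5) :* ((s₂ :* e :+ e :* e) :* o) :+ con (- + 5) :* ((s₂ :+ con (+ 2) :* e) :* (s₂ :+ con (+ 2) :* e) :* w)))
                   ≋.refl S₄ O W S₂ E ⟩
      main ⊕ κ (+ 2) ⊛ (O ⊛ O) ⊛ (κ 1ℤ ⊕ κ (+ 2) ⊛ S₂) ⊕ κ (+ 8) ⊛ h₁
        ≈⟨ ⊕-cong (⊕-cong ≋.refl (⊛-cong (⊛-cong ≋.refl O²-factor) (⊕-cong ≋.refl (⊛-cong ≋.refl S₂-split)))) ≋.refl ⟩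
      main ⊕ κ (+ 2) ⊛ ((κ 1ℤ ⊕ κ (+ 2) ⊛ S₈) ⊛ O₂) ⊛ (κ 1ℤ ⊕ κ (+ 2) ⊛ (S₈ ⊕ O₂)) ⊕ κ (+ 8) ⊛ h₁
        ≈⟨ solve 4 (λ m s₈ o₂ h → m :+ con (+ 2) :* ((con 1ℤ :+ con (+ 2) :* s₈) :* o₂) :* (con 1ℤ :+ con (+ 2) :* (s₈ :+ o₂)) :+ con
            (+ 8) :* h
            := m :+ con (+ 2) :* o₂ :+ con (+ 4) :* (o₂ :* o₂) :+ con (+ 8) :* (s₈ :* o₂ :+ s₈ :* s₈ :* o₂ :+ s₈ :* o₂ :* o₂ :+ h)) ≋.refl
                main S₈ O₂ h₁ ⟩
      main ⊕ κ (+ 2) ⊛ O₂ ⊕ κ (+ 4) ⊛ (O₂ ⊛ O₂) ⊕ κ (+ 8) ⊛ h₂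
        ≈⟨ ⊕-cong (⊕-cong ≋.refl (⊛-cong ≋.refl (proj₂ (frobenius O₂)))) ≋.refl ⟩
      main ⊕ κ (+ 2) ⊛ O₂ ⊕ κ (+ 4) ⊛ (O₄ ⊕ κ (+ 2) ⊛ G) ⊕ κ (+ 8) ⊛ h₂
        ≈⟨ solve 5 (λ m o₂ o₄ g h → m :+ con (+ 2) :* o₂ :+ con (+ 4) :* (o₄ :+ con (+ 2) :* g) :+ con (+ 8) :* h :=
            m :+ con (+ 2) :* o₂ :+ con (+ 4) :* o₄ :+ con (+ 8) :* (g :+ h)) ≋.refl main O₂ O₄ G h₂ ⟩
      main ⊕ κ (+ 2) ⊛ O₂ ⊕ κ (+ 4) ⊛ O₄ ⊕ κ (+ 8) ⊛ h ∎)
    where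
    open import Relation.Binary.Reasoning.Setoid seriesSetoid
    main h₁ h₂ h : Series
    main = κ (+ 2) ⊛ (O ⊛ (S₄ ⊕ κ (+ 2) ⊛ (S₂ ⊛ S₄) ⊕ ⊖ (S₂ ⊛ S₂)))
    h₁ = (S₄ ⊕ O) ⊛ W ⊕ E ⊛ (S₄ ⊕ O) ⊛ (O ⊕ κ (+ 4) ⊛ W) ⊕ κ (+ 2) ⊛ (S₂ ⊛ (S₄ ⊕ O) ⊛ W) ⊕ ⊖ (S₂ ⊛ S₂ ⊛ O)
          ⊕ κ (- + 5) ⊛ ((S₂ ⊛ E ⊕ E ⊛ E) ⊛ O) ⊕ κ (- + 5) ⊛ ((S₂ ⊕ κ (+ 2) ⊛ E) ⊛ (S₂ ⊕ κ (+ 2) ⊛ E) ⊛ W)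
    h₂ = S₈ ⊛ O₂ ⊕ S₈ ⊛ S₈ ⊛ O₂ ⊕ S₈ ⊛ O₂ ⊛ O₂ ⊕ h₁
    h = G ⊕ h₂

-- Coefficient congruences and ternary theta series in terms of r₃.

module Coefficients where

  open PowerSeries
  open Overpartitions using (φ; S; P; φ⊛P)
  open ThetaSeries using (r₃)
  open SeriesOperators
  open Squares
  open Expansions
  open SeriesSolver using (solve; _:=_; _:+_; _:*_; _:-_; :-_; con)

  -- A and C are the parts of odd exponent of the theta series of x² + y² + 2z² and x² + 2y² + 2z².
  A C : Series
  A = κ (+ 4) ⊛ (φ₂ ⊛ (φ₄ ⊛ O))
  C = κ (+ 2) ⊛ (O ⊛ (φ₂ ⊛ φ₂))

  at : ∀ c f n → (κ c ⊛ f) n ≡ c * f n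
  at = κ-⊛

  P-coeff-mod16 : ∀ n → + 16 ∣ P n - (κ (+ 2) n + + 4 * S n - r₃ n)
  P-coeff-mod16 n = subst (λ z → + 16 ∣ P n - z)
    (trans (⊕-coeff (κ (+ 2) ⊕ κ (+ 4) ⊛ S) (⊖ r₃) n) (cong₂ _+_
        (trans (⊕-coeff (κ (+ 2)) (κ (+ 4) ⊛ S) n) (cong (λ z → κ (+ 2) n + z) (at (+ 4) S n))) (⊖-coeff r₃ n)))
    (remainder {+ 16} {P} {κ (+ 2) ⊕ κ (+ 4) ⊛ S ⊕ ⊖ r₃} P-mod16 n)

  ΘP-coeff-mod64 : ∀ n → + 64 ∣ + n * P n - (- (+ n * r₃ n) + + 4 * (+ n * S n) + + 32 * O₂ n)
  ΘP-coeff-mod64 n = subst (λ z → + 64 ∣ + n * P n - z) value (remainder {+ 64} {Θ P} {R} (≋.trans (proj₂ ΘP)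
      (≋.trans (⊕-cong (⊕-cong ≋.refl (⊛-cong ≋.refl (proj₂ B-mod4))) ≋.refl)
        (solve 5 (λ r u o h₁ h₂ → con (- 1ℤ) :* r :+ con (+ 4) :* u :+ con (+ 16) :* (con (+ 2) :* o :+ con (+ 4) :* h₁) :+ con
            (+ 128) :* h₂
           := con (- 1ℤ) :* r :+ con (+ 4) :* u :+ con (+ 32) :* o :+ con (+ 64) :* (h₁ :+ con (+ 2) :* h₂)) ≋.refl (Θ r₃) U O₂
               (proj₁ B-mod4) (proj₁ ΘP)))) n)
    where
    R = κ (- 1ℤ) ⊛ Θ r₃ ⊕ κ (+ 4) ⊛ U ⊕ κ (+ 32) ⊛ O₂
    value : R n ≡ - (+ n * r₃ n) + + 4 * (+ n * S n) + + 32 * O₂ n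
    value = trans (⊕-coeff (κ (- 1ℤ) ⊛ Θ r₃ ⊕ κ (+ 4) ⊛ U) (κ (+ 32) ⊛ O₂) n)
      (cong₂ _+_ (trans (⊕-coeff (κ (- 1ℤ) ⊛ Θ r₃) (κ (+ 4) ⊛ U) n)
          (cong₂ _+_ (trans (at (- 1ℤ) (Θ r₃) n) (ℤₚ.-1*i≡-i (+ n * r₃ n))) (at (+ 4) U n))) (at (+ 32) O₂ n))

  -- The product with O from `B-mod8` is rewritten by 32 O (S₄ + 2 S₂ S₄ - S₂²) = 4A - 4C - 8O: a
  -- difference of theta series and one term on squares.
  ΘP-coeff-mod128 : ∀ n → + 128 ∣ + n * P n - (- (+ n * r₃ n) + + 4 *
      (+ n * S n) + + 4 * A n + - + 4 * C n + - + 8 * O n + + 32 * O₂ n + + 64 * O₄ n)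
  ΘP-coeff-mod128 n = subst (λ z → + 128 ∣ + n * P n - z) value (remainder {+ 128} {Θ P} {R} (≋.trans (proj₂ ΘP)
      (≋.trans (⊕-cong (⊕-cong ≋.refl (⊛-cong ≋.refl (proj₂ B-mod8))) ≋.refl)
        (solve 9 (λ r u o s₂ s₄ o₂ o₄ h₁ h₂ → con (- 1ℤ) :* r :+ con (+ 4) :* u
              :+ con (+ 16) :* (con (+ 2) :* (o :* (s₄ :+ con (+ 2) :* (s₂ :* s₄) :+ :- (s₂ :* s₂))) :+ con (+ 2) :* o₂ :+ con
                  (+ 4) :* o₄ :+ con (+ 8) :* h₁) :+ con (+ 128) :* h₂
           := con (- 1ℤ) :* r :+ con (+ 4) :* u :+ con (+ 4) :*
               (con (+ 4) :* ((con 1ℤ :+ con (+ 2) :* s₂) :* ((con 1ℤ :+ con (+ 2) :* s₄) :* o)))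
              :+ con (- + 4) :* (con (+ 2) :* (o :* ((con 1ℤ :+ con (+ 2) :* s₂) :* (con 1ℤ :+ con (+ 2) :* s₂))))
              :+ con (- + 8) :* o :+ con (+ 32) :* o₂ :+ con (+ 64) :* o₄ :+ con (+ 128) :* (h₁ :+ h₂)) ≋.refl (Θ r₃) U O S₂ S₄ O₂ O₄
                  (proj₁ B-mod8) (proj₁ ΘP)))) n)
    where
    R = κ (- 1ℤ) ⊛ Θ r₃ ⊕ κ (+ 4) ⊛ U ⊕ κ (+ 4) ⊛ A ⊕ κ (- + 4) ⊛ C ⊕ κ (- + 8) ⊛ O ⊕ κ (+ 32) ⊛ O₂ ⊕ κ (+ 64) ⊛ O₄
    add : ∀ {f x} c g → f n ≡ x → (f ⊕ κ c ⊛ g) n ≡ x + c * g n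
    add {f} c g e = trans (⊕-coeff f (κ c ⊛ g) n) (cong₂ _+_ e (at c g n))
    value : R n ≡ - (+ n * r₃ n) + + 4 * (+ n * S n) + + 4 * A n + - + 4 * C n + - + 8 * O n + + 32 * O₂ n + + 64 * O₄ n
    value = add (+ 64) O₄ (add (+ 32) O₂ (add (- + 8) O
        (add (- + 4) C (add (+ 4) A (add (+ 4) U (trans (at (- 1ℤ) (Θ r₃) n) (ℤₚ.-1*i≡-i (+ n * r₃ n))))))))

  -- P = 1 - 2 S P. The factor 2 is spent on replacing the inverse of ℓ² modulo 16 by 1, which is
  -- correct only modulo 8.
  P-even : ∀ n → + 2 ∣ P (suc n)
  P-even n = divides (- (S ⊛ P) (suc n)) (trans (isolate (P (suc n)) ((S ⊛ P) (suc n)))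
      (trans (cong (_- + 2 * (S ⊛ P) (suc n)) (trans (sym
          (trans (⊕-coeff P (κ (+ 2) ⊛ (S ⊛ P)) (suc n)) (cong (λ x → P (suc n) + x) (at (+ 2) (S ⊛ P) (suc n))))) (coeff unit (suc n))))
        (negate ((S ⊛ P) (suc n)))))
    where
    unit : P ⊕ κ (+ 2) ⊛ (S ⊛ P) ≋ κ 1ℤ
    unit = ≋.trans (solve 2 (λ p s → p :+ con (+ 2) :* (s :* p) := (con 1ℤ :+ con (+ 2) :* s) :* p) ≋.refl P S) φ⊛P
    isolate : ∀ x y → x ≡ (x + + 2 * y) - + 2 * y
    isolate = solve-∀
    negate : ∀ y → 0ℤ - + 2 * y ≡ - y * + 2
    negate = solve-∀

  -- Θ φ³ = 6 φ² U and φ² ≡ 1 modulo 4. Multiplied by ℓ² - 1, it lets a term supported on squares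
  -- take the place of n r₃(n).
  nr₃-mod8 : ∀ n → + 8 ∣ + n * r₃ n - + 6 * (+ n * S n)
  nr₃-mod8 n = subst (λ z → + 8 ∣ + n * r₃ n - z) (at (+ 6) U n) (remainder {+ 8} {Θ r₃} {κ (+ 6) ⊛ U} (≋.trans (Θ-⊛ (φ ⊛ φ) φ)
      (≋.trans (⊕-cong (⊛-cong (Θ-⊛ φ φ) ≋.refl) ≋.refl)
          (≋.trans (⊕-cong (⊛-cong (⊕-cong (⊛-cong Θφ ≋.refl) (⊛-cong ≋.refl Θφ)) ≋.refl) (⊛-cong ≋.refl Θφ))
        (solve 2 (λ u s → ((con (+ 2) :* u) :* (con 1ℤ :+ con (+ 2) :* s) :+ (con 1ℤ :+ con (+ 2) :* s) :* (con (+ 2) :* u)) :*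
            (con 1ℤ :+ con (+ 2) :* s)
              :+ (con 1ℤ :+ con (+ 2) :* s) :* (con 1ℤ :+ con (+ 2) :* s) :* (con (+ 2) :* u)
            := con (+ 6) :* u :+ con (+ 8) :* (con (+ 3) :* (s :* u) :+ con (+ 3) :* (s :* s :* u))) ≋.refl U S)))) n)
    where
    Θφ : Θ φ ≋ κ (+ 2) ⊛ U
    Θφ = ≋.trans (Θ-⊕ (κ 1ℤ) (κ (+ 2) ⊛ S)) (≋.trans (⊕-cong (pointwise λ { zero → refl ; (suc n) → ℤₚ.*-zeroʳ (+ suc n) }) (Θ-κ⊛ (+ 2) S))
      (solve 1 (λ u → con 0ℤ :+ u := u) ≋.refl (κ (+ 2) ⊛ U)))

  OddSupp EvenSupp : Series → Set
  OddSupp f  = ∀ m → f (m ℕ.+ m) ≡ 0ℤ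
  EvenSupp f = ∀ m → f (suc (m ℕ.+ m)) ≡ 0ℤ

  OddSupp-⊛ : ∀ {f g} → OddSupp f → EvenSupp g → OddSupp (f ⊛ g)
  OddSupp-⊛ {f} {g} p q m = ⊛-zero f g (m ℕ.+ m) λ i j e → vanish i j e (parity i) (parity j)
    where
    vanish : ∀ i j → i ℕ.+ j ≡ m ℕ.+ m → Parity i → Parity j → f i ≡ 0ℤ ⊎ g j ≡ 0ℤ
    vanish _ _ e (even a) _ = inj₁ (p a)
    vanish _ _ e (odd a) (odd b) = inj₂ (q b)
    vanish _ _ e (odd a) (even b) = ⊥-elim (even≢odd m (a ℕ.+ b) (trans (sym e) (cong suc (arrange a b))))
      where
      arrange : ∀ a b → a ℕ.+ a ℕ.+ (b ℕ.+ b) ≡ a ℕ.+ b ℕ.+ (a ℕ.+ b)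
      arrange = solveℕ

  OddSupp-cong : ∀ {f g} → f ≋ g → OddSupp f → OddSupp g
  OddSupp-cong p q m = trans (sym (coeff p (m ℕ.+ m))) (q m)

  OddSupp-O : OddSupp O
  OddSupp-O m = Supp-0 {1} {O} Supp-O (m ℕ.+ m) (even-≢1 m)

  EvenSupp-φ₂ : EvenSupp φ₂
  EvenSupp-φ₂ m = trans (sym (coeff V-φ (suc (m ℕ.+ m)))) (V-odd φ m)

  EvenSupp-φ₄ : EvenSupp φ₄
  EvenSupp-φ₄ m = trans (sym (coeff V-φ₂ (suc (m ℕ.+ m)))) (V-odd φ₂ m)

  OddSupp-κ⊛ : ∀ {f} c → OddSupp f → OddSupp (κ c ⊛ f)
  OddSupp-κ⊛ {f} c p m = trans (at c f (m ℕ.+ m)) (trans (cong (c *_) (p m)) (ℤₚ.*-zeroʳ c))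

  OddSupp-A : OddSupp A
  OddSupp-A = OddSupp-κ⊛ {φ₂ ⊛ (φ₄ ⊛ O)} (+ 4) (OddSupp-cong {O ⊛ φ₄ ⊛ φ₂} (solve 3 (λ o p q → o :* p :* q := q :* (p :* o)) ≋.refl O φ₄ φ₂)
    (OddSupp-⊛ {O ⊛ φ₄} {φ₂} (OddSupp-⊛ {O} {φ₄} OddSupp-O EvenSupp-φ₄) EvenSupp-φ₂))

  OddSupp-C : OddSupp C
  OddSupp-C = OddSupp-κ⊛ {O ⊛ (φ₂ ⊛ φ₂)} (+ 2) (OddSupp-cong {O ⊛ φ₂ ⊛ φ₂} (solve 2 (λ o p → o :* p :* p := o :* (p :* p)) ≋.refl O φ₂)
    (OddSupp-⊛ {O ⊛ φ₂} {φ₂} (OddSupp-⊛ {O} {φ₂} OddSupp-O EvenSupp-φ₂) EvenSupp-φ₂))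

  -- The components of φ³ supported on the four residue classes modulo 4.
  c₀ c₁ c₂ c₃ : Series
  c₀ = φ₄ ⊛ φ₄ ⊛ φ₄
  c₁ = φ₄ ⊛ φ₄ ⊛ O
  c₂ = φ₄ ⊛ (O ⊛ O)
  c₃ = O ⊛ O ⊛ O

  Supp-c₀ : Supp 0 c₀
  Supp-c₀ = Supp-⊛ {0} {0} {φ₄ ⊛ φ₄} {φ₄} Supp-φ₄² Supp-φ₄
  Supp-c₁ : Supp 1 c₁
  Supp-c₁ = Supp-⊛ {0} {1} {φ₄ ⊛ φ₄} {O} Supp-φ₄² Supp-O
  Supp-c₂ : Supp 2 c₂
  Supp-c₂ = Supp-⊛ {0} {2} {φ₄} {O ⊛ O} Supp-φ₄ Supp-O²
  Supp-c₃ : Supp 3 c₃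
  Supp-c₃ = Supp-⊛ {2} {1} {O ⊛ O} {O} Supp-O² Supp-O

  r₃-split : ∀ n → r₃ n ≡ c₀ n + + 6 * c₁ n + + 12 * c₂ n + + 8 * c₃ n
  r₃-split n = trans (coeff (≋.trans (⊛-cong (⊛-cong φ-split φ-split) φ-split)
      (solve 2 (λ e o → (e :+ con (+ 2) :* o) :* (e :+ con (+ 2) :* o) :* (e :+ con (+ 2) :* o)
         := e :* e :* e :+ con (+ 6) :* (e :* e :* o) :+ con (+ 12) :* (e :* (o :* o)) :+ con (+ 8) :* (o :* o :* o)) ≋.refl φ₄ O)) n)
    (add (+ 8) c₃ (add (+ 12) c₂ (add {c₀} (+ 6) c₁ refl)))
    where
    add : ∀ {f x} c g → f n ≡ x → (f ⊕ κ c ⊛ g) n ≡ x + c * g n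
    add {f} c g e = trans (⊕-coeff f (κ c ⊛ g) n) (cong₂ _+_ e (at c g n))

  private
    ≢-by : ∀ {r a b : ℕ} → r ≡ a → a ≢ b → r ≢ b
    ≢-by e a≢b f = a≢b (trans (sym e) f)

  r₃-1mod4 : ∀ n → n % 4 ≡ 1 → r₃ n ≡ + 6 * c₁ n
  r₃-1mod4 n e = trans (r₃-split n) (trans (cong₂ (λ x y → x + + 6 * c₁ n + + 12 * y + + 8 * c₃ n)
      (Supp-0 {0} {c₀} Supp-c₀ n (≢-by e (λ ()))) (Supp-0 {2} {c₂} Supp-c₂ n (≢-by e (λ ()))))
    (trans (cong (λ y → 0ℤ + + 6 * c₁ n + + 12 * 0ℤ + + 8 * y) (Supp-0 {3} {c₃} Supp-c₃ n (≢-by e (λ ())))) (identity (c₁ n))))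
    where
    identity : ∀ x → 0ℤ + + 6 * x + + 12 * 0ℤ + + 8 * 0ℤ ≡ + 6 * x
    identity = solve-∀

  r₃-2mod4 : ∀ n → n % 4 ≡ 2 → r₃ n ≡ + 12 * c₂ n
  r₃-2mod4 n e = trans (r₃-split n) (trans (cong₂ (λ x y → x + + 6 * y + + 12 * c₂ n + + 8 * c₃ n)
      (Supp-0 {0} {c₀} Supp-c₀ n (≢-by e (λ ()))) (Supp-0 {1} {c₁} Supp-c₁ n (≢-by e (λ ()))))
    (trans (cong (λ y → 0ℤ + + 6 * 0ℤ + + 12 * c₂ n + + 8 * y) (Supp-0 {3} {c₃} Supp-c₃ n (≢-by e (λ ())))) (identity (c₂ n))))
    where
    identity : ∀ x → 0ℤ + + 6 * 0ℤ + + 12 * x + + 8 * 0ℤ ≡ + 12 * x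
    identity = solve-∀

  r₃-3mod4 : ∀ n → n % 4 ≡ 3 → r₃ n ≡ + 8 * c₃ n
  r₃-3mod4 n e = trans (r₃-split n) (trans (cong₂ (λ x y → x + + 6 * y + + 12 * c₂ n + + 8 * c₃ n)
      (Supp-0 {0} {c₀} Supp-c₀ n (≢-by e (λ ()))) (Supp-0 {1} {c₁} Supp-c₁ n (≢-by e (λ ()))))
    (trans (cong (λ y → 0ℤ + + 6 * 0ℤ + + 12 * y + + 8 * c₃ n) (Supp-0 {2} {c₂} Supp-c₂ n (≢-by e (λ ())))) (identity (c₃ n))))
    where
    identity : ∀ x → 0ℤ + + 6 * 0ℤ + + 12 * 0ℤ + + 8 * x ≡ + 8 * x
    identity = solve-∀

  -- The component `c₁` is φ₄² O with φ₄² ≡ 1 modulo 4. At n = ℓ² this determines (-1/ℓ).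
  r₃-mod8 : ∀ n → n % 4 ≡ 1 → + 8 ∣ r₃ n - + 6 * O n
  r₃-mod8 n e = subst (λ x → + 8 ∣ x - + 6 * O n) (sym (r₃-1mod4 n e)) (subst (+ 8 ∣_) scale
      (∣-trs {+ 8} {+ 24} (divides (+ 3) refl) (∣-mono (+ 6)
          (remainder {+ 4} {c₁} {O} {h} (solve 2 (λ s o → (con 1ℤ :+ con (+ 2) :* s) :* (con 1ℤ :+ con (+ 2) :* s) :* o :=
          o :+ con (+ 4) :* (s :* o :+ s :* s :* o)) ≋.refl S₄ O) n))))
    where
    h : Series
    h = S₄ ⊛ O ⊕ S₄ ⊛ S₄ ⊛ O
    identity : ∀ x y → + 6 * (x - y) ≡ + 6 * x - + 6 * y
    identity = solve-∀
    scale : + 6 * (c₁ n - O n) ≡ + 6 * c₁ n - + 6 * O n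
    scale = identity (c₁ n) (O n)

  -- By `O²` the component c₂ = φ₄ O² is φ₂ φ₄ O with q² for q. So the part of φ³ with exponents 2
  -- modulo 4 is 12 times that series, and `A` is 4 times it before the substitution.
  A-r₃ : ∀ m → let n = suc (m ℕ.+ m) in + 3 * A n ≡ r₃ (n ℕ.+ n)
  A-r₃ m = sym (trans (r₃-2mod4 (n ℕ.+ n) n+n%4) (trans (cong (+ 12 *_) (trans (coeff c₂-V (n ℕ.+ n)) (V-double (φ₂ ⊛ (φ₄ ⊛ O)) n)))
      (trans (identity ((φ₂ ⊛ (φ₄ ⊛ O)) n)) (cong (+ 3 *_) (sym (at (+ 4) (φ₂ ⊛ (φ₄ ⊛ O)) n))))))
    where
    n = suc (m ℕ.+ m)
    n+n%4 : (n ℕ.+ n) % 4 ≡ 2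
    n+n%4 = trans (cong (_% 4) (e m)) (ℕ/.[m+kn]%n≡m%n 2 m 4)
      where
      e : ∀ m → suc (m ℕ.+ m) ℕ.+ suc (m ℕ.+ m) ≡ 2 ℕ.+ m ℕ.* 4
      e = solveℕ
    c₂-V : c₂ ≋ V (φ₂ ⊛ (φ₄ ⊛ O))
    c₂-V = ≋.sym (≋.trans (V-⊛ φ₂ (φ₄ ⊛ O)) (⊛-cong V-φ₂ (≋.sym O²)))
    identity : ∀ x → + 12 * x ≡ + 3 * (+ 4 * x)
    identity = solve-∀

  -- By `φ₂²` the series `C` has the same odd components as φ³, with weights 2 and 8 in place of 6
  -- and 8; hence a factor 3 on exponents 1 modulo 4 and none on 3 modulo 4.
  C-split : ∀ n → C n ≡ + 2 * c₁ n + + 8 * c₃ n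
  C-split n = trans (coeff (≋.trans (⊛-cong ≋.refl (⊛-cong ≋.refl φ₂²))
      (solve 2 (λ e o → con (+ 2) :* (o :* (e :* e :+ con (+ 4) :* (o :* o))) :=
      con (+ 2) :* (e :* e :* o) :+ con (+ 8) :* (o :* o :* o)) ≋.refl φ₄ O)) n)
    (trans (⊕-coeff (κ (+ 2) ⊛ c₁) (κ (+ 8) ⊛ c₃) n) (cong₂ _+_ (at (+ 2) c₁ n) (at (+ 8) c₃ n)))

  C-1mod4 : ∀ n → n % 4 ≡ 1 → + 3 * C n ≡ r₃ n
  C-1mod4 n e = trans (cong (+ 3 *_) (trans (C-split n)
      (cong (λ y → + 2 * c₁ n + + 8 * y) (Supp-0 {3} {c₃} Supp-c₃ n (≢-by e (λ ())))))) (trans (identity (c₁ n)) (sym (r₃-1mod4 n e)))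
    where
    identity : ∀ x → + 3 * (+ 2 * x + + 8 * 0ℤ) ≡ + 6 * x
    identity = solve-∀

  C-3mod4 : ∀ n → n % 4 ≡ 3 → C n ≡ r₃ n
  C-3mod4 n e = trans (C-split n) (trans (cong (λ y → + 2 * y + + 8 * c₃ n)
      (Supp-0 {1} {c₁} Supp-c₁ n (≢-by e (λ ())))) (trans (identity (c₃ n)) (sym (r₃-3mod4 n e))))
    where
    identity : ∀ x → + 2 * 0ℤ + + 8 * x ≡ + 8 * x
    identity = solve-∀

  -- The difference is 8 O (S₄ - S₂²) modulo 16, and S₂² ≡ S₄ modulo 2. At n = ℓ² this determines
  -- (-2/ℓ).
  A-C-mod16 : ∀ n → + 16 ∣ A n - (C n + + 2 * O n)
  A-C-mod16 n = subst (λ x → + 16 ∣ A n - x) (trans (⊕-coeff C (κ (+ 2) ⊛ O) n) (cong (λ x → C n + x) (at (+ 2) O n)))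
    (remainder {+ 16} {A} {C ⊕ κ (+ 2) ⊛ O} {h} (comb (κ (+ 8) ⊛ O) (≋.sym (proj₂ (frobenius S₂))) (solve 4 (λ o s₂ s₄ e →
        con (+ 4) :* ((con 1ℤ :+ con (+ 2) :* s₂) :* ((con 1ℤ :+ con (+ 2) :* s₄) :* o)) :+ con (+ 8) :* o :* (s₂ :* s₂)
        := con (+ 2) :* (o :* ((con 1ℤ :+ con (+ 2) :* s₂) :* (con 1ℤ :+ con (+ 2) :* s₂))) :+ con (+ 2) :* o :+ con (+ 16) :*
            (s₂ :* s₄ :* o :+ :- (o :* e))
           :+ con (+ 8) :* o :* (s₄ :+ con (+ 2) :* e)) ≋.refl O S₂ S₄ e)) n)
    where
    e h : Series
    e = proj₁ (frobenius S₂)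
    h = S₂ ⊛ S₄ ⊛ O ⊕ ⊖ (O ⊛ e)

-- Scaling by ℓ² and the supplementary laws.

module Characters where

  open PowerSeries
  open Overpartitions using (S)
  open ThetaSeries using (r₃)
  open SeriesOperators
  open Squares
  open Expansions
  open Coefficients
  open ThreeSquares
  open Counting using (sumL-0; ⟦⟧-no)
  open QuadraticResidues using (legendreResidue; legendre-residue; sumL-cong-below)
  open ℤSolver using (solve; _:=_; _:+_; _:*_; _:-_; :-_; con)

  opaque
    unfolding _⊕_
    r₃-1 : r₃ 1 ≡ + 6
    r₃-1 = refl
    r₃-2 : r₃ 2 ≡ + 12
    r₃-2 = refl
    O-1 : O 1 ≡ 1ℤ
    O-1 = refl

  ∣-zero : ∀ {d x} → x ≡ 0ℤ → d ∣ x
  ∣-zero refl = divides 0ℤ refl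

  OO₂-view : ∀ n → O₂ n ≡ 0ℤ ⊎ (∃[ x ] n ≡ x ℕ.* x ℕ.+ x ℕ.* x)
  OO₂-view n with parity n
  ... | odd m = inj₁ (V-odd O m)
  ... | even m with squareView m
  ...   | isSquare x e _ = inj₂ (suc x , cong₂ ℕ._+_ e e)
  ...   | notSquare _ s = inj₁ (trans (V-double O m) (trans (O-coeff m) (cong₂ _-_ s (S₄-vanishes m s))))

  O-vanishes : ∀ n → S n ≡ 0ℤ → O n ≡ 0ℤ
  O-vanishes n s = trans (O-coeff n) (cong₂ _-_ s (S₄-vanishes n s))

  O₄-vanishes : ∀ n → S n ≡ 0ℤ → O₄ n ≡ 0ℤ
  O₄-vanishes n s with parity n
  ... | odd m = V-odd O₂ m
  ... | even m with parity m
  ...   | odd k = trans (V-double O₂ (suc (k ℕ.+ k))) (V-odd O k)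
  ...   | even k = trans (V-double O₂ (k ℕ.+ k)) (trans (V-double O k) (O-vanishes k (trans (sym (S-quadruple k)) s)))

  module Congruences {ℓ : ℕ} (ℓ-prime : Prime ℓ) (ℓ-odd : ℓ % 2 ≡ 1) where
    open HeckeRelation ℓ-prime ℓ-odd

    private
      L u : ℤ
      L = + ℓ
      u = L * L - 1ℤ
      q : ℕ
      q = ℓ ℕ.* ℓ
      instance
        ℓ-nonZero : ℕ.NonZero ℓ
        ℓ-nonZero = prime⇒nonZero ℓ-prime
        q-nonZero : ℕ.NonZero q
        q-nonZero = ℕₚ.m*n≢0 ℓ ℓ

    χ : ℕ → ℤ
    χ n = legendre (- + n) ℓ

    h : ℕ
    h = ℓ / 2

    ℓ≡ : ℓ ≡ suc (h ℕ.+ h)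
    ℓ≡ = trans (ℕ/.m≡m%n+[m/n]*n ℓ 2) (trans (cong (ℕ._+ h ℕ.* 2) ℓ-odd) (cong suc (e h)))
      where
      e : ∀ h → h ℕ.* 2 ≡ h ℕ.+ h
      e = solveℕ

    b : ℕ
    b = h ℕ.* h ℕ.+ h ℕ.+ (h ℕ.* h ℕ.+ h)

    q≡ : q ≡ suc (b ℕ.+ b)
    q≡ = trans (cong₂ ℕ._*_ ℓ≡ ℓ≡) (odd-square h)

    q%4 : q % 4 ≡ 1
    q%4 = trans (cong (_% 4) q≡) (mod4-1 (h ℕ.* h ℕ.+ h))

    +q : + q ≡ L * L
    +q = ℤₚ.pos-* ℓ ℓ

    8∣u : + 8 ∣ u
    8∣u = subst (λ x → + 8 ∣ x - 1ℤ) (trans (cong (+_) (sym (cong₂ ℕ._*_ ℓ≡ ℓ≡))) +q) (odd-square-mod8 h)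

    -- If `q * n` is a square, ℓ divides its root, and n is the square of the quotient.
    S-scale : ∀ n → S (q ℕ.* n) ≡ S n
    S-scale n with squareView n
    ... | isSquare x refl s = trans (trans (cong S (e ℓ (suc x))) (S-square (ℓ ℕ.* suc x) {{ℕₚ.m*n≢0 ℓ (suc x)}})) (sym s)
      where
      e : ∀ l x → l ℕ.* l ℕ.* (x ℕ.* x) ≡ l ℕ.* x ℕ.* (l ℕ.* x)
      e = solveℕ
    ... | notSquare none s = trans (S-notSquare go) (sym s)
      where
      go : ∀ y → q ℕ.* n ≢ suc y ℕ.* suc y
      go y e = root ℓ∣y
        where
        ℓ∣y : ℓ ℕ∣.∣ suc y
        ℓ∣y = reduce (euclidsLemma (suc y) (suc y) ℓ-prime (subst (ℓ ℕ∣.∣_) e (ℕ∣.∣m⇒∣m*n n (ℕ∣.m∣m*n ℓ))))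
        root : ℓ ℕ∣.∣ suc y → ⊥
        root (ℕ∣.divides (suc z) e′) = none z (ℕₚ.*-cancelˡ-≡ n (suc z ℕ.* suc z) q
            (trans e (trans (cong₂ ℕ._*_ e′ e′) (arrange ℓ (suc z)))))
          where
          arrange : ∀ l z → z ℕ.* l ℕ.* (z ℕ.* l) ≡ l ℕ.* l ℕ.* (z ℕ.* z)
          arrange = solveℕ

    -- ℓ² is odd, so scaling by it preserves the parity of the exponent.
    V-scale : ∀ f → (∀ n → f (q ℕ.* n) ≡ f n) → ∀ n → V f (q ℕ.* n) ≡ V f n
    V-scale f p n with parity n
    ... | even m = trans (cong (V f) (ℕₚ.*-distribˡ-+ q m m)) (trans (V-double f (q ℕ.* m)) (trans (p m) (sym (V-double f m))))
    ... | odd m = trans (cong (V f) (trans (cong (ℕ._* suc (m ℕ.+ m)) q≡) (e b m))) (trans (V-odd f (b ℕ.* suc (m ℕ.+ m) ℕ.+ m)) (sym (V-odd f m)))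
      where
      e : ∀ b m → suc (b ℕ.+ b) ℕ.* suc (m ℕ.+ m) ≡ suc (b ℕ.* suc (m ℕ.+ m) ℕ.+ m ℕ.+ (b ℕ.* suc (m ℕ.+ m) ℕ.+ m))
      e = solveℕ

    S₄-scale : ∀ n → S₄ (q ℕ.* n) ≡ S₄ n
    S₄-scale = V-scale S₂ (V-scale S S-scale)

    O-scale : ∀ n → O (q ℕ.* n) ≡ O n
    O-scale n = trans (O-coeff (q ℕ.* n)) (trans (cong₂ _-_ (S-scale n) (S₄-scale n)) (sym (O-coeff n)))

    O₂-scale : ∀ n → O₂ (q ℕ.* n) ≡ O₂ n
    O₂-scale = V-scale O O-scale

    O₄-scale : ∀ n → O₄ (q ℕ.* n) ≡ O₄ n
    O₄-scale = V-scale O₂ O₂-scale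

    q∤small : ∀ n → 0 ℕ.< n → n ℕ.< 3 → ¬ (q ℕ∣.∣ n)
    q∤small (suc n) _ n<3 d = ℕₚ.<⇒≱ n<3 (ℕₚ.≤-trans 3≤ℓ (ℕₚ.≤-trans (ℕₚ.m≤m*n ℓ ℓ) (ℕ∣.∣⇒≤ d)))
      where
      3≤ℓ : 3 ℕ.≤ ℓ
      3≤ℓ = 2<ℓ ℓ-prime ℓ≢2
        where open Rotations using (2<ℓ)

    ∤-root : ∀ x n → ¬ (q ℕ∣.∣ n) → x ℕ.* x ℕ∣.∣ n → ¬ (L ∣ + x)
    ∤-root x n q∤n x²∣n L∣x = q∤n (ℕ∣.∣-trans (ℕ∣.*-pres-∣ (ℤ∣.∣⇒∣ᵤ L∣x) (ℤ∣.∣⇒∣ᵤ L∣x)) x²∣n)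

    χ-scale : ∀ c x → ¬ (L ∣ + x) → χ (c ℕ.* (x ℕ.* x)) ≡ χ c
    χ-scale c x L∤x = trans (cong (λ d → legendre d ℓ)
        (trans (cong -_ (trans (ℤₚ.pos-* c (x ℕ.* x)) (cong (+ c *_) (ℤₚ.pos-* x x)))) (ℤₚ.neg-distribˡ-* (+ c) (+ x * + x))))
      (legendre-scale (- + c) (+ x) L∤x)

    -- A square not divisible by ℓ² has a root prime to ℓ; this makes the symbol constant on the
    -- support of `S`.
    χ-square : ∀ x n → n ≡ x ℕ.* x → ¬ (q ℕ∣.∣ n) → χ n ≡ χ 1
    χ-square x n refl q∤n = trans (cong χ (sym (ℕₚ.*-identityˡ (x ℕ.* x)))) (χ-scale 1 x (∤-root x n q∤n ℕ∣.∣-refl))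

    χ-twice-square : ∀ x n → n ≡ x ℕ.* x ℕ.+ x ℕ.* x → ¬ (q ℕ∣.∣ n) → χ n ≡ χ 2
    χ-twice-square x n refl q∤n = trans (cong χ (cong (x ℕ.* x ℕ.+_) (sym (ℕₚ.+-identityʳ (x ℕ.* x)))))
        (χ-scale 2 x (∤-root x n q∤n (ℕ∣.∣m∣n⇒∣m+n ℕ∣.∣-refl ℕ∣.∣-refl)))

    χ-unit : ∀ n → ¬ (L ∣ + n) → χ n ≡ 1ℤ ⊎ χ n ≡ - 1ℤ
    χ-unit n L∤n = go (residue (- + n)) refl
      where
      values : ∀ p r .{{_ : ℕ.NonZero p}} → legendreResidue p (suc r) ≡ 1ℤ ⊎ legendreResidue p (suc r) ≡ - 1ℤ
      values (suc p) r with any (λ x → does ((x ℕ.* x) % suc p ℕ.≟ suc r)) (upTo (suc p))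
      ... | true  = inj₁ refl
      ... | false = inj₂ refl
      go : ∀ (ρ : ∃[ r ] r ℕ.< ℓ × L ∣ - + n - + r) → (- + n) %ℕ ℓ ≡ proj₁ ρ → χ n ≡ 1ℤ ⊎ χ n ≡ - 1ℤ
      go (zero , _ , p) e = ⊥-elim (L∤n (subst (L ∣_) (trans (cong -_ (ℤₚ.+-identityʳ (- + n))) (ℤₚ.neg-involutive (+ n))) (∣-neg p)))
      go (suc r , _ , _) e = subst (λ x → x ≡ 1ℤ ⊎ x ≡ - 1ℤ) (sym (trans (legendre-residue (- + n) ℓ) (cong (legendreResidue ℓ) e)))
          (values ℓ r)

    -- The number of roots of -n is 1 + χ n = 2, so the search over all residues cannot fail.
    χ-root : ∀ n → χ n ≡ 1ℤ → ∃[ y ] L ∣ + y * + y - - + n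
    χ-root n e with Finₚ.any? (λ (i : Fin ℓ) → L ∣? (+ toℕ i * + toℕ i - - + n))
    ... | yes (i , p) = toℕ i , p
    ... | no none = ⊥-elim (two≢0 (trans (sym (trans (roots-legendre (- + n)) (cong (λ x → 1ℤ + x) e)))
          (trans (sumL-cong-below ℓ λ y y<ℓ → ⟦⟧-no (L ∣? (+ y * + y - - + n)) λ p →
              none (fromℕ< y<ℓ , subst (λ z → L ∣ + z * + z - - + n) (sym (Finₚ.toℕ-fromℕ< y<ℓ)) p)) (sumL-0 (upTo ℓ)))))
      where
      two≢0 : + 2 ≢ 0ℤ
      two≢0 ()

    ε : ℤ
    ε = χ 1

    r₃-hecke-1 : r₃ q ≡ + 6 * (1ℤ + L - ε)
    r₃-hecke-1 = trans (isolate (r₃ q) (ε * r₃ 1)) (trans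
        (cong (_- ε * r₃ 1) (trans (cong (λ m → r₃ m + ε * r₃ 1) (sym (ℕₚ.*-identityʳ q)))
        (hecke-∤ 1 (q∤small 1 (s≤s z≤n) (s≤s (s≤s z≤n))))))
      (trans (cong (λ r → (1ℤ + L) * r - ε * r) r₃-1) (solve 2
          (λ l e → (con 1ℤ :+ l) :* con (+ 6) :- e :* con (+ 6) := con (+ 6) :* (con 1ℤ :+ l :- e)) refl L ε)))
      where
      isolate : ∀ x y → x ≡ x + y - y
      isolate = solve 2 (λ x y → x := x :+ y :- y) refl

    r₃-hecke-2 : r₃ (q ℕ.+ q) ≡ + 12 * (1ℤ + L - χ 2)
    r₃-hecke-2 = trans (isolate (r₃ (q ℕ.+ q)) (χ 2 * r₃ 2))
        (trans (cong (_- χ 2 * r₃ 2) (trans (cong (λ m → r₃ m + χ 2 * r₃ 2) (sym (e q)))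
        (hecke-∤ 2 (q∤small 2 (s≤s z≤n) (s≤s (s≤s (s≤s z≤n)))))))
      (trans (cong (λ r → (1ℤ + L) * r - χ 2 * r) r₃-2) (solve 2
          (λ l e → (con 1ℤ :+ l) :* con (+ 12) :- e :* con (+ 12) := con (+ 12) :* (con 1ℤ :+ l :- e)) refl L (χ 2))))
      where
      e : ∀ q → q ℕ.* 2 ≡ q ℕ.+ q
      e = solveℕ
      isolate : ∀ x y → x ≡ x + y - y
      isolate = solve 2 (λ x y → x := x :+ y :- y) refl

    O-q : O q ≡ 1ℤ
    O-q = trans (cong O (sym (ℕₚ.*-identityʳ q))) (trans (O-scale 1) O-1)

    -- The first supplementary law: r₃(ℓ²) = 6(1 + ℓ - ε) by the Hecke relation at 1, and r₃(ℓ²) ≡ 6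
    -- modulo 8 by `r₃-mod8`.
    ε-mod4 : + 4 ∣ L - ε
    ε-mod4 = subst (+ 4 ∣_) (solve 1 (λ v → con (+ 4) :* v :+ :- (con (+ 3) :* v) := v) refl (L - ε))
        (∣-+ (∣-*ʳ (L - ε) (∣-rfl {+ 4})) (∣-neg 4∣3v))
      where
      4∣3v : + 4 ∣ + 3 * (L - ε)
      4∣3v = ℤ∣.*-cancelˡ-∣ (+ 2) (subst (+ 8 ∣_) (trans (cong₂ (λ x y → x - + 6 * y) r₃-hecke-1 O-q)
        (solve 2 (λ l e → con (+ 6) :* (con 1ℤ :+ l :- e) :- con (+ 6) :* con 1ℤ := con (+ 2) :* (con (+ 3) :* (l :- e))) refl L ε))
            (r₃-mod8 q q%4))

    -- The second supplementary law, in the form ℓ - 2 (-2/ℓ) + (-1/ℓ) ≡ 0 modulo 8.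
    χ2-mod8 : + 8 ∣ L - + 2 * χ 2 + ε
    χ2-mod8 = ℤ∣.*-cancelˡ-∣ (+ 2) (subst (+ 16 ∣_) (trans (cong₂ (λ x y → x - (y + + 2 * O q)) A-q C-q)
        (trans (cong (λ o → + 4 * (1ℤ + L - χ 2) - (+ 2 * (1ℤ + L - ε) + + 2 * o)) O-q)
        (solve 3 (λ l x e → con (+ 4) :* (con 1ℤ :+ l :- x) :- (con (+ 2) :* (con 1ℤ :+ l :- e) :+ con (+ 2) :* con 1ℤ) :=
            con (+ 2) :* (l :- con (+ 2) :* x :+ e)) refl L (χ 2) ε))) (A-C-mod16 q))
      where
      A-q : A q ≡ + 4 * (1ℤ + L - χ 2)
      A-q = ℤₚ.*-cancelˡ-≡ (+ 3) (A q) _ (trans (trans (cong (λ m → + 3 * A m) q≡) (trans (A-r₃ b) (cong (λ m → r₃ (m ℕ.+ m)) (sym q≡))))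
          (trans r₃-hecke-2 (solve 1 (λ x → con (+ 12) :* x := con (+ 3) :* (con (+ 4) :* x)) refl (1ℤ + L - χ 2))))
      C-q : C q ≡ + 2 * (1ℤ + L - ε)
      C-q = ℤₚ.*-cancelˡ-≡ (+ 3) (C q) _ (trans (C-1mod4 q q%4)
          (trans r₃-hecke-1 (solve 1 (λ x → con (+ 6) :* x := con (+ 3) :* (con (+ 2) :* x)) refl (1ℤ + L - ε))))

    ε-unit : ε ≡ 1ℤ ⊎ ε ≡ - 1ℤ
    ε-unit = χ-unit 1 (∤-root 1 1 (q∤small 1 (s≤s z≤n) (s≤s (s≤s z≤n))) ℕ∣.∣-refl)

    χ2-unit : χ 2 ≡ 1ℤ ⊎ χ 2 ≡ - 1ℤ
    χ2-unit = χ-unit 2 (∤2 ℓ-prime ℓ≢2)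
      where open Rotations using (∤2)

    quotient-mod8 : ℤ
    quotient-mod8 = + (ℓ / 8)

    L-mod8 : ∀ r → ℓ % 8 ≡ r → L ≡ + r + + 8 * quotient-mod8
    L-mod8 r e = trans (cong (+_) (trans (ℕ/.m≡m%n+[m/n]*n ℓ 8) (cong (ℕ._+ ℓ / 8 ℕ.* 8) e)))
        (cong (λ x → + r + x) (trans (ℤₚ.pos-* (ℓ / 8) 8) (ℤₚ.*-comm quotient-mod8 (+ 8))))

    private
      8∤ : ∀ x → + 8 ∣ x → ¬ (x ≡ + 4)
      8∤ x p refl with ℕ∣.∣⇒≤ (ℤ∣.∣⇒∣ᵤ p)
      ... | s≤s (s≤s (s≤s (s≤s ())))

      4∤2 : ¬ (+ 4 ∣ + 2)
      4∤2 p with ℕ∣.∣⇒≤ (ℤ∣.∣⇒∣ᵤ p)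
      ... | s≤s (s≤s ())

    ε≡1 : ∀ r → ℓ % 8 ≡ r → + 4 ∣ + r - 1ℤ → ε ≡ 1ℤ
    ε≡1 r e p = [ (λ x → x) , (λ ε≡-1 → ⊥-elim (4∤2 (subst (+ 4 ∣_)
        (trans (cong₂ (λ l e → l - e + (- (+ r - 1ℤ) + - (+ 4 * (+ 2 * quotient-mod8)))) (L-mod8 r e) ε≡-1)
          (solve 2 (λ r j → r :+ con (+ 8) :* j :- (:- con 1ℤ) :+ (:- (r :- con 1ℤ) :+ :- (con (+ 4) :* (con (+ 2) :* j))) :=
              con (+ 2)) refl (+ r) quotient-mod8))
        (∣-+ ε-mod4 (∣-+ (∣-neg p) (∣-neg (∣-*ʳ (+ 2 * quotient-mod8) (∣-rfl {+ 4})))))))) ]′ ε-unit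

    ε≡-1 : ∀ r → ℓ % 8 ≡ r → + 4 ∣ + r + 1ℤ → ε ≡ - 1ℤ
    ε≡-1 r e p = [ (λ ε≡1 → ⊥-elim (4∤2 (subst (+ 4 ∣_)
        (trans (cong₂ (λ l e → - (l - e) + (+ r + 1ℤ + + 4 * (+ 2 * quotient-mod8))) (L-mod8 r e) ε≡1)
          (solve 2 (λ r j → :- (r :+ con (+ 8) :* j :- con 1ℤ) :+ (r :+ con 1ℤ :+ con (+ 4) :* (con (+ 2) :* j)) := con (+ 2)) refl
              (+ r) quotient-mod8))
        (∣-+ (∣-neg ε-mod4) (∣-+ p (∣-*ʳ (+ 2 * quotient-mod8) (∣-rfl {+ 4}))))))) , (λ x → x) ]′ ε-unit

    χ2≡1 : ℓ % 8 ≡ 1 → χ 2 ≡ 1ℤ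
    χ2≡1 e = [ (λ x → x) , (λ χ2≡-1 → ⊥-elim (8∤ (+ 4) (subst (+ 8 ∣_)
        (trans (cong₂ (λ l x → l - + 2 * x + ε + - (+ 8 * quotient-mod8)) (L-mod8 1 e) χ2≡-1)
            (trans (cong (λ ε → 1ℤ + + 8 * quotient-mod8 - + 2 * - 1ℤ + ε + - (+ 8 * quotient-mod8)) (ε≡1 1 e (divides 0ℤ refl)))
          (solve 1 (λ j → con 1ℤ :+ con (+ 8) :* j :- con (+ 2) :* (:- con 1ℤ) :+ con 1ℤ :+ :- (con (+ 8) :* j) :=
              con (+ 4)) refl quotient-mod8)))
        (∣-+ χ2-mod8 (∣-neg (∣-*ʳ quotient-mod8 (∣-rfl {+ 8}))))) refl)) ]′ χ2-unit

    -- Both -1 and -2 are squares modulo ℓ in this class; the product of their roots squares to 2.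
    sqrt-2 : ℓ % 8 ≡ 1 → ∃[ w ] L ∣ w * w - + 2
    sqrt-2 e = + x * + y , subst (L ∣_) (identity (+ x) (+ y)) combination
      where
      root₁ = χ-root 1 (ε≡1 1 e (divides 0ℤ refl))
      root₂ = χ-root 2 (χ2≡1 e)
      x = proj₁ root₁
      y = proj₁ root₂
      x²≡-1 : L ∣ + x * + x - - 1ℤ
      x²≡-1 = proj₂ root₁
      y²≡-2 : L ∣ + y * + y - - + 2
      y²≡-2 = proj₂ root₂
      identity : ∀ x y → y * y * (x * x - - 1ℤ) + - (y * y - - + 2) ≡ (x * y) * (x * y) - + 2
      identity = solve 2 (λ x y → y :* y :* (x :* x :- (:- con 1ℤ)) :+ :- (y :* y :- (:- con (+ 2))) :=
          (x :* y) :* (x :* y) :- con (+ 2)) refl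
      combination : L ∣ + y * + y * (+ x * + x - - 1ℤ) + - (+ y * + y - - + 2)
      combination = ∣-+ (∣-*ˡ (+ y * + y) x²≡-1) (∣-neg y²≡-2)

    -- 2 is a square modulo ℓ here. Used for `A`, whose coefficients come from r₃ at twice the
    -- argument.
    χ-double : ℓ % 8 ≡ 1 → ∀ n → χ (n ℕ.+ n) ≡ χ n
    χ-double e n = trans (cong (λ d → legendre (- d) ℓ) (ℤₚ.pos-+ n n))
        (trans (legendre-cong { - (+ n + + n)} { - + n * (w * w)} congruent) (legendre-scale (- + n) w L∤w))
      where
      w = proj₁ (sqrt-2 e)
      w²≡2 : L ∣ w * w - + 2
      w²≡2 = proj₂ (sqrt-2 e)
      identity : ∀ n w → n * (w * w - + 2) ≡ - (n + n) - - n * (w * w)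
      identity = solve 2 (λ n w → n :* (w :* w :- con (+ 2)) := :- (n :+ n) :- (:- n) :* (w :* w)) refl
      congruent : L ∣ - (+ n + + n) - - + n * (w * w)
      congruent = subst (L ∣_) (identity (+ n) w) (∣-*ˡ (+ n) w²≡2)
      identity₂ : ∀ w → w * w + - (w * w - + 2) ≡ + 2
      identity₂ = solve 1 (λ w → w :* w :+ :- (w :* w :- con (+ 2)) := con (+ 2)) refl
      L∤w : ¬ (L ∣ w)
      L∤w d = ∤2 ℓ-prime ℓ≢2 (subst (L ∣_) (identity₂ w) (∣-+ (∣-*ʳ w d) (∣-neg w²≡2)))
        where open Rotations using (∤2)

-- Reduction of the relation for n P(n) to terms on squares.

module Reductions where

  open PowerSeries
  open Overpartitions using (S; P)
  open ThetaSeries using (r₃)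
  open Squares
  open Expansions
  open Coefficients
  open ThreeSquares
  open Characters
  open ℤSolver using (solve; _:=_; _:+_; _:*_; _:-_; :-_; con)

  module Reduction {ℓ : ℕ} (ℓ-prime : Prime ℓ) (ℓ-odd : ℓ % 2 ≡ 1) where
    open HeckeRelation ℓ-prime ℓ-odd using (hecke-∤; hecke-∣; legendre-zero)
    open Congruences ℓ-prime ℓ-odd

    private
      L u : ℤ
      L = + ℓ
      u = L * L - 1ℤ
      q : ℕ
      q = ℓ ℕ.* ℓ
      instance
        ℓ-nonZero : ℕ.NonZero ℓ
        ℓ-nonZero = prime⇒nonZero ℓ-prime

    +q* : ∀ n → + (q ℕ.* n) ≡ L * L * + n
    +q* n = trans (ℤₚ.pos-* q n) (cong (_* + n) +q)

    -- The defect of the eigenvalue 1 + ℓ at n not divisible by ℓ²; `hecke₁` is the defect at n = ℓ²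
    -- k, where the symbol is 0.
    hecke₀ : (ℕ → ℤ) → ℕ → ℤ
    hecke₀ f n = f (q ℕ.* n) + χ n * f n - (1ℤ + L) * f n

    hecke₁ : (ℕ → ℤ) → ℕ → ℤ
    hecke₁ f k = f (q ℕ.* (q ℕ.* k)) + L * f k - (1ℤ + L) * f (q ℕ.* k)

    nP : ℕ → ℤ
    nP n = + n * P n

    r₃-step : ∀ n → ¬ (q ℕ∣.∣ n) → r₃ (q ℕ.* n) ≡ (1ℤ + L) * r₃ n - χ n * r₃ n
    r₃-step n q∤n = trans (solve 2 (λ x y → x := x :+ y :- y) refl (r₃ (q ℕ.* n)) (χ n * r₃ n)) (cong (_- χ n * r₃ n) (hecke-∤ n q∤n))

    r₃-step₁ : ∀ k → r₃ (q ℕ.* (q ℕ.* k)) ≡ (1ℤ + L) * r₃ (q ℕ.* k) - L * r₃ k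
    r₃-step₁ k = trans (solve 2 (λ x y → x := x :+ y :- y) refl (r₃ (q ℕ.* (q ℕ.* k))) (L * r₃ k)) (cong (_- L * r₃ k) (hecke-∣ k))

    module _ (M : ℤ) (Ξ : ℕ → ℤ) (approximation : ∀ n → M ∣ nP n - (- (+ n * r₃ n) + + 4 * (+ n * S n) + Ξ n)) (M∣8u : M ∣ + 8 * u) where

      u-multiple : ∀ x → + 8 ∣ x → M ∣ u * x
      u-multiple x (divides y refl) = subst (M ∣_) (solve 2 (λ u y → y :* (con (+ 8) :* u) := u :* (y :* con (+ 8))) refl u y) (∣-*ˡ y M∣8u)

      -- In the defect of the approximation the r₃ terms leave -(ℓ² - 1)(1 + ℓ - χ) n r₃(n), where
      -- `u-multiple` allows 6 n S(n) for n r₃(n). Adding 4(ℓ² - 1 - (ℓ - χ)) n S(n) gives the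
      -- bracket in the hypothesis. `Ξ` stands for the terms that depend on the modulus.
      hecke₀-∣ : ∀ n → ¬ (q ℕ∣.∣ n) → M ∣ + n * S n * (- (+ 2 * u) - + 4 * (L - χ n) - + 6 * u * (L - χ n)) + hecke₀ Ξ n → M ∣ hecke₀ nP n
      hecke₀-∣ n q∤n main = subst (M ∣_) (identity (nP (q ℕ.* n)) (nP n) (χ n) L (+ n) (r₃ n) (S n) (Ξ (q ℕ.* n)) (Ξ n))
        (∣-+ (∣-+ (∣-+ at-qn (∣-*ˡ (χ n - (1ℤ + L)) (approximation n))) main)
          (∣-*ˡ (- (1ℤ + (L - χ n))) (u-multiple (+ n * r₃ n - + 6 * (+ n * S n)) (nr₃-mod8 n))))
        where
        at-qn : M ∣ nP (q ℕ.* n) - (- (L * L * + n * ((1ℤ + L) * r₃ n - χ n * r₃ n)) + + 4 * (L * L * + n * S n) + Ξ (q ℕ.* n))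
        at-qn = subst (λ z → M ∣ nP (q ℕ.* n) - z) (cong₂ (λ x y → - x + + 4 * y + Ξ (q ℕ.* n)) (cong₂ _*_ (+q* n) (r₃-step n q∤n))
            (cong₂ _*_ (+q* n) (S-scale n))) (approximation (q ℕ.* n))
        identity : ∀ Xq X χ L n r s Ξq Ξ →
          Xq - (- (L * L * n * ((1ℤ + L) * r - χ * r)) + + 4 * (L * L * n * s) + Ξq)
          + (χ - (1ℤ + L)) * (X - (- (n * r) + + 4 * (n * s) + Ξ))
          + (n * s * (- (+ 2 * (L * L - 1ℤ)) - + 4 * (L - χ) - + 6 * (L * L - 1ℤ) * (L - χ)) + (Ξq + χ * Ξ - (1ℤ + L) * Ξ))
          + - (1ℤ + (L - χ)) * ((L * L - 1ℤ) * (n * r - + 6 * (n * s)))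
          ≡ Xq + χ * X - (1ℤ + L) * X
        identity = solve 9 (λ Xq X χ L n r s Ξq Ξ →
          Xq :- (:- (L :* L :* n :* ((con 1ℤ :+ L) :* r :- χ :* r)) :+ con (+ 4) :* (L :* L :* n :* s) :+ Ξq)
          :+ (χ :- (con 1ℤ :+ L)) :* (X :- (:- (n :* r) :+ con (+ 4) :* (n :* s) :+ Ξ))
          :+ (n :* s :* (:- (con (+ 2) :* (L :* L :- con 1ℤ)) :- con (+ 4) :* (L :- χ) :- con (+ 6) :* (L :* L :- con 1ℤ) :* (L :- χ)) :+
              (Ξq :+ χ :* Ξ :- (con 1ℤ :+ L) :* Ξ))
          :+ :- (con 1ℤ :+ (L :- χ)) :* ((L :* L :- con 1ℤ) :* (n :* r :- con (+ 6) :* (n :* s)))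
          := Xq :+ χ :* X :- (con 1ℤ :+ L) :* X) refl

      -- The same substitution: k S(k) gets 4 ℓ u (ℓ - 1) from the theta term and -6 ℓ u (ℓ - 1)
      -- from r₃, in total -2 ℓ u (ℓ - 1).
      hecke₁-∣ : ∀ k → M ∣ + 2 * u * (L - 1ℤ) → M ∣ hecke₁ Ξ k → M ∣ hecke₁ nP k
      hecke₁-∣ k M∣2u main = subst (M ∣_) (identity (nP (q ℕ.* (q ℕ.* k))) (nP (q ℕ.* k)) (nP k) L (+ k) (r₃ (q ℕ.* k)) (r₃ k) (S k)
          (Ξ (q ℕ.* (q ℕ.* k))) (Ξ (q ℕ.* k)) (Ξ k))
        (∣-+ (∣-+ (∣-+ (∣-+ (∣-+ (∣-+ at-qqk (∣-*ˡ L (approximation k))) (∣-*ˡ (- (1ℤ + L)) at-qk)) main)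
          (∣-*ˡ (- (+ k * S k * L)) M∣2u)) (∣-*ˡ (- (1ℤ + L)) (u-multiple _ e₁)))
              (∣-*ˡ (L * (L * L + 1ℤ)) (u-multiple (+ k * r₃ k - + 6 * (+ k * S k)) (nr₃-mod8 k))))
        where
        at-qk : M ∣ nP (q ℕ.* k) - (- (L * L * + k * r₃ (q ℕ.* k)) + + 4 * (L * L * + k * S k) + Ξ (q ℕ.* k))
        at-qk = subst (λ z → M ∣ nP (q ℕ.* k) - z) (cong₂ (λ x y → - (x * r₃ (q ℕ.* k)) + + 4 * (x * y) + Ξ (q ℕ.* k)) (+q* k) (S-scale k))
            (approximation (q ℕ.* k))
        at-qqk : M ∣ nP (q ℕ.* (q ℕ.* k)) - (- (L * L * (L * L * + k) * ((1ℤ + L) * r₃ (q ℕ.* k) - L * r₃ k)) + + 4 *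
            (L * L * (L * L * + k) * S k) + Ξ (q ℕ.* (q ℕ.* k)))
        at-qqk = subst (λ z → M ∣ nP (q ℕ.* (q ℕ.* k)) - z) (cong₂ (λ x y → - x + + 4 * y + Ξ (q ℕ.* (q ℕ.* k)))
            (cong₂ _*_ (trans (+q* (q ℕ.* k)) (cong (L * L *_) (+q* k))) (r₃-step₁ k))
            (cong₂ _*_ (trans (+q* (q ℕ.* k)) (cong (L * L *_) (+q* k))) (trans (S-scale (q ℕ.* k)) (S-scale k))))
                (approximation (q ℕ.* (q ℕ.* k)))
        e₁ : + 8 ∣ L * L * + k * r₃ (q ℕ.* k) - + 6 * (L * L * + k * S k)
        e₁ = subst (+ 8 ∣_) (cong₂ (λ x y → x * r₃ (q ℕ.* k) - + 6 * (x * y)) (+q* k) (S-scale k)) (nr₃-mod8 (q ℕ.* k))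
        identity : ∀ X₂ X₁ X₀ L k r₁ r₀ s Ξ₂ Ξ₁ Ξ₀ →
          X₂ - (- (L * L * (L * L * k) * ((1ℤ + L) * r₁ - L * r₀)) + + 4 * (L * L * (L * L * k) * s) + Ξ₂)
          + L * (X₀ - (- (k * r₀) + + 4 * (k * s) + Ξ₀))
          + - (1ℤ + L) * (X₁ - (- (L * L * k * r₁) + + 4 * (L * L * k * s) + Ξ₁))
          + (Ξ₂ + L * Ξ₀ - (1ℤ + L) * Ξ₁)
          + - (k * s * L) * (+ 2 * (L * L - 1ℤ) * (L - 1ℤ))
          + - (1ℤ + L) * ((L * L - 1ℤ) * (L * L * k * r₁ - + 6 * (L * L * k * s)))
          + L * (L * L + 1ℤ) * ((L * L - 1ℤ) * (k * r₀ - + 6 * (k * s)))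
          ≡ X₂ + L * X₀ - (1ℤ + L) * X₁
        identity = solve 11 (λ X₂ X₁ X₀ L k r₁ r₀ s Ξ₂ Ξ₁ Ξ₀ →
          X₂ :- (:- (L :* L :* (L :* L :* k) :* ((con 1ℤ :+ L) :* r₁ :- L :* r₀)) :+ con (+ 4) :* (L :* L :* (L :* L :* k) :* s) :+ Ξ₂)
          :+ L :* (X₀ :- (:- (k :* r₀) :+ con (+ 4) :* (k :* s) :+ Ξ₀))
          :+ :- (con 1ℤ :+ L) :* (X₁ :- (:- (L :* L :* k :* r₁) :+ con (+ 4) :* (L :* L :* k :* s) :+ Ξ₁))
          :+ (Ξ₂ :+ L :* Ξ₀ :- (con 1ℤ :+ L) :* Ξ₁)
          :+ :- (k :* s :* L) :* (con (+ 2) :* (L :* L :- con 1ℤ) :* (L :- con 1ℤ))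
          :+ :- (con 1ℤ :+ L) :* ((L :* L :- con 1ℤ) :* (L :* L :* k :* r₁ :- con (+ 6) :* (L :* L :* k :* s)))
          :+ L :* (L :* L :+ con 1ℤ) :* ((L :* L :- con 1ℤ) :* (k :* r₀ :- con (+ 6) :* (k :* s)))
          := X₂ :+ L :* X₀ :- (con 1ℤ :+ L) :* X₁) refl

    64∣8u : + 64 ∣ + 8 * u
    64∣8u = ∣-mono (+ 8) 8∣u

    Ξ₆₄ : ℕ → ℤ
    Ξ₆₄ n = + 32 * O₂ n

    -- Where `O₂` is nonzero, n is twice a square, so χ n is 1 or -1 and has the parity of ℓ.
    O₂-even : ∀ n → ¬ (q ℕ∣.∣ n) → + 2 ∣ O₂ n * (χ n - L)
    O₂-even n q∤n = [ (λ z → ∣-zero (cong (_* (χ n - L)) z)) ,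
        (λ (x , e) → ∣-*ˡ (O₂ n) (even-difference (χ n) (subst (λ c → c ≡ 1ℤ ⊎ c ≡ - 1ℤ) (sym (χ-twice-square x n e q∤n)) χ2-unit))) ]′
        (OO₂-view n)
      where
      L≡ : L ≡ 1ℤ + (+ h + + h)
      L≡ = cong (+_) ℓ≡
      even-difference : ∀ c → c ≡ 1ℤ ⊎ c ≡ - 1ℤ → + 2 ∣ c - L
      even-difference c (inj₁ refl) = divides (- + h) (trans (cong (λ l → 1ℤ - l) L≡)
          (solve 1 (λ h → con 1ℤ :- (con 1ℤ :+ (h :+ h)) := :- h :* con (+ 2)) refl (+ h)))
      even-difference c (inj₂ refl) = divides (- 1ℤ - + h)
          (trans (cong (λ l → - 1ℤ - l) L≡) (solve 1 (λ h → :- con 1ℤ :- (con 1ℤ :+ (h :+ h)) := (:- con 1ℤ :- h) :* con (+ 2)) refl (+ h)))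

    Ξ₆₄-hecke₀ : ∀ n → ¬ (q ℕ∣.∣ n) → + 64 ∣ hecke₀ Ξ₆₄ n
    Ξ₆₄-hecke₀ n q∤n = subst (+ 64 ∣_) (trans (solve 3
        (λ o c l → con (+ 32) :* (o :* (c :- l)) := con (+ 32) :* o :+ c :* (con (+ 32) :* o) :- (con 1ℤ :+ l) :* (con (+ 32) :* o)) refl
        (O₂ n) (χ n) L)
        (cong (λ x → + 32 * x + χ n * (+ 32 * O₂ n) - (1ℤ + L) * (+ 32 * O₂ n)) (sym (O₂-scale n))))
      (∣-mono (+ 32) (O₂-even n q∤n))

    -- For a function unchanged by n to ℓ² n the relation reads 1 + ℓ = 1 + ℓ, so at multiples of ℓ²
    -- the terms on squares have no defect.
    constant-hecke₁ : ∀ f → (∀ n → f (q ℕ.* n) ≡ f n) → ∀ k → hecke₁ f k ≡ 0ℤ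
    constant-hecke₁ f p k = trans (cong₂ (λ x y → x + L * f k - (1ℤ + L) * y) (trans (p (q ℕ.* k)) (p k)) (p k))
        (solve 2 (λ x l → x :+ l :* x :- (con 1ℤ :+ l) :* x := con 0ℤ) refl (f k) L)

    Ξ₆₄-hecke₁ : ∀ k → hecke₁ Ξ₆₄ k ≡ 0ℤ
    Ξ₆₄-hecke₁ = constant-hecke₁ Ξ₆₄ (λ n → cong (+ 32 *_) (O₂-scale n))

    square-term : ∀ M n → ¬ (q ℕ∣.∣ n) → M ∣ - (+ 2 * u) - + 4 * (L - ε) - + 6 * u * (L - ε) → M
        ∣ + n * S n * (- (+ 2 * u) - + 4 * (L - χ n) - + 6 * u * (L - χ n))
    square-term M n q∤n p with squareView n
    ... | notSquare _ s = ∣-zero (trans (cong (λ s → + n * s * (- (+ 2 * u) - + 4 * (L - χ n) - + 6 * u * (L - χ n))) s) (solve 2 (λ n x → n :* con 0ℤ :* x := con 0ℤ) refl (+ n) (- (+ 2 * u) - + 4 * (L - χ n) - + 6 * u * (L - χ n))))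
    ... | isSquare x e _ = ∣-*ˡ (+ n * S n) (subst (λ c → M ∣ - (+ 2 * u) - + 4 * (L - c) - + 6 * u * (L - c)) (sym (χ-square (suc x) n e q∤n)) p)

-- The relation for n P(n) in the four classes of ℓ modulo 8.

module Eigenforms where

  open PowerSeries
  open Overpartitions using (S)
  open ThetaSeries using (r₃)
  open SeriesOperators
  open Squares
  open Expansions
  open Coefficients
  open ThreeSquares
  open Characters
  open Reductions
  open Overpartitions using (if-yes; if-no)
  open ℤSolver using (solve; _:=_; _:+_; _:*_; _:-_; :-_; con)

  pbarDiv-∣ : ∀ d k .{{_ : ℕ.NonZero d}} → pbarDiv (d ℕ.* k) d ≡ pbar k
  pbarDiv-∣ d@(suc _) k = trans (if-yes (d ℕ∣.∣? d ℕ.* k) (ℕ∣.m∣m*n k)) (cong pbar (trans (cong (_/ d) (ℕₚ.*-comm d k)) (ℕ/.m*n/n≡m k d)))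

  pbarDiv-∤ : ∀ d n → ¬ (d ℕ∣.∣ n) → pbarDiv n d ≡ 0
  pbarDiv-∤ zero n _ = refl
  pbarDiv-∤ d@(suc _) n d∤n = if-no (d ℕ∣.∣? n) d∤n

  gamma-1 : ∀ ℓ → ℓ % 8 ≡ 1 → gamma ℓ ≡ 7
  gamma-1 ℓ e with ℓ % 8 | e
  ... | .1 | refl = refl

  gamma-3 : ∀ ℓ → ℓ % 8 ≡ 3 → gamma ℓ ≡ 5
  gamma-3 ℓ e with ℓ % 8 | e
  ... | .3 | refl = refl

  gamma-5 : ∀ ℓ → ℓ % 8 ≡ 5 → gamma ℓ ≡ 6
  gamma-5 ℓ e with ℓ % 8 | e
  ... | .5 | refl = refl

  gamma-7 : ∀ ℓ → ℓ % 8 ≡ 7 → gamma ℓ ≡ 6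
  gamma-7 ℓ e with ℓ % 8 | e
  ... | .7 | refl = refl

  data OddResidue (ℓ : ℕ) : Set where
    one   : ℓ % 8 ≡ 1 → OddResidue ℓ
    three : ℓ % 8 ≡ 3 → OddResidue ℓ
    five  : ℓ % 8 ≡ 5 → OddResidue ℓ
    seven : ℓ % 8 ≡ 7 → OddResidue ℓ

  oddResidue : ∀ ℓ → ℓ % 2 ≡ 1 → OddResidue ℓ
  oddResidue ℓ ℓ-odd = go (ℓ % 8) refl (ℕ/.m%n<n ℓ 8)
      (trans (sym (trans (cong (_% 2) decompose) (ℕ/.[m+kn]%n≡m%n (ℓ % 8) (ℓ / 8 ℕ.* 4) 2))) ℓ-odd)
    where
    e : ∀ a b → a ℕ.+ b ℕ.* 8 ≡ a ℕ.+ b ℕ.* 4 ℕ.* 2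
    e = solveℕ
    decompose : ℓ ≡ ℓ % 8 ℕ.+ ℓ / 8 ℕ.* 4 ℕ.* 2
    decompose = trans (ℕ/.m≡m%n+[m/n]*n ℓ 8) (e (ℓ % 8) (ℓ / 8))
    go : ∀ r → ℓ % 8 ≡ r → r ℕ.< 8 → r % 2 ≡ 1 → OddResidue ℓ
    go 1 p _ _ = one p
    go 3 p _ _ = three p
    go 5 p _ _ = five p
    go 7 p _ _ = seven p
    go 0 _ _ ()
    go 2 _ _ ()
    go 4 _ _ ()
    go 6 _ _ ()
    go (suc (suc (suc (suc (suc (suc (suc (suc r)))))))) _ (s≤s (s≤s (s≤s (s≤s (s≤s (s≤s (s≤s (s≤s ())))))))) _

  κ-scale : ∀ c m .{{_ : ℕ.NonZero m}} n → κ c (m ℕ.* n) ≡ κ c n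
  κ-scale c m zero = cong (κ c) (ℕₚ.*-zeroʳ m)
  κ-scale c (suc m) (suc n) = refl

  module Assembly {ℓ : ℕ} (ℓ-prime : Prime ℓ) (ℓ-odd : ℓ % 2 ≡ 1) where
    open HeckeRelation ℓ-prime ℓ-odd using (hecke-∤; hecke-∣; legendre-zero)
    open Congruences ℓ-prime ℓ-odd
    open Reduction ℓ-prime ℓ-odd

    private
      L u j : ℤ
      L = + ℓ
      u = L * L - 1ℤ
      j = quotient-mod8
      q : ℕ
      q = ℓ ℕ.* ℓ
      instance
        ℓ-nonZero : ℕ.NonZero ℓ
        ℓ-nonZero = prime⇒nonZero ℓ-prime
        q-nonZero : ℕ.NonZero q
        q-nonZero = ℕₚ.m*n≢0 ℓ ℓ

    half* : ℕ → ℕ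
    half* m = b ℕ.* suc (m ℕ.+ m) ℕ.+ m

    q*odd : ∀ m → q ℕ.* suc (m ℕ.+ m) ≡ suc (half* m ℕ.+ half* m)
    q*odd m = trans (cong (ℕ._* suc (m ℕ.+ m)) q≡) (e b m)
      where
      e : ∀ b m → suc (b ℕ.+ b) ℕ.* suc (m ℕ.+ m) ≡ suc (b ℕ.* suc (m ℕ.+ m) ℕ.+ m ℕ.+ (b ℕ.* suc (m ℕ.+ m) ℕ.+ m))
      e = solveℕ

    q*even : ∀ m → q ℕ.* (m ℕ.+ m) ≡ q ℕ.* m ℕ.+ q ℕ.* m
    q*even m = ℕₚ.*-distribˡ-+ q m m

    q*-mod4 : ∀ n → (q ℕ.* n) % 4 ≡ n % 4
    q*-mod4 n = trans (ℕ/.%-distribˡ-* q n 4) (trans (cong (λ x → (x ℕ.* (n % 4)) % 4) q%4)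
        (trans (cong (_% 4) (ℕₚ.*-identityˡ (n % 4))) (ℕ/.m%n%n≡m%n n 4)))

    -- With ℓ² = 2b + 1, (b + 1) · 2n = ℓ² n + n.
    q∤double : ∀ n → ¬ (q ℕ∣.∣ n) → ¬ (q ℕ∣.∣ n ℕ.+ n)
    q∤double n q∤n d = q∤n (ℕ∣.∣m+n∣m⇒∣n (subst (q ℕ∣.∣_) (trans (e n b) (cong (λ x → n ℕ.* x ℕ.+ n) (sym q≡))) (ℕ∣.∣m⇒∣m*n (suc b) d))
        (ℕ∣.n∣m*n n))
      where
      e : ∀ n b → (n ℕ.+ n) ℕ.* suc b ≡ n ℕ.* suc (b ℕ.+ b) ℕ.+ n
      e = solveℕ

    hecke₀-zero : ∀ f n → f (q ℕ.* n) ≡ 0ℤ → f n ≡ 0ℤ → hecke₀ f n ≡ 0ℤ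
    hecke₀-zero f n p r = trans (cong₂ (λ x y → x + χ n * y - (1ℤ + L) * y) p r)
        (solve 2 (λ c l → con 0ℤ :+ c :* con 0ℤ :- (con 1ℤ :+ l) :* con 0ℤ := con 0ℤ) refl (χ n) L)

    hecke₁-zero : ∀ f k → f (q ℕ.* (q ℕ.* k)) ≡ 0ℤ → f (q ℕ.* k) ≡ 0ℤ → f k ≡ 0ℤ → hecke₁ f k ≡ 0ℤ
    hecke₁-zero f k p r s = trans (cong₂ (λ x y → x + L * y - (1ℤ + L) * f (q ℕ.* k)) p s)
        (trans (cong (λ z → 0ℤ + L * 0ℤ - (1ℤ + L) * z) r)
        (solve 1 (λ l → con 0ℤ :+ l :* con 0ℤ :- (con 1ℤ :+ l) :* con 0ℤ := con 0ℤ) refl L))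

    -- The argument `m` of r₃ may differ from `n`, provided the symbols agree: `A` uses m = 2n, `C`
    -- uses m = n.
    hecke₀-from-r₃ : ∀ c .{{_ : ℤ.NonZero c}} f n m → c * f (q ℕ.* n) ≡ r₃ (q ℕ.* m) → c * f n ≡ r₃ m → χ m ≡ χ n → ¬ (q ℕ∣.∣ m) →
        hecke₀ f n ≡ 0ℤ
    hecke₀-from-r₃ c f n m p r s q∤m = ℤₚ.*-cancelˡ-≡ c (hecke₀ f n) 0ℤ
        (trans (solve 5 (λ c a x b l → c :* (a :+ x :* b :- (con 1ℤ :+ l) :* b) :=
        c :* a :+ x :* (c :* b) :- (con 1ℤ :+ l) :* (c :* b)) refl c (f (q ℕ.* n)) (χ n) (f n) L)
      (trans (cong₂ (λ x y → x + χ n * y - (1ℤ + L) * y) p r)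
          (trans (cong (_- (1ℤ + L) * r₃ m) (trans (cong (λ z → r₃ (q ℕ.* m) + z * r₃ m) (sym s)) (hecke-∤ m q∤m)))
          (trans (ℤₚ.+-inverseʳ ((1ℤ + L) * r₃ m)) (sym (ℤₚ.*-zeroʳ c))))))

    hecke₁-from-r₃ : ∀ c .{{_ : ℤ.NonZero c}} f k m → c * f (q ℕ.* (q ℕ.* k)) ≡ r₃ (q ℕ.* (q ℕ.* m)) → c * f (q ℕ.* k) ≡ r₃ (q ℕ.* m) →
        c * f k ≡ r₃ m → hecke₁ f k ≡ 0ℤ
    hecke₁-from-r₃ c f k m p r s = ℤₚ.*-cancelˡ-≡ c (hecke₁ f k) 0ℤ
        (trans (solve 5 (λ c x y z l → c :* (x :+ l :* y :- (con 1ℤ :+ l) :* z) :=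
        c :* x :+ l :* (c :* y) :- (con 1ℤ :+ l) :* (c :* z)) refl c (f (q ℕ.* (q ℕ.* k))) (f k) (f (q ℕ.* k)) L)
      (trans (cong₂ (λ x y → x + L * y - (1ℤ + L) * (c * f (q ℕ.* k))) p s)
          (trans (cong₂ (λ x y → x - (1ℤ + L) * y) (hecke-∣ m) r) (trans (ℤₚ.+-inverseʳ ((1ℤ + L) * r₃ (q ℕ.* m))) (sym (ℤₚ.*-zeroʳ c))))))

    A-odd : ∀ n m → n ≡ suc (m ℕ.+ m) → + 3 * A n ≡ r₃ (n ℕ.+ n)
    A-odd n m refl = A-r₃ m

    C-odd : ∀ n → n % 4 ≡ 1 ⊎ n % 4 ≡ 3 → (n % 4 ≡ 1 × + 3 * C n ≡ r₃ n) ⊎ (n % 4 ≡ 3 × + 1 * C n ≡ r₃ n)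
    C-odd n (inj₁ e) = inj₁ (e , C-1mod4 n e)
    C-odd n (inj₂ e) = inj₂ (e , trans (ℤₚ.*-identityˡ (C n)) (C-3mod4 n e))

    -- The relation of r₃ at 2n carries the symbol (-2n/ℓ), which equals the required (-n/ℓ) because
    -- 2 is a square modulo ℓ.
    A-hecke₀ : ℓ % 8 ≡ 1 → ∀ n → ¬ (q ℕ∣.∣ n) → hecke₀ A n ≡ 0ℤ
    A-hecke₀ e n q∤n with parity n
    ... | even m = hecke₀-zero A (m ℕ.+ m) (trans (cong A (q*even m)) (OddSupp-A (q ℕ.* m))) (OddSupp-A m)
    ... | odd m = hecke₀-from-r₃ (+ 3) A n′ (n′ ℕ.+ n′) (trans (A-odd (q ℕ.* n′) (half* m) (q*odd m)) (cong r₃ (sym (q*even n′)))) (A-r₃ m) (χ-double e n′) (q∤double n′ q∤n)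
      where n′ = suc (m ℕ.+ m)

    A-hecke₁ : ∀ k → hecke₁ A k ≡ 0ℤ
    A-hecke₁ k with parity k
    ... | even m = hecke₁-zero A (m ℕ.+ m) (trans (cong A (trans (cong (q ℕ.*_) (q*even m)) (q*even (q ℕ.* m)))) (OddSupp-A (q ℕ.* (q ℕ.* m)))) (trans (cong A (q*even m)) (OddSupp-A (q ℕ.* m))) (OddSupp-A m)
    ... | odd m = hecke₁-from-r₃ (+ 3) A k′ (k′ ℕ.+ k′)
            (trans (A-odd (q ℕ.* (q ℕ.* k′)) (half* (half* m)) (trans (cong (q ℕ.*_) (q*odd m)) (q*odd (half* m))))
                (cong r₃ (sym (trans (cong (q ℕ.*_) (q*even k′)) (q*even (q ℕ.* k′))))))
            (trans (A-odd (q ℕ.* k′) (half* m) (q*odd m)) (cong r₃ (sym (q*even k′)))) (A-r₃ m)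
      where k′ = suc (m ℕ.+ m)

    C-hecke₀ : ∀ n → ¬ (q ℕ∣.∣ n) → hecke₀ C n ≡ 0ℤ
    C-hecke₀ n q∤n with parity n
    ... | even m = hecke₀-zero C (m ℕ.+ m) (trans (cong C (q*even m)) (OddSupp-C (q ℕ.* m))) (OddSupp-C m)
    ... | odd m = go (C-odd n′ (odd-mod4 m))
      where
      n′ = suc (m ℕ.+ m)
      go : (n′ % 4 ≡ 1 × + 3 * C n′ ≡ r₃ n′) ⊎ (n′ % 4 ≡ 3 × + 1 * C n′ ≡ r₃ n′) → hecke₀ C n′ ≡ 0ℤ
      go (inj₁ (e , c)) = hecke₀-from-r₃ (+ 3) C n′ n′ (C-1mod4 (q ℕ.* n′) (trans (q*-mod4 n′) e)) c refl q∤n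
      go (inj₂ (e , c)) = hecke₀-from-r₃ (+ 1) C n′ n′ (trans (ℤₚ.*-identityˡ (C (q ℕ.* n′))) (C-3mod4 (q ℕ.* n′) (trans (q*-mod4 n′) e))) c
          refl q∤n

    C-hecke₁ : ∀ k → hecke₁ C k ≡ 0ℤ
    C-hecke₁ k with parity k
    ... | even m = hecke₁-zero C (m ℕ.+ m) (trans (cong C (trans (cong (q ℕ.*_) (q*even m)) (q*even (q ℕ.* m)))) (OddSupp-C (q ℕ.* (q ℕ.* m)))) (trans (cong C (q*even m)) (OddSupp-C (q ℕ.* m))) (OddSupp-C m)
    ... | odd m = go (C-odd k′ (odd-mod4 m))
      where
      k′ = suc (m ℕ.+ m)
      go : (k′ % 4 ≡ 1 × + 3 * C k′ ≡ r₃ k′) ⊎ (k′ % 4 ≡ 3 × + 1 * C k′ ≡ r₃ k′) → hecke₁ C k′ ≡ 0ℤ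
      go (inj₁ (e , c)) = hecke₁-from-r₃ (+ 3) C k′ k′ (C-1mod4 (q ℕ.* (q ℕ.* k′)) (trans (q*-mod4 (q ℕ.* k′)) (trans (q*-mod4 k′) e)))
          (C-1mod4 (q ℕ.* k′) (trans (q*-mod4 k′) e)) c
      go (inj₂ (e , c)) = hecke₁-from-r₃ (+ 1) C k′ k′ (trans (ℤₚ.*-identityˡ _)
          (C-3mod4 (q ℕ.* (q ℕ.* k′)) (trans (q*-mod4 (q ℕ.* k′)) (trans (q*-mod4 k′) e))))
          (trans (ℤₚ.*-identityˡ _) (C-3mod4 (q ℕ.* k′) (trans (q*-mod4 k′) e))) c

    Ξ₁₂₈ : ℕ → ℤ
    Ξ₁₂₈ n = + 4 * A n - + 4 * C n - + 8 * O n + + 32 * O₂ n + + 64 * O₄ n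

    approximation₁₂₈ : ∀ n → + 128 ∣ nP n - (- (+ n * r₃ n) + + 4 * (+ n * S n) + Ξ₁₂₈ n)
    approximation₁₂₈ n = subst (λ z → + 128 ∣ nP n - z)
        (solve 7 (λ r s a c o o₂ o₄ → :- r :+ con (+ 4) :* s :+ con (+ 4) :* a :+ (:- con (+ 4)) :* c :+ (:- con (+ 8)) :* o :+ con
        (+ 32) :* o₂ :+ con (+ 64) :* o₄
       := :- r :+ con (+ 4) :* s :+ (con (+ 4) :* a :- con (+ 4) :* c :- con (+ 8) :* o :+ con (+ 32) :* o₂ :+ con (+ 64) :* o₄)) refl
           (+ n * r₃ n) (+ n * S n) (A n) (C n) (O n) (O₂ n) (O₄ n)) (ΘP-coeff-mod128 n)

    Ξ₁₂₈-hecke₀ : ℓ % 8 ≡ 1 → ∀ n → ¬ (q ℕ∣.∣ n) → hecke₀ Ξ₁₂₈ n ≡ (- (+ 8 * O n) + + 32 * O₂ n + + 64 * O₄ n) * (χ n - L)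
    Ξ₁₂₈-hecke₀ e n q∤n =
      (trans (cong (λ z → z + χ n * Ξ₁₂₈ n - (1ℤ + L) * Ξ₁₂₈ n)
          (cong₂ _+_ (cong₂ _+_ (cong (λ z → + 4 * A (q ℕ.* n) - + 4 * C (q ℕ.* n) - + 8 * z) (O-scale n)) (cong (+ 32 *_) (O₂-scale n)))
          (cong (+ 64 *_) (O₄-scale n))))
      (trans (solve 9 (λ a′ a c′ c o o₂ o₄ x l → con (+ 4) :* a′ :- con (+ 4) :* c′ :- con (+ 8) :* o :+ con (+ 32) :* o₂ :+ con
          (+ 64) :* o₄
           :+ x :* (con (+ 4) :* a :- con (+ 4) :* c :- con (+ 8) :* o :+ con (+ 32) :* o₂ :+ con (+ 64) :* o₄) :- (con 1ℤ :+ l) :*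
               (con (+ 4) :* a :- con (+ 4) :* c :- con (+ 8) :* o :+ con (+ 32) :* o₂ :+ con (+ 64) :* o₄)
         := con (+ 4) :* (a′ :+ x :* a :- (con 1ℤ :+ l) :* a) :- con (+ 4) :* (c′ :+ x :* c :- (con 1ℤ :+ l) :* c) :+
             (:- (con (+ 8) :* o) :+ con (+ 32) :* o₂ :+ con (+ 64) :* o₄) :* (x :- l))
           refl (A (q ℕ.* n)) (A n) (C (q ℕ.* n)) (C n) (O n) (O₂ n) (O₄ n) (χ n) L)
        (trans (cong₂ (λ x y → + 4 * x - + 4 * y + (- (+ 8 * O n) + + 32 * O₂ n + + 64 * O₄ n) * (χ n - L)) (A-hecke₀ e n q∤n)
            (C-hecke₀ n q∤n)) (ℤₚ.+-identityˡ _))))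

    Ξ₁₂₈-hecke₁ : ∀ k → hecke₁ Ξ₁₂₈ k ≡ 0ℤ
    Ξ₁₂₈-hecke₁ k = trans (solve 10 (λ a₂ a₁ a₀ c₂ c₁ c₀ o₂ o₁ o₀ l →
        con (+ 4) :* a₂ :- con (+ 4) :* c₂ :+ o₂ :+ l :* (con (+ 4) :* a₀ :- con (+ 4) :* c₀ :+ o₀) :- (con 1ℤ :+ l) :*
        (con (+ 4) :* a₁ :- con (+ 4) :* c₁ :+ o₁)
        := con (+ 4) :* (a₂ :+ l :* a₀ :- (con 1ℤ :+ l) :* a₁) :- con (+ 4) :* (c₂ :+ l :* c₀ :- (con 1ℤ :+ l) :* c₁) :+
            (o₂ :+ l :* o₀ :- (con 1ℤ :+ l) :* o₁)) refl
        (A (q ℕ.* (q ℕ.* k))) (A (q ℕ.* k)) (A k) (C (q ℕ.* (q ℕ.* k))) (C (q ℕ.* k)) (C k) (squares (q ℕ.* (q ℕ.* k))) (squares (q ℕ.* k))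
            (squares k) L ⟨by⟩ regroup)
      (trans (cong₂ (λ x y → + 4 * x - + 4 * y + hecke₁ squares k) (A-hecke₁ k) (C-hecke₁ k))
          (trans (ℤₚ.+-identityˡ _) (constant-hecke₁ squares
          (λ n → cong₂ _+_ (cong₂ _+_ (cong (λ x → - (+ 8 * x)) (O-scale n)) (cong (+ 32 *_) (O₂-scale n))) (cong (+ 64 *_) (O₄-scale n)))
          k)))
      where
      squares : ℕ → ℤ
      squares n = - (+ 8 * O n) + + 32 * O₂ n + + 64 * O₄ n
      split : ∀ n → Ξ₁₂₈ n ≡ + 4 * A n - + 4 * C n + squares n
      split n = solve 5 (λ a c x y z → con (+ 4) :* a :- con (+ 4) :* c :- con (+ 8) :* x :+ con (+ 32) :* y :+ con (+ 64) :* z :=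
          con (+ 4) :* a :- con (+ 4) :* c :+ (:- (con (+ 8) :* x) :+ con (+ 32) :* y :+ con (+ 64) :* z)) refl (A n) (C n) (O n) (O₂ n)
          (O₄ n)
      regroup : hecke₁ Ξ₁₂₈ k ≡ (+ 4 * A (q ℕ.* (q ℕ.* k)) - + 4 * C (q ℕ.* (q ℕ.* k)) + squares (q ℕ.* (q ℕ.* k))) + L *
          (+ 4 * A k - + 4 * C k + squares k) - (1ℤ + L) * (+ 4 * A (q ℕ.* k) - + 4 * C (q ℕ.* k) + squares (q ℕ.* k))
      regroup = cong₂ _-_ (cong₂ (λ x y → x + L * y) (split (q ℕ.* (q ℕ.* k))) (split k)) (cong ((1ℤ + L) *_) (split (q ℕ.* k)))
      _⟨by⟩_ : ∀ {x y z : ℤ} → y ≡ z → x ≡ y → x ≡ z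
      p ⟨by⟩ r = trans r p

    -- With ℓ = 1 + 8j the bracket is -64j modulo 128 and n S(n) ≡ O(n) modulo 2, while -8 O(n)
    -- times χ - ℓ = -8j gives 64j O(n): the two cancel. The remaining terms are multiples of 128 by
    -- themselves.
    main₁₂₈ : ℓ % 8 ≡ 1 → ∀ n → χ n ≡ 1ℤ → + 128 ∣ + n * S n * (- (+ 2 * u) - + 4 * (L - χ n) - + 6 * u * (L - χ n)) +
        (- (+ 8 * O n) + + 32 * O₂ n + + 64 * O₄ n) * (χ n - L)
    main₁₂₈ e n χ≡1 =
        subst (+ 128 ∣_)
        (sym (trans (cong₂ (λ c l → + n * S n * (- (+ 2 * (l * l - 1ℤ)) - + 4 * (l - c) - + 6 * (l * l - 1ℤ) * (l - c)) +
        (- (+ 8 * O n) + + 32 * O₂ n + + 64 * O₄ n) * (c - l)) χ≡1 (L-mod8 1 e))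
        (trans (cong (λ z → z * (- (+ 2 * ((1ℤ + + 8 * j) * (1ℤ + + 8 * j) - 1ℤ)) - + 4 * (1ℤ + + 8 * j - 1ℤ) - + 6 *
            ((1ℤ + + 8 * j) * (1ℤ + + 8 * j) - 1ℤ) * (1ℤ + + 8 * j - 1ℤ)) + (- (+ 8 * O n) + + 32 * O₂ n + + 64 * O₄ n) *
            (1ℤ - (1ℤ + + 8 * j))) nS≡)
          (identity j y (O n) (O₂ n) (O₄ n))))) (∣-*ʳ (value j y (O n) (O₂ n) (O₄ n)) (∣-rfl {+ 128}))
      where
      d : + 8 ∣ + n * S n - (O n + + 4 * O₄ n)
      d = subst (λ z → + 8 ∣ + n * S n - z) (sum₂ {O} {O₄} n) (U-mod8 n)
      y = _∣_.quotient d
      nS≡ : + n * S n ≡ O n + + 4 * O₄ n + y * + 8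
      nS≡ = trans (solve 2 (λ a b → a := b :+ (a :- b)) refl (+ n * S n) (O n + + 4 * O₄ n))
          (cong (λ z → O n + + 4 * O₄ n + z) (_∣_.equality d))
      value : ℤ → ℤ → ℤ → ℤ → ℤ → ℤ
      value j y o o₂ o₄ = (o + + 4 * o₄ + y * + 8) * (- (j * j) - + 6 * (j * j) * (+ 4 * j + 1ℤ)) - j *
          (+ 4 * y + + 2 * o₄) - + 2 * j * o₂ - + 4 * j * o₄
      identity : ∀ j y o o₂ o₄ → (o + + 4 * o₄ + y * + 8) *
          (- (+ 2 * ((1ℤ + + 8 * j) * (1ℤ + + 8 * j) - 1ℤ)) - + 4 * (1ℤ + + 8 * j - 1ℤ) - + 6 * ((1ℤ + + 8 * j) * (1ℤ + + 8 * j) - 1ℤ) *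
          (1ℤ + + 8 * j - 1ℤ)) + (- (+ 8 * o) + + 32 * o₂ + + 64 * o₄) * (1ℤ - (1ℤ + + 8 * j))
         ≡ + 128 * ((o + + 4 * o₄ + y * + 8) * (- (j * j) - + 6 * (j * j) * (+ 4 * j + 1ℤ)) - j *
             (+ 4 * y + + 2 * o₄) - + 2 * j * o₂ - + 4 * j * o₄)
      identity = solve 5 (λ j y o o₂ o₄ → (o :+ con (+ 4) :* o₄ :+ y :* con (+ 8)) :*
          (:- (con (+ 2) :* ((con 1ℤ :+ con (+ 8) :* j) :* (con 1ℤ :+ con (+ 8) :* j) :- con 1ℤ)) :- con (+ 4) :*
          (con 1ℤ :+ con (+ 8) :* j :- con 1ℤ) :- con (+ 6) :* ((con 1ℤ :+ con (+ 8) :* j) :* (con 1ℤ :+ con (+ 8) :* j) :- con 1ℤ) :*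
          (con 1ℤ :+ con (+ 8) :* j :- con 1ℤ)) :+ (:- (con (+ 8) :* o) :+ con (+ 32) :* o₂ :+ con (+ 64) :* o₄) :*
          (con 1ℤ :- (con 1ℤ :+ con (+ 8) :* j))
         := con (+ 128) :* ((o :+ con (+ 4) :* o₄ :+ y :* con (+ 8)) :*
             (:- (j :* j) :- con (+ 6) :* (j :* j) :* (con (+ 4) :* j :+ con 1ℤ)) :- j :* (con (+ 4) :* y :+ con (+ 2) :* o₄) :- con
             (+ 2) :* j :* o₂ :- con (+ 4) :* j :* o₄)) refl

    -- Every summand vanishes unless n is a square or twice a square, and then χ n is (-1/ℓ) or
    -- (-2/ℓ), both equal to 1 in this class.
    term₁₂₈ : ℓ % 8 ≡ 1 → ∀ n → ¬ (q ℕ∣.∣ n) → + 128 ∣ + n * S n * (- (+ 2 * u) - + 4 * (L - χ n) - + 6 * u * (L - χ n)) +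
        (- (+ 8 * O n) + + 32 * O₂ n + + 64 * O₄ n) * (χ n - L)
    term₁₂₈ e n q∤n = go (squareView n) (OO₂-view n)
      where
      go : SquareView n → O₂ n ≡ 0ℤ ⊎ (∃[ x ] n ≡ x ℕ.* x ℕ.+ x ℕ.* x) → + 128
          ∣ + n * S n * (- (+ 2 * u) - + 4 * (L - χ n) - + 6 * u * (L - χ n)) + (- (+ 8 * O n) + + 32 * O₂ n + + 64 * O₄ n) * (χ n - L)
      go (isSquare x n≡ _) _ = main₁₂₈ e n (trans (χ-square (suc x) n n≡ q∤n) (ε≡1 1 e (divides 0ℤ refl)))
      go (notSquare _ _) (inj₂ (x , n≡)) = main₁₂₈ e n (trans (χ-twice-square x n n≡ q∤n) (χ2≡1 e))
      go (notSquare _ s) (inj₁ o₂) = ∣-zero (trans (cong₂ (λ s o → + n * s * w + (- (+ 8 * O n) + + 32 * o + + 64 * O₄ n) * (χ n - L)) s o₂)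
          (trans (cong₂ (λ o o₄ → + n * 0ℤ * w + (- (+ 8 * o) + + 32 * 0ℤ + + 64 * o₄) * (χ n - L)) (O-vanishes n s) (O₄-vanishes n s))
            (solve 3 (λ n w v → n :* con 0ℤ :* w :+ (:- (con (+ 8) :* con 0ℤ) :+ con (+ 32) :* con 0ℤ :+ con (+ 64) :* con 0ℤ) :* v :=
                con 0ℤ) refl (+ n) w (χ n - L))))
        where w = - (+ 2 * u) - + 4 * (L - χ n) - + 6 * u * (L - χ n)

    -- The two shapes of the second congruence, according to whether ℓ² divides n.
    Eigen : ℤ → Set
    Eigen M = (∀ n → ¬ (q ℕ∣.∣ n) → M ∣ hecke₀ nP n) × (∀ k → M ∣ hecke₁ nP k)

    -- Covers the classes 3, 5 and 7. Once ε is known, the last two hypotheses are statements about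
    -- polynomials in ℓ.
    eigen₆₄ : ∀ M → M ∣ + 64 → M ∣ - (+ 2 * u) - + 4 * (L - ε) - + 6 * u * (L - ε) → M ∣ + 2 * u * (L - 1ℤ) → Eigen M
    eigen₆₄ M M∣64 p r = (λ n q∤n → hecke₀-∣ M Ξ₆₄ approx M∣8u n q∤n (∣-+ (square-term M n q∤n p) (∣-trs M∣64 (Ξ₆₄-hecke₀ n q∤n))))
      , λ k → hecke₁-∣ M Ξ₆₄ approx M∣8u k r (∣-zero (Ξ₆₄-hecke₁ k))
      where
      approx : ∀ n → M ∣ nP n - (- (+ n * r₃ n) + + 4 * (+ n * S n) + Ξ₆₄ n)
      approx n = ∣-trs M∣64 (ΘP-coeff-mod64 n)
      M∣8u = ∣-trs M∣64 64∣8u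

    eigen₁₂₈ : ℓ % 8 ≡ 1 → Eigen (+ 128)
    eigen₁₂₈ e = (λ n q∤n → hecke₀-∣ (+ 128) Ξ₁₂₈ approximation₁₂₈ 128∣8u n q∤n
        (subst (λ z → + 128 ∣ + n * S n * (- (+ 2 * u) - + 4 * (L - χ n) - + 6 * u * (L - χ n)) + z) (sym (Ξ₁₂₈-hecke₀ e n q∤n))
        (term₁₂₈ e n q∤n)))
      , λ k → hecke₁-∣ (+ 128) Ξ₁₂₈ approximation₁₂₈ 128∣8u k 128∣2u (∣-zero (Ξ₁₂₈-hecke₁ k))
      where
      128∣8u : + 128 ∣ + 8 * u
      128∣8u = divides (+ 4 * (j * j) + j) (trans (cong (λ l → + 8 * (l * l - 1ℤ)) (L-mod8 1 e))
          (solve 1 (λ j → con (+ 8) :* ((con 1ℤ :+ con (+ 8) :* j) :* (con 1ℤ :+ con (+ 8) :* j) :- con 1ℤ) :=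
          (con (+ 4) :* (j :* j) :+ j) :* con (+ 128)) refl j))
      128∣2u : + 128 ∣ + 2 * u * (L - 1ℤ)
      128∣2u = divides (+ 2 * (+ 4 * (j * j) + j) * j) (trans (cong (λ l → + 2 * (l * l - 1ℤ) * (l - 1ℤ)) (L-mod8 1 e))
          (solve 1 (λ j → con (+ 2) :* ((con 1ℤ :+ con (+ 8) :* j) :* (con 1ℤ :+ con (+ 8) :* j) :- con 1ℤ) :*
          (con 1ℤ :+ con (+ 8) :* j :- con 1ℤ) := con (+ 2) :* (con (+ 4) :* (j :* j) :+ j) :* j :* con (+ 128)) refl j))

    -- With ℓ = 3 + 8j and ε = -1 the cofactor of 32 in the first bracket is odd, so the term on
    -- squares stops at 32; this accounts for γ = 5.
    eigen₃ : ℓ % 8 ≡ 3 → Eigen (+ 32)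
    eigen₃ e = eigen₆₄ (+ 32) (divides (+ 2) refl)
      (divides (- (+ 4 * (j * j)) - + 4 * j - 1ℤ - + 6 * ((+ 8 * (j * j) + + 6 * j + 1ℤ) * (+ 2 * j + 1ℤ)))
          (trans (cong₂ (λ l x → - (+ 2 * (l * l - 1ℤ)) - + 4 * (l - x) - + 6 * (l * l - 1ℤ) * (l - x)) (L-mod8 3 e)
          (ε≡-1 3 e (divides 1ℤ refl)))
        (solve 1 (λ j → let l = con (+ 3) :+ con (+ 8) :* j ; x = :- con 1ℤ in :- (con (+ 2) :* (l :* l :- con 1ℤ)) :- con (+ 4) :* (l :- x) :- con (+ 6) :* (l :* l :- con 1ℤ) :* (l :- x)
           := (:- (con (+ 4) :* (j :* j)) :- con (+ 4) :* j :- con 1ℤ :- con (+ 6) :*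
               ((con (+ 8) :* (j :* j) :+ con (+ 6) :* j :+ con 1ℤ) :* (con (+ 2) :* j :+ con 1ℤ))) :* con (+ 32)) refl j)))
      (divides ((+ 8 * (j * j) + + 6 * j + 1ℤ) * (+ 4 * j + 1ℤ)) (trans (cong (λ l → + 2 * (l * l - 1ℤ) * (l - 1ℤ)) (L-mod8 3 e))
        (solve 1 (λ j → let l = con (+ 3) :+ con (+ 8) :* j in con (+ 2) :* (l :* l :- con 1ℤ) :* (l :- con 1ℤ) := (con (+ 8) :* (j :* j) :+ con (+ 6) :* j :+ con 1ℤ) :* (con (+ 4) :* j :+ con 1ℤ) :* con (+ 32)) refl j)))

    eigen₅ : ℓ % 8 ≡ 5 → Eigen (+ 64)
    eigen₅ e = eigen₆₄ (+ 64) (divides 1ℤ refl)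
      (divides (- (+ 2 * (j * j)) - + 3 * j - 1ℤ - + 3 * ((+ 8 * (j * j) + + 10 * j + + 3) * (+ 2 * j + 1ℤ)))
          (trans (cong₂ (λ l x → - (+ 2 * (l * l - 1ℤ)) - + 4 * (l - x) - + 6 * (l * l - 1ℤ) * (l - x)) (L-mod8 5 e)
          (ε≡1 5 e (divides 1ℤ refl)))
        (solve 1 (λ j → let l = con (+ 5) :+ con (+ 8) :* j ; x = con 1ℤ in :- (con (+ 2) :* (l :* l :- con 1ℤ)) :- con (+ 4) :* (l :- x) :- con (+ 6) :* (l :* l :- con 1ℤ) :* (l :- x)
           := (:- (con (+ 2) :* (j :* j)) :- con (+ 3) :* j :- con 1ℤ :- con (+ 3) :*
               ((con (+ 8) :* (j :* j) :+ con (+ 10) :* j :+ con (+ 3)) :* (con (+ 2) :* j :+ con 1ℤ))) :* con (+ 64)) refl j)))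
      (divides ((+ 8 * (j * j) + + 10 * j + + 3) * (+ 2 * j + 1ℤ)) (trans (cong (λ l → + 2 * (l * l - 1ℤ) * (l - 1ℤ)) (L-mod8 5 e))
        (solve 1 (λ j → let l = con (+ 5) :+ con (+ 8) :* j in con (+ 2) :* (l :* l :- con 1ℤ) :* (l :- con 1ℤ) := (con (+ 8) :* (j :* j) :+ con (+ 10) :* j :+ con (+ 3)) :* (con (+ 2) :* j :+ con 1ℤ) :* con (+ 64)) refl j)))

    eigen₇ : ℓ % 8 ≡ 7 → Eigen (+ 64)
    eigen₇ e = eigen₆₄ (+ 64) (divides 1ℤ refl)
      (divides (- (+ 2 * (j * j)) - + 4 * j - + 2 - + 12 * ((+ 4 * (j * j) + + 7 * j + + 3) * (j + 1ℤ)))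
          (trans (cong₂ (λ l x → - (+ 2 * (l * l - 1ℤ)) - + 4 * (l - x) - + 6 * (l * l - 1ℤ) * (l - x)) (L-mod8 7 e)
          (ε≡-1 7 e (divides (+ 2) refl)))
        (solve 1 (λ j → let l = con (+ 7) :+ con (+ 8) :* j ; x = :- con 1ℤ in :- (con (+ 2) :* (l :* l :- con 1ℤ)) :- con (+ 4) :* (l :- x) :- con (+ 6) :* (l :* l :- con 1ℤ) :* (l :- x)
           := (:- (con (+ 2) :* (j :* j)) :- con (+ 4) :* j :- con (+ 2) :- con (+ 12) :*
               ((con (+ 4) :* (j :* j) :+ con (+ 7) :* j :+ con (+ 3)) :* (j :+ con 1ℤ))) :* con (+ 64)) refl j)))
      (divides ((+ 4 * (j * j) + + 7 * j + + 3) * (+ 4 * j + + 3)) (trans (cong (λ l → + 2 * (l * l - 1ℤ) * (l - 1ℤ)) (L-mod8 7 e))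
        (solve 1 (λ j → let l = con (+ 7) :+ con (+ 8) :* j in con (+ 2) :* (l :* l :- con 1ℤ) :* (l :- con 1ℤ) := (con (+ 4) :* (j :* j) :+ con (+ 7) :* j :+ con (+ 3)) :* (con (+ 4) :* j :+ con (+ 3)) :* con (+ 64)) refl j)))

    eigen : Eigen (+ (2 ℕ.^ gamma ℓ))
    eigen = go (oddResidue ℓ ℓ-odd)
      where
      go : OddResidue ℓ → Eigen (+ (2 ℕ.^ gamma ℓ))
      go (one e)   = subst (λ g → Eigen (+ (2 ℕ.^ g))) (sym (gamma-1 ℓ e)) (eigen₁₂₈ e)
      go (three e) = subst (λ g → Eigen (+ (2 ℕ.^ g))) (sym (gamma-3 ℓ e)) (eigen₃ e)
      go (five e)  = subst (λ g → Eigen (+ (2 ℕ.^ g))) (sym (gamma-5 ℓ e)) (eigen₅ e)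
      go (seven e) = subst (λ g → Eigen (+ (2 ℕ.^ g))) (sym (gamma-7 ℓ e)) (eigen₇ e)

-- Translation to overpartitions and the two congruences.

module Congruence where

  open PowerSeries
  open Overpartitions using (S; P; sgn-+; sgn²; sgn-double)
  open ThetaSeries using (r₃)
  open SeriesOperators
  open Squares
  open Expansions
  open Coefficients
  open ThreeSquares
  open Characters
  open Reductions
  open Eigenforms
  open ℤSolver using (solve; _:=_; _:+_; _:*_; _:-_; :-_; con)

  module Conclusion {ℓ : ℕ} (ℓ-prime : Prime ℓ) (ℓ-odd : ℓ % 2 ≡ 1) where
    open HeckeRelation ℓ-prime ℓ-odd using (hecke-∤; hecke-∣; legendre-zero)
    open Congruences ℓ-prime ℓ-odd
    open Reduction ℓ-prime ℓ-odd
    open Assembly ℓ-prime ℓ-odd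

    private
      L u : ℤ
      L = + ℓ
      u = L * L - 1ℤ
      q : ℕ
      q = ℓ ℕ.* ℓ
      instance
        ℓ-nonZero : ℕ.NonZero ℓ
        ℓ-nonZero = prime⇒nonZero ℓ-prime
        q-nonZero : ℕ.NonZero q
        q-nonZero = ℕₚ.m*n≢0 ℓ ℓ

    S-mod4 : ∀ n → ¬ (q ℕ∣.∣ n) → + 4 ∣ S n * (χ n - L)
    S-mod4 n q∤n = go (squareView n)
      where
      go : SquareView n → + 4 ∣ S n * (χ n - L)
      go (notSquare _ s) = ∣-zero (trans (cong (_* (χ n - L)) s) (ℤₚ.*-zeroˡ (χ n - L)))
      go (isSquare x e _) = ∣-*ˡ (S n) (subst (λ c → + 4 ∣ c - L) (sym (χ-square (suc x) n e q∤n))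
        (subst (+ 4 ∣_) (solve 2 (λ l e → :- (l :- e) := e :- l) refl L ε) (∣-neg ε-mod4)))

    -- The part -r₃ satisfies the relation exactly, and the part 4S leaves 4 S(n)(χ - ℓ), divisible
    -- by 16 by the first supplementary law. As n is not 0, the constant 2 does not enter.
    P-hecke₀ : ∀ n → ¬ (q ℕ∣.∣ n) → + 16 ∣ hecke₀ P n
    P-hecke₀ zero q∤0 = ⊥-elim (q∤0 (q ℕ∣.∣0))
    P-hecke₀ n@(suc _) q∤n = subst (+ 16 ∣_) (identity (P (q ℕ.* n)) (P n) (χ n) L (r₃ n) (S n))
        (∣-+ (∣-+ at-qn (∣-*ˡ (χ n - (1ℤ + L)) (P-coeff-mod16 n))) (∣-mono (+ 4) (S-mod4 n q∤n)))
      where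
      at-qn : + 16 ∣ P (q ℕ.* n) - (0ℤ + + 4 * S n - ((1ℤ + L) * r₃ n - χ n * r₃ n))
      at-qn = subst (λ z → + 16 ∣ P (q ℕ.* n) - z) (cong₂ _-_ (cong₂ (λ x y → x + + 4 * y) (κ-scale (+ 2) q n) (S-scale n)) (r₃-step n q∤n))
          (P-coeff-mod16 (q ℕ.* n))
      identity : ∀ Pq P χ L r s → Pq - (0ℤ + + 4 * s - ((1ℤ + L) * r - χ * r)) + (χ - (1ℤ + L)) * (P - (0ℤ + + 4 * s - r)) + + 4 *
          (s * (χ - L)) ≡ Pq + χ * P - (1ℤ + L) * P
      identity = solve 6 (λ Pq P χ L r s → Pq :- (con 0ℤ :+ con (+ 4) :* s :- ((con 1ℤ :+ L) :* r :- χ :* r)) :+ (χ :- (con 1ℤ :+ L)) :*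
          (P :- (con 0ℤ :+ con (+ 4) :* s :- r)) :+ con (+ 4) :* (s :* (χ :- L)) := Pq :+ χ :* P :- (con 1ℤ :+ L) :* P) refl

    P-hecke₁ : ∀ k → + 16 ∣ hecke₁ P k
    P-hecke₁ k = subst (+ 16 ∣_) (identity (P (q ℕ.* (q ℕ.* k))) (P (q ℕ.* k)) (P k) L (r₃ (q ℕ.* k)) (r₃ k) (κ (+ 2) k) (S k))
        (∣-+ (∣-+ at-qqk (∣-*ˡ L (P-coeff-mod16 k))) (∣-*ˡ (- (1ℤ + L)) at-qk))
      where
      at-qk : + 16 ∣ P (q ℕ.* k) - (κ (+ 2) k + + 4 * S k - r₃ (q ℕ.* k))
      at-qk = subst (λ z → + 16 ∣ P (q ℕ.* k) - (z - r₃ (q ℕ.* k))) (cong₂ (λ x y → x + + 4 * y) (κ-scale (+ 2) q k) (S-scale k))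
          (P-coeff-mod16 (q ℕ.* k))
      at-qqk : + 16 ∣ P (q ℕ.* (q ℕ.* k)) - (κ (+ 2) k + + 4 * S k - ((1ℤ + L) * r₃ (q ℕ.* k) - L * r₃ k))
      at-qqk = subst (λ z → + 16 ∣ P (q ℕ.* (q ℕ.* k)) - z)
          (cong₂ _-_ (cong₂ (λ x y → x + + 4 * y) (trans (κ-scale (+ 2) q (q ℕ.* k)) (κ-scale (+ 2) q k))
          (trans (S-scale (q ℕ.* k)) (S-scale k))) (r₃-step₁ k)) (P-coeff-mod16 (q ℕ.* (q ℕ.* k)))
      identity : ∀ P₂ P₁ P₀ L r₁ r₀ c s → P₂ - (c + + 4 * s - ((1ℤ + L) * r₁ - L * r₀)) + L * (P₀ - (c + + 4 * s - r₀)) + - (1ℤ + L) *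
          (P₁ - (c + + 4 * s - r₁)) ≡ P₂ + L * P₀ - (1ℤ + L) * P₁
      identity = solve 8 (λ P₂ P₁ P₀ L r₁ r₀ c s → P₂ :- (c :+ con (+ 4) :* s :- ((con 1ℤ :+ L) :* r₁ :- L :* r₀)) :+ L :*
          (P₀ :- (c :+ con (+ 4) :* s :- r₀)) :+ :- (con 1ℤ :+ L) :* (P₁ :- (c :+ con (+ 4) :* s :- r₁)) :=
          P₂ :+ L :* P₀ :- (con 1ℤ :+ L) :* P₁) refl

    -- ℓ² is odd, so one common sign factors out of the whole relation and passes it from `P` to
    -- `pbar`.
    sgn-q* : ∀ n → sgn (q ℕ.* n) ≡ sgn n
    sgn-q* n = trans (cong sgn (trans (cong (ℕ._* n) q≡) (cong (n ℕ.+_) (ℕₚ.*-distribʳ-+ n b b))))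
        (trans (sgn-+ n (b ℕ.* n ℕ.+ b ℕ.* n)) (trans (cong (sgn n *_) (sgn-double (b ℕ.* n))) (ℤₚ.*-identityʳ (sgn n))))

    pbar-P : ∀ n → + pbar n ≡ sgn n * P n
    pbar-P n = sym (trans (sym (ℤₚ.*-assoc (sgn n) (sgn n) (+ pbar n))) (trans (cong (_* + pbar n) (sgn² n)) (ℤₚ.*-identityˡ (+ pbar n))))

    pbar-P-q : ∀ n → + pbar (ℓ ℕ.^ 2 ℕ.* n) ≡ sgn n * P (q ℕ.* n)
    pbar-P-q n = trans (cong (λ m → + pbar (m ℕ.* n)) ℓ^2) (trans (pbar-P (q ℕ.* n)) (cong (_* P (q ℕ.* n)) (sgn-q* n)))
      where
      ℓ^2 : ℓ ℕ.^ 2 ≡ q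
      ℓ^2 = cong (ℓ ℕ.*_) (ℕₚ.*-identityʳ ℓ)

    pbarDiv-ℓ² : ∀ n → pbarDiv n (ℓ ℕ.^ 2) ≡ pbarDiv n q
    pbarDiv-ℓ² n = cong (pbarDiv n) (cong (ℓ ℕ.*_) (ℕₚ.*-identityʳ ℓ))

    L^2 : L ^ 2 ≡ L * L
    L^2 = cong (L *_) (ℤₚ.*-identityʳ L)

    L^3 : L ^ 3 ≡ L * (L * L)
    L^3 = cong (L *_) L^2

    -- ℓ² ≡ 1 modulo 8; the missing factor 2 comes from `P-even`.
    u₂-mod8 : ∀ u₂ → + 16 ∣ u₂ * L ^ 2 - 1ℤ → + 8 ∣ u₂ - 1ℤ
    u₂-mod8 u₂ p = subst (+ 8 ∣_) (identity u₂ L) (∣-+ (∣-trs {+ 8} {+ 16} (divides (+ 2) refl) (subst (λ x → + 16 ∣ u₂ * x - 1ℤ) L^2 p))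
        (∣-*ˡ (- u₂) 8∣u))
      where
      identity : ∀ v l → v * (l * l) - 1ℤ + - v * (l * l - 1ℤ) ≡ v - 1ℤ
      identity = solve 2 (λ v l → v :* (l :* l) :- con 1ℤ :+ :- v :* (l :* l :- con 1ℤ) := v :- con 1ℤ) refl

    -- ℓ⁴ - 1 = u(u + 2) with 8 dividing u, so ℓ⁴ ≡ 1 modulo 16 and the inverse of ℓ³ is ℓ.
    u₃-mod16 : ∀ u₃ → + 16 ∣ u₃ * L ^ 3 - 1ℤ → + 16 ∣ u₃ - L
    u₃-mod16 u₃ p = subst (+ 16 ∣_) (identity u₃ L) (∣-+ (∣-*ˡ L (subst (λ x → + 16 ∣ u₃ * x - 1ℤ) L^3 p)) (∣-*ˡ (- u₃) L⁴))
      where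
      identity : ∀ v l → l * (v * (l * (l * l)) - 1ℤ) + - v * ((l * l - 1ℤ) * (l * l - 1ℤ + + 2)) ≡ v - l
      identity = solve 2 (λ v l → l :* (v :* (l :* (l :* l)) :- con 1ℤ) :+ :- v :* ((l :* l :- con 1ℤ) :* (l :* l :- con 1ℤ :+ con (+ 2)))
          := v :- l) refl
      fourth-power : ∀ x → + 8 ∣ x → + 16 ∣ x * (x + + 2)
      fourth-power x (divides a refl) = divides (a * (a * + 4 + 1ℤ))
          (solve 1 (λ a → a :* con (+ 8) :* (a :* con (+ 8) :+ con (+ 2)) := a :* (a :* con (+ 4) :+ con 1ℤ) :* con (+ 16)) refl a)
      L⁴ : + 16 ∣ u * (u + + 2)
      L⁴ = fourth-power u 8∣u

    χ-multiple : ∀ k → χ (q ℕ.* k) ≡ 0ℤ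
    χ-multiple k = legendre-zero { - + (q ℕ.* k)} (∣-neg (subst (L ∣_) (sym (+q* k)) (∣-*ʳ (+ k) (∣-*ʳ L (∣-rfl {L})))))

    at₂ : ∀ k → + pbar (ℓ ℕ.^ 2 ℕ.* (q ℕ.* k)) ≡ sgn k * P (q ℕ.* (q ℕ.* k))
    at₂ k = trans (pbar-P-q (q ℕ.* k)) (cong (_* P (q ℕ.* (q ℕ.* k))) (sgn-q* k))

    at₁ : ∀ k → + pbar (q ℕ.* k) ≡ sgn k * P (q ℕ.* k)
    at₁ k = trans (pbar-P (q ℕ.* k)) (cong (_* P (q ℕ.* k)) (sgn-q* k))

    at₀ : ∀ k → + pbarDiv (q ℕ.* k) (ℓ ℕ.^ 2) ≡ sgn k * P k
    at₀ k = trans (cong (+_) (trans (pbarDiv-ℓ² (q ℕ.* k)) (pbarDiv-∣ q k))) (pbar-P k)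

    private
      M : ℕ
      M = 2 ℕ.^ gamma ℓ

    module _ (u₂ u₃ v₁ : ℤ) (hu₂ : + 16 ∣ u₂ * L ^ 2 - 1ℤ) (hu₃ : + 16 ∣ u₃ * L ^ 3 - 1ℤ) (hv₁ : + M ∣ v₁ * L - 1ℤ) where

      first : ∀ n → + 16 ∣ (+ pbar (ℓ ℕ.^ 2 ℕ.* n) + χ n * u₂ * + pbar n + u₃ * + pbarDiv n (ℓ ℕ.^ 2)) - (1ℤ + L) * + pbar n
      first n with q ℕ∣.∣? n
      ... | no q∤n = subst (+ 16 ∣_) (sym (trans (cong₂ _-_ (cong₂ _+_ (cong₂ (λ x y → x + χ n * u₂ * y) (pbar-P-q n) (pbar-P n)) (cong (λ x → u₃ * + x) (trans (pbarDiv-ℓ² n) (pbarDiv-∤ q n q∤n)))) (cong ((1ℤ + L) *_) (pbar-P n)))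
            (identity (sgn n) (P (q ℕ.* n)) (P n) (χ n) u₂ u₃ L)))
          (∣-*ˡ (sgn n) (∣-+ (P-hecke₀ n q∤n) (∣-*ˡ (χ n) (product n q∤n))))
        where
        identity : ∀ σ Pq P χ u₂ u₃ L → σ * Pq + χ * u₂ * (σ * P) + u₃ * 0ℤ - (1ℤ + L) * (σ * P)
            ≡ σ * (Pq + χ * P - (1ℤ + L) * P + χ * ((u₂ - 1ℤ) * P))
        identity = solve 7 (λ σ Pq P χ u₂ u₃ L → σ :* Pq :+ χ :* u₂ :* (σ :* P) :+ u₃ :* con 0ℤ :- (con 1ℤ :+ L) :* (σ :* P) :=
            σ :* (Pq :+ χ :* P :- (con 1ℤ :+ L) :* P :+ χ :* ((u₂ :- con 1ℤ) :* P))) refl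
        product : ∀ n → ¬ (q ℕ∣.∣ n) → + 16 ∣ (u₂ - 1ℤ) * P n
        product zero q∤0 = ⊥-elim (q∤0 (q ℕ∣.∣0))
        product (suc n) _ = multiply (u₂ - 1ℤ) (P (suc n)) (u₂-mod8 u₂ hu₂) (P-even n)
          where
          multiply : ∀ x y → + 8 ∣ x → + 2 ∣ y → + 16 ∣ x * y
          multiply x y (divides a refl) (divides b refl) = divides (a * b)
              (solve 2 (λ a b → a :* con (+ 8) :* (b :* con (+ 2)) := a :* b :* con (+ 16)) refl a b)
      ... | yes (ℕ∣.divides k n≡) = multiple k n (trans n≡ (ℕₚ.*-comm k q))
        where
        identity : ∀ σ P₂ P₁ P₀ u₂ u₃ L → σ * P₂ + 0ℤ * u₂ * (σ * P₁) + u₃ * (σ * P₀) - (1ℤ + L) * (σ * P₁)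
            ≡ σ * (P₂ + L * P₀ - (1ℤ + L) * P₁ + P₀ * (u₃ - L))
        identity = solve 7 (λ σ P₂ P₁ P₀ u₂ u₃ L → σ :* P₂ :+ con 0ℤ :* u₂ :* (σ :* P₁) :+ u₃ :* (σ :* P₀) :- (con 1ℤ :+ L) :* (σ :* P₁) :=
            σ :* (P₂ :+ L :* P₀ :- (con 1ℤ :+ L) :* P₁ :+ P₀ :* (u₃ :- L))) refl
        multiple : ∀ k n → n ≡ q ℕ.* k → + 16 ∣ (+ pbar (ℓ ℕ.^ 2 ℕ.* n) + χ n * u₂ * + pbar n + u₃ * + pbarDiv n (ℓ ℕ.^ 2)) -
            (1ℤ + L) * + pbar n
        multiple k n refl =
            subst (+ 16 ∣_)
            (sym (trans (cong₂ _-_ (cong₂ _+_ (cong₂ _+_ (at₂ k) (cong₂ (λ x y → x * u₂ * y) (χ-multiple k) (at₁ k)))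
            (cong (u₃ *_) (at₀ k))) (cong ((1ℤ + L) *_) (at₁ k)))
            (identity (sgn k) (P (q ℕ.* (q ℕ.* k))) (P (q ℕ.* k)) (P k) u₂ u₃ L)))
          (∣-*ˡ (sgn k) (∣-+ (P-hecke₁ k) (∣-*ˡ (P k) (u₃-mod16 u₃ hu₃))))

      -- The coefficients of the statement are already those of n P(n): ℓ² n is the new index, and
      -- at n = ℓ² k the factor v₁ n is congruent to ℓ k, so `Eigen` applies in both of its shapes.
      second : ∀ n → + M ∣ (L ^ 2 * + n * + pbar (ℓ ℕ.^ 2 ℕ.* n) + χ n * + n * + pbar n + v₁ * + n * + pbarDiv n (ℓ ℕ.^ 2)) -
          (1ℤ + L) * + n * + pbar n
      second n with q ℕ∣.∣? n
      ... | no q∤n = subst (+ M ∣_) (sym (trans (cong₂ _-_ (cong₂ _+_ (cong₂ _+_ (cong₂ (λ x y → x * + n * y) L^2 (pbar-P-q n)) (cong (χ n * + n *_) (pbar-P n))) (cong (λ x → v₁ * + n * + x) (trans (pbarDiv-ℓ² n) (pbarDiv-∤ q n q∤n)))) (cong ((1ℤ + L) * + n *_) (pbar-P n)))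
            (trans (identity (sgn n) (P (q ℕ.* n)) (P n) (χ n) v₁ L (+ n))
                (cong (λ m → sgn n * (m * P (q ℕ.* n) + χ n * nP n - (1ℤ + L) * nP n)) (sym (+q* n))))))
          (∣-*ˡ (sgn n) (proj₁ eigen n q∤n))
        where
        identity : ∀ σ Pq P χ v L n → L * L * n * (σ * Pq) + χ * n * (σ * P) + v * n * 0ℤ - (1ℤ + L) * n * (σ * P)
            ≡ σ * (L * L * n * Pq + χ * (n * P) - (1ℤ + L) * (n * P))
        identity = solve 7 (λ σ Pq P χ v L n → L :* L :* n :* (σ :* Pq) :+ χ :* n :* (σ :* P) :+ v :* n :* con 0ℤ :- (con 1ℤ :+ L) :* n :*
            (σ :* P) := σ :* (L :* L :* n :* Pq :+ χ :* (n :* P) :- (con 1ℤ :+ L) :* (n :* P))) refl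
      ... | yes (ℕ∣.divides k n≡) = multiple k n (trans n≡ (ℕₚ.*-comm k q))
        where
        identity : ∀ σ P₂ P₁ P₀ v L n k → L * L * (L * L * k) * (σ * P₂) + 0ℤ * n * (σ * P₁) + v * (L * L * k) * (σ * P₀) - (1ℤ + L) * n *
            (σ * P₁)
          ≡ σ * (L * L * (L * L * k) * P₂ + L * (k * P₀) - (1ℤ + L) * (n * P₁) + L * (k * P₀) * (v * L - 1ℤ))
        identity = solve 8 (λ σ P₂ P₁ P₀ v L n k → L :* L :* (L :* L :* k) :* (σ :* P₂) :+ con 0ℤ :* n :* (σ :* P₁) :+ v :* (L :* L :* k) :*
            (σ :* P₀) :- (con 1ℤ :+ L) :* n :* (σ :* P₁)
          := σ :* (L :* L :* (L :* L :* k) :* P₂ :+ L :* (k :* P₀) :- (con 1ℤ :+ L) :* (n :* P₁) :+ L :* (k :* P₀) :* (v :* L :- con 1ℤ)))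
              refl
        multiple : ∀ k n → n ≡ q ℕ.* k → + M ∣ (L ^ 2 * + n * + pbar (ℓ ℕ.^ 2 ℕ.* n) + χ n * + n * + pbar n + v₁ * + n * + pbarDiv n
            (ℓ ℕ.^ 2)) - (1ℤ + L) * + n * + pbar n
        multiple k n refl =
            subst (+ M ∣_)
            (sym (trans (cong₂ _-_ (cong₂ _+_ (cong₂ _+_ (cong₂ (λ x y → x * y) (cong₂ _*_ L^2 (+q* k)) (at₂ k))
            (cong₂ (λ x y → x * + n * y) (χ-multiple k) (at₁ k))) (cong₂ (λ x y → v₁ * x * y) (+q* k) (at₀ k)))
            (cong ((1ℤ + L) * + n *_) (at₁ k)))
            (trans (identity (sgn k) (P (q ℕ.* (q ℕ.* k))) (P (q ℕ.* k)) (P k) v₁ L (+ n) (+ k))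
              (cong (λ m → sgn k * (m * P (q ℕ.* (q ℕ.* k)) + L * nP k - (1ℤ + L) * nP (q ℕ.* k) + L * nP k * (v₁ * L - 1ℤ)))
                  (sym (trans (+q* (q ℕ.* k)) (cong (L * L *_) (+q* k))))))))
          (∣-*ˡ (sgn k) (∣-+ (proj₂ eigen k) (∣-*ˡ (L * nP k) hv₁)))

open Congruence using (module Conclusion)

theorem1p4 : (ℓ : ℕ) → Prime ℓ → ℓ % 2 ≡ 1 →
    (u2 u3 v1 : ℤ) →
    u2 * (+ ℓ) ^ 2 ≡ + 1 [mod 16 ] →
    u3 * (+ ℓ) ^ 3 ≡ + 1 [mod 16 ] →
    v1 * (+ ℓ) ≡ + 1 [mod (2 ℕ.^ gamma ℓ) ] →
    (n : ℕ) →
    (+ pbar (ℓ ℕ.^ 2 ℕ.* n) + legendre (- (+ n)) ℓ * u2 * + pbar n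
    + u3 * + pbarDiv n (ℓ ℕ.^ 2)
    ≡ (+ 1 + + ℓ) * + pbar n [mod 16 ])
    ×
    ((+ ℓ) ^ 2 * + n * + pbar (ℓ ℕ.^ 2 ℕ.* n)
    + legendre (- (+ n)) ℓ * + n * + pbar n
    + v1 * + n * + pbarDiv n (ℓ ℕ.^ 2)
    ≡ (+ 1 + + ℓ) * + n * + pbar n [mod (2 ℕ.^ gamma ℓ) ])
theorem1p4 ℓ ℓ-prime ℓ-odd u2 u3 v1 hu2 hu3 hv1 n =
    ℤ∣.∣⇒∣ᵤ (first u2 u3 v1 hu2′ hu3′ hv1′ n) , ℤ∣.∣⇒∣ᵤ (second u2 u3 v1 hu2′ hu3′ hv1′ n)
  where
  open Conclusion ℓ-prime ℓ-odd
  hu2′ : + 16 ∣ u2 * (+ ℓ) ^ 2 - 1ℤ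
  hu2′ = ℤ∣.∣ᵤ⇒∣ hu2
  hu3′ : + 16 ∣ u3 * (+ ℓ) ^ 3 - 1ℤ
  hu3′ = ℤ∣.∣ᵤ⇒∣ hu3
  hv1′ : + (2 ℕ.^ gamma ℓ) ∣ v1 * (+ ℓ) - 1ℤ
  hv1′ = ℤ∣.∣ᵤ⇒∣ hv1
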